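{- Let $w$ be an annular web of degree $n$. Then for any radial cut $I$ of $w$, $$\mathrm{LLT}_{w,I}[\mathbf x;q]=(q-q^{ -1})^n\,X_w\!\left[\frac{\mathbf x}{q-q^{ -1}};q\right].$$ Consequently, $\mathrm{LLT}_{w,I}$ is symmetric in $x_1,x_2,\dots$ and independent of $I$.
   Context: **Annular webs.** Let $\mathbb A=[0,1]\times[0,1]/\big((x,0)\sim(x,1)\big)$ be the annulus; left/right refer to the first coordinate, upward to the second. An annular web $w$ is a finite trivalent graph embedded in $\mathbb A$ (vertex-free essential circles are allowed as edges), all of whose edges are oriented upward (the second coordinate increases along each edge), together with a thickness $t(e)\in\mathbb Z_{>0}$ for each edge $e$, such that at every vertex the total incoming thickness equals the total outgoing thickness. Every vertex is a merge (two incoming edges, one outgoing) or a split (one incoming, two outgoing). The degree $\deg(w)$ is $\sum t(e)$ over the edges crossed by any radial (horizontal) segment transverse to $w$ and avoiding vertices. **$X_w$.** Let $\mathbb N=\{1,2,\dots\}$. A coloring $c$ of $w$ assigns to each edge $e$ a finite set $c(e)\subset\mathbb N$ with $|c(e)|=t(e)$ such that at every vertex the union of the color sets on incoming edges equals the union on outgoing edges; $\mathcal C(w)$ is the set of colorings. Put $\mathrm{inv}_w(c)=\sum_m\sum_{a\in c(e_R),\,b\in c(e_L)}\mathrm{sgn}(a-b)$ over all merges $m$, with $e_L,e_R$ the left and right incoming edges of $m$. $\Gamma_i(c)$ is the union of the edges $e$ with $i\in c(e)$ (a disjoint union of circles), $x^c=\prod_ix_i^{|\Gamma_i(c)|}$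 with $|\cdot|$ the number of components, and $X_w[\mathbf x;q]=\sum_{c\in\mathcal C(w)}q^{\mathrm{inv}_w(c)}x^c$, which is a symmetric function. The plethystic substitution $f\!\left[\frac{\mathbf x}{q-q^{ -1}};q\right]$ is the $\mathbb Q(q)$-algebra endomorphism of symmetric functions with $p_m\mapsto\frac{p_m}{q^m-q^{ -m}}$ for all power sums $p_m$, $m\ge1$. **Radial cut, labeled loop decompositions.** A radial cut $I$ is a radial (horizontal) segment across $\mathbb A$ transverse to $w$ and disjoint from its vertices. Let $e_1,\dots,e_r$ be the edges meeting $I$, from left to right; the initial thickness is $t(I)=(t(e_1),\dots,t(e_r))$. For a composition $\alpha=(\alpha_1,\dots,\alpha_r)$, $[\alpha]!=[\alpha_1]!\cdots[\alpha_r]!$ with $[k]!=[1]\cdots[k]$ and $[k]=\frac{q^k-q^{ -k}}{q-q^{ -1}}$. Let $B_j=\{t(e_1)+\cdots+t(e_{j-1})+1,\dots,t(e_1)+\cdots+t(e_j)\}\subset[n]=\{1,\dots,n\}$. A standard labeled loop decomposition of $(w,I)$ is a map $\mathcal L$ from edges of $w$ to subsets of $[n]$ with (1) $\mathcal L(e_j)=B_j$ for all $j$; (2) $|\mathcal L(e)|=t(e)$ for all $e$; (3) at every merge or split, the label set of the single edge on one side is the disjoint union of the label sets of the two edges on the other side. $\mathrm{SLD}(w,I)$ is the set of these. For $u\in[n]$, $L_u$ is the loop formed by the edges whose label set contains $u$. **Web LLT function.** For $\mathcal L\in\mathrm{SLD}(w,I)$, the multiset $\mathsf A_I(\mathcal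 L)$ of ordered attacking pairs consists of: one pair $(u,v)$ for each block $B_j$ and each $u<v$ in $B_j$; and, for each merge, one pair $(u,v)$ whenever $L_u$ enters the merge from the left and $L_v$ from the right (all counted with multiplicity). For an arbitrary map $\sigma:[n]\to\mathbb Z_{>0}$ put $\epsilon_\sigma(u,v)=+1$ if $\sigma(v)>\sigma(u)$, or $\sigma(v)=\sigma(u)$ and $v<u$; and $\epsilon_\sigma(u,v)=-1$ otherwise. Put $\mathrm{inv}_{\mathcal L}(\sigma)=\sum_{(u,v)\in\mathsf A_I(\mathcal L)}\epsilon_\sigma(u,v)$ and $x^\sigma=\prod_{u=1}^nx_{\sigma(u)}$. The web LLT function of $w$ relative to $I$ is $$\mathrm{LLT}_{w,I}[\mathbf x;q]=\frac1{[t(I)]!}\sum_{\mathcal L\in\mathrm{SLD}(w,I)}\ \sum_{\sigma:[n]\to\mathbb Z_{>0}}q^{\mathrm{inv}_{\mathcal L}(\sigma)}x^\sigma .$$ -}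

module Defs where

open import Algebra.Bundles.Raw using (RawRing)
import Algebra.Definitions.RawSemiring as RawSemiringDefs
import Data.Bool.Properties as Bool
open import Data.Bool.Base using (if_then_else_)
open import Data.Empty using (⊥-elim)
open import Data.Fin.Base using (Fin; zero; suc; toℕ; fromℕ; inject₁)
open import Data.Fin.Induction using (<-weakInduction)
open import Data.Fin.Permutation using (Permutation′; _⟨$⟩ʳ_)
import Data.Fin.Properties as Fin
open import Data.Fin.Subset using (Subset; inside; outside; _∈_; _∪_; _∩_; ∣_∣)
  renaming (⊤ to full; ⊥ to empty)
open import Data.Fin.Subset.Properties using (_∈?_)
open import Data.Integer.Base using (ℤ; +_; -[1+_]; 0ℤ; 1ℤ; -1ℤ) renaming (_+_ to _+ℤ_; -_ to -ℤ_)
open import Data.List.Base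
  using (List; []; _∷_; _++_; map; foldr; concatMap; filter; length; lookup; upTo; allFin; cartesianProduct)
open import Data.List.Relation.Unary.All using (All; all?)
open import Data.List.Relation.Unary.Any using (Any; any?)
open import Data.Nat.Base using (ℕ; zero; suc; NonZero; _+_; _∸_; _<_; z≤n; s≤s)
open import Data.Nat.ListAction using (sum)
import Data.Nat.Properties as ℕ
open import Data.Product.Base using (Σ; _×_; _,_; ∃-syntax)
import Data.Product.Properties as Product
open import Data.Rational.Base using (ℚ; 0ℚ; 1ℚ; 1/_; ≢-nonZero)
  renaming (_+_ to _+ℚ_; _*_ to _*ℚ_; -_ to -ℚ_; NonZero to NonZeroℚ)
import Data.Rational.Properties as ℚ
open import Data.Sum.Base using (_⊎_)
open import Data.Vec.Base as Vec using (Vec; []; _∷_)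
import Data.Vec.Properties as Vec
open import Function.Base using (_∘_)
open import Relation.Binary.Definitions using (DecidableEquality; tri<; tri≈; tri>)
open import Relation.Binary.PropositionalEquality
  using (_≡_; _≢_; refl; sym; trans; cong; cong₂; module ≡-Reasoning)
open import Relation.Nullary.Decidable using (Dec; yes; no; does; map′; _×-dec_; _⊎-dec_)

------------------------------------------------------------------------
-- ℚ[q], by coefficient lists with the constant term first

Poly : Set
Poly = List ℚ

coeff : Poly → ℕ → ℚ
coeff []      _       = 0ℚ
coeff (a ∷ p) zero    = a
coeff (a ∷ p) (suc k) = coeff p k

infix 4 _≈ᴾ_
infixl 6 _+ᴾ_
infixl 7 _*ᴾ_

_≈ᴾ_ : Poly → Poly → Set
p ≈ᴾ r = ∀ k → coeff p k ≡ coeff r k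

NonZeroᴾ : Poly → Set
NonZeroᴾ p = ∃[ k ] coeff p k ≢ 0ℚ

_+ᴾ_ : Poly → Poly → Poly
[]      +ᴾ r       = r
p       +ᴾ []      = p
(a ∷ p) +ᴾ (b ∷ r) = a +ℚ b ∷ p +ᴾ r

_*ᴾ_ : Poly → Poly → Poly
[]      *ᴾ r = []
(a ∷ p) *ᴾ r = map (a *ℚ_) r +ᴾ (0ℚ ∷ p *ᴾ r)

nonZeroᴾ? : ∀ p → Dec (NonZeroᴾ p)
nonZeroᴾ? [] = no λ { (_ , 0≢0) → 0≢0 refl }
nonZeroᴾ? (a ∷ p) with a ℚ.≟ 0ℚ
... | no a≢0 = yes (zero , a≢0)
... | yes a≡0 = map′ (λ { (k , ≢0) → suc k , ≢0 })
                     (λ { (zero , ≢0) → ⊥-elim (≢0 a≡0) ; (suc k , ≢0) → k , ≢0 })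
                     (nonZeroᴾ? p)

private
  coeff-+ : ∀ p r k → coeff (p +ᴾ r) k ≡ coeff p k +ℚ coeff r k
  coeff-+ []      r       k       = sym (ℚ.+-identityˡ (coeff r k))
  coeff-+ (a ∷ p) []      k       = sym (ℚ.+-identityʳ (coeff (a ∷ p) k))
  coeff-+ (a ∷ p) (b ∷ r) zero    = refl
  coeff-+ (a ∷ p) (b ∷ r) (suc k) = coeff-+ p r k

  coeff-map : ∀ a r k → coeff (map (a *ℚ_) r) k ≡ a *ℚ coeff r k
  coeff-map a []      k       = sym (ℚ.*-zeroʳ a)
  coeff-map a (b ∷ r) zero    = refl
  coeff-map a (b ∷ r) (suc k) = coeff-map a r k

  coeff-* : ∀ a p r k → coeff ((a ∷ p) *ᴾ r) k ≡ a *ℚ coeff r k +ℚ coeff (0ℚ ∷ p *ᴾ r) k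
  coeff-* a p r k = trans (coeff-+ (map (a *ℚ_) r) (0ℚ ∷ p *ᴾ r) k)
                          (cong (_+ℚ coeff (0ℚ ∷ p *ᴾ r) k) (coeff-map a r k))

  a≢0⇒b≢0⇒ab≢0 : ∀ {a b} → a ≢ 0ℚ → b ≢ 0ℚ → a *ℚ b ≢ 0ℚ
  a≢0⇒b≢0⇒ab≢0 {a} {b} a≢0 b≢0 ab≡0 = b≢0 (begin
    b                  ≡⟨ ℚ.*-identityˡ b ⟨
    1ℚ *ℚ b            ≡⟨ cong (_*ℚ b) (ℚ.*-inverseˡ a) ⟨
    (1/ a *ℚ a) *ℚ b   ≡⟨ ℚ.*-assoc (1/ a) a b ⟩
    1/ a *ℚ (a *ℚ b)   ≡⟨ cong (1/ a *ℚ_) ab≡0 ⟩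
    1/ a *ℚ 0ℚ         ≡⟨ ℚ.*-zeroʳ (1/ a) ⟩
    0ℚ                 ∎)
    where
    open ≡-Reasoning
    instance
      a-nonZero : NonZeroℚ a
      a-nonZero = ≢-nonZero a≢0

  VanishesBelow : Poly → ℕ → Set
  VanishesBelow r k = ∀ j → j < k → coeff r j ≡ 0ℚ

  order : ∀ r → NonZeroᴾ r → ∃[ k ] (coeff r k ≢ 0ℚ × VanishesBelow r k)
  order [] (_ , 0≢0) = ⊥-elim (0≢0 refl)
  order (a ∷ r) r≉0 with a ℚ.≟ 0ℚ
  order (a ∷ r) r≉0            | no a≢0  = zero , a≢0 , λ _ ()
  order (a ∷ r) (zero , a≢0)   | yes a≡0 = ⊥-elim (a≢0 a≡0)
  order (a ∷ r) (suc k , ≢0)   | yes a≡0 with order r (k , ≢0)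
  ... | m , m≢0 , below = suc m , m≢0 , λ where
    zero    _         → a≡0
    (suc j) (s≤s j<m) → below j j<m

  *-vanishesBelow : ∀ p r k → VanishesBelow r k → VanishesBelow (p *ᴾ r) k
  *-vanishesBelow []      r k below j j<k = refl
  *-vanishesBelow (a ∷ p) r k below j j<k = begin
    coeff ((a ∷ p) *ᴾ r) j                     ≡⟨ coeff-* a p r j ⟩
    a *ℚ coeff r j +ℚ coeff (0ℚ ∷ p *ᴾ r) j    ≡⟨ cong₂ _+ℚ_ (cong (a *ℚ_) (below j j<k)) (shifted j j<k) ⟩
    a *ℚ 0ℚ +ℚ 0ℚ                              ≡⟨ ℚ.+-identityʳ (a *ℚ 0ℚ) ⟩
    a *ℚ 0ℚ                                    ≡⟨ ℚ.*-zeroʳ a ⟩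
    0ℚ                                         ∎
    where
    open ≡-Reasoning
    shifted : VanishesBelow (0ℚ ∷ p *ᴾ r) k
    shifted zero    _   = refl
    shifted (suc i) i<k = *-vanishesBelow p r k below i (ℕ.<-trans (ℕ.n<1+n i) i<k)

*-nonZeroᴾ : ∀ p r → NonZeroᴾ p → NonZeroᴾ r → NonZeroᴾ (p *ᴾ r)
*-nonZeroᴾ [] r (_ , 0≢0) _ = ⊥-elim (0≢0 refl)
*-nonZeroᴾ (a ∷ p) r p≉0 r≉0 with a ℚ.≟ 0ℚ
*-nonZeroᴾ (a ∷ p) r (zero , a≢0) r≉0 | yes a≡0 = ⊥-elim (a≢0 a≡0)
*-nonZeroᴾ (a ∷ p) r (suc k , ≢0) r≉0 | yes a≡0 with *-nonZeroᴾ p r (k , ≢0) r≉0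
... | m , m≢0 = suc m , λ eq → m≢0 (begin
    coeff (p *ᴾ r) m                                ≡⟨ ℚ.+-identityˡ _ ⟨
    0ℚ +ℚ coeff (p *ᴾ r) m                          ≡⟨ cong (_+ℚ coeff (p *ᴾ r) m) (ℚ.*-zeroˡ (coeff r (suc m))) ⟨
    0ℚ *ℚ coeff r (suc m) +ℚ coeff (p *ᴾ r) m       ≡⟨ cong (λ z → z *ℚ coeff r (suc m) +ℚ coeff (p *ᴾ r) m) a≡0 ⟨
    a *ℚ coeff r (suc m) +ℚ coeff (p *ᴾ r) m        ≡⟨ coeff-* a p r (suc m) ⟨
    coeff ((a ∷ p) *ᴾ r) (suc m)                    ≡⟨ eq ⟩
    0ℚ                                              ∎)
    where open ≡-Reasoning
*-nonZeroᴾ (a ∷ p) r p≉0 r≉0 | no a≢0 with order r r≉0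
... | m , m≢0 , below = m , λ eq → a≢0⇒b≢0⇒ab≢0 a≢0 m≢0 (begin
    a *ℚ coeff r m                                  ≡⟨ ℚ.+-identityʳ _ ⟨
    a *ℚ coeff r m +ℚ 0ℚ                            ≡⟨ cong (a *ℚ coeff r m +ℚ_) (shifted m below) ⟨
    a *ℚ coeff r m +ℚ coeff (0ℚ ∷ p *ᴾ r) m         ≡⟨ coeff-* a p r m ⟨
    coeff ((a ∷ p) *ᴾ r) m                          ≡⟨ eq ⟩
    0ℚ                                              ∎)
    where
    open ≡-Reasoning
    shifted : ∀ m → VanishesBelow r m → coeff (0ℚ ∷ p *ᴾ r) m ≡ 0ℚ
    shifted zero    _     = refl
    shifted (suc j) below = *-vanishesBelow p r (suc j) below j (ℕ.n<1+n j)

------------------------------------------------------------------------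
-- ℚ(q), as fractions of polynomials

record K : Set where
  constructor frac
  field
    num   : Poly
    den   : Poly
    den≉0 : NonZeroᴾ den

open K

oneᴾ : Poly
oneᴾ = 1ℚ ∷ []

oneᴾ≉0 : NonZeroᴾ oneᴾ
oneᴾ≉0 = zero , λ ()

infix 4 _≈ᴷ_
infixl 6 _+ᴷ_ _-ᴷ_
infixl 7 _*ᴷ_
infix 9 _⁻¹

_≈ᴷ_ : K → K → Set
x ≈ᴷ y = num x *ᴾ den y ≈ᴾ num y *ᴾ den x

_+ᴷ_ _*ᴷ_ _-ᴷ_ : K → K → K
x +ᴷ y = frac (num x *ᴾ den y +ᴾ num y *ᴾ den x) (den x *ᴾ den y) (*-nonZeroᴾ (den x) (den y) (den≉0 x) (den≉0 y))
x *ᴷ y = frac (num x *ᴾ num y) (den x *ᴾ den y) (*-nonZeroᴾ (den x) (den y) (den≉0 x) (den≉0 y))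

negᴷ : K → K
negᴷ x = frac (map -ℚ_ (num x)) (den x) (den≉0 x)

x -ᴷ y = x +ᴷ negᴷ y

0ᴷ 1ᴷ q : K
0ᴷ = frac [] oneᴾ oneᴾ≉0
1ᴷ = frac oneᴾ oneᴾ oneᴾ≉0
q  = frac (0ℚ ∷ 1ℚ ∷ []) oneᴾ oneᴾ≉0

-- Total, with the junk value 0⁻¹ = 0; it is only ever applied to nonzero elements.
_⁻¹ : K → K
x ⁻¹ with nonZeroᴾ? (num x)
... | yes num≉0 = frac (den x) (num x) num≉0
... | no  _     = 0ᴷ

ℚ⟨q⟩ : RawRing _ _
ℚ⟨q⟩ = record
  { Carrier = K ; _≈_ = _≈ᴷ_ ; _+_ = _+ᴷ_ ; _*_ = _*ᴷ_ ; -_ = negᴷ ; 0# = 0ᴷ ; 1# = 1ᴷ }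

open RawSemiringDefs (RawRing.rawSemiring ℚ⟨q⟩) public using () renaming (_^_ to _^ᴷ_)

q^_ : ℤ → K
q^ (+ n)      = q ^ᴷ n
q^ (-[1+ n ]) = (q ⁻¹) ^ᴷ suc n

q^m-q^-m : ℕ → K
q^m-q^-m m = q^ (+ m) -ᴷ q^ (-ℤ + m)

q-q⁻¹ : K
q-q⁻¹ = q -ᴷ q ⁻¹

[_] : ℕ → K
[ k ] = q^m-q^-m k *ᴷ q-q⁻¹ ⁻¹

[_]! : ℕ → K
[ zero  ]! = 1ᴷ
[ suc k ]! = [ k ]! *ᴷ [ suc k ]

[_]!ᶜ : List ℕ → K
[ α ]!ᶜ = foldr (λ a x → [ a ]! *ᴷ x) 1ᴷ α

∑ᴷ : {A : Set} → List A → (A → K) → K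
∑ᴷ xs f = foldr (λ a x → f a +ᴷ x) 0ᴷ xs

∑ℤ : {A : Set} → List A → (A → ℤ) → ℤ
∑ℤ xs f = foldr (λ a x → f a +ℤ x) 0ℤ xs

------------------------------------------------------------------------
-- Power series in x₁, x₂, …

-- A series is given by its coefficients: F N β is the coefficient of
-- x₁^β₁ ⋯ x_N^β_N.  The variable x_{i+1} corresponds to i : Fin N.
Series : Set
Series = (N : ℕ) → Vec ℕ N → K

_≟ᵛ_ : ∀ {N} → DecidableEquality (Vec ℕ N)
_≟ᵛ_ = Vec.≡-dec ℕ._≟_

infix 4 _≋_
infixr 7 _•_

_≋_ : Series → Series → Set
F ≋ G = ∀ N β → F N β ≈ᴷ G N β

_•_ : K → Series → Series
(a • F) N β = a *ᴷ F N β

Symmetric : Series → Set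
Symmetric F = ∀ N (π : Permutation′ N) (β : Vec ℕ N) →
  F N (Vec.tabulate (λ i → Vec.lookup β (π ⟨$⟩ʳ i))) ≈ᴷ F N β

constant : K → Series
constant a N β = if does (β ≟ᵛ Vec.replicate N 0) then a else 0ᴷ

_⊞_ : Series → Series → Series
(F ⊞ G) N β = F N β +ᴷ G N β

splittings : ∀ {N} → Vec ℕ N → List (Vec ℕ N × Vec ℕ N)
splittings []      = ([] , []) ∷ []
splittings (b ∷ β) = concatMap
  (λ a → map (λ { (γ , δ) → (a ∷ γ) , (b ∸ a ∷ δ) }) (splittings β)) (upTo (suc b))

_⊠_ : Series → Series → Series
(F ⊠ G) N β = ∑ᴷ (splittings β) λ { (γ , δ) → F N γ *ᴷ G N δ }

powerSum : ℕ → Series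
powerSum m N β = ∑ᴷ (allFin N) λ i →
  if does (β ≟ᵛ (Vec.replicate N 0 Vec.[ i ]≔ m)) then 1ᴷ else 0ᴷ

------------------------------------------------------------------------
-- Symmetric functions and plethysm

-- Symmetric functions over ℚ(q) form the free commutative ℚ(q)-algebra on
-- p₁, p₂, …; an element is written here as a polynomial expression in them,
-- and two expressions are the same symmetric function when their expansions
-- ⟦_⟧ agree.
infixl 6 _⊕_
infixl 7 _⊗_

data Λ : Set where
  ⟨_⟩     : K → Λ
  p[_]    : (m : ℕ) .{{_ : NonZero m}} → Λ
  _⊕_ _⊗_ : Λ → Λ → Λ

⟦_⟧ : Λ → Series
⟦ ⟨ a ⟩ ⟧  = constant a
⟦ p[ m ] ⟧ = powerSum m
⟦ f ⊕ g ⟧  = ⟦ f ⟧ ⊞ ⟦ g ⟧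
⟦ f ⊗ g ⟧  = ⟦ f ⟧ ⊠ ⟦ g ⟧

-- The ℚ(q)-algebra endomorphism f ↦ f[x/(q-q⁻¹)].
_[x/q-q⁻¹] : Λ → Λ
⟨ a ⟩ [x/q-q⁻¹]   = ⟨ a ⟩
p[ m ] [x/q-q⁻¹]  = ⟨ q^m-q^-m m ⁻¹ ⟩ ⊗ p[ m ]
(f ⊕ g) [x/q-q⁻¹] = f [x/q-q⁻¹] ⊕ g [x/q-q⁻¹]
(f ⊗ g) [x/q-q⁻¹] = f [x/q-q⁻¹] ⊗ g [x/q-q⁻¹]

-- G = F[x/(q-q⁻¹)] for a symmetric function F.  By algebraic independence of
-- the power sums, G does not depend on the expression f chosen for F.
_IsPlethysmOf_ : Series → Series → Set
G IsPlethysmOf F = Σ Λ λ f → ⟦ f ⟧ ≋ F × ⟦ f [x/q-q⁻¹] ⟧ ≋ G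

------------------------------------------------------------------------
-- Annular webs

-- The part of a web between two consecutive radial cuts: pieces placed side by
-- side, each with at most one vertex.  The indices are the thicknesses met by
-- the lower and by the upper cut, from left to right.
data Layer : List ℕ → List ℕ → Set where
  []     : Layer [] []
  strand : ∀ a .{{_ : NonZero a}} {s t} → Layer s t → Layer (a ∷ s) (a ∷ t)
  merge  : ∀ a b .{{_ : NonZero a}} .{{_ : NonZero b}} {s t} →
           Layer s t → Layer (a ∷ b ∷ s) (a + b ∷ t)
  split  : ∀ a b .{{_ : NonZero a}} .{{_ : NonZero b}} {s t} →
           Layer s t → Layer (a + b ∷ s) (a ∷ b ∷ t)

-- Since all edges go upward, choosing radial cuts 0, …, k, at least one between
-- any two consecutive heights at which there are vertices, determines a web, up
-- to isotopies of the annulus preserving the second coordinate, by its layers.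
-- The last layer goes from cut k back to cut 0.  Layers without vertices are
-- allowed, so every radial cut of a web can be taken to be among these.
record Web : Set where
  field
    k         : ℕ
    thickness : Fin (suc k) → List ℕ
    layer     : (i : Fin k) → Layer (thickness (inject₁ i)) (thickness (suc i))
    closing   : Layer (thickness (fromℕ k)) (thickness zero)

  Cut : Set
  Cut = Fin (suc k)

  -- Edges are subdivided where they meet a cut: (I , j) is the segment meeting
  -- cut I in position j.  Each end of it is a vertex, or else the midpoint of
  -- a strand, where it is joined to the next segment of the same edge.
  Edge : Set
  Edge = Σ Cut λ I → Fin (length (thickness I))

  thick : Edge → ℕ
  thick (I , j) = lookup (thickness I) j

  degree : ℕ
  degree = sum (thickness zero)

open Web

layer-sum : ∀ {s t} → Layer s t → sum s ≡ sum t
layer-sum []            = refl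
layer-sum (strand a ℓ)  = cong (λ x → a + x) (layer-sum ℓ)
layer-sum (merge a b ℓ) = trans (cong (λ x → a + (b + x)) (layer-sum ℓ)) (sym (ℕ.+-assoc a b _))
layer-sum (split a b ℓ) = trans (ℕ.+-assoc a b _) (cong (λ x → a + (b + x)) (layer-sum ℓ))

degree-cut : (w : Web) (I : Cut w) → sum (thickness w I) ≡ degree w
degree-cut w = <-weakInduction (λ I → sum (thickness w I) ≡ degree w) refl
  (λ i eq → trans (sym (layer-sum (layer w i))) eq)

data Node (E : Set) : Set where
  through   : (e₀ e₁ : E) → Node E
  mergeNode : (eL eR e : E) → Node E
  splitNode : (e eL eR : E) → Node E

ends : {E : Set} → Node E → List E
ends (through e₀ e₁)     = e₀ ∷ e₁ ∷ []
ends (mergeNode eL eR e) = eL ∷ eR ∷ e ∷ []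
ends (splitNode e eL eR) = e ∷ eL ∷ eR ∷ []

layerNodes : {E : Set} {s t : List ℕ} → Layer s t →
             (Fin (length s) → E) → (Fin (length t) → E) → List (Node E)
layerNodes []            f g = []
layerNodes (strand _ ℓ)  f g = through (f zero) (g zero) ∷ layerNodes ℓ (f ∘ suc) (g ∘ suc)
layerNodes (merge _ _ ℓ) f g =
  mergeNode (f zero) (f (suc zero)) (g zero) ∷ layerNodes ℓ (λ j → f (suc (suc j))) (g ∘ suc)
layerNodes (split _ _ ℓ) f g =
  splitNode (f zero) (g zero) (g (suc zero)) ∷ layerNodes ℓ (f ∘ suc) (λ j → g (suc (suc j)))

nodes : (w : Web) → List (Node (Edge w))
nodes w = concatMap (λ i → layerNodes (layer w i) (inject₁ i ,_) (suc i ,_)) (allFin (k w))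
       ++ layerNodes (closing w) (fromℕ (k w) ,_) (zero ,_)

-- The pairs (e_L , e_R) of incoming edges of the merges.
merges : (w : Web) → List (Edge w × Edge w)
merges w = concatMap (λ { (mergeNode eL eR _) → (eL , eR) ∷ [] ; _ → [] }) (nodes w)

edges : (w : Web) → List (Edge w)
edges w = concatMap (λ I → map (I ,_) (allFin _)) (allFin _)

_≟ᵉ_ : ∀ {w} → DecidableEquality (Edge w)
_≟ᵉ_ = Product.≡-dec Fin._≟_ Fin._≟_

------------------------------------------------------------------------
-- Finite enumerations

choices : ∀ {n} {A : Fin n → Set} → (∀ i → List (A i)) → List (∀ i → A i)
choices {zero}  xs = (λ ()) ∷ []
choices {suc n} xs = concatMap
  (λ a → map (λ f → λ { zero → a ; (suc i) → f i }) (choices (xs ∘ suc))) (xs zero)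

subsets : ∀ N → List (Subset N)
subsets zero    = [] ∷ []
subsets (suc N) = map (inside ∷_) (subsets N) ++ map (outside ∷_) (subsets N)

elements : ∀ {N} → Subset N → List (Fin N)
elements A = filter (_∈? A) (allFin _)

_≟ˢ_ : ∀ {N} → DecidableEquality (Subset N)
_≟ˢ_ = Vec.≡-dec Bool._≟_

Labeling : Web → ℕ → Set
Labeling w N = Edge w → Subset N

labelings : ∀ w N → List (Labeling w N)
labelings w N = map (λ f → λ { (I , j) → f I j })
  (choices (λ I → choices (λ j → subsets N)))

SizesMatch : ∀ w {N} → Labeling w N → Set
SizesMatch w c = All (λ e → ∣ c e ∣ ≡ thick w e) (edges w)

sizesMatch? : ∀ w {N} (c : Labeling w N) → Dec (SizesMatch w c)
sizesMatch? w c = all? (λ e → ∣ c e ∣ ℕ.≟ thick w e) (edges w)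

------------------------------------------------------------------------
-- The symmetric function X_w

UnionsAgree : {E : Set} {N : ℕ} → (E → Subset N) → Node E → Set
UnionsAgree c (through e₀ e₁)     = c e₀ ≡ c e₁
UnionsAgree c (mergeNode eL eR e) = c eL ∪ c eR ≡ c e
UnionsAgree c (splitNode e eL eR) = c e ≡ c eL ∪ c eR

unionsAgree? : ∀ {E N} (c : E → Subset N) v → Dec (UnionsAgree c v)
unionsAgree? c (through e₀ e₁)     = c e₀ ≟ˢ c e₁
unionsAgree? c (mergeNode eL eR e) = (c eL ∪ c eR) ≟ˢ c e
unionsAgree? c (splitNode e eL eR) = c e ≟ˢ (c eL ∪ c eR)

IsColoring : ∀ w {N} → Labeling w N → Set
IsColoring w c = SizesMatch w c × All (UnionsAgree c) (nodes w)

isColoring? : ∀ w {N} (c : Labeling w N) → Dec (IsColoring w c)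
isColoring? w c = sizesMatch? w c ×-dec all? (unionsAgree? c) (nodes w)

-- The colorings with colors among 1, …, N; no others contribute to the
-- coefficient of a monomial in x₁, …, x_N.
colorings : ∀ w N → List (Labeling w N)
colorings w N = filter (isColoring? w) (labelings w N)

sgn : ∀ {N} → Fin N → Fin N → ℤ
sgn a b with Fin.<-cmp a b
... | tri< _ _ _ = -1ℤ
... | tri≈ _ _ _ = 0ℤ
... | tri> _ _ _ = 1ℤ

inv : ∀ w {N} → Labeling w N → ℤ
inv w c = ∑ℤ (merges w) λ { (eL , eR) →
  ∑ℤ (elements (c eR)) λ a → ∑ℤ (elements (c eL)) λ b → sgn a b }

-- Connected components of the union of a list Γ of edges.
module Components (w : Web) where

  Touching : Edge w → Edge w → Set
  Touching d e = Any (λ v → Any (d ≡_) (ends v) × Any (e ≡_) (ends v)) (nodes w)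

  touching? : ∀ d e → Dec (Touching d e)
  touching? d e = any? (λ v → any? (_≟ᵉ_ {w} d) (ends v) ×-dec any? (_≟ᵉ_ {w} e) (ends v)) (nodes w)

  -- Joined by a chain in Γ of at most m steps.
  Chain : List (Edge w) → ℕ → Edge w → Edge w → Set
  Chain Γ zero    d e = d ≡ e
  Chain Γ (suc m) d e = d ≡ e ⊎ Any (λ d′ → Touching d d′ × Chain Γ m d′ e) Γ

  chain? : ∀ Γ m d e → Dec (Chain Γ m d e)
  chain? Γ zero    d e = _≟ᵉ_ {w} d e
  chain? Γ (suc m) d e = _≟ᵉ_ {w} d e ⊎-dec any? (λ d′ → touching? d d′ ×-dec chain? Γ m d′ e) Γ

  Connected : List (Edge w) → Edge w → Edge w → Set
  Connected Γ = Chain Γ (length Γ)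

  connected? : ∀ Γ d e → Dec (Connected Γ d e)
  connected? Γ = chain? Γ (length Γ)

  -- The number of edges of Γ not connected to a later one.
  componentCount : List (Edge w) → ℕ
  componentCount Γ = go Γ
    where
    go : List (Edge w) → ℕ
    go []       = 0
    go (e ∷ es) = (if does (any? (connected? Γ e) es) then 0 else 1) + go es

open Components using (componentCount)

Γ : ∀ w {N} → Labeling w N → Fin N → List (Edge w)
Γ w c i = filter (λ e → i ∈? c e) (edges w)

exponents : ∀ w {N} → Labeling w N → Vec ℕ N
exponents w c = Vec.tabulate (λ i → componentCount w (Γ w c i))

X : Web → Series
X w N β = ∑ᴷ (filter (λ c → exponents w c ≟ᵛ β) (colorings w N)) λ c → q^ (inv w c)

------------------------------------------------------------------------
-- The web LLT function

DisjointUnions : {E : Set} {n : ℕ} → (E → Subset n) → Node E → Set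
DisjointUnions ℒ (through e₀ e₁)     = ℒ e₀ ≡ ℒ e₁
DisjointUnions ℒ (mergeNode eL eR e) = ℒ eL ∪ ℒ eR ≡ ℒ e × ℒ eL ∩ ℒ eR ≡ empty
DisjointUnions ℒ (splitNode e eL eR) = ℒ eL ∪ ℒ eR ≡ ℒ e × ℒ eL ∩ ℒ eR ≡ empty

disjointUnions? : ∀ {E n} (ℒ : E → Subset n) v → Dec (DisjointUnions ℒ v)
disjointUnions? ℒ (through e₀ e₁)     = ℒ e₀ ≟ˢ ℒ e₁
disjointUnions? ℒ (mergeNode eL eR e) = ((ℒ eL ∪ ℒ eR) ≟ˢ ℒ e) ×-dec ((ℒ eL ∩ ℒ eR) ≟ˢ empty)
disjointUnions? ℒ (splitNode e eL eR) = ((ℒ eL ∪ ℒ eR) ≟ˢ ℒ e) ×-dec ((ℒ eL ∩ ℒ eR) ≟ˢ empty)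

-- Consecutive intervals of sizes t₁, …, t_r.
block : (t : List ℕ) → Fin (length t) → Subset (sum t)
block (a ∷ t) zero    = full {a} Vec.++ empty
block (a ∷ t) (suc j) = empty {a} Vec.++ block t j

module _ (w : Web) (I : Cut w) where

  private
    t = thickness w I
    n = sum t

  IsSLD : Labeling w n → Set
  IsSLD ℒ = (∀ j → ℒ (I , j) ≡ block t j) × SizesMatch w ℒ × All (DisjointUnions ℒ) (nodes w)

  isSLD? : ∀ ℒ → Dec (IsSLD ℒ)
  isSLD? ℒ = Fin.all? (λ j → ℒ (I , j) ≟ˢ block t j)
    ×-dec sizesMatch? w ℒ ×-dec all? (disjointUnions? ℒ) (nodes w)

  SLD : List (Labeling w n)
  SLD = filter isSLD? (labelings w n)

  -- L_u contains the edge e exactly when u ∈ ℒ e.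
  attackingPairs : Labeling w n → List (Fin n × Fin n)
  attackingPairs ℒ =
       concatMap (λ j → filter (λ { (u , v) → u Fin.<? v })
                          (cartesianProduct (elements (block t j)) (elements (block t j))))
                 (allFin (length t))
    ++ concatMap (λ { (eL , eR) → cartesianProduct (elements (ℒ eL)) (elements (ℒ eR)) }) (merges w)

  ε : ∀ {N} → (Fin n → Fin N) → Fin n → Fin n → ℤ
  ε σ u v = if does ((σ u Fin.<? σ v) ⊎-dec ((σ v Fin.≟ σ u) ×-dec (v Fin.<? u))) then 1ℤ else -1ℤ

  invL : ∀ {N} → Labeling w n → (Fin n → Fin N) → ℤ
  invL ℒ σ = ∑ℤ (attackingPairs ℒ) λ { (u , v) → ε σ u v }

  content : ∀ {N} → (Fin n → Fin N) → Vec ℕ N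
  content σ = Vec.tabulate (λ i → length (filter (λ u → σ u Fin.≟ i) (allFin n)))

  LLT : Series
  LLT N β = [ t ]!ᶜ ⁻¹ *ᴷ
    ∑ᴷ SLD λ ℒ → ∑ᴷ (filter (λ σ → content σ ≟ᵛ β) (choices (λ _ → allFin N))) λ σ → q^ (invL ℒ σ)

{-# OPTIONS --safe #-}
module Submission where

-- Both sides are traces of one element of the Hecke algebra of type A, the
-- product of the layers of the web around the annulus: colorings compute its
-- trace on words in the colors, and labeled loop decompositions its trace on
-- permutations of n labels refined by σ, where ties are broken by the label.
-- In both representations T_s acts on adjacent letters through their order
-- alone; merges and splits become (anti)symmetrizers up to quantum factorials.
-- A trace on the Hecke algebras is determined by its values on Coxeter elements
-- of Young subgroups, where it is multiplicative, so it suffices to compare the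
-- two traces on a single Coxeter element of length m.  There they are, up to
-- a factor z = q - q⁻¹, the degree-m parts of ∏ᵢ (1 + z t xᵢ / (1 - y t xᵢ)), with
-- y = -q⁻¹ for the colors and y = 0 for the labels.  The coefficients of p_m in
-- the logarithmic derivatives of these products are ±(q^m - q^{-m}) and ±z^m, so
-- Newton's identities turn one into the other under p_m ↦ z^m p_m / (q^m - q^{-m}).

-- Colorings give a trace in the usual sense, a sum of diagonal entries over all words. Loop
-- decompositions do not: for each `σ` a single diagonal entry occurs, at the identity word, in a
-- representation whose order depends on `σ`. Only the sum over `σ` is cyclic, by exchanging the
-- colors of two adjacent positions and relabelling; this preserves the order unless the two colors
-- tie, and the tied case is the delicate one. The eigenvalue `x = -p` on equal letters forces the
-- antisymmetrizers to kill words with a repeated letter and to have rank one on the rearrangements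
-- of a set. Hence operators on words turn into transfer matrices on sets of letters, whose closed
-- paths are the colorings and the loop decompositions. Division is postponed: most of the argument
-- holds over any commutative semiring with `x + p ≈ 0`, factorials being carried along on both
-- sides of equations until quantum integers become invertible.

open import Algebra.Bundles using (CommutativeRing; CommutativeSemiring)
open import Data.Integer.Base as ℤ using (ℤ; 0ℤ; 1ℤ; -1ℤ)
open import Level using (0ℓ)

-- Finite sums, products and indicators in a commutative semiring.

module Sums (R : CommutativeSemiring 0ℓ 0ℓ) where

  open import Data.Bool.Base using (Bool; true; false; if_then_else_; _∧_)
  open import Data.List.Base
  open import Data.List.Membership.Propositional using (_∈_)
  open import Data.List.Relation.Binary.Permutation.Propositional using (_↭_)
  import Data.List.Relation.Binary.Permutation.Propositional as Perm
  open import Data.List.Relation.Unary.Any using (here; there)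
  open import Function.Base using (_∘_)
  open import Relation.Binary.PropositionalEquality as ≡ using (_≡_)
  open import Relation.Nullary.Decidable using (Dec; does; yes; no)
  open import Relation.Unary using (Decidable)

  open CommutativeSemiring R public hiding (zero)
  open import Algebra.Solver.Ring.NaturalCoefficients.Default R public
    using (solve; _:=_; _:+_; _:*_; con)
  open import Relation.Binary.Reasoning.Setoid setoid public

  private
    variable
      A B : Set

  ∑ : List A → (A → Carrier) → Carrier
  ∑ xs f = foldr (λ a y → f a + y) 0# xs

  ∏ : List A → (A → Carrier) → Carrier
  ∏ xs f = foldr (λ a y → f a * y) 1# xs

  𝟙 : Bool → Carrier
  𝟙 b = if b then 1# else 0#

  ι : {P : Set} → Dec P → Carrier
  ι d = 𝟙 (does d)

  swap-inner : ∀ a b c d → (a + b) + (c + d) ≈ (a + c) + (b + d)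
  swap-inner = solve 4 (λ a b c d → (a :+ b) :+ (c :+ d) := (a :+ c) :+ (b :+ d)) refl

  x*yz≈y*xz : ∀ a b c → a * (b * c) ≈ b * (a * c)
  x*yz≈y*xz = solve 3 (λ a b c → a :* (b :* c) := b :* (a :* c)) refl

  ∑-cong∈ : (xs : List A) {f g : A → Carrier} → (∀ {a} → a ∈ xs → f a ≈ g a) → ∑ xs f ≈ ∑ xs g
  ∑-cong∈ []       e = refl
  ∑-cong∈ (a ∷ xs) e = +-cong (e (here ≡.refl)) (∑-cong∈ xs (e ∘ there))

  ∑-cong : (xs : List A) {f g : A → Carrier} → (∀ a → f a ≈ g a) → ∑ xs f ≈ ∑ xs g
  ∑-cong xs e = ∑-cong∈ xs λ {a} _ → e a

  ∑-≡ : {xs ys : List A} {f : A → Carrier} → xs ≡ ys → ∑ xs f ≈ ∑ ys f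
  ∑-≡ ≡.refl = refl

  ∑-++ : (xs ys : List A) {f : A → Carrier} → ∑ (xs ++ ys) f ≈ ∑ xs f + ∑ ys f
  ∑-++ []       ys = sym (+-identityˡ _)
  ∑-++ (a ∷ xs) ys = trans (+-congˡ (∑-++ xs ys)) (sym (+-assoc _ _ _))

  ∑-map : (g : A → B) (xs : List A) {f : B → Carrier} → ∑ (map g xs) f ≈ ∑ xs (f ∘ g)
  ∑-map g []       = refl
  ∑-map g (a ∷ xs) = +-congˡ (∑-map g xs)

  ∑-concatMap : (g : A → List B) (xs : List A) {f : B → Carrier} →
                ∑ (concatMap g xs) f ≈ ∑ xs (λ a → ∑ (g a) f)
  ∑-concatMap g []       = refl
  ∑-concatMap g (a ∷ xs) = trans (∑-++ (g a) (concatMap g xs)) (+-congˡ (∑-concatMap g xs))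

  ∑-0 : (xs : List A) {f : A → Carrier} → (∀ a → f a ≈ 0#) → ∑ xs f ≈ 0#
  ∑-0 []       e = refl
  ∑-0 (a ∷ xs) e = trans (+-cong (e a) (∑-0 xs e)) (+-identityˡ 0#)

  ∑-+ : (xs : List A) {f g : A → Carrier} → ∑ xs (λ a → f a + g a) ≈ ∑ xs f + ∑ xs g
  ∑-+ []       = sym (+-identityˡ 0#)
  ∑-+ (a ∷ xs) = trans (+-congˡ (∑-+ xs)) (swap-inner _ _ _ _)

  ∑-*ˡ : (c : Carrier) (xs : List A) {f : A → Carrier} → ∑ xs (λ a → c * f a) ≈ c * ∑ xs f
  ∑-*ˡ c []       = sym (zeroʳ c)
  ∑-*ˡ c (a ∷ xs) = trans (+-congˡ (∑-*ˡ c xs)) (sym (distribˡ c _ _))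

  ∑-*ʳ : (c : Carrier) (xs : List A) {f : A → Carrier} → ∑ xs (λ a → f a * c) ≈ ∑ xs f * c
  ∑-*ʳ c []       = sym (zeroˡ c)
  ∑-*ʳ c (a ∷ xs) = trans (+-congˡ (∑-*ʳ c xs)) (sym (distribʳ c _ _))

  ∑-swap : (xs : List A) (ys : List B) {f : A → B → Carrier} →
           ∑ xs (λ a → ∑ ys (f a)) ≈ ∑ ys (λ b → ∑ xs (λ a → f a b))
  ∑-swap []       ys = sym (∑-0 ys λ _ → refl)
  ∑-swap (a ∷ xs) ys = trans (+-congˡ (∑-swap xs ys)) (sym (∑-+ ys))

  ∑-filter : {P : A → Set} (P? : Decidable P) (xs : List A) {f : A → Carrier} →
             ∑ (filter P? xs) f ≈ ∑ xs (λ a → ι (P? a) * f a)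
  ∑-filter P? [] = refl
  ∑-filter P? (a ∷ xs) with does (P? a)
  ... | true  = +-cong (sym (*-identityˡ _)) (∑-filter P? xs)
  ... | false = trans (∑-filter P? xs) (sym (trans (+-congʳ (zeroˡ _)) (+-identityˡ _)))

  ∑-↭ : {xs ys : List A} {f : A → Carrier} → xs ↭ ys → ∑ xs f ≈ ∑ ys f
  ∑-↭ Perm.refl           = refl
  ∑-↭ (Perm.prep x e)     = +-congˡ (∑-↭ e)
  ∑-↭ (Perm.swap x y e)   = trans (sym (+-assoc _ _ _))
    (trans (+-cong (+-comm _ _) (∑-↭ e)) (+-assoc _ _ _))
  ∑-↭ (Perm.trans e e′)   = trans (∑-↭ e) (∑-↭ e′)

  ∏-cong∈ : (xs : List A) {f g : A → Carrier} → (∀ {a} → a ∈ xs → f a ≈ g a) → ∏ xs f ≈ ∏ xs g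
  ∏-cong∈ []       e = refl
  ∏-cong∈ (a ∷ xs) e = *-cong (e (here ≡.refl)) (∏-cong∈ xs (e ∘ there))

  ∏-cong : (xs : List A) {f g : A → Carrier} → (∀ a → f a ≈ g a) → ∏ xs f ≈ ∏ xs g
  ∏-cong xs e = ∏-cong∈ xs λ {a} _ → e a

  ∏-++ : (xs ys : List A) {f : A → Carrier} → ∏ (xs ++ ys) f ≈ ∏ xs f * ∏ ys f
  ∏-++ []       ys = sym (*-identityˡ _)
  ∏-++ (a ∷ xs) ys = trans (*-congˡ (∏-++ xs ys)) (sym (*-assoc _ _ _))

  ∏-map : (g : A → B) (xs : List A) {f : B → Carrier} → ∏ (map g xs) f ≈ ∏ xs (f ∘ g)
  ∏-map g []       = refl
  ∏-map g (a ∷ xs) = *-congˡ (∏-map g xs)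

  ∏-concatMap : (g : A → List B) (xs : List A) {f : B → Carrier} →
                ∏ (concatMap g xs) f ≈ ∏ xs (λ a → ∏ (g a) f)
  ∏-concatMap g []       = refl
  ∏-concatMap g (a ∷ xs) = trans (∏-++ (g a) (concatMap g xs)) (*-congˡ (∏-concatMap g xs))

  ∏-* : (xs : List A) {f g : A → Carrier} → ∏ xs (λ a → f a * g a) ≈ ∏ xs f * ∏ xs g
  ∏-* []       = sym (*-identityˡ 1#)
  ∏-* (a ∷ xs) = trans (*-congˡ (∏-* xs))
    (solve 4 (λ a b c d → (a :* b) :* (c :* d) := (a :* c) :* (b :* d)) refl _ _ _ _)

  ∏-filter : {P : A → Set} (P? : Decidable P) (xs : List A) {f : A → Carrier} →
             ∏ (filter P? xs) f ≈ ∏ xs (λ a → if does (P? a) then f a else 1#)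
  ∏-filter P? [] = refl
  ∏-filter P? (a ∷ xs) with does (P? a)
  ... | true  = *-congˡ (∏-filter P? xs)
  ... | false = trans (∏-filter P? xs) (sym (*-identityˡ _))

  𝟙-∧ : ∀ a b → 𝟙 (a ∧ b) ≈ 𝟙 a * 𝟙 b
  𝟙-∧ true  b = sym (*-identityˡ _)
  𝟙-∧ false b = sym (zeroˡ _)

  ι-yes : {P : Set} (d : Dec P) → P → ι d ≈ 1#
  ι-yes (yes _) _ = refl
  ι-yes (no ¬p) p with () ← ¬p p

  ι-no : {P : Set} (d : Dec P) → (P → 0# ≈ 1#) → ι d ≈ 0#
  ι-no (yes p) f = sym (f p)
  ι-no (no ¬p) f = refl

  ι-cong : {P Q : Set} (d : Dec P) (e : Dec Q) → (P → Q) → (Q → P) → ι d ≈ ι e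
  ι-cong (yes p) e       f g = sym (ι-yes e (f p))
  ι-cong (no ¬p) (yes q) f g with () ← ¬p (g q)
  ι-cong (no ¬p) (no ¬q) f g = refl

  -- Lets an equation that holds only on the support of an indicator be used inside a sum;
  -- conditions on contents, degrees and sizes are exploited in this way.
  ι-guard : {P : Set} (d : Dec P) {a b : Carrier} → (P → a ≈ b) → ι d * a ≈ ι d * b
  ι-guard (yes p) e = *-congˡ (e p)
  ι-guard (no ¬p) e = trans (zeroˡ _) (sym (zeroˡ _))

  if-0 : ∀ b {a} → (if b then a else 0#) ≈ 𝟙 b * a
  if-0 true  = sym (*-identityˡ _)
  if-0 false = sym (zeroˡ _)

-- Words in the Hecke generators, reduced up to conjugation to Coxeter elements.

module Reduction where

  open import Data.List.Base
  open import Data.List.Properties using (++-assoc; ++-identityʳ)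
  open import Data.List.Relation.Unary.All as All using (All; []; _∷_)
  open import Data.List.Relation.Unary.All.Properties using (++⁺)
  open import Data.Nat.Base
  open import Data.Nat.Induction using (<-rec)
  open import Data.Nat.Properties
  open import Data.Product.Base using (_,_; ∃-syntax)
  open import Data.Sum.Base using (_⊎_; inj₁; inj₂)
  open import Relation.Binary.Definitions using (tri<; tri≈; tri>)
  open import Relation.Binary.PropositionalEquality
  open import Relation.Nullary.Decidable using (yes; no)

  Far : ℕ → ℕ → Set
  Far s t = (suc (suc s) ≤ t) ⊎ (suc (suc t) ≤ s)

  -- Words in the generators T_s; asc m r and dn m k are the runs m, …, m+r-1 and
  -- m-1, …, m-k.
  asc dn : ℕ → ℕ → List ℕ
  asc m zero    = []
  asc m (suc r) = m ∷ asc (suc m) r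
  dn m       zero    = []
  dn zero    (suc k) = []
  dn (suc m) (suc k) = m ∷ dn m k

  asc-≥ : ∀ m r → All (m ≤_) (asc m r)
  asc-≥ m zero    = []
  asc-≥ m (suc r) = ≤-refl ∷ All.map <⇒≤ (asc-≥ (suc m) r)

  dn-< : ∀ m k → All (_< m) (dn m k)
  dn-< m       zero    = []
  dn-< zero    (suc k) = []
  dn-< (suc m) (suc k) = ≤-refl ∷ All.map m<n⇒m<1+n (dn-< m k)

  dn-≥ : ∀ s m k → s + suc k < m → All (suc (suc s) ≤_) (dn m k)
  dn-≥ s m       zero    h = []
  dn-≥ s zero    (suc k) h = []
  dn-≥ s (suc m) (suc k) (s≤s h) rewrite +-suc s (suc k) =
    ≤-trans (s≤s (≤-trans (m≤m+n (suc s) k) (≤-reflexive (sym (+-suc s k))))) h ∷ dn-≥ s m k h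

  dn-snoc : ∀ s k → dn (suc k + s) (suc k) ≡ dn (suc k + s) k ++ s ∷ []
  dn-snoc s zero    = refl
  dn-snoc s (suc k) = cong (suc k + s ∷_) (dn-snoc s k)

  -- The Hecke relations as closure rules for a predicate on words. `quadratic` asks for both
  -- shorter words because T_s² is a combination of T_s and 1; linear combinations themselves never
  -- appear, so the induction is about words only.
  record RewriteClosed (m : ℕ) (Q : List ℕ → Set) : Set where
    field
      quadratic : ∀ u s v → Q (u ++ v) → Q (u ++ s ∷ v) → Q (u ++ s ∷ s ∷ v)
      braid     : ∀ u s v → suc s < m → Q (u ++ s ∷ suc s ∷ s ∷ v) → Q (u ++ suc s ∷ s ∷ suc s ∷ v)
      commute   : ∀ u s t v → Far s t → Q (u ++ t ∷ s ∷ v) → Q (u ++ s ∷ t ∷ v)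

  module NormalForm {m Q} (closed : RewriteClosed m Q) where
    open RewriteClosed closed

    pass : ∀ u s d v → All (Far s) d → Q (u ++ s ∷ d ++ v) → Q (u ++ d ++ s ∷ v)
    pass u s []      v []         h = h
    pass u s (t ∷ d) v (far ∷ fs) h = subst Q (++-assoc u (t ∷ []) _)
      (pass (u ++ t ∷ []) s d v fs (subst Q (sym (++-assoc u (t ∷ []) _)) (commute u t s _ (flip-far far) h)))
      where
      flip-far : ∀ {s t} → Far s t → Far t s
      flip-far (inj₁ l) = inj₂ l
      flip-far (inj₂ l) = inj₁ l

    -- The letter t + 1 at the right of a descending run commutes past the r letters below t, meets
    -- the pair t + 1, t, comes out of the braid relation as t, and commutes past the i letters
    -- above.
    slide : ∀ i r t u v → i + suc t < m →
            Q (u ++ t ∷ dn (i + suc (suc t)) (i + suc (suc r)) ++ v) →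
            Q (u ++ dn (i + suc (suc t)) (i + suc (suc r)) ++ suc t ∷ v)
    slide zero r t u v t<m h = subst Q (++-assoc u (suc t ∷ t ∷ []) _)
      (pass (u ++ suc t ∷ t ∷ []) (suc t) (dn t r) v (All.map (λ l → inj₂ (s≤s l)) (dn-< t r))
        (subst Q (sym (++-assoc u (suc t ∷ t ∷ []) _)) (braid u t _ t<m h)))
    slide (suc i) r t u v t<m h = subst Q (++-assoc u (a ∷ []) _)
      (slide i r t (u ++ a ∷ []) v (<-trans (n<1+n _) t<m)
        (subst Q (sym (++-assoc u (a ∷ []) _)) (commute u a t _ (inj₂ a-far) h)))
      where
      a = i + suc (suc t)
      a-far : suc (suc t) ≤ a
      a-far = m≤n+m _ i

    snoc : ∀ {s k} → s + suc k ≡ m → dn m (suc k) ≡ dn m k ++ s ∷ []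
    snoc {s} {k} refl rewrite +-comm s (suc k) = dn-snoc s k

    module _ (base : ∀ g k → All (_< pred m) g → k ≤ m → Q (g ++ dn m k)) where

      -- The words `dn m k` represent the right cosets of the symmetric group on m strands in that
      -- on m + 1. A letter s appended to g, m-1, ..., m-k is absorbed in one of four ways: far
      -- below the run it joins g, s = m-k-1 prolongs the run, s = m-k doubles its last letter and
      -- calls for `quadratic`, and a larger s slides through the run into g as s-1.
      normalize : ∀ v g k → All (_< m) v → All (_< pred m) g → k ≤ m → Q ((g ++ dn m k) ++ v)
      normalize [] g k [] gs k≤m = subst Q (sym (++-identityʳ _)) (base g k gs k≤m)
      normalize (s ∷ v) g k (s<m ∷ vs) gs k≤m with <-cmp (s + suc k) m
      ... | tri< l _ _ = subst Q (sym (++-assoc g (dn m k) (s ∷ v)))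
        (pass g s (dn m k) v (All.map inj₁ (dn-≥ s m k l))
          (subst Q (trans (++-assoc (g ++ s ∷ []) (dn m k) v) (++-assoc g (s ∷ []) _))
            (normalize v (g ++ s ∷ []) k vs (++⁺ gs (s<m-1 ∷ [])) k≤m)))
        where
        s<m-1 : s < pred m
        s<m-1 = pred-mono-≤ (≤-trans (s≤s (≤-trans (m≤m+n (suc s) k) (≤-reflexive (sym (+-suc s k))))) l)
      ... | tri≈ _ s+k+1≡m _ = subst Q
        (trans (cong (λ d → (g ++ d) ++ v) (snoc s+k+1≡m)) (trans (cong (_++ v) (sym (++-assoc g _ (s ∷ [])))) (++-assoc (g ++ dn m k) (s ∷ []) v)))
        (normalize v g (suc k) vs gs (≤-trans (m≤n+m (suc k) s) (≤-reflexive s+k+1≡m)))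
      ... | tri> _ _ l with <-cmp (s + k) m
      ...   | tri< l′ _ _ with () ← <⇒≱ l′ (s≤s⁻¹ (≤-trans l (≤-reflexive (+-suc s k))))
      ...   | tri≈ _ s+k≡m _ = ends k s+k≡m k≤m
        where
        ends : ∀ k → s + k ≡ m → k ≤ m → Q ((g ++ dn m k) ++ s ∷ v)
        ends zero     s+k≡m _ with () ← <-irrefl (trans (sym (+-identityʳ s)) s+k≡m) s<m
        ends (suc k′) s+k≡m k≤m = subst (λ d → Q (d ++ s ∷ v)) (sym split)
          (subst Q (sym (++-assoc (g ++ dn m k′) (s ∷ []) (s ∷ v)))
            (quadratic (g ++ dn m k′) s v
              (normalize v g k′ vs gs (≤-trans (n≤1+n k′) k≤m))
              (subst Q (trans (cong (_++ v) split) (++-assoc (g ++ dn m k′) (s ∷ []) v))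
                (normalize v g (suc k′) vs gs k≤m))))
          where
          split : g ++ dn m (suc k′) ≡ (g ++ dn m k′) ++ s ∷ []
          split = trans (cong (g ++_) (snoc s+k≡m)) (sym (++-assoc g _ (s ∷ [])))
      normalize (zero ∷ v) g k (s<m ∷ vs) gs k≤m | tri> _ _ l | tri> _ _ m<k with () ← <⇒≱ m<k k≤m
      normalize (suc t ∷ v) g k (s<m ∷ vs) gs k≤m | tri> _ _ l | tri> _ _ m<s+k
        -- In the shape required by `slide`, i counts the letters of the run above s = t + 1, and r
        -- counts those to be placed below t.
        with i , si≡m ← m≤n⇒∃[o]m+o≡n s<m
        with r , ir≡k ← m≤n⇒∃[o]m+o≡n {suc (suc i)} {k} (+-cancelˡ-≤ t _ _ (s≤s⁻¹ (≤-trans (≤-reflexive (trans (cong (λ a → suc a) (+-comm t (suc (suc i)))) (trans (cong (λ a → suc (suc (suc a))) (+-comm i t)) (cong suc si≡m)))) m<s+k)))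
        = subst Q (sym (++-assoc g (dn m k) (suc t ∷ v))) (subst (λ d → Q (g ++ d ++ suc t ∷ v)) dn≡
            (slide i r t g v (subst (i + suc t <_) i≡m (+-monoʳ-< i (n<1+n _)))
              (subst (λ d → Q (g ++ t ∷ d ++ v)) (sym dn≡)
                (subst Q (trans (++-assoc (g ++ t ∷ []) (dn m k) v) (++-assoc g (t ∷ []) _))
                  (normalize v (g ++ t ∷ []) k vs (++⁺ gs (pred-mono-≤ s<m ∷ [])) k≤m)))))
        where
        i≡m : i + suc (suc t) ≡ m
        i≡m = trans (+-comm i (suc (suc t))) si≡m
        dn≡ : dn (i + suc (suc t)) (i + suc (suc r)) ≡ dn m k
        dn≡ = cong₂ dn i≡m (trans (trans (+-suc i (suc r)) (cong suc (+-suc i r))) ir≡k)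

  -- `P n` concerns words on n strands. A generator T_s with n ≤ s + 1 has no two strands to act on;
  -- `drop-junk` reflects that it acts by a scalar. In `coxeter` the run `asc m r` is a Coxeter
  -- element on r + 1 new strands to the right of g, with r = 0 adding a lone strand.
  record TraceClosed (P : ℕ → List ℕ → Set) : Set where
    field
      nil       : P 0 []
      quadratic : ∀ n u s v → P n (u ++ v) → P n (u ++ s ∷ v) → P n (u ++ s ∷ s ∷ v)
      braid     : ∀ n u s v → suc (suc s) < n → P n (u ++ s ∷ suc s ∷ s ∷ v) → P n (u ++ suc s ∷ s ∷ suc s ∷ v)
      commute   : ∀ n u s t v → Far s t → P n (u ++ t ∷ s ∷ v) → P n (u ++ s ∷ t ∷ v)
      cyclic    : ∀ n u v → P n (u ++ v) → P n (v ++ u)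
      drop-junk : ∀ n u s v → n ≤ suc s → P n (u ++ v) → P n (u ++ s ∷ v)
      coxeter   : ∀ m r g → All (λ s → suc s < m) g → P m g → P (m + suc r) (g ++ asc m r)

  module _ {P : ℕ → List ℕ → Set} (closed : TraceClosed P) where
    open TraceClosed closed

    private
      pass-asc : ∀ n u v d a → All (λ t → All (Far t) a) d → P n (u ++ a ++ d ++ v) → P n (u ++ d ++ a ++ v)
      pass-asc n u v []      a []         h = h
      pass-asc n u v (t ∷ d) a (far ∷ fs) h = subst (P n) (++-assoc u (t ∷ []) _)
        (pass-asc n (u ++ t ∷ []) v d a fs (subst (P n) (sym (++-assoc u (t ∷ []) _)) (back u a far h)))
        where
        back : ∀ u a → All (Far t) a → P n (u ++ a ++ t ∷ d ++ v) → P n (u ++ t ∷ a ++ d ++ v)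
        back u []      []         h = h
        back u (b ∷ a) (f ∷ fs) h = commute n u t b _ f (subst (P n) (++-assoc u (b ∷ []) _)
          (back (u ++ b ∷ []) a fs (subst (P n) (sym (++-assoc u (b ∷ []) _)) h)))

      context : ∀ m r t → m + suc r ≡ t → RewriteClosed m (λ g → P t (g ++ asc m r))
      context m r t refl = record
        { quadratic = λ u s v h h′ → subst (P _) (sym (++-assoc u _ _))
            (quadratic _ u s _ (subst (P _) (++-assoc u v _) h) (subst (P _) (++-assoc u (s ∷ v) _) h′))
        ; braid = λ u s v s<m h → subst (P _) (sym (++-assoc u _ _))
            (braid _ u s _ (≤-trans (s≤s s<m) (≤-trans (≤-reflexive (+-comm 1 m)) (+-monoʳ-≤ m (s≤s z≤n)))) (subst (P _) (++-assoc u (s ∷ suc s ∷ s ∷ v) _) h))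
        ; commute = λ u s t v f h → subst (P _) (sym (++-assoc u _ _))
            (commute _ u s t _ f (subst (P _) (++-assoc u (t ∷ s ∷ v) _) h))
        }

      -- Cyclicity lowers the start m of the ascending run until the remaining
      -- factor only involves strands to its left.
      claim : ∀ m r → (∀ {m′} → m′ < m + suc r → ∀ g → P m′ g) →
              ∀ g → All (_< m) g → P (m + suc r) (g ++ asc m r)
      claim zero r ih [] [] = coxeter 0 r [] [] nil
      claim (suc m) r ih g gs = NormalForm.normalize (context (suc m) r _ refl) base g [] 0 gs [] z≤n
        where
        base : ∀ g k → All (_< m) g → k ≤ suc m → P (suc m + suc r) ((g ++ dn (suc m) k) ++ asc (suc m) r)
        base g zero gs _ = subst (λ u → P _ (u ++ asc (suc m) r)) (sym (++-identityʳ g))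
          (coxeter (suc m) r g (All.map s≤s gs) (ih (m<m+n (suc m) (s≤s z≤n)) g))
        -- The word is g, m, `dn m k`, `asc (suc m) r`. All letters of `dn m k` are below m, so it
        -- commutes past the ascending run; carried cyclically to the front, it leaves m attached to
        -- that run, which becomes `asc m (suc r)`.
        base g (suc k) gs _ = subst (P _) (sym (++-assoc g (m ∷ dn m k) _))
          (subst (P _) (trans (++-assoc g (m ∷ []) _) (cong (λ l → g ++ m ∷ dn m k ++ l) (++-identityʳ _)))
          (pass-asc _ (g ++ m ∷ []) [] (dn m k) (asc (suc m) r)
            (All.map (λ l → All.map (λ l′ → inj₁ (≤-trans (s≤s l) l′)) (asc-≥ (suc m) r)) (dn-< m k))
            (subst (P _) (trans (++-assoc g (m ∷ asc (suc m) r) (dn m k)) (trans (sym (++-assoc g (m ∷ []) _)) (cong (λ l → (g ++ m ∷ []) ++ asc (suc m) r ++ l) (sym (++-identityʳ _)))))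
              (cyclic _ (dn m k) (g ++ m ∷ asc (suc m) r)
                (subst₂ P (+-suc m (suc r)) (++-assoc (dn m k) g _)
                  (claim m (suc r) (λ l → ih (≤-trans l (≤-reflexive (+-suc m (suc r))))) (dn m k ++ g) (++⁺ (dn-< m k) gs)))))))

      strip : ∀ n → (∀ g → All (λ s → suc s < n) g → P n g) → ∀ u v → All (λ s → suc s < n) u → P n (u ++ v)
      strip n h u []      us = subst (P n) (sym (++-identityʳ u)) (h u us)
      strip n h u (s ∷ v) us with suc s <? n
      ... | yes s<n = subst (P n) (++-assoc u (s ∷ []) v) (strip n h (u ++ s ∷ []) v (++⁺ us (s<n ∷ [])))
      ... | no  s≮n = drop-junk n u s v (≮⇒≥ s≮n) (strip n h u v us)

    trace-induction : ∀ n g → P n g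
    trace-induction = <-rec _ step
      where
      step : ∀ n → (∀ {m} → m < n → ∀ g → P m g) → ∀ g → P n g
      step zero    ih g = strip 0 (λ { [] [] → nil }) [] g []
      -- The run `asc n 0` is empty, so every word on n + 1 strands already has the form to which
      -- `claim` applies.
      step (suc n) ih g = strip (suc n) (λ g gs → subst₂ P (+-comm n 1) (++-identityʳ g)
        (claim n 0 (λ l → ih (≤-trans l (≤-reflexive (+-comm n 1)))) g (All.map s≤s⁻¹ gs))) [] g []

-- The Hecke algebra acting on functions of words.

module Hecke (R : CommutativeSemiring 0ℓ 0ℓ) (z p x : CommutativeSemiring.Carrier R) where

  open import Data.List.Base
  open import Data.List.Relation.Unary.All using (All; []; _∷_)
  open import Data.Nat.Base as ℕ using (ℕ; zero; suc)
  open import Data.Nat.Properties using (m≤n⇒∃[o]m+o≡n)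
  open import Data.Sum.Base using (inj₁; inj₂)
  open import Data.Product.Base using (_×_; _,_)
  open import Data.Unit.Base using (⊤)
  open import Function.Base using (_∘_)
  open import Relation.Binary.PropositionalEquality as ≡ using (_≡_)

  open Sums R
  open Reduction using (Far)

  data Cmp : Set where
    lt eq gt : Cmp

  flip : Cmp → Cmp
  flip lt = gt
  flip eq = eq
  flip gt = lt

  -- Transitivity in the form of a table, so that the braid relation can be verified by cases on
  -- three comparisons.
  Consistent : Cmp → Cmp → Cmp → Set
  Consistent lt gt c = ⊤
  Consistent gt lt c = ⊤
  Consistent eq d  c = c ≡ d
  Consistent lt _  c = c ≡ lt
  Consistent gt _  c = c ≡ gt

  record Order (A : Set) : Set where
    field
      cmp        : A → A → Cmp
      cmp-flip   : ∀ a b → cmp b a ≡ flip (cmp a b)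
      cmp-eq     : ∀ a b → cmp a b ≡ eq → a ≡ b
      consistent : ∀ a b c → Consistent (cmp a b) (cmp b c) (cmp a c)

    cmp-refl : ∀ a → cmp a a ≡ eq
    cmp-refl a with cmp a a | cmp-flip a a
    ... | eq | _ = ≡.refl

  q : Carrier
  q = z + p

  -- T_s satisfies (T_s - q)(T_s + p) = 0, and two equal adjacent letters are
  -- multiplied by its eigenvalue x = -p.
  α e : Cmp → Carrier
  α lt = z
  α eq = x
  α gt = 0#
  e lt = q
  e eq = 0#
  e gt = p

  -- Formal expressions, with no relations imposed: one and the same element has to be evaluated for
  -- many ordered alphabets and for words of every length, and the relations are proved for each
  -- action instead.
  data H : Set where
    T       : ℕ → H
    sc      : Carrier → H
    _⊞_ _⊙_ : H → H → H

  infixl 6 _⊞_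
  infixr 7 _⊙_

  word : List ℕ → H
  word []       = sc 1#
  word (s ∷ ss) = T s ⊙ word ss

  sw : {A : Set} → ℕ → List A → List A
  sw zero    (a ∷ b ∷ w) = b ∷ a ∷ w
  sw zero    w           = w
  sw (suc s) (a ∷ w)     = a ∷ sw s w
  sw (suc s) []          = []

  sw-length : {A : Set} (s : ℕ) (w : List A) → length (sw s w) ≡ length w
  sw-length zero    []          = ≡.refl
  sw-length zero    (a ∷ [])    = ≡.refl
  sw-length zero    (a ∷ b ∷ w) = ≡.refl
  sw-length (suc s) []          = ≡.refl
  sw-length (suc s) (a ∷ w)     = ≡.cong suc (sw-length s w)

  sw-involutive : {A : Set} (s : ℕ) (w : List A) → sw s (sw s w) ≡ w
  sw-involutive zero    []          = ≡.refl
  sw-involutive zero    (a ∷ [])    = ≡.refl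
  sw-involutive zero    (a ∷ b ∷ w) = ≡.refl
  sw-involutive (suc s) []          = ≡.refl
  sw-involutive (suc s) (a ∷ w)     = ≡.cong (a ∷_) (sw-involutive s w)

  sw-map : {A B : Set} (g : A → B) (s : ℕ) (w : List A) → sw s (map g w) ≡ map g (sw s w)
  sw-map g zero    []          = ≡.refl
  sw-map g zero    (a ∷ [])    = ≡.refl
  sw-map g zero    (a ∷ b ∷ w) = ≡.refl
  sw-map g (suc s) []          = ≡.refl
  sw-map g (suc s) (a ∷ w)     = ≡.cong (g a ∷_) (sw-map g s w)

  sw-All : {A : Set} {D : A → Set} (s : ℕ) (w : List A) → All D w → All D (sw s w)
  sw-All zero    []          ds           = ds
  sw-All zero    (a ∷ [])    ds           = ds
  sw-All zero    (a ∷ b ∷ w) (d ∷ d′ ∷ ds) = d′ ∷ d ∷ ds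
  sw-All (suc s) []          ds           = ds
  sw-All (suc s) (a ∷ w)     (d ∷ ds)     = d ∷ sw-All s w ds

  module Act {A : Set} (O : Order A) where
    open Order O

    Fun : Set
    Fun = List A → Carrier

    -- Where s exceeds the length of the word, T s acts by the scalar q, so that
    -- the quadratic relation holds there too.
    al ga : ℕ → List A → Carrier
    al zero    (a ∷ b ∷ w) = α (cmp a b)
    al (suc s) (a ∷ w)     = al s w
    al _       _           = q
    ga zero    (a ∷ b ∷ w) = e (cmp a b)
    ga (suc s) (a ∷ w)     = ga s w
    ga _       _           = 0#

    act : ℕ → Fun → Fun
    act s f w = al s w * f w + ga s w * f (sw s w)

    ⟪_⟫ : H → Fun → Fun
    ⟪ T s ⟫   = act s
    ⟪ sc c ⟫  f w = c * f w
    ⟪ h ⊞ g ⟫ f w = ⟪ h ⟫ f w + ⟪ g ⟫ f w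
    ⟪ h ⊙ g ⟫ f = ⟪ h ⟫ (⟪ g ⟫ f)

    -- Operators evaluate a function only at words reached by adjacent swaps, so any class D stable
    -- under swaps is enough. It is applied to words of a given length and to words without
    -- repetition.
    ⟪⟫-cong-on : (D : List A → Set) → (∀ s w → D w → D (sw s w)) → ∀ h {f g} →
                 (∀ w → D w → f w ≈ g w) → ∀ w → D w → ⟪ h ⟫ f w ≈ ⟪ h ⟫ g w
    ⟪⟫-cong-on D cl (T s)   ≈f w d = +-cong (*-congˡ (≈f w d)) (*-congˡ (≈f (sw s w) (cl s w d)))
    ⟪⟫-cong-on D cl (sc c)  ≈f w d = *-congˡ (≈f w d)
    ⟪⟫-cong-on D cl (h ⊞ g) ≈f w d = +-cong (⟪⟫-cong-on D cl h ≈f w d) (⟪⟫-cong-on D cl g ≈f w d)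
    ⟪⟫-cong-on D cl (h ⊙ g) ≈f w d = ⟪⟫-cong-on D cl h (⟪⟫-cong-on D cl g ≈f) w d

    ⟪⟫-cong : ∀ h n {f g} → (∀ w → length w ≡ n → f w ≈ g w) →
              ∀ w → length w ≡ n → ⟪ h ⟫ f w ≈ ⟪ h ⟫ g w
    ⟪⟫-cong h n = ⟪⟫-cong-on (λ w → length w ≡ n) (λ s w → ≡.trans (sw-length s w)) h

    ⟪⟫-ext : ∀ h {f g} → (∀ w → f w ≈ g w) → ∀ w → ⟪ h ⟫ f w ≈ ⟪ h ⟫ g w
    ⟪⟫-ext h ≈f w = ⟪⟫-cong h (length w) (λ v _ → ≈f v) w ≡.refl

    ⟪⟫-* : ∀ h c (f : Fun) w → ⟪ h ⟫ (λ v → c * f v) w ≈ c * ⟪ h ⟫ f w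
    ⟪⟫-* (T s)   c f w = solve 5 (λ a b c f g → a :* (c :* f) :+ b :* (c :* g) := c :* (a :* f :+ b :* g)) refl _ _ _ _ _
    ⟪⟫-* (sc d)  c f w = x*yz≈y*xz _ _ _
    ⟪⟫-* (h ⊞ g) c f w = trans (+-cong (⟪⟫-* h c f w) (⟪⟫-* g c f w)) (sym (distribˡ c _ _))
    ⟪⟫-* (h ⊙ g) c f w = trans (⟪⟫-ext h (⟪⟫-* g c f) w) (⟪⟫-* h c (⟪ g ⟫ f) w)

    ⟪⟫-+ : ∀ h (f g : Fun) w → ⟪ h ⟫ (λ v → f v + g v) w ≈ ⟪ h ⟫ f w + ⟪ h ⟫ g w
    ⟪⟫-+ (T s)    f g w = solve 6 (λ a b f g f′ g′ → a :* (f :+ g) :+ b :* (f′ :+ g′) := (a :* f :+ b :* f′) :+ (a :* g :+ b :* g′)) refl _ _ _ _ _ _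
    ⟪⟫-+ (sc d)   f g w = distribˡ d _ _
    ⟪⟫-+ (h ⊞ h′) f g w = trans (+-cong (⟪⟫-+ h f g w) (⟪⟫-+ h′ f g w)) (swap-inner _ _ _ _)
    ⟪⟫-+ (h ⊙ h′) f g w = trans (⟪⟫-ext h (⟪⟫-+ h′ f g) w) (⟪⟫-+ h _ _ w)

    word-++ : ∀ u v f w → ⟪ word (u ++ v) ⟫ f w ≈ ⟪ word u ⟫ (⟪ word v ⟫ f) w
    word-++ []      v f w = sym (*-identityˡ _)
    word-++ (s ∷ u) v f w = ⟪⟫-ext (T s) (word-++ u v f) w

    act-commute : ∀ s r f w → act s (act (suc (suc s) ℕ.+ r) f) w ≈ act (suc (suc s) ℕ.+ r) (act s f) w
    act-commute zero r f []          = refl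
    act-commute zero r f (a ∷ [])    = refl
    act-commute zero r f (a ∷ b ∷ w) = solve 8
      (λ k l m n f₁ f₂ f₃ f₄ → k :* (m :* f₁ :+ n :* f₂) :+ l :* (m :* f₃ :+ n :* f₄)
                            := m :* (k :* f₁ :+ l :* f₃) :+ n :* (k :* f₂ :+ l :* f₄)) refl _ _ _ _ _ _ _ _
    act-commute (suc s) r f []      = refl
    act-commute (suc s) r f (a ∷ w) = act-commute s r (f ∘ (a ∷_)) w

    module Relations (x+p≈0 : x + p ≈ 0#) where

      -- x = -p is a root of (X - q)(X + p). In place of a subtraction, the vanishing term q (x + p)
      -- is added.
      xx≈zx+qp : x * x ≈ z * x + q * p
      xx≈zx+qp = begin
        x * x                                  ≈⟨ +-identityʳ _ ⟨
        x * x + 0#                             ≈⟨ +-congˡ (trans (*-congˡ x+p≈0) (zeroʳ (z + p))) ⟨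
        x * x + (z + p) * (x + p)              ≈⟨ solve 3 (λ x p z → x :* x :+ (z :+ p) :* (x :+ p) := x :* (x :+ p) :+ (z :* x :+ (z :+ p) :* p)) refl x p z ⟩
        x * (x + p) + (z * x + (z + p) * p)    ≈⟨ +-congʳ (trans (*-congˡ x+p≈0) (zeroʳ x)) ⟩
        0# + (z * x + (z + p) * p)             ≈⟨ +-identityˡ _ ⟩
        z * x + q * p                          ∎

      act-quadratic : ∀ s f w → act s (act s f) w ≈ z * act s f w + (q * p) * f w
      act-quadratic zero f [] = solve 3 (λ z p f → (z :+ p) :* ((z :+ p) :* f :+ con 0 :* f) :+ con 0 :* ((z :+ p) :* f :+ con 0 :* f)
        := z :* ((z :+ p) :* f :+ con 0 :* f) :+ (z :+ p) :* p :* f) refl z p _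
      act-quadratic zero f (a ∷ []) = solve 3 (λ z p f → (z :+ p) :* ((z :+ p) :* f :+ con 0 :* f) :+ con 0 :* ((z :+ p) :* f :+ con 0 :* f)
        := z :* ((z :+ p) :* f :+ con 0 :* f) :+ (z :+ p) :* p :* f) refl z p _
      act-quadratic zero f (a ∷ b ∷ w) rewrite cmp-flip a b with cmp a b
      ... | lt = solve 4 (λ z p f g → z :* (z :* f :+ (z :+ p) :* g) :+ (z :+ p) :* (con 0 :* g :+ p :* f)
        := z :* (z :* f :+ (z :+ p) :* g) :+ (z :+ p) :* p :* f) refl z p _ _
      ... | eq = begin
        x * (x * f₁ + 0# * f₂) + 0# * (x * f₂ + 0# * f₁)
          ≈⟨ solve 3 (λ x f g → x :* (x :* f :+ con 0 :* g) :+ con 0 :* (x :* g :+ con 0 :* f) := x :* x :* f) refl x f₁ f₂ ⟩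
        x * x * f₁                  ≈⟨ *-congʳ xx≈zx+qp ⟩
        (z * x + q * p) * f₁        ≈⟨ solve 5 (λ z x f g qp → (z :* x :+ qp) :* f := z :* (x :* f :+ con 0 :* g) :+ qp :* f) refl z x f₁ f₂ (q * p) ⟩
        z * (x * f₁ + 0# * f₂) + q * p * f₁ ∎
        where
        f₁ = f (a ∷ b ∷ w)
        f₂ = f (b ∷ a ∷ w)
      ... | gt = solve 4 (λ z p f g → con 0 :* (con 0 :* f :+ p :* g) :+ p :* (z :* g :+ (z :+ p) :* f)
        := z :* (con 0 :* f :+ p :* g) :+ (z :+ p) :* p :* f) refl z p _ _
      act-quadratic (suc s) f [] = solve 3 (λ z p f → (z :+ p) :* ((z :+ p) :* f :+ con 0 :* f) :+ con 0 :* ((z :+ p) :* f :+ con 0 :* f)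
        := z :* ((z :+ p) :* f :+ con 0 :* f) :+ (z :+ p) :* p :* f) refl z p _
      act-quadratic (suc s) f (a ∷ w) = act-quadratic s (f ∘ (a ∷_)) w

      private
        -- The unknowns stand for the values of f at the rearrangements of three letters. Since the
        -- coefficients depend only on comparisons, the braid relation amounts to one polynomial
        -- identity per consistent pattern; just the patterns a < b = c and a = b < c need x² = z x
        -- + q p, the others being formal in z, p and x.
        braid-coefficients : ∀ ab bc ac → Consistent ab bc ac → ∀ abc bac acb cab bca cba →
          α ab * (α bc * (α ab * abc + e ab * bac) + e bc * (α ac * acb + e ac * cab)) +
          e ab * (α ac * (α (flip ab) * bac + e (flip ab) * abc) + e ac * (α bc * bca + e bc * cba))
          ≈
          α bc * (α ab * (α bc * abc + e bc * acb) + e ab * (α ac * bac + e ac * bca)) +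
          e bc * (α ac * (α (flip bc) * acb + e (flip bc) * abc) + e ac * (α ab * cab + e ab * cba))
        braid-coefficients lt lt _ ≡.refl = λ f g h i j k → solve 8 (λ z p f g h i j k → let q = z :+ p in
          z :* (z :* (z :* f :+ q :* g) :+ q :* (z :* h :+ q :* i)) :+
          q :* (z :* (con 0 :* g :+ p :* f) :+ q :* (z :* j :+ q :* k)) :=
          z :* (z :* (z :* f :+ q :* h) :+ q :* (z :* g :+ q :* j)) :+
          q :* (z :* (con 0 :* h :+ p :* f) :+ q :* (z :* i :+ q :* k))) refl z p f g h i j k
        braid-coefficients lt eq _ ≡.refl f g h i j k = begin
          _ ≈⟨ solve 9 (λ z p x f g h i j k → let q = z :+ p in
            z :* (x :* (z :* f :+ q :* g) :+ con 0 :* (z :* h :+ q :* i)) :+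
            q :* (z :* (con 0 :* g :+ p :* f) :+ q :* (x :* j :+ con 0 :* k)) :=
            z :* (z :* x :+ q :* p) :* f :+ (x :* z :* q :* g :+ q :* q :* x :* j)) refl z p x f g h i j k ⟩
          z * (z * x + q * p) * f + (x * z * q * g + q * q * x * j)
            ≈⟨ +-congʳ (*-congʳ (*-congˡ (sym xx≈zx+qp))) ⟩
          z * (x * x) * f + (x * z * q * g + q * q * x * j)
            ≈⟨ solve 9 (λ z p x f g h i j k → let q = z :+ p in
            z :* (x :* x) :* f :+ (x :* z :* q :* g :+ q :* q :* x :* j) :=
            x :* (z :* (x :* f :+ con 0 :* h) :+ q :* (z :* g :+ q :* j)) :+
            con 0 :* (z :* (x :* h :+ con 0 :* f) :+ q :* (z :* i :+ q :* k))) refl z p x f g h i j k ⟩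
          _ ∎
        braid-coefficients lt gt lt _ = λ f g h i j k → solve 8 (λ z p f g h i j k → let q = z :+ p in
          z :* (con 0 :* (z :* f :+ q :* g) :+ p :* (z :* h :+ q :* i)) :+
          q :* (z :* (con 0 :* g :+ p :* f) :+ q :* (con 0 :* j :+ p :* k)) :=
          con 0 :* (z :* (con 0 :* f :+ p :* h) :+ q :* (z :* g :+ q :* j)) :+
          p :* (z :* (z :* h :+ q :* f) :+ q :* (z :* i :+ q :* k))) refl z p f g h i j k
        braid-coefficients lt gt eq _ = λ f g h i j k → solve 9 (λ z p x f g h i j k → let q = z :+ p in
          z :* (con 0 :* (z :* f :+ q :* g) :+ p :* (x :* h :+ con 0 :* i)) :+
          q :* (x :* (con 0 :* g :+ p :* f) :+ con 0 :* (con 0 :* j :+ p :* k)) :=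
          con 0 :* (z :* (con 0 :* f :+ p :* h) :+ q :* (x :* g :+ con 0 :* j)) :+
          p :* (x :* (z :* h :+ q :* f) :+ con 0 :* (z :* i :+ q :* k))) refl z p x f g h i j k
        braid-coefficients lt gt gt _ = λ f g h i j k → solve 8 (λ z p f g h i j k → let q = z :+ p in
          z :* (con 0 :* (z :* f :+ q :* g) :+ p :* (con 0 :* h :+ p :* i)) :+
          q :* (con 0 :* (con 0 :* g :+ p :* f) :+ p :* (con 0 :* j :+ p :* k)) :=
          con 0 :* (z :* (con 0 :* f :+ p :* h) :+ q :* (con 0 :* g :+ p :* j)) :+
          p :* (con 0 :* (z :* h :+ q :* f) :+ p :* (z :* i :+ q :* k))) refl z p f g h i j k
        braid-coefficients eq lt _ ≡.refl f g h i j k = begin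
          _ ≈⟨ solve 9 (λ z p x f g h i j k → let q = z :+ p in
            x :* (z :* (x :* f :+ con 0 :* g) :+ q :* (z :* h :+ q :* i)) :+
            con 0 :* (z :* (x :* g :+ con 0 :* f) :+ q :* (z :* j :+ q :* k)) :=
            z :* (x :* x) :* f :+ (x :* z :* q :* h :+ q :* q :* x :* i)) refl z p x f g h i j k ⟩
          z * (x * x) * f + (x * z * q * h + q * q * x * i)
            ≈⟨ +-congʳ (*-congʳ (*-congˡ xx≈zx+qp)) ⟩
          z * (z * x + q * p) * f + (x * z * q * h + q * q * x * i)
            ≈⟨ solve 9 (λ z p x f g h i j k → let q = z :+ p in
            z :* (z :* x :+ q :* p) :* f :+ (x :* z :* q :* h :+ q :* q :* x :* i) :=
            z :* (x :* (z :* f :+ q :* h) :+ con 0 :* (z :* g :+ q :* j)) :+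
            q :* (z :* (con 0 :* h :+ p :* f) :+ q :* (x :* i :+ con 0 :* k))) refl z p x f g h i j k ⟩
          _ ∎
        braid-coefficients eq eq _ ≡.refl = λ f g h i j k → solve 7 (λ x f g h i j k →
          x :* (x :* (x :* f :+ con 0 :* g) :+ con 0 :* (x :* h :+ con 0 :* i)) :+
          con 0 :* (x :* (x :* g :+ con 0 :* f) :+ con 0 :* (x :* j :+ con 0 :* k)) :=
          x :* (x :* (x :* f :+ con 0 :* h) :+ con 0 :* (x :* g :+ con 0 :* j)) :+
          con 0 :* (x :* (x :* h :+ con 0 :* f) :+ con 0 :* (x :* i :+ con 0 :* k))) refl x f g h i j k
        braid-coefficients eq gt _ ≡.refl f g h i j k = begin
          _ ≈⟨ solve 9 (λ z p x f g h i j k → let q = z :+ p in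
            x :* (con 0 :* (x :* f :+ con 0 :* g) :+ p :* (con 0 :* h :+ p :* i)) :+
            con 0 :* (con 0 :* (x :* g :+ con 0 :* f) :+ p :* (con 0 :* j :+ p :* k)) :=
            con 0 :* (x :* (con 0 :* f :+ p :* h) :+ con 0 :* (con 0 :* g :+ p :* j)) :+
            p :* (con 0 :* (z :* h :+ q :* f) :+ p :* (x :* i :+ con 0 :* k))) refl z p x f g h i j k ⟩
          _ ∎
        braid-coefficients gt lt lt _ = λ f g h i j k → solve 8 (λ z p f g h i j k → let q = z :+ p in
          con 0 :* (z :* (con 0 :* f :+ p :* g) :+ q :* (z :* h :+ q :* i)) :+
          p :* (z :* (z :* g :+ q :* f) :+ q :* (z :* j :+ q :* k)) :=
          z :* (con 0 :* (z :* f :+ q :* h) :+ p :* (z :* g :+ q :* j)) :+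
          q :* (z :* (con 0 :* h :+ p :* f) :+ q :* (con 0 :* i :+ p :* k))) refl z p f g h i j k
        braid-coefficients gt lt eq _ = λ f g h i j k → solve 9 (λ z p x f g h i j k → let q = z :+ p in
          con 0 :* (z :* (con 0 :* f :+ p :* g) :+ q :* (x :* h :+ con 0 :* i)) :+
          p :* (x :* (z :* g :+ q :* f) :+ con 0 :* (z :* j :+ q :* k)) :=
          z :* (con 0 :* (z :* f :+ q :* h) :+ p :* (x :* g :+ con 0 :* j)) :+
          q :* (x :* (con 0 :* h :+ p :* f) :+ con 0 :* (con 0 :* i :+ p :* k))) refl z p x f g h i j k
        braid-coefficients gt lt gt _ = λ f g h i j k → solve 8 (λ z p f g h i j k → let q = z :+ p in
          con 0 :* (z :* (con 0 :* f :+ p :* g) :+ q :* (con 0 :* h :+ p :* i)) :+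
          p :* (con 0 :* (z :* g :+ q :* f) :+ p :* (z :* j :+ q :* k)) :=
          z :* (con 0 :* (z :* f :+ q :* h) :+ p :* (con 0 :* g :+ p :* j)) :+
          q :* (con 0 :* (con 0 :* h :+ p :* f) :+ p :* (con 0 :* i :+ p :* k))) refl z p f g h i j k
        braid-coefficients gt eq _ ≡.refl = λ f g h i j k → solve 9 (λ z p x f g h i j k → let q = z :+ p in
          con 0 :* (x :* (con 0 :* f :+ p :* g) :+ con 0 :* (con 0 :* h :+ p :* i)) :+
          p :* (con 0 :* (z :* g :+ q :* f) :+ p :* (x :* j :+ con 0 :* k)) :=
          x :* (con 0 :* (x :* f :+ con 0 :* h) :+ p :* (con 0 :* g :+ p :* j)) :+
          con 0 :* (con 0 :* (x :* h :+ con 0 :* f) :+ p :* (con 0 :* i :+ p :* k))) refl z p x f g h i j k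
        braid-coefficients gt gt _ ≡.refl = λ f g h i j k → solve 8 (λ z p f g h i j k → let q = z :+ p in
          con 0 :* (con 0 :* (con 0 :* f :+ p :* g) :+ p :* (con 0 :* h :+ p :* i)) :+
          p :* (con 0 :* (z :* g :+ q :* f) :+ p :* (con 0 :* j :+ p :* k)) :=
          con 0 :* (con 0 :* (con 0 :* f :+ p :* h) :+ p :* (con 0 :* g :+ p :* j)) :+
          p :* (con 0 :* (z :* h :+ q :* f) :+ p :* (con 0 :* i :+ p :* k))) refl z p f g h i j k

      -- The length bound matters: on words of length s + 2 the generator T_{s+1} is the scalar q,
      -- and the relation would read q T_s² = q² T_s.
      act-braid : ∀ s f w → suc (suc s) ℕ.< length w →
                  act s (act (suc s) (act s f)) w ≈ act (suc s) (act s (act (suc s) f)) w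
      act-braid zero f (a ∷ b ∷ c ∷ w) _ rewrite cmp-flip a b | cmp-flip b c =
        braid-coefficients (cmp a b) (cmp b c) (cmp a c) (consistent a b c) _ _ _ _ _ _
      act-braid zero f (a ∷ b ∷ []) (ℕ.s≤s (ℕ.s≤s ()))
      act-braid zero f (a ∷ []) (ℕ.s≤s ())
      act-braid (suc s) f (a ∷ w) (ℕ.s≤s l) = act-braid s (f ∘ (a ∷_)) w l

      quadratic : ∀ u s v f w → ⟪ word (u ++ s ∷ s ∷ v) ⟫ f w ≈
                  z * ⟪ word (u ++ s ∷ v) ⟫ f w + (q * p) * ⟪ word (u ++ v) ⟫ f w
      quadratic u s v f w = begin
        ⟪ word (u ++ s ∷ s ∷ v) ⟫ f w
          ≈⟨ trans (word-++ u _ f w) (⟪⟫-ext (word u) (act-quadratic s (⟪ word v ⟫ f)) w) ⟩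
        ⟪ word u ⟫ (λ w → z * ⟪ word (s ∷ v) ⟫ f w + (q * p) * ⟪ word v ⟫ f w) w
          ≈⟨ trans (⟪⟫-+ (word u) _ _ w) (+-cong (⟪⟫-* (word u) z _ w) (⟪⟫-* (word u) (q * p) _ w)) ⟩
        z * ⟪ word u ⟫ (⟪ word (s ∷ v) ⟫ f) w + (q * p) * ⟪ word u ⟫ (⟪ word v ⟫ f) w
          ≈⟨ +-cong (*-congˡ (word-++ u _ f w)) (*-congˡ (word-++ u _ f w)) ⟨
        z * ⟪ word (u ++ s ∷ v) ⟫ f w + (q * p) * ⟪ word (u ++ v) ⟫ f w ∎

      braid : ∀ n u s v f w → suc (suc s) ℕ.< n → length w ≡ n →
              ⟪ word (u ++ suc s ∷ s ∷ suc s ∷ v) ⟫ f w ≈ ⟪ word (u ++ s ∷ suc s ∷ s ∷ v) ⟫ f w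
      braid n u s v f w s<n l = trans (word-++ u _ f w) (trans
        (⟪⟫-cong (word u) n (λ w l → sym (act-braid s (⟪ word v ⟫ f) w (≡.subst (suc (suc s) ℕ.<_) (≡.sym l) s<n))) w l)
        (sym (word-++ u _ f w)))

    commute : ∀ u s t v f w → Far s t → ⟪ word (u ++ s ∷ t ∷ v) ⟫ f w ≈ ⟪ word (u ++ t ∷ s ∷ v) ⟫ f w
    commute u s t v f w far = trans (word-++ u _ f w) (trans (⟪⟫-ext (word u) (two far) w) (sym (word-++ u _ f w)))
      where
      two : ∀ {s t} → Far s t → ∀ w → act s (act t (⟪ word v ⟫ f)) w ≈ act t (act s (⟪ word v ⟫ f)) w
      two (inj₁ l) w with r , ≡.refl ← m≤n⇒∃[o]m+o≡n l = act-commute _ r (⟪ word v ⟫ f) w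
      two (inj₂ l) w with r , ≡.refl ← m≤n⇒∃[o]m+o≡n l = sym (act-commute _ r (⟪ word v ⟫ f) w)

    short : ∀ s w → length w ℕ.≤ suc s → (al s w ≡ q) × (ga s w ≡ 0#)
    short zero    []          l = ≡.refl , ≡.refl
    short zero    (a ∷ [])    l = ≡.refl , ≡.refl
    short zero    (a ∷ b ∷ w) (ℕ.s≤s ())
    short (suc s) []          l = ≡.refl , ≡.refl
    short (suc s) (a ∷ w)     (ℕ.s≤s l) = short s w l

    drop-junk : ∀ n u s v f w → n ℕ.≤ suc s → length w ≡ n →
                ⟪ word (u ++ s ∷ v) ⟫ f w ≈ q * ⟪ word (u ++ v) ⟫ f w
    drop-junk n u s v f w n≤s l = trans (word-++ u _ f w) (trans
      (⟪⟫-cong (word u) n scalar w l) (trans (⟪⟫-* (word u) q _ w) (*-congˡ (sym (word-++ u v f w)))))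
      where
      scalar : ∀ w → length w ≡ n → act s (⟪ word v ⟫ f) w ≈ q * ⟪ word v ⟫ f w
      scalar w l with short s w (≡.subst (ℕ._≤ suc s) (≡.sym l) n≤s)
      ... | al≡ , ga≡ = trans (+-cong (*-congʳ (reflexive al≡)) (trans (*-congʳ (reflexive ga≡)) (zeroˡ _))) (+-identityʳ _)

  -- `al` and `ga` see letters only through `cmp`, hence relabelling by a comparison-preserving map
  -- intertwines the actions. D restricts this requirement to the letters of the word at hand.
  transport : ∀ {A B : Set} (O : Order A) (O′ : Order B) (g : B → A) {D : B → Set} →
              (∀ {b b′} → D b → D b′ → Order.cmp O (g b) (g b′) ≡ Order.cmp O′ b b′) →
              ∀ h f w → All D w → Act.⟪_⟫ O h f (map g w) ≈ Act.⟪_⟫ O′ h (f ∘ map g) w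
  transport O O′ g {D} ≡cmp = go
    where
    open Act
    al≡ : ∀ s w → All D w → al O s (map g w) ≡ al O′ s w
    al≡ zero    []          ds           = ≡.refl
    al≡ zero    (a ∷ [])    ds           = ≡.refl
    al≡ zero    (a ∷ b ∷ w) (d ∷ d′ ∷ _) = ≡.cong α (≡cmp d d′)
    al≡ (suc s) []          ds           = ≡.refl
    al≡ (suc s) (a ∷ w)     (_ ∷ ds)     = al≡ s w ds
    ga≡ : ∀ s w → All D w → ga O s (map g w) ≡ ga O′ s w
    ga≡ zero    []          ds           = ≡.refl
    ga≡ zero    (a ∷ [])    ds           = ≡.refl
    ga≡ zero    (a ∷ b ∷ w) (d ∷ d′ ∷ _) = ≡.cong e (≡cmp d d′)
    ga≡ (suc s) []          ds           = ≡.refl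
    ga≡ (suc s) (a ∷ w)     (_ ∷ ds)     = ga≡ s w ds
    go′ : ∀ h {f f′} → (∀ w → All D w → f (map g w) ≈ f′ w) → ∀ w → All D w →
          ⟪_⟫ O h f (map g w) ≈ ⟪_⟫ O′ h f′ w
    go′ (T s) ≈f w ds rewrite al≡ s w ds | ga≡ s w ds | sw-map g s w =
      +-cong (*-congˡ (≈f w ds)) (*-congˡ (≈f (sw s w) (sw-All s w ds)))
    go′ (sc c)  ≈f w ds = *-congˡ (≈f w ds)
    go′ (h ⊞ k) ≈f w ds = +-cong (go′ h ≈f w ds) (go′ k ≈f w ds)
    go′ (h ⊙ k) ≈f w ds = go′ h (go′ k ≈f) w ds
    go : ∀ h f w → All D w → ⟪_⟫ O h f (map g w) ≈ ⟪_⟫ O′ h (f ∘ map g) w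
    go h f = go′ h (λ _ _ → refl)

-- Insertion and deletion in finite subsets.

module Subsets where

  open import Data.Bool.Base using (Bool; true; false)
  open import Data.Fin.Base using (Fin; zero; suc)
  open import Data.Fin.Subset using (Subset; ∣_∣) renaming (⊥ to ∅)
  open import Data.Nat.Base using (ℕ; zero; suc)
  open import Data.Nat.Properties using (suc-injective)
  open import Data.Vec.Base using (Vec; []; _∷_; lookup; _[_]≔_)
  import Data.Vec.Properties as Vec
  open import Relation.Binary.PropositionalEquality

  private
    variable
      N : ℕ

  ins del : Fin N → Subset N → Subset N
  ins y A = A [ y ]≔ true
  del y A = A [ y ]≔ false

  lookup-∅ : (y : Fin N) → lookup (∅ {N}) y ≡ false
  lookup-∅ y = Vec.lookup-replicate y false

  true≢false : true ≢ false
  true≢false ()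

  ∣ins∣ : (y : Fin N) (A : Subset N) → lookup A y ≡ false → ∣ ins y A ∣ ≡ suc ∣ A ∣
  ∣ins∣ zero    (false ∷ A) _ = refl
  ∣ins∣ (suc y) (true ∷ A)  h = cong suc (∣ins∣ y A h)
  ∣ins∣ (suc y) (false ∷ A) h = ∣ins∣ y A h

  del-ins : (y : Fin N) (A : Subset N) → lookup A y ≡ false → del y (ins y A) ≡ A
  del-ins y A h = trans (Vec.[]≔-idempotent A y) (trans (cong (A [ y ]≔_) (sym h)) (Vec.[]≔-lookup A y))

  ins-del : (y : Fin N) (A : Subset N) → lookup A y ≡ true → ins y (del y A) ≡ A
  ins-del y A h = trans (Vec.[]≔-idempotent A y) (trans (cong (A [ y ]≔_) (sym h)) (Vec.[]≔-lookup A y))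

  lookup-ins : (y : Fin N) (A : Subset N) → lookup (ins y A) y ≡ true
  lookup-ins y A = Vec.lookup∘updateAt y A

  lookup-del : (y : Fin N) (A : Subset N) → lookup (del y A) y ≡ false
  lookup-del y A = Vec.lookup∘updateAt y A

  lookup-del-≢ : {x y : Fin N} (A : Subset N) → y ≢ x → lookup (del x A) y ≡ lookup A y
  lookup-del-≢ A y≢x = Vec.lookup∘updateAt′ _ _ y≢x A

  del-ins-≢ : {x y : Fin N} (A : Subset N) → y ≢ x → del y (ins x A) ≡ ins x (del y A)
  del-ins-≢ A y≢x = Vec.[]≔-commutes A _ _ (λ x≡y → y≢x (sym x≡y))

  ∣del∣ : (y : Fin N) (A : Subset N) {a : ℕ} → lookup A y ≡ true → ∣ A ∣ ≡ suc a → ∣ del y A ∣ ≡ a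
  ∣del∣ y A h c = suc-injective (trans (sym (∣ins∣ y (del y A) (lookup-del y A)))
    (trans (cong ∣_∣ (ins-del y A h)) c))

  ∣∣≡0⇒∅ : (A : Subset N) → ∣ A ∣ ≡ 0 → A ≡ ∅
  ∣∣≡0⇒∅ []          _ = refl
  ∣∣≡0⇒∅ (false ∷ A) h = cong (false ∷_) (∣∣≡0⇒∅ A h)

  ∣∅∣ : ∀ N → ∣ ∅ {N} ∣ ≡ 0
  ∣∅∣ zero    = refl
  ∣∅∣ (suc N) = ∣∅∣ N

  subset-induction : (P : Subset N → Set) → P ∅ →
                     (∀ b A → lookup A b ≡ false → P A → P (ins b A)) → ∀ A → P A
  subset-induction P P∅ step [] = P∅
  subset-induction P P∅ step (h ∷ A) = lemma h
    where
    tail : P (false ∷ A)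
    tail = subset-induction (λ A → P (false ∷ A)) P∅ (λ b A → step (suc b) (false ∷ A)) A
    lemma : ∀ h → P (h ∷ A)
    lemma true  = step zero (false ∷ A) refl tail
    lemma false = tail

-- Quantum factorials and the antisymmetrizers.

module Antisym (R : CommutativeSemiring 0ℓ 0ℓ) (z p x : CommutativeSemiring.Carrier R) where

  open import Data.Bool.Base using (Bool; true; false; if_then_else_)
  open import Data.Fin.Base using (Fin; zero; suc)
  open import Data.Fin.Subset using (Subset; ∣_∣) renaming (⊥ to ∅)
  open import Data.List.Base hiding (lookup)
  open import Data.List.Properties using (map-tabulate)
  open import Data.Nat.Base using (ℕ; zero; suc)
  open import Data.Sum.Base using (_⊎_; inj₁; inj₂)
  open import Data.Vec.Base using (Vec; []; _∷_; lookup)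
  open import Function.Base using (_∘_; id)
  open import Relation.Binary.PropositionalEquality as ≡ using (_≡_; _≢_)
  open Sums R
  open Hecke R z p x
  open Subsets

  pw : ℕ → Carrier
  pw zero    = 1#
  pw (suc n) = p * pw n

  -- The quantum integer: the sum of q^i p^j over i + j = a - 1, which avoids dividing q^a - p^a by
  -- z.
  br : ℕ → Carrier
  br zero    = 0#
  br (suc a) = q * br a + pw a

  fact : ℕ → Carrier
  fact zero    = 1#
  fact (suc a) = fact a * br (suc a)

  ∑-allFin : ∀ N {f : Fin (suc N) → Carrier} → ∑ (allFin (suc N)) f ≈ f zero + ∑ (allFin N) (f ∘ suc)
  ∑-allFin N {f} = +-congˡ (trans (∑-≡ (≡.sym (map-tabulate {n = N} id Fin.suc))) (∑-map Fin.suc (allFin N)))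

  ∏-allFin : ∀ N {f : Fin (suc N) → Carrier} → ∏ (allFin (suc N)) f ≈ f zero * ∏ (allFin N) (f ∘ suc)
  ∏-allFin N {f} = *-congˡ (trans (reflexive (≡.cong (λ xs → ∏ xs f) (≡.sym (map-tabulate {n = N} id Fin.suc)))) (∏-map Fin.suc (allFin N)))

  ∑∈ ∏∈ : ∀ {N} → Subset N → (Fin N → Carrier) → Carrier
  ∑∈ A G = ∑ (allFin _) λ y → 𝟙 (lookup A y) * G y
  ∏∈ A G = ∏ (allFin _) λ y → if lookup A y then G y else 1#

  ∑∈-∅ : ∀ N {G : Fin N → Carrier} → ∑∈ ∅ G ≈ 0#
  ∑∈-∅ N = ∑-0 (allFin N) λ y → trans (*-congʳ (reflexive (≡.cong 𝟙 (lookup-∅ y)))) (zeroˡ _)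

  ∑∈-cong : ∀ {N} (A : Subset N) {F G : Fin N → Carrier} →
            (∀ y → lookup A y ≡ true → F y ≈ G y) → ∑∈ A F ≈ ∑∈ A G
  ∑∈-cong {N} A {F} {G} h = ∑-cong (allFin N) λ y → lemma y (lookup A y) ≡.refl
    where
    lemma : ∀ y b → lookup A y ≡ b → 𝟙 b * F y ≈ 𝟙 b * G y
    lemma y true  y∈A = *-congˡ (h y y∈A)
    lemma y false _   = trans (zeroˡ _) (sym (zeroˡ _))

  ∑∈-+ : ∀ {N} (A : Subset N) {F G : Fin N → Carrier} → ∑∈ A (λ y → F y + G y) ≈ ∑∈ A F + ∑∈ A G
  ∑∈-+ {N} A = trans (∑-cong (allFin N) λ y → distribˡ _ _ _) (∑-+ (allFin N))

  ∑∈-*ˡ : ∀ {N} c (A : Subset N) {F : Fin N → Carrier} → ∑∈ A (λ y → c * F y) ≈ c * ∑∈ A F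
  ∑∈-*ˡ {N} c A = trans (∑-cong (allFin N) λ y → x*yz≈y*xz _ _ _) (∑-*ˡ c (allFin N))

  ∑∈-*ʳ : ∀ {N} c (A : Subset N) {F : Fin N → Carrier} → ∑∈ A (λ y → F y * c) ≈ ∑∈ A F * c
  ∑∈-*ʳ {N} c A = trans (∑-cong (allFin N) λ y → sym (*-assoc _ _ _)) (∑-*ʳ c (allFin N))

  ∑∈-swap : ∀ {N} {B : Set} (A : Subset N) (xs : List B) {F : Fin N → B → Carrier} →
            ∑∈ A (λ y → ∑ xs (F y)) ≈ ∑ xs (λ b → ∑∈ A (λ y → F y b))
  ∑∈-swap {N} A xs = trans (∑-cong (allFin N) λ y → sym (∑-*ˡ _ xs)) (∑-swap (allFin N) xs)

  ∑∈-ins : ∀ {N} (b : Fin N) (A : Subset N) {G : Fin N → Carrier} → lookup A b ≡ false →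
           ∑∈ (ins b A) G ≈ G b + ∑∈ A G
  ∑∈-ins {suc N} zero (.false ∷ A) ≡.refl = trans (∑-allFin N) (+-cong (*-identityˡ _)
    (sym (trans (∑-allFin N) (trans (+-congʳ (zeroˡ _)) (+-identityˡ _)))))
  ∑∈-ins {suc N} (suc b) (h ∷ A) {G} b∉A = begin
    ∑∈ (ins (suc b) (h ∷ A)) G                ≈⟨ ∑-allFin N ⟩
    𝟙 h * G zero + ∑∈ (ins b A) (G ∘ suc)     ≈⟨ +-congˡ (∑∈-ins b A b∉A) ⟩
    𝟙 h * G zero + (G (suc b) + ∑∈ A (G ∘ suc)) ≈⟨ solve 3 (λ a b c → a :+ (b :+ c) := b :+ (a :+ c)) refl _ _ _ ⟩
    G (suc b) + (𝟙 h * G zero + ∑∈ A (G ∘ suc)) ≈⟨ +-congˡ (∑-allFin N) ⟨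
    G (suc b) + ∑∈ (h ∷ A) G                   ∎

  ∏∈-∅ : ∀ N {G : Fin N → Carrier} → ∏∈ ∅ G ≈ 1#
  ∏∈-∅ zero    = refl
  ∏∈-∅ (suc N) = trans (∏-allFin N) (trans (*-identityˡ _) (∏∈-∅ N))

  ∏∈-ins : ∀ {N} (b : Fin N) (A : Subset N) {G : Fin N → Carrier} → lookup A b ≡ false →
           ∏∈ (ins b A) G ≈ G b * ∏∈ A G
  ∏∈-ins {suc N} zero (.false ∷ A) ≡.refl = trans (∏-allFin N) (*-congˡ
    (sym (trans (∏-allFin N) (*-identityˡ _))))
  ∏∈-ins {suc N} (suc b) (h ∷ A) {G} b∉A = begin
    ∏∈ (ins (suc b) (h ∷ A)) G                ≈⟨ ∏-allFin N ⟩
    _ * ∏∈ (ins b A) (G ∘ suc)     ≈⟨ *-congˡ (∏∈-ins b A b∉A) ⟩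
    _ * (G (suc b) * ∏∈ A (G ∘ suc)) ≈⟨ x*yz≈y*xz _ _ _ ⟩
    G (suc b) * (_ * ∏∈ A (G ∘ suc)) ≈⟨ *-congˡ (∏-allFin N) ⟨
    G (suc b) * ∏∈ (h ∷ A) G                   ∎

  infixr 5 _then_
  data Orders {N} : Subset N → List (Fin N) → Set where
    []     : Orders ∅ []
    _then_ : ∀ {A y w} → lookup A y ≡ true → Orders (del y A) w → Orders A (y ∷ w)

  wset : ∀ {N} → List (Fin N) → Subset N
  wset []      = ∅
  wset (y ∷ w) = ins y (wset w)

  Orders⇒wset : ∀ {N} {A : Subset N} {w} → Orders A w → wset w ≡ A
  Orders⇒wset []         = ≡.refl
  Orders⇒wset {A = A} (_then_ {y = y} y∈A o) = ≡.trans (≡.cong (ins y) (Orders⇒wset o)) (ins-del y A y∈A)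

  Orders⇒length : ∀ {N} {A : Subset N} {w} → Orders A w → length w ≡ ∣ A ∣
  Orders⇒length {N} []           = ≡.sym (∣∅∣ N)
  Orders⇒length {A = A} (_then_ {y = y} y∈A o) = ≡.trans (≡.cong suc (Orders⇒length o))
    (≡.trans (≡.sym (∣ins∣ y (del y A) (lookup-del y A))) (≡.cong ∣_∣ (ins-del y A y∈A)))

  -- A sum over the orderings of A. The number a is meant to be ∣ A ∣ and is carried separately to
  -- make the recursion structural.
  sym-sum : ∀ {N} → ℕ → Subset N → (List (Fin N) → Carrier) → Carrier
  sym-sum zero    A f = f []
  sym-sum (suc a) A f = ∑∈ A λ y → sym-sum a (del y A) (f ∘ (y ∷_))

  sym-cong : ∀ {N} a (A : Subset N) {f g} → ∣ A ∣ ≡ a → (∀ w → Orders A w → f w ≈ g w) →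
             sym-sum a A f ≈ sym-sum a A g
  sym-cong zero    A ∣A∣ h rewrite ∣∣≡0⇒∅ A ∣A∣ = h [] []
  sym-cong (suc a) A ∣A∣ h = ∑∈-cong A λ y y∈A →
    sym-cong a (del y A) (∣del∣ y A y∈A ∣A∣) λ w o → h (y ∷ w) (y∈A then o)

  sym-ext : ∀ {N} a (A : Subset N) {f g} → (∀ w → f w ≈ g w) → sym-sum a A f ≈ sym-sum a A g
  sym-ext zero    A h = h []
  sym-ext (suc a) A h = ∑∈-cong A λ y _ → sym-ext a (del y A) λ w → h (y ∷ w)

  sym-+ : ∀ {N} a (A : Subset N) {f g} → sym-sum a A (λ w → f w + g w) ≈ sym-sum a A f + sym-sum a A g
  sym-+ zero    A = refl
  sym-+ (suc a) A = trans (∑∈-cong A λ y _ → sym-+ a (del y A)) (∑∈-+ A)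

  sym-*ˡ : ∀ {N} a (A : Subset N) c {f} → sym-sum a A (λ w → c * f w) ≈ c * sym-sum a A f
  sym-*ˡ zero    A c = refl
  sym-*ˡ (suc a) A c = trans (∑∈-cong A λ y _ → sym-*ˡ a (del y A) c) (∑∈-*ˡ c A)

  sym-*ʳ : ∀ {N} a (A : Subset N) c {f} → sym-sum a A (λ w → f w * c) ≈ sym-sum a A f * c
  sym-*ʳ a A c = trans (sym-ext a A λ w → *-comm _ _) (trans (sym-*ˡ a A c) (*-comm _ _))

  sym-∑ : ∀ {N} a (A : Subset N) {B : Set} (xs : List B) {f : B → List (Fin N) → Carrier} →
          sym-sum a A (λ w → ∑ xs (λ b → f b w)) ≈ ∑ xs (λ b → sym-sum a A (f b))
  sym-∑ zero    A xs = refl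
  sym-∑ (suc a) A xs = trans (∑∈-cong A λ y _ → sym-∑ a (del y A) xs) (∑∈-swap A xs)

  sh1 : H → H
  sh1 (T s)   = T (suc s)
  sh1 (sc c)  = sc c
  sh1 (h ⊞ g) = sh1 h ⊞ sh1 g
  sh1 (h ⊙ g) = sh1 h ⊙ sh1 g

  sh : ℕ → H → H
  sh zero    h = h
  sh (suc k) h = sh1 (sh k h)

  -- C a moves a letter past a others and AS a is the antisymmetrizer on the
  -- first a letters, up to a power of q the sum over all permutations π of
  -- q^ℓ(π) T_π.
  C : ℕ → H
  C zero    = sc 1#
  C (suc a) = sc (pw (suc a)) ⊞ T 0 ⊙ sh1 (C a)

  AS : ℕ → H
  AS zero    = sc 1#
  AS (suc a) = sh1 (AS a) ⊙ C a

  module Weights {N} (O : Order (Fin N)) (x+p≈0 : x + p ≈ 0#) where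
    open Order O
    open Act O

    ⟪sh1⟫ : ∀ h f y w → ⟪ sh1 h ⟫ f (y ∷ w) ≈ ⟪ h ⟫ (f ∘ (y ∷_)) w
    ⟪sh1⟫ (T s)   f y w = refl
    ⟪sh1⟫ (sc c)  f y w = refl
    ⟪sh1⟫ (h ⊞ g) f y w = +-cong (⟪sh1⟫ h f y w) (⟪sh1⟫ g f y w)
    ⟪sh1⟫ (h ⊙ g) f y w = trans (⟪sh1⟫ h _ y w) (⟪⟫-ext h (⟪sh1⟫ g f y) w)

    ⟪sh⟫ : ∀ h f u w → ⟪ sh (length u) h ⟫ f (u ++ w) ≈ ⟪ h ⟫ (f ∘ (u ++_)) w
    ⟪sh⟫ h f []      w = refl
    ⟪sh⟫ h f (y ∷ u) w = trans (⟪sh1⟫ (sh (length u) h) f y (u ++ w)) (⟪sh⟫ h (f ∘ (y ∷_)) u w)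

    ee : Fin N → Fin N → Carrier
    ee a b = e (cmp a b)

    ex : Fin N → Subset N → Carrier
    ex a A = ∏∈ A (ee a)

    ew : Fin N → List (Fin N) → Carrier
    ew a w = ∏ w (ee a)

    -- The inversion weight: an increasing pair of positions contributes q, a decreasing one p, and
    -- a repeated letter makes the weight 0.
    ewt : List (Fin N) → Carrier
    ewt []      = 1#
    ewt (a ∷ w) = ew a w * ewt w

    ee-refl : ∀ a → ee a a ≈ 0#
    ee-refl a = reflexive (≡.cong e (cmp-refl a))

    ex-del : ∀ a b A → lookup A b ≡ true → ex a A ≈ ee a b * ex a (del b A)
    ex-del a b A b∈A = trans (reflexive (≡.cong (ex a) (≡.sym (ins-del b A b∈A))))
                             (∏∈-ins b (del b A) (lookup-del b A))

    ex-∈ : ∀ a A → lookup A a ≡ true → ex a A ≈ 0#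
    ex-∈ a A a∈A = trans (ex-del a a A a∈A) (trans (*-congʳ (ee-refl a)) (zeroˡ _))

    ew≈ex : ∀ a {A w} → Orders A w → ew a w ≈ ex a A
    ew≈ex a []                 = sym (∏∈-∅ N)
    ew≈ex a {A} (_then_ {y = y} y∈A o) = trans (*-congˡ (ew≈ex a o)) (sym (ex-del a y A y∈A))

    -- A letter repeated in w brings in a factor `ex a A` with a in A, which contains `e eq = 0`.
    distinct? : ∀ w → ewt w ≈ 0# ⊎ Orders (wset w) w
    distinct? [] = inj₂ []
    distinct? (a ∷ w) with distinct? w
    ... | inj₁ ≈0 = inj₁ (trans (*-congˡ ≈0) (zeroʳ _))
    ... | inj₂ o  with lookup (wset w) a in h
    ...   | true  = inj₁ (trans (*-congʳ (trans (ew≈ex a o) (ex-∈ a (wset w) h))) (zeroˡ _))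
    ...   | false = inj₂ (lookup-ins a (wset w) then ≡.subst (λ A → Orders A w) (≡.sym (del-ins a (wset w) h)) o)

    e≈p+α : ∀ c → e c ≈ p + α c
    e≈p+α lt = +-comm z p
    e≈p+α eq = trans (sym x+p≈0) (+-comm x p)
    e≈p+α gt = sym (+-identityʳ p)

    private
      -- For distinct letters this is what remains, when they become infinitely far apart, of a
      -- partial fraction identity for e(a,b) = (q b - p a)/(b - a) and α(a,b) = e(a,b) - p = z b/(b
      -- - a). It drives the induction in `lagrange`.
      three-term : ∀ ab bc ac → Consistent ab bc ac → bc ≢ eq →
                   α ab * α bc + α ac * e (flip bc) ≈ e ab * α ac
      three-term lt lt _ ≡.refl _ = solve 2 (λ z p → z :* z :+ z :* p := (z :+ p) :* z) refl z p
      three-term ab eq ac _ eq≢eq with () ← eq≢eq ≡.refl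
      three-term lt gt ac _ _ = trans (+-congʳ (zeroʳ z)) (trans (+-identityˡ _) (*-comm _ _))
      three-term eq lt _ ≡.refl _ = trans (+-congˡ (*-comm z p)) (trans (sym (distribʳ z x p)) (*-congʳ x+p≈0))
      three-term eq gt _ ≡.refl _ = solve 2 (λ x q → x :* con 0 :+ con 0 :* q := con 0 :* con 0) refl x q
      three-term gt lt ac _ _ = trans (+-congʳ (zeroˡ _)) (trans (+-identityˡ _) (*-comm _ _))
      three-term gt gt _ ≡.refl _ = solve 2 (λ p q → con 0 :* con 0 :+ con 0 :* q := p :* con 0) refl p q

      ≢⇒cmp≢eq : ∀ {a b} → a ≢ b → cmp a b ≢ eq
      ≢⇒cmp≢eq a≢b c = a≢b (cmp-eq _ _ c)

      ∈∉⇒≢ : ∀ {A : Subset N} {a b} → lookup A a ≡ true → lookup A b ≡ false → a ≢ b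
      ∈∉⇒≢ a∈A a∉A ≡.refl = true≢false (≡.trans (≡.sym a∈A) a∉A)

      ex-del-ins : ∀ {A b y} → lookup A y ≡ true → lookup A b ≡ false →
                   ex y (del y (ins b A)) ≈ ee y b * ex y (del y A)
      ex-del-ins {A} {b} {y} y∈A b∉A = trans (reflexive (≡.cong (ex y) (del-ins-≢ A y≢b)))
        (∏∈-ins b (del y A) (≡.trans (lookup-del-≢ A (y≢b ∘ ≡.sym)) b∉A))
        where y≢b = ∈∉⇒≢ {A} y∈A b∉A

    -- Lagrange interpolation in disguise.
    lagrange : ∀ A a → pw ∣ A ∣ + ∑∈ A (λ y → α (cmp a y) * ex y (del y A)) ≈ ex a A
    lagrange = subset-induction _
      (λ a → trans (+-cong (reflexive (≡.cong pw (∣∅∣ N))) (∑∈-∅ N)) (trans (+-identityʳ 1#) (sym (∏∈-∅ N)))) step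
      where
      step : ∀ b A → lookup A b ≡ false →
             (∀ a → pw ∣ A ∣ + ∑∈ A (λ y → α (cmp a y) * ex y (del y A)) ≈ ex a A) →
             ∀ a → pw ∣ ins b A ∣ + ∑∈ (ins b A) (λ y → α (cmp a y) * ex y (del y (ins b A))) ≈ ex a (ins b A)
      step b A b∉A ih a = begin
        pw ∣ ins b A ∣ + ∑∈ (ins b A) (λ y → α (cmp a y) * ex y (del y (ins b A)))
          ≈⟨ +-cong (reflexive (≡.cong pw (∣ins∣ b A b∉A))) (∑∈-ins b A b∉A) ⟩
        p * P + (αab * ex b (del b (ins b A)) + ∑∈ A (λ y → α (cmp a y) * ex y (del y (ins b A))))
          ≈⟨ +-congˡ (+-cong
               (*-congˡ (trans (reflexive (≡.cong (ex b) (del-ins b A b∉A))) (sym (ih b))))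
               (∑∈-cong A λ y y∈A → *-congˡ (ex-del-ins {A} y∈A b∉A))) ⟩
        p * P + (αab * (P + ∑∈ A (λ y → α (cmp b y) * X y)) + ∑∈ A (λ y → α (cmp a y) * (ee y b * X y)))
          ≈⟨ solve 5 (λ p P α s t → p :* P :+ (α :* (P :+ s) :+ t) := (p :+ α) :* P :+ (α :* s :+ t)) refl p P αab _ _ ⟩
        (p + αab) * P + (αab * ∑∈ A (λ y → α (cmp b y) * X y) + ∑∈ A (λ y → α (cmp a y) * (ee y b * X y)))
          ≈⟨ +-congˡ (trans (+-congʳ (sym (∑∈-*ˡ αab A))) (sym (∑∈-+ A))) ⟩
        (p + αab) * P + ∑∈ A (λ y → αab * (α (cmp b y) * X y) + α (cmp a y) * (ee y b * X y))
          ≈⟨ +-cong (*-congʳ (sym (e≈p+α (cmp a b)))) (∑∈-cong A pointwise) ⟩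
        ee a b * P + ∑∈ A (λ y → ee a b * (α (cmp a y) * X y))
          ≈⟨ trans (+-congˡ (∑∈-*ˡ (ee a b) A)) (sym (distribˡ _ _ _)) ⟩
        ee a b * (P + ∑∈ A (λ y → α (cmp a y) * X y))
          ≈⟨ *-congˡ (ih a) ⟩
        ee a b * ex a A
          ≈⟨ ∏∈-ins b A b∉A ⟨
        ex a (ins b A) ∎
        where
        P = pw ∣ A ∣
        αab = α (cmp a b)
        X : Fin N → Carrier
        X y = ex y (del y A)
        pointwise : ∀ y → lookup A y ≡ true →
          αab * (α (cmp b y) * X y) + α (cmp a y) * (ee y b * X y) ≈ ee a b * (α (cmp a y) * X y)
        pointwise y y∈A = begin
          αab * (α (cmp b y) * X y) + α (cmp a y) * (ee y b * X y)
            ≈⟨ solve 5 (λ a b c d X → a :* (b :* X) :+ c :* (d :* X) := (a :* b :+ c :* d) :* X) refl _ _ _ _ _ ⟩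
          (αab * α (cmp b y) + α (cmp a y) * ee y b) * X y
            ≈⟨ *-congʳ (+-congˡ (*-congˡ (reflexive (≡.cong e (cmp-flip b y))))) ⟩
          (αab * α (cmp b y) + α (cmp a y) * e (flip (cmp b y))) * X y
            ≈⟨ *-congʳ (three-term (cmp a b) (cmp b y) (cmp a y) (consistent a b y) (≢⇒cmp≢eq (∈∉⇒≢ {A} y∈A b∉A ∘ ≡.sym))) ⟩
          ee a b * α (cmp a y) * X y
            ≈⟨ *-assoc _ _ _ ⟩
          ee a b * (α (cmp a y) * X y) ∎

    -- When b joins A, the new summand `ex b A` is expanded by `lagrange` into p^∣A∣ and a sum with
    -- coefficients α(b,y). These combine with the factors e(y,b) of the old summands, because
    -- α(b,y) + e(y,b) = q for y ≠ b, and the recursion of `br` results.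
    ∑-ex : ∀ A → ∑∈ A (λ y → ex y (del y A)) ≈ br ∣ A ∣
    ∑-ex = subset-induction _ (trans (∑∈-∅ N) (reflexive (≡.cong br (≡.sym (∣∅∣ N))))) step
      where
      q-split : ∀ c → c ≢ eq → α c + e (flip c) ≈ q
      q-split lt _ = refl
      q-split eq eq≢eq with () ← eq≢eq ≡.refl
      q-split gt _ = +-identityˡ q
      step : ∀ b A → lookup A b ≡ false → ∑∈ A (λ y → ex y (del y A)) ≈ br ∣ A ∣ →
             ∑∈ (ins b A) (λ y → ex y (del y (ins b A))) ≈ br ∣ ins b A ∣
      step b A b∉A ih = begin
        ∑∈ (ins b A) (λ y → ex y (del y (ins b A)))
          ≈⟨ ∑∈-ins b A b∉A ⟩
        ex b (del b (ins b A)) + ∑∈ A (λ y → ex y (del y (ins b A)))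
          ≈⟨ +-cong (trans (reflexive (≡.cong (ex b) (del-ins b A b∉A))) (sym (lagrange A b)))
                    (∑∈-cong A λ y y∈A → ex-del-ins {A} y∈A b∉A) ⟩
        (pw ∣ A ∣ + ∑∈ A (λ y → α (cmp b y) * X y)) + ∑∈ A (λ y → ee y b * X y)
          ≈⟨ trans (+-assoc _ _ _) (+-congˡ (sym (∑∈-+ A))) ⟩
        pw ∣ A ∣ + ∑∈ A (λ y → α (cmp b y) * X y + ee y b * X y)
          ≈⟨ +-congˡ (trans (∑∈-cong A pointwise) (trans (∑∈-*ˡ q A) (*-congˡ ih))) ⟩
        pw ∣ A ∣ + q * br ∣ A ∣
          ≈⟨ +-comm _ _ ⟩
        br (suc ∣ A ∣)
          ≈⟨ reflexive (≡.cong br (∣ins∣ b A b∉A)) ⟨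
        br ∣ ins b A ∣ ∎
        where
        X : Fin N → Carrier
        X y = ex y (del y A)
        pointwise : ∀ y → lookup A y ≡ true → α (cmp b y) * X y + ee y b * X y ≈ q * X y
        pointwise y y∈A = trans (sym (distribʳ _ _ _)) (*-congʳ (trans
          (+-congˡ (reflexive (≡.cong e (cmp-flip b y))))
          (q-split (cmp b y) (≢⇒cmp≢eq (∈∉⇒≢ {A} y∈A b∉A ∘ ≡.sym)))))

    -- The generating function of permutations by inversions, obtained by splitting off the first
    -- letter. It is also the scalar by which the square of the antisymmetrizer differs from itself.
    sym-ewt : ∀ a A → ∣ A ∣ ≡ a → sym-sum a A ewt ≈ fact a
    sym-ewt zero    A ∣A∣ = refl
    sym-ewt (suc a) A ∣A∣ = begin
      ∑∈ A (λ y → sym-sum a (del y A) (λ w → ew y w * ewt w))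
        ≈⟨ ∑∈-cong A (λ y y∈A → let ∣A-y∣ = ∣del∣ y A y∈A ∣A∣ in
             trans (sym-cong a (del y A) ∣A-y∣ λ w o → *-congʳ (ew≈ex y o))
            (trans (sym-*ˡ a (del y A) (ex y (del y A))) (*-congˡ (sym-ewt a (del y A) ∣A-y∣)))) ⟩
      ∑∈ A (λ y → ex y (del y A) * fact a)
        ≈⟨ trans (∑∈-*ʳ (fact a) A) (*-comm _ _) ⟩
      fact a * ∑∈ A (λ y → ex y (del y A))
        ≈⟨ *-congˡ (trans (∑-ex A) (reflexive (≡.cong br ∣A∣))) ⟩
      fact (suc a) ∎

    -- Summed over the orderings of A, the front letter y gets spread evenly over all places. The
    -- words that keep y in front collect the coefficient p^∣A∣ + Σ α(y,u) ex(u), which `lagrange`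
    -- evaluates to `ex y A`, and by induction this is also the coefficient of the words in which y
    -- has been passed.
    C-sum : ∀ a A y v f → ∣ A ∣ ≡ a →
            sym-sum a A (λ w → ⟪ C a ⟫ f (y ∷ w ++ v)) ≈ ex y A * sym-sum (suc a) (ins y A) (λ w → f (w ++ v))
    C-sum zero A y v f ∣A∣ rewrite ∣∣≡0⇒∅ A ∣A∣ = *-cong (sym (∏∈-∅ N))
      (sym (trans (∑∈-ins y ∅ (lookup-∅ y)) (trans (+-congˡ (∑∈-∅ N)) (+-identityʳ _))))
    C-sum (suc a) A y v f ∣A∣ = begin
      ∑∈ A (λ u → sym-sum a (del u A) (λ w → P * f (y ∷ u ∷ w ++ v) +
        (α (cmp y u) * ⟪ sh1 (C a) ⟫ f (y ∷ u ∷ w ++ v) + ee y u * ⟪ sh1 (C a) ⟫ f (u ∷ y ∷ w ++ v))))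
        ≈⟨ ∑∈-cong A (λ u u∈A → summand u u∈A (∣del∣ u A u∈A ∣A∣)) ⟩
      ∑∈ A (λ u → P * F y u + (α (cmp y u) * ex u (del u A) * S + ex y A * G u))
        ≈⟨ trans (∑∈-+ A) (+-cong (∑∈-*ˡ P A) (trans (∑∈-+ A) (+-cong (∑∈-*ʳ S A) (∑∈-*ˡ (ex y A) A)))) ⟩
      P * S + (∑∈ A (λ u → α (cmp y u) * ex u (del u A)) * S + ex y A * ∑∈ A G)
        ≈⟨ solve 4 (λ P S s t → P :* S :+ (s :* S :+ t) := (P :+ s) :* S :+ t) refl _ _ _ _ ⟩
      (P + ∑∈ A (λ u → α (cmp y u) * ex u (del u A))) * S + ex y A * ∑∈ A G
        ≈⟨ +-congʳ (*-congʳ (trans (+-congʳ (reflexive (≡.cong pw (≡.sym ∣A∣)))) (lagrange A y))) ⟩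
      ex y A * S + ex y A * ∑∈ A G
        ≈⟨ distribˡ _ _ _ ⟨
      ex y A * (S + ∑∈ A G)
        ≈⟨ collect (lookup A y) ≡.refl ⟩
      ex y A * sym-sum (suc (suc a)) (ins y A) (λ w → f (w ++ v)) ∎
      where
      P = pw (suc a)
      F : Fin N → Fin N → Carrier
      F y u = sym-sum a (del u A) (λ w → f (y ∷ u ∷ w ++ v))
      S = sym-sum (suc a) A (λ w → f (y ∷ w ++ v))
      G : Fin N → Carrier
      G u = sym-sum (suc a) (ins y (del u A)) (λ w → f (u ∷ w ++ v))
      summand : ∀ u → lookup A u ≡ true → ∣ del u A ∣ ≡ a →
        sym-sum a (del u A) (λ w → P * f (y ∷ u ∷ w ++ v) +
          (α (cmp y u) * ⟪ sh1 (C a) ⟫ f (y ∷ u ∷ w ++ v) + ee y u * ⟪ sh1 (C a) ⟫ f (u ∷ y ∷ w ++ v)))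
        ≈ P * F y u + (α (cmp y u) * ex u (del u A) * S + ex y A * G u)
      summand u u∈A ∣A-u∣ = trans (sym-+ a (del u A)) (+-cong (sym-*ˡ a (del u A) P) (trans (sym-+ a (del u A)) (+-cong
        (trans (sym-*ˡ a (del u A) _) (trans (*-congˡ (begin
          sym-sum a (del u A) (λ w → ⟪ sh1 (C a) ⟫ f (y ∷ u ∷ w ++ v))
            ≈⟨ sym-ext a (del u A) (λ w → ⟪sh1⟫ (C a) f y (u ∷ w ++ v)) ⟩
          sym-sum a (del u A) (λ w → ⟪ C a ⟫ (f ∘ (y ∷_)) (u ∷ w ++ v))
            ≈⟨ C-sum a (del u A) u v (f ∘ (y ∷_)) ∣A-u∣ ⟩
          ex u (del u A) * sym-sum (suc a) (ins u (del u A)) (λ w → f (y ∷ w ++ v))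
            ≈⟨ *-congˡ (reflexive (≡.cong (λ B → sym-sum (suc a) B (λ w → f (y ∷ w ++ v))) (ins-del u A u∈A))) ⟩
          ex u (del u A) * S ∎)) (sym (*-assoc _ _ _))))
        (trans (sym-*ˡ a (del u A) _) (trans (*-congˡ (begin
          sym-sum a (del u A) (λ w → ⟪ sh1 (C a) ⟫ f (u ∷ y ∷ w ++ v))
            ≈⟨ sym-ext a (del u A) (λ w → ⟪sh1⟫ (C a) f u (y ∷ w ++ v)) ⟩
          sym-sum a (del u A) (λ w → ⟪ C a ⟫ (f ∘ (u ∷_)) (y ∷ w ++ v))
            ≈⟨ C-sum a (del u A) y v (f ∘ (u ∷_)) ∣A-u∣ ⟩
          ex y (del u A) * G u ∎)) (trans (sym (*-assoc _ _ _)) (*-congʳ (sym (ex-del y u A u∈A)))))))))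
      collect : ∀ b → lookup A y ≡ b → ex y A * (S + ∑∈ A G) ≈ ex y A * sym-sum (suc (suc a)) (ins y A) (λ w → f (w ++ v))
      -- If y already lies in A, both sides contain the factor `ex y A = 0`, so it does not matter
      -- that `ins y A` is then too small for the sum on the right.
      collect true  y∈A = trans (trans (*-congʳ (ex-∈ y A y∈A)) (zeroˡ _)) (sym (trans (*-congʳ (ex-∈ y A y∈A)) (zeroˡ _)))
      collect false y∉A = *-congˡ (sym (trans (∑∈-ins y A y∉A) (+-cong
        (reflexive (≡.cong (λ B → sym-sum (suc a) B (λ w → f (y ∷ w ++ v))) (del-ins y A y∉A)))
        (∑∈-cong A λ u u∈A → reflexive (≡.cong (λ B → sym-sum (suc a) B (λ w → f (u ∷ w ++ v)))
          (del-ins-≢ A (∈∉⇒≢ {A} u∈A y∉A)))))))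

    -- On the rearrangements of a given set of letters the antisymmetrizer has rank one: w enters
    -- through the scalar `ewt w`, and f is summed over all orderings alike. Every later passage
    -- from words to sets rests on this.
    ⟪AS⟫ : ∀ f w v → ⟪ AS (length w) ⟫ f (w ++ v) ≈ ewt w * sym-sum (length w) (wset w) (λ u → f (u ++ v))
    ⟪AS⟫ f []      v = refl
    ⟪AS⟫ f (y ∷ w) v = begin
      ⟪ sh1 (AS (length w)) ⟫ (⟪ C (length w) ⟫ f) (y ∷ w ++ v)
        ≈⟨ ⟪sh1⟫ (AS (length w)) _ y (w ++ v) ⟩
      ⟪ AS (length w) ⟫ (⟪ C (length w) ⟫ f ∘ (y ∷_)) (w ++ v)
        ≈⟨ ⟪AS⟫ _ w v ⟩
      ewt w * sym-sum (length w) (wset w) (λ u → ⟪ C (length w) ⟫ f (y ∷ u ++ v))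
        ≈⟨ lemma (distinct? w) ⟩
      ew y w * ewt w * sym-sum (suc (length w)) (ins y (wset w)) (λ u → f (u ++ v)) ∎
      where
      lemma : ewt w ≈ 0# ⊎ Orders (wset w) w →
        ewt w * sym-sum (length w) (wset w) (λ u → ⟪ C (length w) ⟫ f (y ∷ u ++ v)) ≈
        ew y w * ewt w * sym-sum (suc (length w)) (ins y (wset w)) (λ u → f (u ++ v))
      lemma (inj₁ ≈0) = trans (trans (*-congʳ ≈0) (zeroˡ _)) (sym (trans (*-congʳ (trans (*-congˡ ≈0) (zeroʳ _))) (zeroˡ _)))
      lemma (inj₂ o)  = trans (*-congˡ (C-sum (length w) (wset w) y v f (≡.sym (Orders⇒length o))))
        (trans (*-congˡ (*-congʳ (sym (ew≈ex y o))))
          (solve 3 (λ a b c → a :* (b :* c) := b :* a :* c) refl _ _ _))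

-- Ordered alphabets, sums over words and contents.

module Words (R : CommutativeSemiring 0ℓ 0ℓ) (z p x : CommutativeSemiring.Carrier R) where

  open import Data.Fin.Base as Fin using (Fin; toℕ)
  import Data.Fin.Properties as Fin
  open import Data.List.Base hiding (updateAt)
  open import Data.List.Relation.Unary.All as All using (All; []; _∷_)
  open import Data.Nat.Base as ℕ using (ℕ; zero; suc)
  import Data.Nat.Properties as ℕ
  open import Data.Unit.Base using (tt)
  open import Data.Vec.Base as Vec using (Vec; updateAt)
  import Data.Vec.Properties as Vec
  open import Function.Base using (_∘_)
  open import Relation.Binary.PropositionalEquality as ≡ using (_≡_)
  open import Relation.Nullary.Decidable using (yes; no)

  open Sums R
  open Hecke R z p x
  ncmp : ℕ → ℕ → Cmp
  ncmp zero    zero    = eq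
  ncmp zero    (suc n) = lt
  ncmp (suc m) zero    = gt
  ncmp (suc m) (suc n) = ncmp m n

  ncmp-flip : ∀ m n → ncmp n m ≡ flip (ncmp m n)
  ncmp-flip zero    zero    = ≡.refl
  ncmp-flip zero    (suc n) = ≡.refl
  ncmp-flip (suc m) zero    = ≡.refl
  ncmp-flip (suc m) (suc n) = ncmp-flip m n

  ncmp-refl : ∀ m → ncmp m m ≡ eq
  ncmp-refl zero    = ≡.refl
  ncmp-refl (suc m) = ncmp-refl m

  ncmp-eq : ∀ m n → ncmp m n ≡ eq → m ≡ n
  ncmp-eq zero    zero    h = ≡.refl
  ncmp-eq (suc m) (suc n) h = ≡.cong suc (ncmp-eq m n h)

  ncmp-consistent : ∀ l m n → Consistent (ncmp l m) (ncmp m n) (ncmp l n)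
  ncmp-consistent zero    zero    n       = ≡.refl
  ncmp-consistent zero    (suc m) zero    = tt
  ncmp-consistent zero    (suc m) (suc n) with ncmp m n
  ... | lt = ≡.refl
  ... | eq = ≡.refl
  ... | gt = tt
  ncmp-consistent (suc l) zero    zero    = ≡.refl
  ncmp-consistent (suc l) zero    (suc n) = tt
  ncmp-consistent (suc l) (suc m) zero    with ncmp l m
  ... | lt = tt
  ... | eq = ≡.refl
  ... | gt = ≡.refl
  ncmp-consistent (suc l) (suc m) (suc n) = ncmp-consistent l m n

  finOrder : ∀ N → Order (Fin N)
  finOrder N = record
    { cmp        = λ a b → ncmp (toℕ a) (toℕ b)
    ; cmp-flip   = λ a b → ncmp-flip (toℕ a) (toℕ b)
    ; cmp-eq     = λ a b h → Fin.toℕ-injective (ncmp-eq _ _ h)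
    ; consistent = λ a b c → ncmp-consistent (toℕ a) (toℕ b) (toℕ c)
    }

  lex : Cmp → Cmp → Cmp
  lex lt _ = lt
  lex eq d = d
  lex gt _ = gt

  -- Ties of color are broken backwards, as in the definition of ε_σ.
  module _ {A : Set} (color : A → ℕ) (label : A → ℕ) (label-injective : ∀ {a b} → label a ≡ label b → a ≡ b) where
    private
      cmp : A → A → Cmp
      cmp a b = lex (ncmp (color a) (color b)) (ncmp (label b) (label a))

      lex-flip : ∀ c d → lex (flip c) (flip d) ≡ flip (lex c d)
      lex-flip lt d = ≡.refl
      lex-flip eq d = ≡.refl
      lex-flip gt d = ≡.refl

      lex-eq : ∀ c d → lex c d ≡ eq → d ≡ eq
      lex-eq eq d h = h

      Consistent-sym : ∀ c d c′ → Consistent c d c′ → Consistent d c c′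
      Consistent-sym lt lt _ h = h
      Consistent-sym lt eq _ h = h
      Consistent-sym lt gt _ h = tt
      Consistent-sym eq lt _ h = h
      Consistent-sym eq eq _ h = h
      Consistent-sym eq gt _ h = h
      Consistent-sym gt lt _ h = tt
      Consistent-sym gt eq _ h = h
      Consistent-sym gt gt _ h = h

      lex-consistent : ∀ c d c′ d′ c″ d″ → Consistent c c′ c″ → Consistent d d′ d″ →
                       Consistent (lex c d) (lex c′ d′) (lex c″ d″)
      lex-consistent lt d lt d′ _ d″ ≡.refl h = ≡.refl
      lex-consistent lt d eq lt _ d″ ≡.refl h = ≡.refl
      lex-consistent lt d eq eq _ d″ ≡.refl h = ≡.refl
      lex-consistent lt d eq gt _ d″ ≡.refl h = tt
      lex-consistent lt d gt d′ c″ d″ _ h = tt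
      lex-consistent eq lt lt d′ _ d″ ≡.refl h = ≡.refl
      lex-consistent eq eq lt d′ _ d″ ≡.refl h = ≡.refl
      lex-consistent eq gt lt d′ _ d″ ≡.refl h = tt
      lex-consistent eq d eq d′ _ d″ ≡.refl h = h
      lex-consistent eq lt gt d′ _ d″ ≡.refl h = tt
      lex-consistent eq eq gt d′ _ d″ ≡.refl h = ≡.refl
      lex-consistent eq gt gt d′ _ d″ ≡.refl h = ≡.refl
      lex-consistent gt d lt d′ c″ d″ _ h = tt
      lex-consistent gt d eq lt _ d″ ≡.refl h = tt
      lex-consistent gt d eq eq _ d″ ≡.refl h = ≡.refl
      lex-consistent gt d eq gt _ d″ ≡.refl h = ≡.refl
      lex-consistent gt d gt d′ _ d″ ≡.refl h = ≡.refl

    lexOrder : Order A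
    lexOrder = record
      { cmp        = cmp
      ; cmp-flip   = λ a b → ≡.trans (≡.cong₂ lex (ncmp-flip (color a) (color b)) (ncmp-flip (label b) (label a)))
                                     (lex-flip (ncmp (color a) (color b)) _)
      ; cmp-eq     = λ a b h → ≡.sym (label-injective (ncmp-eq _ _ (lex-eq (ncmp (color a) (color b)) _ h)))
      ; consistent = λ a b c → lex-consistent _ (ncmp (label b) (label a)) _ (ncmp (label c) (label b)) _ _
          (ncmp-consistent (color a) (color b) (color c))
          (Consistent-sym _ _ _ (ncmp-consistent (label c) (label b) (label a)))
      }

  words : ∀ N → ℕ → List (List (Fin N))
  words N zero    = [] ∷ []
  words N (suc n) = concatMap (λ a → map (a ∷_) (words N n)) (allFin N)

  ∑-words : ∀ N n {F : List (Fin N) → Carrier} →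
            ∑ (words N (suc n)) F ≈ ∑ (allFin N) (λ a → ∑ (words N n) (λ w → F (a ∷ w)))
  ∑-words N n = trans (∑-concatMap _ (allFin N)) (∑-cong (allFin N) λ a → ∑-map (a ∷_) (words N n))

  ∑-words-++ : ∀ N m n {F : List (Fin N) → Carrier} →
               ∑ (words N (m ℕ.+ n)) F ≈ ∑ (words N m) (λ u → ∑ (words N n) (λ v → F (u ++ v)))
  ∑-words-++ N zero    n = sym (+-identityʳ _)
  ∑-words-++ N (suc m) n = trans (∑-words N (m ℕ.+ n))
    (trans (∑-cong (allFin N) λ a → ∑-words-++ N m n) (sym (∑-words N m)))

  ∑-words-sw : ∀ N s n {F : List (Fin N) → Carrier} →
               ∑ (words N n) F ≈ ∑ (words N n) (F ∘ sw s)
  ∑-words-sw N zero zero = refl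
  ∑-words-sw N zero (suc zero) = trans (∑-words N 0) (trans (∑-cong (allFin N) λ a → refl) (sym (∑-words N 0)))
  ∑-words-sw N zero (suc (suc n)) {F} = begin
    ∑ (words N (suc (suc n))) F
      ≈⟨ trans (∑-words N (suc n)) (∑-cong (allFin N) λ a → ∑-words N n) ⟩
    ∑ (allFin N) (λ a → ∑ (allFin N) (λ b → ∑ (words N n) (λ w → F (a ∷ b ∷ w))))
      ≈⟨ ∑-swap (allFin N) (allFin N) ⟩
    ∑ (allFin N) (λ b → ∑ (allFin N) (λ a → ∑ (words N n) (λ w → F (a ∷ b ∷ w))))
      ≈⟨ trans (∑-words N (suc n)) (∑-cong (allFin N) λ a → ∑-words N n) ⟨
    ∑ (words N (suc (suc n))) (F ∘ sw 0) ∎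
  ∑-words-sw N (suc s) zero = refl
  ∑-words-sw N (suc s) (suc n) = trans (∑-words N n)
    (trans (∑-cong (allFin N) λ a → ∑-words-sw N s n) (sym (∑-words N n)))

  words-length : ∀ N n → All (λ w → length w ≡ n) (words N n)
  words-length N zero    = ≡.refl ∷ []
  words-length N (suc n) = go (allFin N)
    where
    open import Data.List.Relation.Unary.All.Properties using (++⁺; map⁺)
    go : ∀ as → All (λ w → length w ≡ suc n) (concatMap (λ a → map (a ∷_) (words N n)) as)
    go []       = []
    go (a ∷ as) = ++⁺ (map⁺ (All.map (≡.cong suc) (words-length N n))) (go as)

  ∑-words-cong : ∀ N n {F G : List (Fin N) → Carrier} →
                 (∀ w → length w ≡ n → F w ≈ G w) → ∑ (words N n) F ≈ ∑ (words N n) G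
  ∑-words-cong N n h = ∑-cong∈ (words N n) λ {w} w∈ → h w (All.lookup (words-length N n) w∈)

  cont : ∀ {N} → List (Fin N) → Vec ℕ N
  cont {N} []  = Vec.replicate N 0
  cont (a ∷ w) = updateAt (cont w) a suc

  cont-sw : ∀ {N} s (w : List (Fin N)) → cont (sw s w) ≡ cont w
  cont-sw zero    []          = ≡.refl
  cont-sw zero    (a ∷ [])    = ≡.refl
  cont-sw zero    (a ∷ b ∷ w) with b Fin.≟ a
  ... | yes ≡.refl = ≡.refl
  ... | no  b≢a    = Vec.updateAt-commutes b a b≢a (cont w)
  cont-sw (suc s) []          = ≡.refl
  cont-sw (suc s) (a ∷ w)     = ≡.cong (λ v → updateAt v a suc) (cont-sw s w)

-- The color and label traces: cyclicity and values at Coxeter elements.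

module Traces (R : CommutativeSemiring 0ℓ 0ℓ) (z p x : CommutativeSemiring.Carrier R) where

  open import Data.Bool.Base using (Bool; true; false)
  open import Data.Fin.Base as Fin using (Fin; toℕ)
  import Data.Fin.Properties as Fin
  open import Data.List.Base hiding (updateAt)
  open import Data.List.Membership.Propositional using (_∈_)
  open import Data.List.Relation.Unary.All as All using (All; []; _∷_)
  open import Data.List.Relation.Unary.AllPairs using ([]; _∷_)
  open import Data.List.Relation.Unary.Any using (here; there)
  open import Data.List.Relation.Unary.Unique.Propositional using (Unique)
  import Data.List.Properties as List
  open import Data.Nat.Base as ℕ using (ℕ; zero; suc; s≤s; z≤n)
  import Data.Nat.Properties as ℕ
  open import Data.Product.Base using (_×_; _,_; proj₂)
  open import Data.Empty using (⊥; ⊥-elim)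
  open import Data.Unit.Base using (⊤; tt)
  open import Data.Vec.Base using (Vec)
  open import Function.Base using (_∘_; id)
  open import Relation.Binary.Definitions using (DecidableEquality)
  open import Relation.Binary.PropositionalEquality as ≡ using (_≡_; _≢_)
  open import Relation.Nullary.Decidable using (Dec; yes; no)

  open import Defs using (_≟ᵛ_)
  open Sums R
  open Hecke R z p x
  open Words R z p x
  open Reduction using (asc; Far)

  χ : ∀ {N} → Vec ℕ N → List (Fin N) → Carrier
  χ β σ = ι (cont σ ≟ᵛ β)

  χ-sw : ∀ {N} (β : Vec ℕ N) s σ → χ β (sw s σ) ≈ χ β σ
  χ-sw β s σ = reflexive (≡.cong (λ c → ι (c ≟ᵛ β)) (cont-sw s σ))

  module Delta {A : Set} (_≟_ : DecidableEquality A) where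
    δ : List A → List A → Carrier
    δ w v = ι (List.≡-dec _≟_ v w)

    δ? : ∀ w v → Dec (v ≡ w)
    δ? w v = List.≡-dec _≟_ v w

    δ-refl : ∀ w → δ w w ≈ 1#
    δ-refl w = ι-yes (List.≡-dec _≟_ w w) ≡.refl

    δ-sw : ∀ s w v → δ w (sw s v) ≈ δ (sw s w) v
    δ-sw s w v = ι-cong (δ? w (sw s v)) (δ? (sw s w) v)
      (λ h → ≡.trans (≡.sym (sw-involutive s v)) (≡.cong (sw s) h))
      (λ h → ≡.trans (≡.cong (sw s) h) (sw-involutive s w))

    δ-guard : ∀ w v {a b} → (v ≡ w → a ≈ b) → δ w v * a ≈ δ w v * b
    δ-guard w v = ι-guard (List.≡-dec _≟_ v w)

    δ-++ : ∀ u u′ v v′ → length u ≡ length u′ → δ (u′ ++ v′) (u ++ v) ≈ δ u′ u * δ v′ v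
    δ-++ []      []        v v′ l = sym (trans (*-congʳ (δ-refl [])) (*-identityˡ _))
    δ-++ (a ∷ u) (b ∷ u′) v v′ l with a ≟ b
    ... | yes ≡.refl = δ-++ u u′ v v′ (ℕ.suc-injective l)
    ... | no a≢b = sym (zeroˡ _)

  -- A common frame for both traces. For each σ one diagonal entry is taken at the word `W σ` in the
  -- order `O σ`: colors use the word σ itself and a fixed order, labels use the identity word and
  -- an order that varies with σ.
  module Trace {N : ℕ} {A : Set} (_≟_ : DecidableEquality A) (O : List (Fin N) → Order A)
               (W : List (Fin N) → List A) where
    open Delta _≟_ public

    -- The matrix entry of h in row w and column v.
    K : List (Fin N) → H → List A → List A → Carrier
    K σ h w v = Act.⟪_⟫ (O σ) h (δ v) w

    ga : List (Fin N) → ℕ → List A → Carrier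
    ga σ = Act.ga (O σ)

    tr : (n : ℕ) → Vec ℕ N → H → Carrier
    tr n β h = ∑ (words N n) λ σ → χ β σ * K σ h (W σ) (W σ)

    module _ (W-length : ∀ σ → length (W σ) ≡ length σ) (n : ℕ) (β : Vec ℕ N) where

      tr-cong : ∀ h g → (∀ σ f w → length w ≡ n → Act.⟪_⟫ (O σ) h f w ≈ Act.⟪_⟫ (O σ) g f w) → tr n β h ≈ tr n β g
      tr-cong h g h≈g = ∑-words-cong N n λ σ l → *-congˡ (h≈g σ _ (W σ) (≡.trans (W-length σ) l))

      tr-sc : ∀ c h → tr n β (sc c ⊙ h) ≈ c * tr n β h
      tr-sc c h = trans (∑-cong (words N n) λ σ → x*yz≈y*xz _ _ _) (∑-*ˡ c (words N n))

      tr-⊞ : ∀ h g → tr n β (h ⊞ g) ≈ tr n β h + tr n β g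
      tr-⊞ h g = trans (∑-cong (words N n) λ σ → distribˡ _ _ _) (∑-+ (words N n))

      -- T_s g and g T_s have the same contribution from the diagonal part `al` of T_s, one σ at a
      -- time. The hypothesis equates what is left, the off-diagonal contributions, after summation
      -- over σ.
      module _ (exchange : ∀ s g →
        ∑ (words N n) (λ σ → χ β σ * (ga σ s (W σ) * K σ g (sw s (W σ)) (W σ))) ≈
        ∑ (words N n) (λ σ → χ β σ * (ga σ s (sw s (W σ)) * K σ g (W σ) (sw s (W σ))))) where

        tr-T : ∀ s g → tr n β (T s ⊙ g) ≈ tr n β (g ⊙ T s)
        tr-T s g = begin
          ∑ (words N n) (λ σ → χ β σ * (al σ (W σ) * K σ g (W σ) (W σ) + ga σ s (W σ) * K σ g (sw s (W σ)) (W σ)))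
            ≈⟨ trans (∑-cong (words N n) λ σ → distribˡ _ _ _) (∑-+ (words N n)) ⟩
          ∑ (words N n) (λ σ → χ β σ * (al σ (W σ) * K σ g (W σ) (W σ))) +
          ∑ (words N n) (λ σ → χ β σ * (ga σ s (W σ) * K σ g (sw s (W σ)) (W σ)))
            ≈⟨ +-congˡ (exchange s g) ⟩
          ∑ (words N n) (λ σ → χ β σ * (al σ (W σ) * K σ g (W σ) (W σ))) +
          ∑ (words N n) (λ σ → χ β σ * (ga σ s (sw s (W σ)) * K σ g (W σ) (sw s (W σ))))
            ≈⟨ trans (∑-cong (words N n) λ σ → trans (*-congˡ (right σ)) (distribˡ _ _ _)) (∑-+ (words N n)) ⟨
          tr n β (g ⊙ T s) ∎
          where
          al : List (Fin N) → List A → Carrier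
          al σ = Act.al (O σ) s
          right : ∀ σ → K σ (g ⊙ T s) (W σ) (W σ) ≈
                  al σ (W σ) * K σ g (W σ) (W σ) + ga σ s (sw s (W σ)) * K σ g (W σ) (sw s (W σ))
          right σ = begin
            ⟪ g ⟫ (λ v → al σ v * δ w v + ga σ s v * δ w (sw s v)) w
              ≈⟨ ⟪⟫-ext g (λ v → +-cong
                   (trans (*-comm _ _) (trans (δ-guard w v λ { ≡.refl → refl }) (*-comm _ _)))
                   (trans (*-congˡ (δ-sw s w v)) (trans (*-comm _ _) (trans (δ-guard (sw s w) v λ { ≡.refl → refl }) (*-comm _ _))))) w ⟩
            ⟪ g ⟫ (λ v → al σ w * δ w v + ga σ s (sw s w) * δ (sw s w) v) w
              ≈⟨ trans (⟪⟫-+ g _ _ w) (+-cong (⟪⟫-* g _ _ w) (⟪⟫-* g _ _ w)) ⟩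
            al σ w * K σ g w w + ga σ s (sw s w) * K σ g w (sw s w) ∎
            where
            open Act (O σ) using (⟪_⟫; ⟪⟫-ext; ⟪⟫-+; ⟪⟫-*)
            w = W σ

        -- A single generator is moved by `tr-T`; a product h h′ is moved past g in two turns.
        tr-cyclic : ∀ h g → tr n β (h ⊙ g) ≈ tr n β (g ⊙ h)
        tr-cyclic (T s)    g = tr-T s g
        tr-cyclic (sc c)   g = ∑-cong (words N n) λ σ → *-congˡ (sym (Act.⟪⟫-* (O σ) g c _ (W σ)))
        tr-cyclic (h ⊞ h′) g = begin
          tr n β ((h ⊞ h′) ⊙ g)            ≈⟨ tr-⊞ (h ⊙ g) (h′ ⊙ g) ⟩
          tr n β (h ⊙ g) + tr n β (h′ ⊙ g) ≈⟨ +-cong (tr-cyclic h g) (tr-cyclic h′ g) ⟩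
          tr n β (g ⊙ h) + tr n β (g ⊙ h′) ≈⟨ tr-⊞ (g ⊙ h) (g ⊙ h′) ⟨
          tr n β (g ⊙ h ⊞ g ⊙ h′)          ≈⟨ ∑-cong (words N n) (λ σ → *-congˡ (Act.⟪⟫-+ (O σ) g _ _ (W σ))) ⟨
          tr n β (g ⊙ (h ⊞ h′))            ∎
        tr-cyclic (h ⊙ h′) g = trans (tr-cyclic h (h′ ⊙ g)) (tr-cyclic h′ (g ⊙ h))

        tr-word-cyclic : ∀ u v → tr n β (word (u ++ v)) ≈ tr n β (word (v ++ u))
        tr-word-cyclic u v = trans (tr-cong (word (u ++ v)) (word u ⊙ word v) λ σ f w _ → Act.word-++ (O σ) u v f w)
          (trans (tr-cyclic (word u) (word v)) (sym (tr-cong (word (v ++ u)) (word v ⊙ word u) λ σ f w _ → Act.word-++ (O σ) v u f w)))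

      tr-commute : ∀ u s t v → Far s t → tr n β (word (u ++ s ∷ t ∷ v)) ≈ tr n β (word (u ++ t ∷ s ∷ v))
      tr-commute u s t v far = tr-cong (word (u ++ s ∷ t ∷ v)) (word (u ++ t ∷ s ∷ v)) λ σ f w _ → Act.commute (O σ) u s t v f w far

      tr-drop : ∀ u s v → n ℕ.≤ suc s → tr n β (word (u ++ s ∷ v)) ≈ q * tr n β (word (u ++ v))
      tr-drop u s v n≤s = trans (tr-cong (word (u ++ s ∷ v)) (sc q ⊙ word (u ++ v)) λ σ f w l → Act.drop-junk (O σ) n u s v f w n≤s l) (tr-sc q (word (u ++ v)))

      module _ (x+p≈0 : x + p ≈ 0#) where

        tr-quadratic : ∀ u s v → tr n β (word (u ++ s ∷ s ∷ v)) ≈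
                       z * tr n β (word (u ++ s ∷ v)) + (q * p) * tr n β (word (u ++ v))
        tr-quadratic u s v = trans
          (tr-cong (word (u ++ s ∷ s ∷ v)) (sc z ⊙ word (u ++ s ∷ v) ⊞ sc (q * p) ⊙ word (u ++ v))
            λ σ f w _ → Act.Relations.quadratic (O σ) x+p≈0 u s v f w)
          (trans (tr-⊞ (sc z ⊙ word (u ++ s ∷ v)) (sc (q * p) ⊙ word (u ++ v)))
            (+-cong (tr-sc z (word (u ++ s ∷ v))) (tr-sc (q * p) (word (u ++ v)))))

        tr-braid : ∀ u s v → suc (suc s) ℕ.< n →
                   tr n β (word (u ++ suc s ∷ s ∷ suc s ∷ v)) ≈ tr n β (word (u ++ s ∷ suc s ∷ s ∷ v))
        tr-braid u s v s<n = tr-cong (word (u ++ suc s ∷ s ∷ suc s ∷ v)) (word (u ++ s ∷ suc s ∷ s ∷ v)) λ σ f w l → Act.Relations.braid (O σ) x+p≈0 n u s v f w s<n l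

  module ColorTrace (N : ℕ) where
    open Trace (Fin._≟_ {N}) (λ _ → finOrder N) id public

    exchange : ∀ n β s g →
      ∑ (words N n) (λ σ → χ β σ * (ga σ s σ * K σ g (sw s σ) σ)) ≈
      ∑ (words N n) (λ σ → χ β σ * (ga σ s (sw s σ) * K σ g σ (sw s σ)))
    exchange n β s g = trans (∑-words-sw N s n) (∑-cong (words N n) λ σ → *-cong (χ-sw β s σ)
      (*-congˡ (reflexive (≡.cong (λ w → K σ g w (sw s σ)) (sw-involutive s σ)))))

  -- The transposition of the labels s and s + 1, the counterpart on labels of what `sw s` does to
  -- positions.
  τ : ℕ → ℕ → ℕ
  τ zero    zero          = 1
  τ zero    (suc zero)    = 0
  τ zero    (suc (suc u)) = suc (suc u)
  τ (suc s) zero          = zero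
  τ (suc s) (suc u)       = suc (τ s u)

  τ-involutive : ∀ s u → τ s (τ s u) ≡ u
  τ-involutive zero    zero          = ≡.refl
  τ-involutive zero    (suc zero)    = ≡.refl
  τ-involutive zero    (suc (suc u)) = ≡.refl
  τ-involutive (suc s) zero          = ≡.refl
  τ-involutive (suc s) (suc u)       = ≡.cong suc (τ-involutive s u)

  τ-lower : ∀ s → τ s s ≡ suc s
  τ-lower zero    = ≡.refl
  τ-lower (suc s) = ≡.cong suc (τ-lower s)

  τ-upper : ∀ s → τ s (suc s) ≡ s
  τ-upper zero    = ≡.refl
  τ-upper (suc s) = ≡.cong suc (τ-upper s)

  τ-fixes : ∀ s u → u ≢ s → u ≢ suc s → τ s u ≡ u
  τ-fixes zero    zero          u≢s u≢s+1 = ⊥-elim (u≢s ≡.refl)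
  τ-fixes zero    (suc zero)    u≢s u≢s+1 = ⊥-elim (u≢s+1 ≡.refl)
  τ-fixes zero    (suc (suc u)) u≢s u≢s+1 = ≡.refl
  τ-fixes (suc s) zero          u≢s u≢s+1 = ≡.refl
  τ-fixes (suc s) (suc u)       u≢s u≢s+1 = ≡.cong suc (τ-fixes s u (u≢s ∘ ≡.cong suc) (u≢s+1 ∘ ≡.cong suc))

  ncmp-τ : ∀ s a b → (a ≡ s → b ≡ suc s → ⊥) → (a ≡ suc s → b ≡ s → ⊥) → ncmp (τ s a) (τ s b) ≡ ncmp a b
  ncmp-τ zero    zero          zero          h h′ = ≡.refl
  ncmp-τ zero    zero          (suc zero)    h h′ = ⊥-elim (h ≡.refl ≡.refl)
  ncmp-τ zero    zero          (suc (suc b)) h h′ = ≡.refl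
  ncmp-τ zero    (suc zero)    zero          h h′ = ⊥-elim (h′ ≡.refl ≡.refl)
  ncmp-τ zero    (suc zero)    (suc zero)    h h′ = ≡.refl
  ncmp-τ zero    (suc zero)    (suc (suc b)) h h′ = ≡.refl
  ncmp-τ zero    (suc (suc a)) zero          h h′ = ≡.refl
  ncmp-τ zero    (suc (suc a)) (suc zero)    h h′ = ≡.refl
  ncmp-τ zero    (suc (suc a)) (suc (suc b)) h h′ = ≡.refl
  ncmp-τ (suc s) zero          zero          h h′ = ≡.refl
  ncmp-τ (suc s) zero          (suc b)       h h′ = ≡.refl
  ncmp-τ (suc s) (suc a)       zero          h h′ = ≡.refl
  ncmp-τ (suc s) (suc a)       (suc b)       h h′ = ncmp-τ s a b
    (λ e e′ → h (≡.cong suc e) (≡.cong suc e′)) (λ e e′ → h′ (≡.cong suc e) (≡.cong suc e′))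

  map-τ-fixes : ∀ s w → All (_≢ s) w → All (_≢ suc s) w → map (τ s) w ≡ w
  map-τ-fixes s []      []       []         = ≡.refl
  map-τ-fixes s (u ∷ w) (h ∷ hs) (h′ ∷ hs′) = ≡.cong₂ _∷_ (τ-fixes s u h h′) (map-τ-fixes s w hs hs′)

  asc-> : ∀ m r l → l ℕ.< m → All (_≢ l) (asc m r)
  asc-> m zero    l l<m = []
  asc-> m (suc r) l l<m = ℕ.>⇒≢ l<m ∷ asc-> (suc m) r l (ℕ.m<n⇒m<1+n l<m)

  length-asc : ∀ m r → length (asc m r) ≡ r
  length-asc m zero    = ≡.refl
  length-asc m (suc r) = ≡.cong suc (length-asc (suc m) r)

  Unique-asc : ∀ m r → Unique (asc m r)
  Unique-asc m zero    = []
  Unique-asc m (suc r) = All.map ≡.≢-sym (asc-> (suc m) r m ℕ.≤-refl) ∷ Unique-asc (suc m) r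

  map-τ-asc : ∀ m s r → suc s ℕ.< r → map (τ (m ℕ.+ s)) (asc m r) ≡ sw s (asc m r)
  map-τ-asc m zero (suc (suc r)) l rewrite ℕ.+-identityʳ m =
    ≡.cong₂ _∷_ (τ-lower m) (≡.cong₂ _∷_ (τ-upper m)
      (map-τ-fixes m _ (asc-> _ r m (ℕ.m<n⇒m<1+n ℕ.≤-refl)) (asc-> _ r (suc m) ℕ.≤-refl)))
  map-τ-asc m (suc s) (suc r) (s≤s l) = ≡.cong₂ _∷_ (τ-fixes (m ℕ.+ suc s) m (ℕ.<⇒≢ (ℕ.m<m+n m (s≤s z≤n))) (ℕ.<⇒≢ (ℕ.≤-trans (ℕ.m<m+n m {suc s} (s≤s z≤n)) (ℕ.n≤1+n _))))
    (≡.trans (≡.cong (λ k → map (τ k) (asc (suc m) r)) (ℕ.+-suc m s)) (map-τ-asc (suc m) s r l))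
  map-τ-asc m zero (suc zero) (s≤s ())

  -- Labels beyond the end of σ read the default color 0, so that `labelOrder σ` is an order on all
  -- of ℕ.
  at : ∀ {N} → List (Fin N) → ℕ → ℕ
  at []      u       = 0
  at (a ∷ σ) zero    = toℕ a
  at (a ∷ σ) (suc u) = at σ u

  at-τ : ∀ {N} s (σ : List (Fin N)) u → suc s ℕ.< length σ → at (sw s σ) (τ s u) ≡ at σ u
  at-τ zero    (a ∷ [])    u             (s≤s ())
  at-τ zero    (a ∷ b ∷ σ) zero          l = ≡.refl
  at-τ zero    (a ∷ b ∷ σ) (suc zero)    l = ≡.refl
  at-τ zero    (a ∷ b ∷ σ) (suc (suc u)) l = ≡.refl
  at-τ (suc s) (a ∷ σ)     zero          l = ≡.refl
  at-τ (suc s) (a ∷ σ)     (suc u)       (s≤s l) = at-τ s σ u l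

  sw-tie : ∀ {N} s (σ : List (Fin N)) → suc s ℕ.< length σ → at σ s ≡ at σ (suc s) → sw s σ ≡ σ
  sw-tie zero    (a ∷ [])    (s≤s ()) h
  sw-tie zero    (a ∷ b ∷ σ) l h with Fin.toℕ-injective h
  ... | ≡.refl = ≡.refl
  sw-tie (suc s) (a ∷ σ)     (s≤s l) h = ≡.cong (a ∷_) (sw-tie s σ l h)

  labelOrder : ∀ {N} → List (Fin N) → Order ℕ
  labelOrder σ = lexOrder (at σ) id id

  Unique-sw : ∀ {A : Set} s (w : List A) → Unique w → Unique (sw s w)
  Unique-sw zero    []          us = us
  Unique-sw zero    (a ∷ [])    us = us
  Unique-sw zero    (a ∷ b ∷ w) ((a≢b ∷ a≢) ∷ b≢ ∷ us) = (≡.≢-sym a≢b ∷ b≢) ∷ a≢ ∷ us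
  Unique-sw (suc s) []          us = us
  Unique-sw (suc s) (a ∷ w)     (a≢ ∷ us) = sw-All s w a≢ ∷ Unique-sw s w us

  -- For σ with equal colors at s and s+1, these labels are adjacent in the order
  -- and the Hecke action on positions commutes with the one of a generator
  -- exchanging the two labels.
  module Tie {N} (σ : List (Fin N)) (s : ℕ) (s<n : suc s ℕ.< length σ) (tie : at σ s ≡ at σ (suc s)) where
    open Order (labelOrder σ)
    open Act (labelOrder σ)

    -- For a word containing both labels, `true` means that s + 1 stands to the left of s. As ties
    -- are broken backwards, s + 1 is the smaller of the two, so `true` corresponds to the
    -- comparison `lt`.
    before : List ℕ → Bool
    before [] = true
    before (u ∷ w) with u ℕ.≟ suc s | u ℕ.≟ s
    ... | yes _ | _     = true
    ... | no _  | yes _ = false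
    ... | no _  | no _  = before w

    before-upper : ∀ w → before (suc s ∷ w) ≡ true
    before-upper w with suc s ℕ.≟ suc s
    ... | yes _  = ≡.refl
    ... | no s≢s = ⊥-elim (s≢s ≡.refl)

    before-lower : ∀ w → before (s ∷ w) ≡ false
    before-lower w with s ℕ.≟ suc s | s ℕ.≟ s
    ... | no _  | yes _  = ≡.refl
    ... | no _  | no s≢s = ⊥-elim (s≢s ≡.refl)

    before-other : ∀ u w → u ≢ s → u ≢ suc s → before (u ∷ w) ≡ before w
    before-other u w u≢s u≢s+1 with u ℕ.≟ suc s | u ℕ.≟ s
    ... | yes h | _     = ⊥-elim (u≢s+1 h)
    ... | no _  | yes h = ⊥-elim (u≢s h)
    ... | no _  | no _  = ≡.refl

    before-cong : ∀ u {v w} → before v ≡ before w → before (u ∷ v) ≡ before (u ∷ w)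
    before-cong u h with u ℕ.≟ suc s | u ℕ.≟ s
    ... | yes _ | _     = ≡.refl
    ... | no _  | yes _ = ≡.refl
    ... | no _  | no _  = h

    before-swap : ∀ c d w → (c ≡ s → d ≡ suc s → ⊥) → (c ≡ suc s → d ≡ s → ⊥) → before (d ∷ c ∷ w) ≡ before (c ∷ d ∷ w)
    before-swap c d w h h′ = cases (c ℕ.≟ s) (c ℕ.≟ suc s) (d ℕ.≟ s) (d ℕ.≟ suc s)
      where
      cases : Dec (c ≡ s) → Dec (c ≡ suc s) → Dec (d ≡ s) → Dec (d ≡ suc s) → before (d ∷ c ∷ w) ≡ before (c ∷ d ∷ w)
      cases (yes ≡.refl) _ (yes ≡.refl) _ = ≡.refl
      cases (yes c≡s) _ (no _) (yes d≡s+1) = ⊥-elim (h c≡s d≡s+1)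
      cases (yes ≡.refl) _ (no d≢s) (no d≢s+1) =
        ≡.trans (before-other d _ d≢s d≢s+1) (≡.trans (before-lower w) (≡.sym (before-lower _)))
      cases (no _) (yes ≡.refl) _ (yes ≡.refl) = ≡.refl
      cases (no _) (yes c≡s+1) (yes d≡s) (no _) = ⊥-elim (h′ c≡s+1 d≡s)
      cases (no _) (yes ≡.refl) (no d≢s) (no d≢s+1) =
        ≡.trans (before-other d _ d≢s d≢s+1) (≡.trans (before-upper w) (≡.sym (before-upper _)))
      cases (no c≢s) (no c≢s+1) _ _ =
        ≡.trans (before-cong d (before-other c w c≢s c≢s+1)) (≡.sym (before-other c _ c≢s c≢s+1))

    τs : List ℕ → List ℕ
    τs = map (τ s)

    τs-involutive : ∀ w → τs (τs w) ≡ w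
    τs-involutive []      = ≡.refl
    τs-involutive (u ∷ w) = ≡.cong₂ _∷_ (τ-involutive s u) (τs-involutive w)

    at-τ-tie : ∀ u → at σ (τ s u) ≡ at σ u
    at-τ-tie u = ≡.trans (≡.cong (λ ρ → at ρ (τ s u)) (≡.sym (sw-tie s σ s<n tie))) (at-τ s σ u s<n)

    cmp-τ : ∀ c d → (c ≡ s → d ≡ suc s → ⊥) → (c ≡ suc s → d ≡ s → ⊥) → cmp (τ s c) (τ s d) ≡ cmp c d
    cmp-τ c d h h′ = ≡.cong₂ lex (≡.cong₂ ncmp (at-τ-tie c) (at-τ-tie d))
      (ncmp-τ s d c (λ e e′ → h′ e′ e) (λ e e′ → h e′ e))

    cmp-up : cmp s (suc s) ≡ gt
    cmp-up rewrite tie | ncmp-refl (at σ (suc s)) = ncmp-suc s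
      where
      ncmp-suc : ∀ s → ncmp (suc s) s ≡ gt
      ncmp-suc zero    = ≡.refl
      ncmp-suc (suc s) = ncmp-suc s

    cmp-down : cmp (suc s) s ≡ lt
    cmp-down = ≡.trans (cmp-flip s (suc s)) (≡.cong flip cmp-up)

    -- Either the labels at positions t and t + 1 are not the pair s, s + 1, and then the
    -- coefficients of T_t are invariant under τ; or they are this pair, and then swapping positions
    -- and swapping labels is the same thing.
    data Local (t : ℕ) (w : List ℕ) : Set where
      apart : al t (τs w) ≡ al t w → ga t (τs w) ≡ ga t w → before (sw t w) ≡ before w → Local t w
      upper : al t w ≡ z → ga t w ≡ q → al t (τs w) ≡ 0# → ga t (τs w) ≡ p → τs w ≡ sw t w →
              before w ≡ true → before (sw t w) ≡ false → s ∈ w → suc s ∈ w → Local t w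
      lower : al t w ≡ 0# → ga t w ≡ p → al t (τs w) ≡ z → ga t (τs w) ≡ q → τs w ≡ sw t w →
              before w ≡ false → before (sw t w) ≡ true → s ∈ w → suc s ∈ w → Local t w

    local : ∀ t w → Unique w → Local t w
    local zero [] us = apart ≡.refl ≡.refl ≡.refl
    local zero (c ∷ []) us = apart ≡.refl ≡.refl ≡.refl
    local zero (c ∷ d ∷ w) ((_ ∷ c≢) ∷ d≢ ∷ us) with c ℕ.≟ s | d ℕ.≟ suc s | c ℕ.≟ suc s | d ℕ.≟ s
    ... | yes ≡.refl | yes ≡.refl | _ | _ = lower (≡.cong α cmp-up) (≡.cong e cmp-up) (≡.cong α cmp-τ′) (≡.cong e cmp-τ′)
          (≡.cong₂ _∷_ (τ-lower s) (≡.cong₂ _∷_ (τ-upper s) (map-τ-fixes s w (All.map ≡.≢-sym c≢) (All.map ≡.≢-sym d≢))))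
          (before-lower _) (before-upper _) (here ≡.refl) (there (here ≡.refl))
      where
      cmp-τ′ : cmp (τ s s) (τ s (suc s)) ≡ lt
      cmp-τ′ = ≡.trans (≡.cong₂ cmp (τ-lower s) (τ-upper s)) cmp-down
    ... | _ | _ | yes ≡.refl | yes ≡.refl = upper (≡.cong α cmp-down) (≡.cong e cmp-down) (≡.cong α cmp-τ′) (≡.cong e cmp-τ′)
          (≡.cong₂ _∷_ (τ-upper s) (≡.cong₂ _∷_ (τ-lower s) (map-τ-fixes s w (All.map ≡.≢-sym d≢) (All.map ≡.≢-sym c≢))))
          (before-upper _) (before-lower _) (there (here ≡.refl)) (here ≡.refl)
      where
      cmp-τ′ : cmp (τ s (suc s)) (τ s s) ≡ gt
      cmp-τ′ = ≡.trans (≡.cong₂ cmp (τ-upper s) (τ-lower s)) cmp-up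
    ... | no c≢s | _ | no c≢s+1 | _ = apart′ (λ h _ → c≢s h) (λ h _ → c≢s+1 h)
      where
      apart′ : (c ≡ s → d ≡ suc s → ⊥) → (c ≡ suc s → d ≡ s → ⊥) → Local zero (c ∷ d ∷ w)
      apart′ h h′ = apart (≡.cong α (cmp-τ c d h h′)) (≡.cong e (cmp-τ c d h h′)) (before-swap c d w h h′)
    ... | no c≢s | _ | yes _ | no d≢s = apart (≡.cong α (cmp-τ c d h h′)) (≡.cong e (cmp-τ c d h h′)) (before-swap c d w h h′)
      where
      h : c ≡ s → d ≡ suc s → ⊥
      h e _ = c≢s e
      h′ : c ≡ suc s → d ≡ s → ⊥
      h′ _ e = d≢s e
    ... | yes _ | no d≢s+1 | no c≢s+1 | _ = apart (≡.cong α (cmp-τ c d h h′)) (≡.cong e (cmp-τ c d h h′)) (before-swap c d w h h′)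
      where
      h : c ≡ s → d ≡ suc s → ⊥
      h _ e = d≢s+1 e
      h′ : c ≡ suc s → d ≡ s → ⊥
      h′ e _ = c≢s+1 e
    local (suc t) [] us = apart ≡.refl ≡.refl ≡.refl
    local (suc t) (c ∷ w) (c≢ ∷ us) with local t w us
    ... | apart al≡ ga≡ b = apart al≡ ga≡ (before-cong c b)
    ... | upper a b c′ d τ≡ b₁ b₂ s∈ s+1∈ = upper a b c′ d (≡.cong₂ _∷_ (τ-fixes s c c≢s c≢s+1) τ≡)
          (≡.trans (before-other c w c≢s c≢s+1) b₁) (≡.trans (before-other c (sw t w) c≢s c≢s+1) b₂) (there s∈) (there s+1∈)
      where
      c≢s = All.lookup c≢ s∈
      c≢s+1 = All.lookup c≢ s+1∈
    ... | lower a b c′ d τ≡ b₁ b₂ s∈ s+1∈ = lower a b c′ d (≡.cong₂ _∷_ (τ-fixes s c c≢s c≢s+1) τ≡)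
          (≡.trans (before-other c w c≢s c≢s+1) b₁) (≡.trans (before-other c (sw t w) c≢s c≢s+1) b₂) (there s∈) (there s+1∈)
      where
      c≢s = All.lookup c≢ s∈
      c≢s+1 = All.lookup c≢ s+1∈

    branch : Bool → Carrier → Carrier → Carrier
    branch true  a b = z * a + q * b
    branch false a b = p * b

    -- The generator on labels: `branch` repeats the coefficients α and e at `lt` and `gt`, with
    -- `before` in place of a comparison of adjacent letters. The case of equal letters does not
    -- arise for labels.
    Rᵃ : Fun → Fun
    Rᵃ f w = branch (before w) (f w) (f (τs w))

    branch-+ : ∀ b {a a′ c c′} → branch b a c + branch b a′ c′ ≈ branch b (a + a′) (c + c′)
    branch-+ true  = solve 6 (λ z q a a′ c c′ → (z :* a :+ q :* c) :+ (z :* a′ :+ q :* c′) := z :* (a :+ a′) :+ q :* (c :+ c′)) refl _ _ _ _ _ _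
    branch-+ false = sym (distribˡ p _ _)

    branch-* : ∀ b k {a c} → k * branch b a c ≈ branch b (k * a) (k * c)
    branch-* true  k = solve 5 (λ z q k a c → k :* (z :* a :+ q :* c) := z :* (k :* a) :+ q :* (k :* c)) refl _ _ _ _ _
    branch-* false k = x*yz≈y*xz _ _ _

    sw-τ : ∀ t w → τs w ≡ sw t w → sw t (τs w) ≡ τs (τs w)
    sw-τ t w τ≡ = ≡.trans (sw-map (τ s) t w) (≡.cong τs (≡.sym τ≡))

    -- Where T_t moves the pair s, s + 1 itself, `act t` and `Rᵃ` are the same operation on w and
    -- its swap; elsewhere T_t is blind to τ and keeps `before`.
    act-Rᵃ : ∀ t f w → Unique w → act t (Rᵃ f) w ≈ Rᵃ (act t f) w
    act-Rᵃ t f w us with local t w us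
    ... | apart al≡ ga≡ b rewrite b | al≡ | ga≡ | sw-map (τ s) t w =
      trans (+-cong (branch-* (before w) _) (branch-* (before w) _)) (branch-+ (before w))
    ... | upper a b c d τ≡ b₁ b₂ _ _ rewrite b₁ | b₂ | a | b | c | d | sw-τ t w τ≡ | ≡.sym τ≡ =
      +-congˡ (*-congˡ (sym (trans (+-congʳ (zeroˡ _)) (+-identityˡ _))))
    ... | lower a b c d τ≡ b₁ b₂ _ _ rewrite b₁ | b₂ | a | b | c | d | sw-τ t w τ≡ | ≡.sym τ≡ =
      trans (+-congʳ (zeroˡ _)) (+-identityˡ _)

    ⟪⟫-Rᵃ : ∀ h f w → Unique w → ⟪ h ⟫ (Rᵃ f) w ≈ Rᵃ (⟪ h ⟫ f) w
    ⟪⟫-Rᵃ (T t)   f w us = act-Rᵃ t f w us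
    ⟪⟫-Rᵃ (sc c)  f w us = branch-* (before w) c
    ⟪⟫-Rᵃ (h ⊞ g) f w us = trans (+-cong (⟪⟫-Rᵃ h f w us) (⟪⟫-Rᵃ g f w us)) (branch-+ (before w))
    ⟪⟫-Rᵃ (h ⊙ g) f w us = trans (⟪⟫-cong-on Unique Unique-sw h (⟪⟫-Rᵃ g f) w us) (⟪⟫-Rᵃ h (⟪ g ⟫ f) w us)

    open Delta ℕ._≟_

    before-asc : ∀ m → m ℕ.≤ s → ∀ r → s ℕ.< m ℕ.+ r → before (asc m r) ≡ false
    before-asc m m≤s zero    l = ⊥-elim (ℕ.<-irrefl ≡.refl (ℕ.≤-trans l (ℕ.≤-trans (ℕ.≤-reflexive (ℕ.+-identityʳ m)) m≤s)))
    before-asc m m≤s (suc r) l = cases (m ℕ.≟ s)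
      where
      cases : Dec (m ≡ s) → before (asc m (suc r)) ≡ false
      cases (yes ≡.refl) = before-lower _
      cases (no m≢s) = ≡.trans (before-other m _ m≢s (λ { ≡.refl → ℕ.<-irrefl ≡.refl m≤s }))
        (before-asc (suc m) (ℕ.≤∧≢⇒< m≤s m≢s) r (≡.subst (s ℕ.<_) (ℕ.+-suc m r) l))

    -- The commutation with `Rᵃ`, evaluated at the identity word w. There s stands before s + 1 and
    -- τ acts as `sw s`, so that `Rᵃ` applied to δ w gives q times the delta at the swapped word,
    -- whereas reading the result of `Rᵃ` at w gives p times the value at the swapped word.
    tie-exchange : ∀ h → let w = asc 0 (length σ) in
      q * ⟪ h ⟫ (δ (sw s w)) w ≈ p * ⟪ h ⟫ (δ w) (sw s w)
    tie-exchange h = begin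
      q * ⟪ h ⟫ (δ (sw s w)) w
        ≈⟨ ⟪⟫-* h q _ w ⟨
      ⟪ h ⟫ (λ v → q * δ (sw s w) v) w
        ≈⟨ ⟪⟫-ext h (λ v → sym (Rᵃ-δ v)) w ⟩
      ⟪ h ⟫ (Rᵃ (δ w)) w
        ≈⟨ ⟪⟫-Rᵃ h (δ w) w (Unique-asc 0 (length σ)) ⟩
      Rᵃ (⟪ h ⟫ (δ w)) w
        ≈⟨ reflexive (≡.cong (λ b → branch b (⟪ h ⟫ (δ w) w) (⟪ h ⟫ (δ w) (τs w))) before-w) ⟩
      p * ⟪ h ⟫ (δ w) (τs w)
        ≈⟨ *-congˡ (reflexive (≡.cong (⟪ h ⟫ (δ w)) τ-w)) ⟩
      p * ⟪ h ⟫ (δ w) (sw s w) ∎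
      where
      w = asc 0 (length σ)
      τ-w : τs w ≡ sw s w
      τ-w = map-τ-asc 0 s (length σ) s<n
      before-w : before w ≡ false
      before-w = before-asc 0 z≤n (length σ) (ℕ.<-trans ℕ.≤-refl s<n)
      before-τw : ∀ m → m ℕ.≤ s → ∀ r → suc s ℕ.< m ℕ.+ r → before (τs (asc m r)) ≡ true
      before-τw m m≤s zero    l = ⊥-elim (ℕ.<-irrefl ≡.refl (ℕ.≤-trans (ℕ.<⇒≤ l) (ℕ.≤-trans (ℕ.≤-reflexive (ℕ.+-identityʳ m)) m≤s)))
      before-τw m m≤s (suc r) l = cases (m ℕ.≟ s)
        where
        cases : Dec (m ≡ s) → before (τs (asc m (suc r))) ≡ true
        cases (yes ≡.refl) = ≡.trans (≡.cong (λ u → before (u ∷ τs (asc (suc m) r))) (τ-lower s)) (before-upper _)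
        cases (no m≢s) = ≡.trans (≡.cong (λ u → before (u ∷ τs (asc (suc m) r))) (τ-fixes s m m≢s m≢s+1))
          (≡.trans (before-other m _ m≢s m≢s+1) (before-τw (suc m) (ℕ.≤∧≢⇒< m≤s m≢s) r (≡.subst (suc s ℕ.<_) (ℕ.+-suc m r) l)))
          where
          m≢s+1 : m ≢ suc s
          m≢s+1 ≡.refl = ℕ.<-irrefl ≡.refl m≤s
      δ-τ : ∀ v → δ w (τs v) ≈ δ (sw s w) v
      δ-τ v = ι-cong (δ? w (τs v)) (δ? (sw s w) v) (λ h → ≡.trans (≡.sym (τs-involutive v)) (≡.trans (≡.cong τs h) τ-w))
        (λ h → ≡.trans (≡.cong τs h) (≡.trans (≡.cong τs (≡.sym τ-w)) (τs-involutive w)))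
      Rᵃ-δ : ∀ v → Rᵃ (δ w) v ≈ q * δ (sw s w) v
      Rᵃ-δ v with List.≡-dec ℕ._≟_ v w
      ... | yes ≡.refl = begin
        branch (before w) 1# (δ w (τs w)) ≈⟨ reflexive (≡.cong (λ b → branch b 1# (δ w (τs w))) before-w) ⟩
        p * δ w (τs w)                    ≈⟨ trans (*-congˡ off) (zeroʳ p) ⟩
        0#                                ≈⟨ trans (*-congˡ (trans (sym (δ-τ w)) off)) (zeroʳ q) ⟨
        q * δ (sw s w) w                  ∎
        where
        off : δ w (τs w) ≈ 0#
        off = ι-no (δ? w (τs w)) λ h → ⊥-elim (true≢false (≡.trans (≡.sym (before-τw 0 z≤n (length σ) s<n)) (≡.trans (≡.cong before {τs w} {w} h) before-w)))
          where
          true≢false : true ≡ false → ⊥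
          true≢false ()
      ... | no v≢w = off-diagonal (List.≡-dec ℕ._≟_ (τs v) w)
        where
        off-diagonal : (d : Dec (τs v ≡ w)) → branch (before v) 0# (ι d) ≈ q * δ (sw s w) v
        off-diagonal (no τv≢w) = trans (zero-branch (before v)) (sym (trans (*-congˡ (trans (sym (δ-τ v)) (ι-no (δ? w (τs v)) (λ h → ⊥-elim (τv≢w h))))) (zeroʳ q)))
          where
          zero-branch : ∀ b → branch b 0# 0# ≈ 0#
          zero-branch true  = trans (+-cong (zeroʳ z) (zeroʳ q)) (+-identityˡ 0#)
          zero-branch false = zeroʳ p
        off-diagonal (yes τv≡w) = begin
          branch (before v) 0# 1#  ≈⟨ reflexive (≡.cong (λ b → branch b 0# 1#) before-v) ⟩
          z * 0# + q * 1#          ≈⟨ trans (+-congʳ (zeroʳ z)) (+-identityˡ _) ⟩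
          q * 1#                   ≈⟨ *-congˡ (trans (sym (ι-yes (List.≡-dec ℕ._≟_ (τs v) w) τv≡w)) (δ-τ v)) ⟩
          q * δ (sw s w) v         ∎
          where
          before-v : before v ≡ true
          before-v = ≡.trans (≡.cong before (≡.trans (≡.sym (τs-involutive v)) (≡.cong τs τv≡w))) (before-τw 0 z≤n (length σ) s<n)

  module LabelTrace (N : ℕ) where
    open Trace ℕ._≟_ (labelOrder {N}) (λ σ → asc 0 (length σ)) public

    private
      lex-strict : ∀ c {d d′} → c ≢ eq → lex c d ≡ lex c d′
      lex-strict lt c≢ = ≡.refl
      lex-strict eq c≢ = ⊥-elim (c≢ ≡.refl)
      lex-strict gt c≢ = ≡.refl

      ga-asc : ∀ σ s m r → suc s ℕ.< r → ga σ s (asc m r) ≡ e (Order.cmp (labelOrder σ) (m ℕ.+ s) (suc (m ℕ.+ s)))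
      ga-asc σ zero    m (suc (suc r)) l rewrite ℕ.+-identityʳ m = ≡.refl
      ga-asc σ zero    m (suc zero) (s≤s ())
      ga-asc σ (suc s) m (suc r) (s≤s l) rewrite ℕ.+-suc m s = ga-asc σ s (suc m) r l

      ga-sw-asc : ∀ σ s m r → suc s ℕ.< r → ga σ s (sw s (asc m r)) ≡ e (Order.cmp (labelOrder σ) (suc (m ℕ.+ s)) (m ℕ.+ s))
      ga-sw-asc σ zero    m (suc (suc r)) l rewrite ℕ.+-identityʳ m = ≡.refl
      ga-sw-asc σ zero    m (suc zero) (s≤s ())
      ga-sw-asc σ (suc s) m (suc r) (s≤s l) rewrite ℕ.+-suc m s = ga-sw-asc σ s (suc m) r l

    -- The substitution of `sw s σ` for σ matches the summands one by one. If the colors at s and s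
    -- + 1 tie, σ is unchanged and `tie-exchange` supplies the equation, the weights being
    -- `e lt = q` and `e gt = p`. If s is out of range, both sides consist of zeros.
    exchange : ∀ n β s g → let W = λ σ → asc 0 (length σ) in
      ∑ (words N n) (λ σ → χ β σ * (ga σ s (W σ) * K σ g (sw s (W σ)) (W σ))) ≈
      ∑ (words N n) (λ σ → χ β σ * (ga σ s (sw s (W σ)) * K σ g (W σ) (sw s (W σ))))
    exchange n β s g with suc s ℕ.<? n
    ... | no s≮n = ∑-words-cong N n λ σ l → *-congˡ (trans (zero-term σ (W σ) (trans≡ σ l)) (sym (zero-term σ (sw s (W σ)) (≡.trans (sw-length s (W σ)) (trans≡ σ l)))))
      where
      W : List (Fin N) → List ℕ
      W σ = asc 0 (length σ)
      trans≡ : ∀ σ → length σ ≡ n → length (W σ) ≡ n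
      trans≡ σ l = ≡.trans (length-asc 0 (length σ)) l
      zero-term : ∀ σ w {k} → length w ≡ n → ga σ s w * k ≈ 0#
      zero-term σ w l = trans (*-congʳ (reflexive (proj₂ (Act.short (labelOrder σ) s w
        (≡.subst (ℕ._≤ suc s) (≡.sym l) (ℕ.≮⇒≥ s≮n)))))) (zeroˡ _)
    ... | yes s<n = sym (trans (∑-words-cong N n pointwise) (sym (∑-words-sw N s n)))
      where
      W : List (Fin N) → List ℕ
      W σ = asc 0 (length σ)
      pointwise : ∀ σ → length σ ≡ n →
        χ β σ * (ga σ s (sw s (W σ)) * K σ g (W σ) (sw s (W σ))) ≈
        χ β (sw s σ) * (ga (sw s σ) s (W (sw s σ)) * K (sw s σ) g (sw s (W (sw s σ))) (W (sw s σ)))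
      pointwise σ l with at σ s ℕ.≟ at σ (suc s)
      ... | yes tie = ≡.subst (λ ρ → χ β σ * (ga σ s (sw s (W σ)) * K σ g (W σ) (sw s (W σ))) ≈
            χ β ρ * (ga ρ s (W ρ) * K ρ g (sw s (W ρ)) (W ρ))) (≡.sym (sw-tie s σ s<σ tie))
            (*-congˡ (trans (*-congʳ (reflexive (≡.trans (ga-sw-asc σ s 0 _ s<σ) (≡.cong e cmp-down))))
              (trans (tie-exchange g) (*-congʳ (sym (reflexive (≡.trans (ga-asc σ s 0 _ s<σ) (≡.cong e cmp-up))))))))
        where
        s<σ : suc s ℕ.< length σ
        s<σ = ≡.subst (suc s ℕ.<_) (≡.sym l) s<n
        open Tie σ s s<σ tie
      -- With different colors, the relabelling τ carries the order of σ to that of `sw s σ`: colors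
      -- move along with their positions, and the labels s and s + 1, the only ones whose numerical
      -- order changes, are told apart by color.
      ... | no  untied rewrite sw-length s σ = *-cong (sym (χ-sw β s σ)) (*-cong weight kernel)
        where
        s<σ : suc s ℕ.< length σ
        s<σ = ≡.subst (suc s ℕ.<_) (≡.sym l) s<n
        ρ = sw s σ
        w = W σ
        cmp = Order.cmp (labelOrder σ)
        cmp-τ : ∀ a b → Order.cmp (labelOrder ρ) (τ s a) (τ s b) ≡ cmp a b
        cmp-τ a b with a ℕ.≟ s | b ℕ.≟ suc s | a ℕ.≟ suc s | b ℕ.≟ s
        ... | yes ≡.refl | yes ≡.refl | _ | _ = ≡.trans (≡.cong₂ lex (≡.cong₂ ncmp (at-τ s σ s s<σ) (at-τ s σ (suc s) s<σ)) ≡.refl)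
          (lex-strict _ (λ h → untied (ncmp-eq _ _ h)))
        ... | _ | _ | yes ≡.refl | yes ≡.refl = ≡.trans (≡.cong₂ lex (≡.cong₂ ncmp (at-τ s σ (suc s) s<σ) (at-τ s σ s s<σ)) ≡.refl)
          (lex-strict _ (λ h → untied (≡.sym (ncmp-eq _ _ h))))
        ... | no a≢s | _ | no a≢s+1 | _ = ≡.cong₂ lex (≡.cong₂ ncmp (at-τ s σ a s<σ) (at-τ s σ b s<σ)) (ncmp-τ s b a (λ _ h → a≢s+1 h) (λ _ h → a≢s h))
        ... | no a≢s | _ | yes _ | no b≢s = ≡.cong₂ lex (≡.cong₂ ncmp (at-τ s σ a s<σ) (at-τ s σ b s<σ)) (ncmp-τ s b a (λ h _ → b≢s h) (λ _ h → a≢s h))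
        ... | yes _ | no b≢s+1 | no a≢s+1 | _ = ≡.cong₂ lex (≡.cong₂ ncmp (at-τ s σ a s<σ) (at-τ s σ b s<σ)) (ncmp-τ s b a (λ _ h → a≢s+1 h) (λ h _ → b≢s+1 h))
        weight : ga σ s (sw s w) ≈ ga ρ s w
        weight = reflexive (≡.trans (ga-sw-asc σ s 0 _ s<σ) (≡.trans
          (≡.cong e (≡.trans (≡.sym (cmp-τ (suc s) s)) (≡.cong₂ (Order.cmp (labelOrder ρ)) (τ-upper s) (τ-lower s))))
          (≡.sym (ga-asc ρ s 0 _ s<σ))))
        τ-w : map (τ s) w ≡ sw s w
        τ-w = map-τ-asc 0 s _ s<σ
        δ-τ : ∀ v → δ w (map (τ s) v) ≈ δ (sw s w) v
        δ-τ v = ι-cong (δ? w (map (τ s) v)) (δ? (sw s w) v) (λ h → ≡.trans (≡.sym (map-involutive v)) (≡.trans (≡.cong (map (τ s)) h) τ-w))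
          (λ h → ≡.trans (≡.cong (map (τ s)) (≡.trans h (≡.sym τ-w))) (map-involutive w))
          where
          map-involutive : ∀ v → map (τ s) (map (τ s) v) ≡ v
          map-involutive []      = ≡.refl
          map-involutive (u ∷ v) = ≡.cong₂ _∷_ (τ-involutive s u) (map-involutive v)
        kernel : K σ g w (sw s w) ≈ K ρ g (sw s w) w
        kernel = begin
          K σ g w (sw s w)                                  ≈⟨ Act.⟪⟫-ext (labelOrder σ) g (λ v → sym (δ-τ v)) w ⟩
          Act.⟪_⟫ (labelOrder σ) g (δ w ∘ map (τ s)) w      ≈⟨ transport (labelOrder ρ) (labelOrder σ) (τ s) {λ _ → ⊤} (λ {a} {b} _ _ → cmp-τ a b) g (δ w) w (All.universal (λ _ → tt) w) ⟨
          K ρ g (map (τ s) w) w                             ≈⟨ reflexive (≡.cong (λ v → K ρ g v w) τ-w) ⟩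
          K ρ g (sw s w) w                                  ∎

  asc-suc : ∀ m r → asc (suc m) r ≡ map suc (asc m r)
  asc-suc m zero    = ≡.refl
  asc-suc m (suc r) = ≡.cong (suc m ∷_) (asc-suc (suc m) r)

  asc-+ : ∀ m k r → asc m (k ℕ.+ r) ≡ asc m k ++ asc (m ℕ.+ k) r
  asc-+ m zero    r = ≡.cong (λ l → asc l r) (≡.sym (ℕ.+-identityʳ m))
  asc-+ m (suc k) r = ≡.cong (m ∷_) (≡.trans (asc-+ (suc m) k r) (≡.cong (λ l → asc (suc m) k ++ asc l r) (≡.sym (ℕ.+-suc m k))))

  module Coxeter {A : Set} (_≟_ : DecidableEquality A) (O : Order A) where
    open Order O
    open Act O
    open Delta _≟_

    chain : List A → Carrier
    chain (a ∷ b ∷ w) = α (cmp a b) * chain (b ∷ w)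
    chain _           = 1#

    private
      word-suc : ∀ ss f a w → ⟪ word (map suc ss) ⟫ f (a ∷ w) ≈ ⟪ word ss ⟫ (f ∘ (a ∷_)) w
      word-suc []       f a w = refl
      word-suc (s ∷ ss) f a w = +-cong (*-congˡ (word-suc ss f a w)) (*-congˡ (word-suc ss f a (sw s w)))

      word-asc-suc : ∀ m r f a w → ⟪ word (asc (suc m) r) ⟫ f (a ∷ w) ≈ ⟪ word (asc m r) ⟫ (f ∘ (a ∷_)) w
      word-asc-suc m r f a w = trans (reflexive (≡.cong (λ ss → ⟪ word ss ⟫ f (a ∷ w)) (asc-suc m r))) (word-suc (asc m r) f a w)

      word-asc-++ : ∀ u r f v → ⟪ word (asc (length u) r) ⟫ f (u ++ v) ≈ ⟪ word (asc 0 r) ⟫ (f ∘ (u ++_)) v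
      word-asc-++ []      r f v = refl
      word-asc-++ (a ∷ u) r f v = trans (word-asc-suc (length u) r f a (u ++ v)) (word-asc-++ u r (f ∘ (a ∷_)) v)

      al-++ : ∀ s u v → suc s ℕ.< length u → (al s (u ++ v) ≡ al s u) × (ga s (u ++ v) ≡ ga s u) × (sw s (u ++ v) ≡ sw s u ++ v)
      al-++ zero    (a ∷ [])    v (s≤s ())
      al-++ zero    (a ∷ b ∷ u) v l = ≡.refl , ≡.refl , ≡.refl
      al-++ (suc s) (a ∷ u)     v (s≤s l) with al-++ s u v l
      ... | h , h′ , h″ = h , h′ , ≡.cong (a ∷_) h″

      word-prefix : ∀ g f u v → All (λ s → suc s ℕ.< length u) g → ⟪ word g ⟫ f (u ++ v) ≈ ⟪ word g ⟫ (λ u′ → f (u′ ++ v)) u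
      word-prefix []      f u v []       = refl
      word-prefix (s ∷ g) f u v (l ∷ ls) with al-++ s u v l
      ... | h , h′ , h″ rewrite h | h′ | h″ = +-cong (*-congˡ (word-prefix g f u v ls))
        (*-congˡ (word-prefix g f (sw s u) v (≡.subst (λ k → All (λ s → suc s ℕ.< k) g) (≡.sym (sw-length s u)) ls)))

      δ-∷ : ∀ a w v → δ (a ∷ w) (a ∷ v) ≈ δ w v
      δ-∷ a w v = ι-cong (δ? (a ∷ w) (a ∷ v)) (δ? w v) (λ { ≡.refl → ≡.refl }) (λ h → ≡.cong (a ∷_) h)

      ⟪⟫-0 : ∀ h {f} → (∀ w → f w ≈ 0#) → ∀ w → ⟪ h ⟫ f w ≈ 0#
      ⟪⟫-0 h f≈0 w = trans (⟪⟫-ext h (λ v → trans (f≈0 v) (sym (zeroˡ _))) w) (trans (⟪⟫-* h 0# (λ _ → 0#) w) (zeroˡ _))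

      -- Once T_0 has swapped the first two letters, no later generator touches position 0, so the
      -- original word cannot reappear unless the two letters are equal, and then the swap has
      -- coefficient `e eq = 0`. Only the diagonal coefficients survive.
      coxeter-chain : ∀ r w → length w ≡ suc r → ⟪ word (asc 0 r) ⟫ (δ w) w ≈ chain w
      coxeter-chain zero    (a ∷ [])    l = trans (*-identityˡ _) (δ-refl (a ∷ []))
      coxeter-chain (suc r) (a ∷ b ∷ w) l = begin
        α (cmp a b) * ⟪ word (asc 1 r) ⟫ (δ (a ∷ b ∷ w)) (a ∷ b ∷ w) + e (cmp a b) * ⟪ word (asc 1 r) ⟫ (δ (a ∷ b ∷ w)) (b ∷ a ∷ w)
          ≈⟨ +-cong (*-congˡ diagonal) off-diagonal ⟩
        α (cmp a b) * chain (b ∷ w) + 0#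
          ≈⟨ +-identityʳ _ ⟩
        chain (a ∷ b ∷ w) ∎
        where
        diagonal : ⟪ word (asc 1 r) ⟫ (δ (a ∷ b ∷ w)) (a ∷ b ∷ w) ≈ chain (b ∷ w)
        diagonal = trans (word-asc-suc 0 r _ a (b ∷ w))
          (trans (⟪⟫-ext (word (asc 0 r)) (δ-∷ a (b ∷ w)) (b ∷ w)) (coxeter-chain r (b ∷ w) (ℕ.suc-injective l)))
        off-diagonal : e (cmp a b) * ⟪ word (asc 1 r) ⟫ (δ (a ∷ b ∷ w)) (b ∷ a ∷ w) ≈ 0#
        off-diagonal with a ≟ b
        ... | yes ≡.refl = trans (*-congʳ (reflexive (≡.cong e (cmp-refl a)))) (zeroˡ _)
        ... | no a≢b = trans (*-congˡ (trans (word-asc-suc 0 r _ b (a ∷ w))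
          (⟪⟫-0 (word (asc 0 r)) (λ v → ι-no (δ? (a ∷ b ∷ w) (b ∷ v)) λ h → ⊥-elim (a≢b (≡.sym (List.∷-injectiveˡ h)))) (a ∷ w)))) (zeroʳ _)

    -- The generators in g stay within the prefix u, and the run starts at position `length u` and
    -- stays within the suffix v; a matrix entry at u ++ v therefore factors.
    coxeter : ∀ g u r v → All (λ s → suc s ℕ.< length u) g → length v ≡ suc r →
              ⟪ word (g ++ asc (length u) r) ⟫ (δ (u ++ v)) (u ++ v) ≈ ⟪ word g ⟫ (δ u) u * chain v
    coxeter g u r v gs l = begin
      ⟪ word (g ++ asc (length u) r) ⟫ (δ (u ++ v)) (u ++ v)
        ≈⟨ word-++ g _ _ (u ++ v) ⟩
      ⟪ word g ⟫ (⟪ word (asc (length u) r) ⟫ (δ (u ++ v))) (u ++ v)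
        ≈⟨ word-prefix g _ u v gs ⟩
      ⟪ word g ⟫ (λ u′ → ⟪ word (asc (length u) r) ⟫ (δ (u ++ v)) (u′ ++ v)) u
        ≈⟨ ⟪⟫-cong (word g) (length u) inner u ≡.refl ⟩
      ⟪ word g ⟫ (λ u′ → chain v * δ u u′) u
        ≈⟨ trans (⟪⟫-* (word g) (chain v) (δ u) u) (*-comm _ _) ⟩
      ⟪ word g ⟫ (δ u) u * chain v ∎
      where
      inner : ∀ u′ → length u′ ≡ length u → ⟪ word (asc (length u) r) ⟫ (δ (u ++ v)) (u′ ++ v) ≈ chain v * δ u u′
      inner u′ lu = begin
        ⟪ word (asc (length u) r) ⟫ (δ (u ++ v)) (u′ ++ v)
          ≈⟨ reflexive (≡.cong (λ k → ⟪ word (asc k r) ⟫ (δ (u ++ v)) (u′ ++ v)) (≡.sym lu)) ⟩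
        ⟪ word (asc (length u′) r) ⟫ (δ (u ++ v)) (u′ ++ v)
          ≈⟨ word-asc-++ u′ r _ v ⟩
        ⟪ word (asc 0 r) ⟫ (λ v′ → δ (u ++ v) (u′ ++ v′)) v
          ≈⟨ ⟪⟫-ext (word (asc 0 r)) (λ v′ → δ-++ u′ u v′ v lu) v ⟩
        ⟪ word (asc 0 r) ⟫ (λ v′ → δ u u′ * δ v v′) v
          ≈⟨ trans (⟪⟫-* (word (asc 0 r)) (δ u u′) (δ v) v) (*-comm _ _) ⟩
        ⟪ word (asc 0 r) ⟫ (δ v) v * δ u u′
          ≈⟨ *-congʳ (coxeter-chain r v l) ⟩
        chain v * δ u u′ ∎

  ch : ∀ {N} → (Cmp → Carrier) → List (Fin N) → Carrier
  ch κ (a ∷ b ∷ w) = κ (ncmp (toℕ a) (toℕ b)) * ch κ (b ∷ w)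
  ch κ _           = 1#

  -- In the identity word labels increase, and ties of color are broken backwards; a tie thus
  -- compares as `gt` and has diagonal coefficient 0, where equal colors in the color trace have x.
  α₀ : Cmp → Carrier
  α₀ lt = z
  α₀ eq = 0#
  α₀ gt = 0#

  module _ (N : ℕ) (m r : ℕ) (β : Vec ℕ N) (g : List ℕ) (gs : All (λ s → suc s ℕ.< m) g) where

    color-coxeter : ColorTrace.tr N (m ℕ.+ suc r) β (word (g ++ asc m r)) ≈
      ∑ (words N m) (λ u → ∑ (words N (suc r)) (λ v → χ β (u ++ v) * (ColorTrace.K N u (word g) u u * ch α v)))
    color-coxeter = trans (∑-words-++ N m (suc r)) (∑-words-cong N m λ u lu → ∑-words-cong N (suc r) λ v lv → *-congˡ (factor u v lu lv))
      where
      chain≈ch : ∀ v → Coxeter.chain Fin._≟_ (finOrder N) v ≈ ch α v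
      chain≈ch []          = refl
      chain≈ch (a ∷ [])    = refl
      chain≈ch (a ∷ b ∷ v) = *-congˡ (chain≈ch (b ∷ v))
      factor : ∀ u v → length u ≡ m → length v ≡ suc r → ColorTrace.K N (u ++ v) (word (g ++ asc m r)) (u ++ v) (u ++ v) ≈ ColorTrace.K N u (word g) u u * ch α v
      factor u v ≡.refl lv = trans (Coxeter.coxeter Fin._≟_ (finOrder N) g u r v gs lv) (*-congˡ (chain≈ch v))

    label-coxeter : LabelTrace.tr N (m ℕ.+ suc r) β (word (g ++ asc m r)) ≈
      ∑ (words N m) (λ u → ∑ (words N (suc r)) (λ v → χ β (u ++ v) * (LabelTrace.K N u (word g) (asc 0 (length u)) (asc 0 (length u)) * ch α₀ v)))
    label-coxeter = trans (∑-words-++ N m (suc r)) (∑-words-cong N m λ u lu → ∑-words-cong N (suc r) λ v lv → *-congˡ (factor u v lu lv))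
      where
      at-right : ∀ (u v : List (Fin N)) i → at (u ++ v) (length u ℕ.+ i) ≡ at v i
      at-right []      v i = ≡.refl
      at-right (a ∷ u) v i = at-right u v i
      at-left : ∀ (u v : List (Fin N)) i → i ℕ.< length u → at (u ++ v) i ≡ at u i
      at-left (a ∷ u) v zero    l = ≡.refl
      at-left (a ∷ u) v (suc i) (s≤s l) = at-left u v i l
      α-lex : ∀ c m → α (lex c (ncmp (suc m) m)) ≡ α₀ c
      α-lex lt m = ≡.refl
      α-lex eq m = ≡.cong α (ncmp-suc m)
        where
        ncmp-suc : ∀ s → ncmp (suc s) s ≡ gt
        ncmp-suc zero    = ≡.refl
        ncmp-suc (suc s) = ncmp-suc s
      α-lex gt m = ≡.refl
      chain≈ch : ∀ u (v : List (Fin N)) → Coxeter.chain ℕ._≟_ (labelOrder (u ++ v)) (asc (length u) (length v)) ≈ ch α₀ v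
      chain≈ch u v = trans (reflexive (≡.cong (λ k → Coxeter.chain ℕ._≟_ (labelOrder (u ++ v)) (asc k (length v))) (≡.sym (ℕ.+-identityʳ _))))
        (go v 0 (λ i → at-right u v i))
        where
        go : ∀ v′ j → (∀ i → at (u ++ v) (length u ℕ.+ (j ℕ.+ i)) ≡ at v′ i) →
             Coxeter.chain ℕ._≟_ (labelOrder (u ++ v)) (asc (length u ℕ.+ j) (length v′)) ≈ ch α₀ v′
        go []           j h = refl
        go (a ∷ [])     j h = refl
        go (a ∷ b ∷ v′) j h = *-cong
          (reflexive (≡.trans (α-lex (ncmp (at (u ++ v) (length u ℕ.+ j)) (at (u ++ v) (suc (length u ℕ.+ j)))) (length u ℕ.+ j)) (≡.cong α₀ (≡.cong₂ ncmp {at (u ++ v) (length u ℕ.+ j)} {toℕ a} {at (u ++ v) (suc (length u ℕ.+ j))} {toℕ b}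
            (≡.trans (≡.cong (λ k → at (u ++ v) (length u ℕ.+ k)) (≡.sym (ℕ.+-identityʳ j))) (h 0))
            (≡.trans (≡.cong (at (u ++ v)) (≡.trans (≡.sym (ℕ.+-suc (length u) j)) (≡.cong (length u ℕ.+_) (≡.sym (ℕ.+-comm j 1))))) (h 1))))))
          (trans (reflexive (≡.cong (λ k → Coxeter.chain ℕ._≟_ (labelOrder (u ++ v)) (asc k (suc (length v′)))) (≡.sym (ℕ.+-suc (length u) j))))
            (go (b ∷ v′) (suc j) λ i → ≡.trans (≡.cong (λ k → at (u ++ v) (length u ℕ.+ k)) (≡.sym (ℕ.+-suc j i))) (h (suc i))))
      asc-< : ∀ m r k → m ℕ.+ r ℕ.≤ k → All (ℕ._< k) (asc m r)
      asc-< m zero    k l = []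
      asc-< m (suc r) k l = ℕ.≤-trans (ℕ.m<m+n m (s≤s z≤n)) l ∷ asc-< (suc m) r k (≡.subst (ℕ._≤ k) (ℕ.+-suc m r) l)
      factor : ∀ u v → length u ≡ m → length v ≡ suc r →
        LabelTrace.K N (u ++ v) (word (g ++ asc m r)) (asc 0 (length (u ++ v))) (asc 0 (length (u ++ v))) ≈
        LabelTrace.K N u (word g) (asc 0 (length u)) (asc 0 (length u)) * ch α₀ v
      factor u v ≡.refl lv = begin
        K′ (word (g ++ asc (length u) r)) (asc 0 (length (u ++ v)))
          ≈⟨ reflexive (≡.cong (K′ (word (g ++ asc (length u) r))) (≡.trans (≡.cong (asc 0) (List.length-++ u)) (asc-+ 0 (length u) (length v)))) ⟩
        K′ (word (g ++ asc (length u) r)) (w ++ asc (length u) (length v))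
          ≈⟨ reflexive (≡.cong (λ k → K′ (word (g ++ asc k r)) (w ++ asc (length u) (length v))) (≡.sym lw)) ⟩
        K′ (word (g ++ asc (length w) r)) (w ++ asc (length u) (length v))
          ≈⟨ Coxeter.coxeter ℕ._≟_ (labelOrder (u ++ v)) g w r _ (≡.subst (λ k → All (λ s → suc s ℕ.< k) g) (≡.sym lw) gs) (≡.trans (length-asc _ (length v)) lv) ⟩
        K′ (word g) w * Coxeter.chain ℕ._≟_ (labelOrder (u ++ v)) (asc (length u) (length v))
          ≈⟨ *-cong restrict (chain≈ch u v) ⟩
        LabelTrace.K N u (word g) w w * ch α₀ v ∎
        where
        w = asc 0 (length u)
        lw = length-asc 0 (length u)
        K′ : H → List ℕ → Carrier
        K′ h w = LabelTrace.K N (u ++ v) h w w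
        -- Labels below `length u` take their colors from u, so the orders of u ++ v and of u agree
        -- on everything that g can move.
        restrict : K′ (word g) w ≈ LabelTrace.K N u (word g) w w
        restrict = trans (reflexive (≡.cong (LabelTrace.K N (u ++ v) (word g) w) (≡.sym (List.map-id w)))) (trans
          (reflexive (≡.cong (λ w′ → LabelTrace.K N (u ++ v) (word g) w′ (map id w)) (≡.sym (List.map-id w))))
          (trans (transport (labelOrder (u ++ v)) (labelOrder u) id {ℕ._< length u}
            (λ {a} {b} l l′ → ≡.cong (λ c → lex c (ncmp b a)) (≡.cong₂ ncmp (at-left u v a l) (at-left u v b l′))) (word g) _ w (asc-< 0 (length u) (length u) ℕ.≤-refl))
          (Act.⟪⟫-ext (labelOrder u) (word g) (λ w′ → reflexive (≡.cong₂ (LabelTrace.δ N) (List.map-id w) (List.map-id w′))) w)))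

-- Coxeter values as power series, and Newton's identities.

module PowerSeries (R : CommutativeSemiring 0ℓ 0ℓ) (z p x : CommutativeSemiring.Carrier R) where

  open import Data.Bool.Base using (Bool; if_then_else_)
  open import Data.Empty using (⊥-elim)
  open import Data.Fin.Base using (Fin; toℕ; zero; suc)
  open import Data.List.Base hiding (updateAt; lookup; sum; zipWith; replicate)
  open import Data.List.Membership.Propositional.Properties using (∈-upTo⁻)
  import Data.List.Properties as List
  open import Data.Nat.Base as ℕ using (ℕ; zero; suc; s≤s; _∸_)
  import Data.Nat.Properties as ℕ
  open import Data.Product.Base using (_×_; _,_; proj₁; proj₂)
  open import Data.Vec.Base as Vec using (Vec; []; _∷_; sum; lookup; updateAt; zipWith; replicate; _[_]≔_)
  import Data.Vec.Properties as Vec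
  open import Function.Base using (_∘_)
  open import Relation.Binary.PropositionalEquality as ≡ using (_≡_)
  open import Relation.Nullary.Decidable using (does)

  open import Defs using (_≟ᵛ_; splittings)
  open Sums R
  open Hecke R z p x
  open Antisym R z p x using (∑-allFin)
  open Words R z p x
  open Traces R z p x using (χ; ch)

  pow : Carrier → ℕ → Carrier
  pow a zero    = 1#
  pow a (suc n) = a * pow a n

  nat : ℕ → Carrier
  nat zero    = 0#
  nat (suc n) = 1# + nat n

  ∏ᵛ : (ℕ → Carrier) → ∀ {N} → Vec ℕ N → Carrier
  ∏ᵛ g []      = 1#
  ∏ᵛ g (b ∷ β) = g b * ∏ᵛ g β

  -- The part of degree m of ∏ᵢ ∑_b g b xᵢ^b.
  mult : (ℕ → Carrier) → ℕ → (N : ℕ) → Vec ℕ N → Carrier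
  mult g m N β = ι (sum β ℕ.≟ m) * ∏ᵛ g β

  -- The coefficients of 1 + z t / (1 - y t).
  geo : Carrier → ℕ → Carrier
  geo y zero    = 1#
  geo y (suc b) = z * pow y b

  𝟙-≟ᵛ : ∀ {N} a b (α β : Vec ℕ N) → ι ((a ∷ α) ≟ᵛ (b ∷ β)) ≈ ι (a ℕ.≟ b) * ι (α ≟ᵛ β)
  𝟙-≟ᵛ a b α β = 𝟙-∧ (does (a ℕ.≟ b)) (does (α ≟ᵛ β))

  sum≡0⇒ : ∀ {N} (β : Vec ℕ N) → sum β ≡ 0 → β ≡ replicate N 0
  sum≡0⇒ []          h = ≡.refl
  sum≡0⇒ (zero ∷ β) h = ≡.cong (0 ∷_) (sum≡0⇒ β h)

  sum-replicate-0 : ∀ N → sum (replicate N 0) ≡ 0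
  sum-replicate-0 zero    = ≡.refl
  sum-replicate-0 (suc N) = sum-replicate-0 N

  module Coxeter (κ : Cmp → Carrier) (y : Carrier) (κ-lt : κ lt ≡ z) (κ-eq : κ eq ≡ y) (κ-gt : κ gt ≡ 0#) where

    private
      G : ∀ {N} → Vec ℕ N → Carrier
      G = ∏ᵛ (geo y)

      -- The weight of the weakly increasing word of content β with a letter a
      -- put in front, and with its first letter b.
      from first : ∀ {N} → Fin N → Vec ℕ N → Carrier
      from  zero    (b ∷ β)     = pow y b * G β
      from  (suc a) (b ∷ β)     = ι (b ℕ.≟ 0) * from a β
      first zero    (zero ∷ β)  = 0#
      first zero    (suc b ∷ β) = pow y b * G β
      first (suc a) (b ∷ β)     = ι (b ℕ.≟ 0) * first a β

      first-0 : ∀ {N} b (β : Vec ℕ N) → lookup β b ≡ 0 → first b β ≈ 0#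
      first-0 zero    (.0 ∷ β) ≡.refl = refl
      first-0 (suc b) (c ∷ β)  h      = trans (*-congˡ (first-0 b β h)) (zeroʳ _)

      first-suc : ∀ {N} b (β : Vec ℕ N) {c} → lookup β b ≡ suc c → first b β ≈ from b (updateAt β b ℕ.pred)
      first-suc zero    (.(suc _) ∷ β) ≡.refl = refl
      first-suc (suc b) (c ∷ β)        h      = *-congˡ (first-suc b β h)

      sum-pred : ∀ {N} b (β : Vec ℕ N) {c} → lookup β b ≡ suc c → suc (sum (updateAt β b ℕ.pred)) ≡ sum β
      sum-pred zero    (.(suc _) ∷ β) ≡.refl = ≡.refl
      sum-pred (suc b) (c ∷ β)        h      = ≡.trans (≡.sym (ℕ.+-suc c _)) (≡.cong (c ℕ.+_) (sum-pred b β h))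

      -- An increasing word of content β must start with the smallest letter that occurs, so one
      -- term of the sum is left; the factor z completes that letter's power y^b to `geo`.
      z∑first : ∀ {N} (β : Vec ℕ N) {m} → sum β ≡ suc m → z * ∑ (allFin N) (λ b → first b β) ≈ G β
      z∑first {suc N} (zero ∷ β) h = begin
        z * ∑ (allFin (suc N)) (λ b → first b (zero ∷ β))  ≈⟨ *-congˡ (trans (∑-allFin N) (+-identityˡ _)) ⟩
        z * ∑ (allFin N) (λ b → 1# * first b β)            ≈⟨ *-congˡ (∑-cong (allFin N) λ b → *-identityˡ _) ⟩
        z * ∑ (allFin N) (λ b → first b β)                 ≈⟨ z∑first β h ⟩
        G β                                                ≈⟨ *-identityˡ _ ⟨
        1# * G β                                           ∎
      z∑first {suc N} (suc b ∷ β) h = begin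
        z * ∑ (allFin (suc N)) (λ a → first a (suc b ∷ β)) ≈⟨ *-congˡ (trans (∑-allFin N) (+-congˡ (∑-0 (allFin N) λ _ → zeroˡ _))) ⟩
        z * (pow y b * G β + 0#)                           ≈⟨ trans (*-congˡ (+-identityʳ _)) (sym (*-assoc _ _ _)) ⟩
        z * pow y b * G β                                  ∎

      -- The letter after a is a again, at the price y, or else, once these are used up, the
      -- smallest remaining letter, at the price z.
      ∑κ-first : ∀ {N} a (β : Vec ℕ N) {m} → sum β ≡ suc m →
                 ∑ (allFin N) (λ b → κ (ncmp (toℕ a) (toℕ b)) * first b β) ≈ from a β
      ∑κ-first {suc N} zero (zero ∷ β) h = begin
        ∑ (allFin (suc N)) _                                   ≈⟨ ∑-allFin N ⟩
        κ eq * 0# + ∑ (allFin N) (λ b → κ lt * (1# * first b β)) ≈⟨ trans (+-congʳ (zeroʳ _)) (+-identityˡ _) ⟩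
        ∑ (allFin N) (λ b → κ lt * (1# * first b β))           ≈⟨ ∑-cong (allFin N) (λ b → *-cong (reflexive κ-lt) (*-identityˡ _)) ⟩
        ∑ (allFin N) (λ b → z * first b β)                     ≈⟨ trans (∑-*ˡ z (allFin N)) (z∑first β h) ⟩
        G β                                                    ≈⟨ *-identityˡ _ ⟨
        1# * G β                                               ∎
      ∑κ-first {suc N} zero (suc c ∷ β) h = begin
        ∑ (allFin (suc N)) _                                   ≈⟨ ∑-allFin N ⟩
        κ eq * (pow y c * G β) + _                             ≈⟨ +-cong (*-congʳ (reflexive κ-eq)) (∑-0 (allFin N) λ b → trans (*-congˡ (zeroˡ _)) (zeroʳ _)) ⟩
        y * (pow y c * G β) + 0#                               ≈⟨ trans (+-identityʳ _) (sym (*-assoc _ _ _)) ⟩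
        y * pow y c * G β                                      ∎
      ∑κ-first {suc N} (suc a) (c ∷ β) h = begin
        ∑ (allFin (suc N)) _                                   ≈⟨ ∑-allFin N ⟩
        κ gt * first zero (c ∷ β) + ∑ (allFin N) (λ b → κ (ncmp (toℕ a) (toℕ b)) * (ι (c ℕ.≟ 0) * first b β))
          ≈⟨ +-cong (trans (*-congʳ (reflexive κ-gt)) (zeroˡ _)) (trans (∑-cong (allFin N) λ b → x*yz≈y*xz _ _ _) (∑-*ˡ _ (allFin N))) ⟩
        0# + ι (c ℕ.≟ 0) * ∑ (allFin N) (λ b → κ (ncmp (toℕ a) (toℕ b)) * first b β)
          ≈⟨ +-identityˡ _ ⟩
        ι (c ℕ.≟ 0) * ∑ (allFin N) (λ b → κ (ncmp (toℕ a) (toℕ b)) * first b β)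
          ≈⟨ ι-guard (c ℕ.≟ 0) (λ { ≡.refl → ∑κ-first a β h }) ⟩
        ι (c ℕ.≟ 0) * from a β ∎

      from-replicate : ∀ {N} (a : Fin N) → from a (replicate N 0) ≈ 1#
      from-replicate {suc N} zero    = trans (*-identityˡ _) (G-replicate N)
        where
        G-replicate : ∀ N → G (replicate N 0) ≈ 1#
        G-replicate zero    = refl
        G-replicate (suc N) = trans (*-identityˡ _) (G-replicate N)
      from-replicate {suc N} (suc a) = trans (*-identityˡ _) (from-replicate a)

      χ-∷ : ∀ {N} (β : Vec ℕ N) b w {c} → lookup β b ≡ suc c → χ β (b ∷ w) ≈ χ (updateAt β b ℕ.pred) w
      χ-∷ β b w {c} h = ι-cong (cont (b ∷ w) ≟ᵛ β) (cont w ≟ᵛ updateAt β b ℕ.pred)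
        (λ e → ≡.trans (≡.sym (Vec.updateAt-id b (cont w))) (≡.trans (≡.sym (Vec.updateAt-updateAt b (cont w))) (≡.cong (λ v → updateAt v b ℕ.pred) e)))
        (λ e → ≡.trans (≡.cong (λ v → updateAt v b suc) e) (≡.trans (Vec.updateAt-updateAt b β)
          (Vec.updateAt-id-local b β (≡.trans (≡.cong (λ m → suc (ℕ.pred m)) h) (≡.sym h)))))

      χ-∷-0 : ∀ {N} (β : Vec ℕ N) b w → lookup β b ≡ 0 → χ β (b ∷ w) ≈ 0#
      χ-∷-0 β b w h = ι-no (cont (b ∷ w) ≟ᵛ β) λ e → ⊥-elim (ℕ.0≢1+n
        (≡.trans (≡.sym h) (≡.trans (≡.cong (λ v → lookup v b) (≡.sym e)) (Vec.lookup∘updateAt b (cont w)))))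

      mutual
        from-sum : ∀ N m (a : Fin N) (β : Vec ℕ N) →
          ∑ (words N m) (λ w → χ β w * ch κ (a ∷ w)) ≈ ι (sum β ℕ.≟ m) * from a β
        from-sum N zero a β = begin
          ι (replicate N 0 ≟ᵛ β) * 1# + 0#  ≈⟨ trans (+-identityʳ _) (*-congʳ same) ⟩
          ι (sum β ℕ.≟ 0) * 1#              ≈⟨ ι-guard (sum β ℕ.≟ 0) (λ h → sym (trans (reflexive (≡.cong (from a) (sum≡0⇒ β h))) (from-replicate a))) ⟩
          ι (sum β ℕ.≟ 0) * from a β        ∎
          where
          same : ι (replicate N 0 ≟ᵛ β) ≈ ι (sum β ℕ.≟ 0)
          same = ι-cong (replicate N 0 ≟ᵛ β) (sum β ℕ.≟ 0) (λ { ≡.refl → sum-replicate-0 N }) (λ h → ≡.sym (sum≡0⇒ β h))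
        from-sum N (suc m) a β = begin
          ∑ (words N (suc m)) (λ w → χ β w * ch κ (a ∷ w))
            ≈⟨ ∑-words N m ⟩
          ∑ (allFin N) (λ b → ∑ (words N m) (λ w → χ β (b ∷ w) * (κ (ncmp (toℕ a) (toℕ b)) * ch κ (b ∷ w))))
            ≈⟨ ∑-cong (allFin N) (λ b → trans (∑-cong (words N m) λ w → x*yz≈y*xz _ _ _) (trans (∑-*ˡ _ (words N m)) (*-congˡ (first-sum N m b β)))) ⟩
          ∑ (allFin N) (λ b → κ (ncmp (toℕ a) (toℕ b)) * (ι (sum β ℕ.≟ suc m) * first b β))
            ≈⟨ trans (∑-cong (allFin N) λ b → x*yz≈y*xz _ _ _) (∑-*ˡ _ (allFin N)) ⟩
          ι (sum β ℕ.≟ suc m) * ∑ (allFin N) (λ b → κ (ncmp (toℕ a) (toℕ b)) * first b β)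
            ≈⟨ ι-guard (sum β ℕ.≟ suc m) (∑κ-first a β) ⟩
          ι (sum β ℕ.≟ suc m) * from a β ∎

        first-sum : ∀ N m (b : Fin N) (β : Vec ℕ N) →
          ∑ (words N m) (λ w → χ β (b ∷ w) * ch κ (b ∷ w)) ≈ ι (sum β ℕ.≟ suc m) * first b β
        first-sum N m b β with lookup β b in h
        ... | zero  = trans (∑-0 (words N m) λ w → trans (*-congʳ (χ-∷-0 β b w h)) (zeroˡ _))
          (sym (trans (*-congˡ (first-0 b β h)) (zeroʳ _)))
        ... | suc c = begin
          ∑ (words N m) (λ w → χ β (b ∷ w) * ch κ (b ∷ w))              ≈⟨ ∑-cong (words N m) (λ w → *-congʳ (χ-∷ β b w h)) ⟩
          ∑ (words N m) (λ w → χ (updateAt β b ℕ.pred) w * ch κ (b ∷ w)) ≈⟨ from-sum N m b (updateAt β b ℕ.pred) ⟩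
          ι (sum (updateAt β b ℕ.pred) ℕ.≟ m) * from b (updateAt β b ℕ.pred)
            ≈⟨ *-cong (ι-cong (sum (updateAt β b ℕ.pred) ℕ.≟ m) (sum β ℕ.≟ suc m)
                 (λ e → ≡.trans (≡.sym (sum-pred b β h)) (≡.cong suc e))
                 (λ e → ℕ.suc-injective (≡.trans (sum-pred b β h) e)))
               (sym (first-suc b β h)) ⟩
          ι (sum β ℕ.≟ suc m) * first b β ∎

    -- As `κ gt = 0`, only the weakly increasing word of each content contributes. With d different
    -- letters it has d - 1 ascents, while the product of the `geo` factors has one z for each of
    -- the d letters; the extra z makes up the difference.
    coxeter-series : ∀ N m (β : Vec ℕ N) →
      z * ∑ (words N (suc m)) (λ w → χ β w * ch κ w) ≈ mult (geo y) (suc m) N β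
    coxeter-series N m β = begin
      z * ∑ (words N (suc m)) (λ w → χ β w * ch κ w)
        ≈⟨ *-congˡ (trans (∑-words N m) (∑-cong (allFin N) λ b → first-sum N m b β)) ⟩
      z * ∑ (allFin N) (λ b → ι (sum β ℕ.≟ suc m) * first b β)
        ≈⟨ trans (*-congˡ (∑-*ˡ _ (allFin N))) (x*yz≈y*xz _ _ _) ⟩
      ι (sum β ℕ.≟ suc m) * (z * ∑ (allFin N) (λ b → first b β))
        ≈⟨ ι-guard (sum β ℕ.≟ suc m) (z∑first β) ⟩
      mult (geo y) (suc m) N β ∎

  ∑-upTo : ∀ n {f : ℕ → Carrier} → ∑ (upTo (suc n)) f ≈ f 0 + ∑ (upTo n) (f ∘ suc)
  ∑-upTo n {f} = +-congˡ (trans (∑-≡ (≡.sym (List.map-upTo suc n))) (∑-map suc (upTo n)))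

  ∑-upTo-pick : ∀ n a {f : ℕ → Carrier} → a ℕ.< n → ∑ (upTo n) (λ c → ι (a ℕ.≟ c) * f c) ≈ f a
  ∑-upTo-pick (suc n) zero    {f} l = trans (∑-upTo n) (trans
    (+-cong (*-identityˡ _) (∑-0 (upTo n) λ c → zeroˡ _)) (+-identityʳ _))
  ∑-upTo-pick (suc n) (suc a) {f} (s≤s l) = trans (∑-upTo n) (trans (+-cong (zeroˡ _)
    (trans (∑-cong (upTo n) λ c → *-congʳ (ι-cong (suc a ℕ.≟ suc c) (a ℕ.≟ c) ℕ.suc-injective (≡.cong suc))) (∑-upTo-pick n a l))) (+-identityˡ _))

  ∑-splittings : ∀ {N} b (β : Vec ℕ N) {f : Vec ℕ (suc N) × Vec ℕ (suc N) → Carrier} →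
    ∑ (splittings (b ∷ β)) f ≈
    ∑ (upTo (suc b)) (λ a → ∑ (splittings β) (λ γδ → f (a ∷ proj₁ γδ , b ∸ a ∷ proj₂ γδ)))
  ∑-splittings {N} b β {f} = trans (∑-concatMap (λ a → map (cons a) (splittings β)) (upTo (suc b)) {f})
    (∑-cong (upTo (suc b)) λ a → ∑-map (cons a) (splittings β) {f})
    where
    cons : ℕ → Vec ℕ N × Vec ℕ N → Vec ℕ (suc N) × Vec ℕ (suc N)
    cons a (γ , δ) = a ∷ γ , b ∸ a ∷ δ

  ∑-splittings-pick : ∀ {N} (α γ β : Vec ℕ N) →
    ι (zipWith ℕ._+_ α γ ≟ᵛ β) ≈ ∑ (splittings β) (λ γδ → ι (α ≟ᵛ proj₁ γδ) * ι (γ ≟ᵛ proj₂ γδ))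
  ∑-splittings-pick [] [] [] = sym (trans (+-identityʳ _) (*-identityˡ _))
  ∑-splittings-pick (a ∷ α) (c ∷ γ) (b ∷ β) = begin
    ι ((a ℕ.+ c ∷ zipWith ℕ._+_ α γ) ≟ᵛ (b ∷ β))
      ≈⟨ 𝟙-≟ᵛ (a ℕ.+ c) b (zipWith ℕ._+_ α γ) β ⟩
    ι (a ℕ.+ c ℕ.≟ b) * ι (zipWith ℕ._+_ α γ ≟ᵛ β)
      ≈⟨ *-cong (split-ℕ b a) (∑-splittings-pick α γ β) ⟩
    ∑ (upTo (suc b)) (λ i → ι (a ℕ.≟ i) * ι (c ℕ.≟ b ∸ i)) * ∑ (splittings β) (λ γδ → ι (α ≟ᵛ proj₁ γδ) * ι (γ ≟ᵛ proj₂ γδ))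
      ≈⟨ ∑-*ʳ _ (upTo (suc b)) ⟨
    ∑ (upTo (suc b)) (λ i → ι (a ℕ.≟ i) * ι (c ℕ.≟ b ∸ i) * ∑ (splittings β) (λ γδ → ι (α ≟ᵛ proj₁ γδ) * ι (γ ≟ᵛ proj₂ γδ)))
      ≈⟨ ∑-cong (upTo (suc b)) (λ i → trans (sym (∑-*ˡ _ (splittings β))) (∑-cong (splittings β) λ { (α′ , γ′) →
           trans (solve 4 (λ a b c d → a :* b :* (c :* d) := a :* c :* (b :* d)) refl _ _ _ _)
                 (sym (*-cong (𝟙-≟ᵛ a i α α′) (𝟙-≟ᵛ c (b ∸ i) γ γ′))) })) ⟩
    ∑ (upTo (suc b)) (λ i → ∑ (splittings β) (λ γδ → ι ((a ∷ α) ≟ᵛ (i ∷ proj₁ γδ)) * ι ((c ∷ γ) ≟ᵛ (b ∸ i ∷ proj₂ γδ))))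
      ≈⟨ ∑-splittings b β ⟨
    ∑ (splittings (b ∷ β)) (λ γδ → ι ((a ∷ α) ≟ᵛ proj₁ γδ) * ι ((c ∷ γ) ≟ᵛ proj₂ γδ)) ∎
    where
    split-ℕ : ∀ b a → ι (a ℕ.+ c ℕ.≟ b) ≈ ∑ (upTo (suc b)) (λ i → ι (a ℕ.≟ i) * ι (c ℕ.≟ b ∸ i))
    split-ℕ b zero = sym (trans (∑-upTo b {λ i → ι (0 ℕ.≟ i) * ι (c ℕ.≟ b ∸ i)}) (trans (+-cong (*-identityˡ _) (∑-0 (upTo b) λ i → zeroˡ _)) (+-identityʳ _)))
    split-ℕ zero (suc a) = sym (trans (+-identityʳ _) (zeroˡ _))
    split-ℕ (suc b) (suc a) = begin
      ι (suc (a ℕ.+ c) ℕ.≟ suc b)  ≈⟨ ι-cong (suc (a ℕ.+ c) ℕ.≟ suc b) (a ℕ.+ c ℕ.≟ b) ℕ.suc-injective (≡.cong suc) ⟩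
      ι (a ℕ.+ c ℕ.≟ b)            ≈⟨ split-ℕ b a ⟩
      ∑ (upTo (suc b)) (λ i → ι (a ℕ.≟ i) * ι (c ℕ.≟ b ∸ i))
        ≈⟨ ∑-cong (upTo (suc b)) (λ i → *-congʳ (ι-cong (suc a ℕ.≟ suc i) (a ℕ.≟ i) ℕ.suc-injective (≡.cong suc))) ⟨
      ∑ (upTo (suc b)) (λ i → ι (suc a ℕ.≟ suc i) * ι (c ℕ.≟ b ∸ i))
        ≈⟨ trans (∑-upTo (suc b) {λ i → ι (suc a ℕ.≟ i) * ι (c ℕ.≟ suc b ∸ i)}) (trans (+-congʳ (zeroˡ _)) (+-identityˡ _)) ⟨
      ∑ (upTo (suc (suc b))) (λ i → ι (suc a ℕ.≟ i) * ι (c ℕ.≟ suc b ∸ i)) ∎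

  cont-++ : ∀ {N} (u v : List (Fin N)) → cont (u ++ v) ≡ zipWith ℕ._+_ (cont u) (cont v)
  cont-++ {N} []      v = ≡.sym (Vec.zipWith-identityˡ {f = ℕ._+_} (λ _ → ≡.refl) (cont v))
  cont-++ (a ∷ u) v = ≡.trans (≡.cong (λ c → updateAt c a suc) (cont-++ u v)) (updateAt-+ (cont u) (cont v) a)
    where
    updateAt-+ : ∀ {N} (γ δ : Vec ℕ N) a → updateAt (zipWith ℕ._+_ γ δ) a suc ≡ zipWith ℕ._+_ (updateAt γ a suc) δ
    updateAt-+ (c ∷ γ) (d ∷ δ) zero    = ≡.refl
    updateAt-+ (c ∷ γ) (d ∷ δ) (suc a) = ≡.cong (c ℕ.+ d ∷_) (updateAt-+ γ δ a)

  -- Contents add under concatenation, so a double sum over prefixes and suffixes is a product of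
  -- series.
  product-series : ∀ N m n (β : Vec ℕ N) (F G : List (Fin N) → Carrier) →
    ∑ (words N m) (λ u → ∑ (words N n) (λ v → χ β (u ++ v) * (F u * G v))) ≈
    ∑ (splittings β) (λ γδ → ∑ (words N m) (λ u → χ (proj₁ γδ) u * F u) * ∑ (words N n) (λ v → χ (proj₂ γδ) v * G v))
  product-series N m n β F G = begin
    ∑ (words N m) (λ u → ∑ (words N n) (λ v → χ β (u ++ v) * (F u * G v)))
      ≈⟨ ∑-cong (words N m) (λ u → ∑-cong (words N n) λ v → trans
           (*-congʳ (trans (reflexive (≡.cong (λ c → ι (c ≟ᵛ β)) (cont-++ u v))) (∑-splittings-pick (cont u) (cont v) β)))
           (sym (∑-*ʳ _ (splittings β)))) ⟩
    ∑ (words N m) (λ u → ∑ (words N n) (λ v → ∑ (splittings β) (λ γδ → χ (proj₁ γδ) u * χ (proj₂ γδ) v * (F u * G v))))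
      ≈⟨ trans (∑-cong (words N m) λ u → ∑-swap (words N n) (splittings β)) (∑-swap (words N m) (splittings β)) ⟩
    ∑ (splittings β) (λ γδ → ∑ (words N m) (λ u → ∑ (words N n) (λ v → χ (proj₁ γδ) u * χ (proj₂ γδ) v * (F u * G v))))
      ≈⟨ ∑-cong (splittings β) (λ γδ → trans (∑-cong (words N m) λ u → trans (∑-cong (words N n) λ v →
           solve 4 (λ a b c d → a :* b :* (c :* d) := (a :* c) :* (b :* d)) refl _ _ _ _) (∑-*ˡ _ (words N n))) (∑-*ʳ _ (words N m))) ⟩
    ∑ (splittings β) (λ γδ → ∑ (words N m) (λ u → χ (proj₁ γδ) u * F u) * ∑ (words N n) (λ v → χ (proj₂ γδ) v * G v)) ∎

  power-sum : ℕ → (N : ℕ) → Vec ℕ N → Carrier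
  power-sum m N β = ∑ (allFin N) λ i → if does (β ≟ᵛ (replicate N 0 [ i ]≔ m)) then 1# else 0#

  ∑-splittings-0 : ∀ {N} (F : Vec ℕ N → Carrier) β → ∑ (splittings β) (λ γδ → ι (proj₁ γδ ≟ᵛ replicate N 0) * F (proj₂ γδ)) ≈ F β
  ∑-splittings-0 F []      = trans (+-identityʳ _) (*-identityˡ _)
  ∑-splittings-0 {suc N} F (b ∷ β) = begin
    ∑ (splittings (b ∷ β)) (λ γδ → ι (proj₁ γδ ≟ᵛ replicate (suc N) 0) * F (proj₂ γδ))
      ≈⟨ trans (∑-splittings b β) (∑-upTo b) ⟩
    ∑ (splittings β) (λ γδ → ι ((0 ∷ proj₁ γδ) ≟ᵛ replicate (suc N) 0) * F (b ∷ proj₂ γδ)) +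
    ∑ (upTo b) (λ a → ∑ (splittings β) (λ γδ → ι ((suc a ∷ proj₁ γδ) ≟ᵛ replicate (suc N) 0) * F (b ∸ suc a ∷ proj₂ γδ)))
      ≈⟨ +-cong (∑-cong (splittings β) λ γδ → *-congʳ (trans (𝟙-≟ᵛ 0 0 (proj₁ γδ) _) (*-identityˡ _)))
                (∑-0 (upTo b) λ a → ∑-0 (splittings β) λ γδ → trans (*-congʳ (trans (𝟙-≟ᵛ (suc a) 0 (proj₁ γδ) (replicate N 0)) (zeroˡ _))) (zeroˡ _)) ⟩
    ∑ (splittings β) (λ γδ → ι (proj₁ γδ ≟ᵛ replicate N 0) * F (b ∷ proj₂ γδ)) + 0#
      ≈⟨ trans (+-identityʳ _) (∑-splittings-0 (F ∘ (b ∷_)) β) ⟩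
    F (b ∷ β) ∎

  -- The hypothesis says that Σ c_i t^i is the logarithmic derivative of Σ g_b t^b.
  module Newton (g c : ℕ → Carrier)
                (logarithmic : ∀ b → ∑ (upTo b) (λ i → c i * g (b ∸ suc i)) ≈ nat b * g b) where

    private
      conv : ℕ → ∀ {N} → (Vec ℕ N → Carrier) → Vec ℕ N → Carrier
      conv i {N} F β = ∑ (splittings β) λ γδ → power-sum i N (proj₁ γδ) * F (proj₂ γδ)

      power-sum-∷ : ∀ i {N} a (γ : Vec ℕ N) → power-sum i (suc N) (a ∷ γ) ≈
                    ι (a ℕ.≟ i) * ι (γ ≟ᵛ replicate N 0) + ι (a ℕ.≟ 0) * power-sum i N γ
      power-sum-∷ i {N} a γ = trans (∑-allFin N) (+-cong (𝟙-≟ᵛ a i γ (replicate N 0))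
        (trans (∑-cong (allFin N) λ j → 𝟙-≟ᵛ a 0 γ (replicate N 0 [ j ]≔ i)) (∑-*ˡ _ (allFin N))))

      -- Equal to g (b - i) if i ≤ b, and to 0 otherwise.
      step : ℕ → ℕ → Carrier
      step i b = ∑ (upTo (suc b)) λ a → ι (a ℕ.≟ i) * g (b ∸ a)

      conv-∷ : ∀ i {N} b (β : Vec ℕ N) → conv i (∏ᵛ g) (b ∷ β) ≈ step i b * ∏ᵛ g β + g b * conv i (∏ᵛ g) β
      conv-∷ i {N} b β = begin
        ∑ (splittings (b ∷ β)) (λ γδ → power-sum i (suc N) (proj₁ γδ) * ∏ᵛ g (proj₂ γδ))
          ≈⟨ trans (∑-splittings b β) (∑-cong (upTo (suc b)) λ a → ∑-cong (splittings β) λ γδ → trans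
               (*-congʳ (power-sum-∷ i a (proj₁ γδ)))
               (solve 6 (λ a b c d e f → (a :* b :+ c :* d) :* (e :* f) := (a :* e) :* (b :* f) :+ (c :* e) :* (d :* f)) refl _ _ _ _ _ _)) ⟩
        ∑ (upTo (suc b)) (λ a → ∑ (splittings β) (λ γδ →
          (ι (a ℕ.≟ i) * g (b ∸ a)) * (ι (proj₁ γδ ≟ᵛ replicate N 0) * ∏ᵛ g (proj₂ γδ)) +
          (ι (a ℕ.≟ 0) * g (b ∸ a)) * (power-sum i N (proj₁ γδ) * ∏ᵛ g (proj₂ γδ))))
          ≈⟨ ∑-cong (upTo (suc b)) (λ a → trans (∑-+ (splittings β)) (+-cong
               (trans (∑-*ˡ _ (splittings β)) (*-congˡ (∑-splittings-0 (∏ᵛ g) β))) (∑-*ˡ _ (splittings β)))) ⟩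
        ∑ (upTo (suc b)) (λ a → (ι (a ℕ.≟ i) * g (b ∸ a)) * ∏ᵛ g β + (ι (a ℕ.≟ 0) * g (b ∸ a)) * conv i (∏ᵛ g) β)
          ≈⟨ trans (∑-+ (upTo (suc b))) (+-cong (∑-*ʳ _ (upTo (suc b))) (∑-*ʳ _ (upTo (suc b)))) ⟩
        step i b * ∏ᵛ g β + step 0 b * conv i (∏ᵛ g) β
          ≈⟨ +-congˡ (*-congʳ (trans (∑-upTo b {λ a → ι (a ℕ.≟ 0) * g (b ∸ a)})
               (trans (+-cong (*-identityˡ _) (∑-0 (upTo b) λ a → zeroˡ _)) (+-identityʳ _)))) ⟩
        step i b * ∏ᵛ g β + g b * conv i (∏ᵛ g) β ∎

      ∑-step : ∀ m b → b ℕ.≤ m → ∑ (upTo m) (λ i → c i * step (suc i) b) ≈ nat b * g b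
      ∑-step m b b≤m = begin
        ∑ (upTo m) (λ i → c i * step (suc i) b)
          ≈⟨ ∑-cong (upTo m) (λ i → *-congˡ (trans (∑-upTo b {λ a → ι (a ℕ.≟ suc i) * g (b ∸ a)}) (trans (+-congʳ (zeroˡ _)) (+-identityˡ _)))) ⟩
        ∑ (upTo m) (λ i → c i * ∑ (upTo b) (λ a → ι (suc a ℕ.≟ suc i) * g (b ∸ suc a)))
          ≈⟨ ∑-cong (upTo m) (λ i → trans (sym (∑-*ˡ (c i) (upTo b))) (∑-cong (upTo b) λ a → trans
               (*-congˡ (*-congʳ (ι-cong (suc a ℕ.≟ suc i) (a ℕ.≟ i) ℕ.suc-injective (≡.cong suc))))
               (solve 3 (λ c d e → c :* (d :* e) := (d :* c) :* e) refl _ _ _))) ⟩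
        ∑ (upTo m) (λ i → ∑ (upTo b) (λ a → (ι (a ℕ.≟ i) * c i) * g (b ∸ suc a)))
          ≈⟨ ∑-swap (upTo m) (upTo b) ⟩
        ∑ (upTo b) (λ a → ∑ (upTo m) (λ i → (ι (a ℕ.≟ i) * c i) * g (b ∸ suc a)))
          ≈⟨ ∑-cong∈ (upTo b) (λ {a} a∈ → trans (∑-*ʳ _ (upTo m)) (*-congʳ (∑-upTo-pick m a (ℕ.≤-trans (∈-upTo⁻ a∈) b≤m)))) ⟩
        ∑ (upTo b) (λ a → c a * g (b ∸ suc a))
          ≈⟨ logarithmic b ⟩
        nat b * g b ∎

      nat-+ : ∀ m n → nat (m ℕ.+ n) ≈ nat m + nat n
      nat-+ zero    n = sym (+-identityˡ _)
      nat-+ (suc m) n = trans (+-congˡ (nat-+ m n)) (sym (+-assoc _ _ _))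

      -- The Euler operator on a product over the variables. By `conv-∷`, multiplication by power
      -- sums obeys the Leibniz rule when one variable is split off, and each variable contributes
      -- through its own logarithmic derivative. The bound on m ensures that every nonzero term is
      -- included.
      derivation : ∀ m {N} (β : Vec ℕ N) → sum β ℕ.≤ m →
                   ∑ (upTo m) (λ i → c i * conv (suc i) (∏ᵛ g) β) ≈ nat (sum β) * ∏ᵛ g β
      derivation m [] l = trans (∑-0 (upTo m) λ i → trans (*-congˡ (trans (+-identityʳ _) (zeroˡ _))) (zeroʳ _)) (sym (zeroˡ _))
      derivation m (b ∷ β) l = begin
        ∑ (upTo m) (λ i → c i * conv (suc i) (∏ᵛ g) (b ∷ β))
          ≈⟨ ∑-cong (upTo m) (λ i → trans (*-congˡ (conv-∷ (suc i) b β)) (solve 5 (λ c s G g d → c :* (s :* G :+ g :* d) := (c :* s) :* G :+ g :* (c :* d)) refl _ _ _ _ _)) ⟩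
        ∑ (upTo m) (λ i → (c i * step (suc i) b) * ∏ᵛ g β + g b * (c i * conv (suc i) (∏ᵛ g) β))
          ≈⟨ trans (∑-+ (upTo m)) (+-cong (∑-*ʳ _ (upTo m)) (∑-*ˡ _ (upTo m))) ⟩
        ∑ (upTo m) (λ i → c i * step (suc i) b) * ∏ᵛ g β + g b * ∑ (upTo m) (λ i → c i * conv (suc i) (∏ᵛ g) β)
          ≈⟨ +-cong (*-congʳ (∑-step m b (ℕ.m+n≤o⇒m≤o b l))) (*-congˡ (derivation m β (ℕ.m+n≤o⇒n≤o b l))) ⟩
        (nat b * g b) * ∏ᵛ g β + g b * (nat (sum β) * ∏ᵛ g β)
          ≈⟨ solve 4 (λ b g G s → (b :* g) :* G :+ g :* (s :* G) := (b :+ s) :* (g :* G)) refl _ _ _ _ ⟩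
        (nat b + nat (sum β)) * (g b * ∏ᵛ g β)
          ≈⟨ *-congʳ (nat-+ b (sum β)) ⟨
        nat (sum (b ∷ β)) * ∏ᵛ g (b ∷ β) ∎

      splittings-sum : ∀ {N} (β : Vec ℕ N) {f f′ : Vec ℕ N × Vec ℕ N → Carrier} →
        (∀ γ δ → sum γ ℕ.+ sum δ ≡ sum β → f (γ , δ) ≈ f′ (γ , δ)) → ∑ (splittings β) f ≈ ∑ (splittings β) f′
      splittings-sum []      h = +-congʳ (h [] [] ≡.refl)
      splittings-sum (b ∷ β) h = trans (∑-splittings b β) (trans
        (∑-cong∈ (upTo (suc b)) λ {a} a∈ → splittings-sum β λ γ δ e → h (a ∷ γ) (b ∸ a ∷ δ)
          (≡.trans (ℕ.+-assoc a (sum γ) _) (≡.trans (≡.cong (a ℕ.+_) (≡.trans (≡.sym (ℕ.+-assoc (sum γ) (b ∸ a) (sum δ)))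
            (≡.trans (≡.cong (ℕ._+ sum δ) (ℕ.+-comm (sum γ) (b ∸ a))) (ℕ.+-assoc (b ∸ a) (sum γ) (sum δ)))))
          (≡.trans (≡.sym (ℕ.+-assoc a (b ∸ a) _)) (≡.cong₂ ℕ._+_ (ℕ.m+[n∸m]≡n (ℕ.s≤s⁻¹ (∈-upTo⁻ a∈))) e)))))
        (sym (∑-splittings b β)))

      sum-[]≔ : ∀ N (j : Fin N) i → sum (replicate N 0 [ j ]≔ i) ≡ i
      sum-[]≔ (suc N) zero    i = ≡.trans (≡.cong (i ℕ.+_) (sum-replicate-0 N)) (ℕ.+-identityʳ i)
      sum-[]≔ (suc N) (suc j) i = sum-[]≔ N j i

      power-sum-guard : ∀ i {N} (γ : Vec ℕ N) {a b} → (sum γ ≡ i → a ≈ b) → power-sum i N γ * a ≈ power-sum i N γ * b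
      power-sum-guard i {N} γ h = trans (sym (∑-*ʳ _ (allFin N))) (trans (∑-cong (allFin N) λ j →
        ι-guard (γ ≟ᵛ (replicate N 0 [ j ]≔ i)) λ e → h (≡.trans (≡.cong sum e) (sum-[]≔ N j i))) (∑-*ʳ _ (allFin N)))

    -- The degree m part of `derivation`: since the power sum of index i + 1 is homogeneous of that
    -- degree, the condition that the other factor has degree m - i - 1 becomes the condition that β
    -- has degree m.
    newton : ∀ m N (β : Vec ℕ N) → nat m * mult g m N β ≈
             ∑ (upTo m) (λ i → c i * ∑ (splittings β) (λ γδ → power-sum (suc i) N (proj₁ γδ) * mult g (m ∸ suc i) N (proj₂ γδ)))
    newton m N β = sym (begin
      ∑ (upTo m) (λ i → c i * conv (suc i) (mult g (m ∸ suc i) N) β)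
        ≈⟨ ∑-cong∈ (upTo m) (λ {i} i∈ → *-congˡ (trans
             (splittings-sum β λ γ δ e → trans (power-sum-guard (suc i) γ λ h → *-congʳ (degree i γ δ (∈-upTo⁻ i∈) e h)) (x*yz≈y*xz _ _ _))
             (∑-*ˡ _ (splittings β)))) ⟩
      ∑ (upTo m) (λ i → c i * (ι (sum β ℕ.≟ m) * conv (suc i) (∏ᵛ g) β))
        ≈⟨ trans (∑-cong (upTo m) λ i → x*yz≈y*xz _ _ _) (∑-*ˡ _ (upTo m)) ⟩
      ι (sum β ℕ.≟ m) * ∑ (upTo m) (λ i → c i * conv (suc i) (∏ᵛ g) β)
        ≈⟨ ι-guard (sum β ℕ.≟ m) (λ { ≡.refl → derivation m β ℕ.≤-refl }) ⟩
      ι (sum β ℕ.≟ m) * (nat (sum β) * ∏ᵛ g β)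
        ≈⟨ ι-guard (sum β ℕ.≟ m) (λ { ≡.refl → refl }) ⟩
      ι (sum β ℕ.≟ m) * (nat m * ∏ᵛ g β)
        ≈⟨ x*yz≈y*xz _ _ _ ⟩
      nat m * mult g m N β ∎)
      where
      degree : ∀ i (γ δ : Vec ℕ N) → i ℕ.< m → sum γ ℕ.+ sum δ ≡ sum β → sum γ ≡ suc i →
               ι (sum δ ℕ.≟ m ∸ suc i) ≈ ι (sum β ℕ.≟ m)
      degree i γ δ i<m e h = ι-cong (sum δ ℕ.≟ m ∸ suc i) (sum β ℕ.≟ m)
        (λ d → ≡.trans (≡.sym e) (≡.trans (≡.cong₂ ℕ._+_ h d) (ℕ.m+[n∸m]≡n i<m)))
        (λ d → ≡.trans (≡.sym (ℕ.m+n∸m≡n (suc i) (sum δ))) (≡.cong (_∸ suc i) (≡.trans (≡.cong (ℕ._+ sum δ) (≡.sym h)) (≡.trans e d))))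

  -- The logarithmic derivative of 1 + z t / (1 - y t), whose numerator is 1 - u t.
  module Geometric (y u -1# : Carrier) (u+z≈y : u + z ≈ y) (1+-1≈0 : 1# + -1# ≈ 0#) where

    coefficient : ℕ → Carrier
    coefficient i = pow y (suc i) + -1# * pow u (suc i)

    private
      peel : ∀ (a : Carrier) b → ∑ (upTo (suc (suc b))) (λ i → pow a i * geo y (suc b ∸ i)) ≈
             z * pow y b + a * ∑ (upTo (suc b)) (λ i → pow a i * geo y (b ∸ i))
      peel a b = trans (∑-upTo (suc b) {λ i → pow a i * geo y (suc b ∸ i)}) (+-cong (*-identityˡ _)
        (trans (∑-cong (upTo (suc b)) λ i → *-assoc _ _ _) (∑-*ˡ a (upTo (suc b)))))

      -- The series of `geo y` is (1 - u t)/(1 - y t), and multiplication by 1/(1 - u t) leaves 1/(1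
      -- - y t).
      u-part : ∀ b → ∑ (upTo (suc b)) (λ i → pow u i * geo y (b ∸ i)) ≈ pow y b
      u-part zero    = trans (+-identityʳ _) (*-identityˡ _)
      u-part (suc b) = begin
        ∑ (upTo (suc (suc b))) (λ i → pow u i * geo y (suc b ∸ i)) ≈⟨ peel u b ⟩
        z * pow y b + u * ∑ (upTo (suc b)) (λ i → pow u i * geo y (b ∸ i)) ≈⟨ +-congˡ (*-congˡ (u-part b)) ⟩
        z * pow y b + u * pow y b ≈⟨ trans (+-comm _ _) (sym (distribʳ _ _ _)) ⟩
        (u + z) * pow y b ≈⟨ *-congʳ u+z≈y ⟩
        y * pow y b ∎

      -- In generating functions: y (1 - u t)/(1 - y t)² - u/(1 - y t) = (y - u)/(1 - y t)², whose
      -- numerator is z. The right side lists the coefficients of z/(1 - y t)².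
      y-part : ∀ b → y * ∑ (upTo (suc b)) (λ i → pow y i * geo y (b ∸ i)) + -1# * u * pow y b ≈ nat (suc b) * (z * pow y b)
      y-part zero = begin
        y * (1# * 1# + 0#) + -1# * u * 1#   ≈⟨ +-congʳ (*-congʳ (sym u+z≈y)) ⟩
        (u + z) * (1# * 1# + 0#) + -1# * u * 1#
          ≈⟨ solve 3 (λ u z n → (u :+ z) :* (con 1 :* con 1 :+ con 0) :+ n :* u :* con 1 := (con 1 :+ n) :* u :+ z) refl u z -1# ⟩
        (1# + -1#) * u + z                  ≈⟨ +-congʳ (trans (*-congʳ 1+-1≈0) (zeroˡ u)) ⟩
        0# + z                              ≈⟨ solve 1 (λ z → con 0 :+ z := (con 1 :+ con 0) :* (z :* con 1)) refl z ⟩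
        (1# + 0#) * (z * 1#)                ∎
      y-part (suc b) = begin
        y * ∑ (upTo (suc (suc b))) (λ i → pow y i * geo y (suc b ∸ i)) + -1# * u * (y * pow y b)
          ≈⟨ +-congʳ (*-congˡ (peel y b)) ⟩
        y * (z * pow y b + y * S) + -1# * u * (y * pow y b)
          ≈⟨ solve 6 (λ y z P S n u → y :* (z :* P :+ y :* S) :+ n :* u :* (y :* P) := z :* (y :* P) :+ y :* (y :* S :+ n :* u :* P)) refl y z (pow y b) S -1# u ⟩
        z * (y * pow y b) + y * (y * S + -1# * u * pow y b)
          ≈⟨ +-congˡ (*-congˡ (y-part b)) ⟩
        z * (y * pow y b) + y * (nat (suc b) * (z * pow y b))
          ≈⟨ solve 4 (λ y z P m → z :* (y :* P) :+ y :* (m :* (z :* P)) := (con 1 :+ m) :* (z :* (y :* P))) refl y z (pow y b) (nat (suc b)) ⟩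
        nat (suc (suc b)) * (z * (y * pow y b)) ∎
        where S = ∑ (upTo (suc b)) (λ i → pow y i * geo y (b ∸ i))

    logarithmic : ∀ b → ∑ (upTo b) (λ i → coefficient i * geo y (b ∸ suc i)) ≈ nat b * geo y b
    logarithmic zero    = sym (zeroˡ _)
    logarithmic (suc b) = begin
      ∑ (upTo (suc b)) (λ i → coefficient i * geo y (b ∸ i))
        ≈⟨ trans (∑-cong (upTo (suc b)) λ i → solve 6 (λ y P n u U g → (y :* P :+ n :* (u :* U)) :* g := y :* (P :* g) :+ n :* u :* (U :* g)) refl _ _ _ _ _ _)
             (trans (∑-+ (upTo (suc b))) (+-cong (∑-*ˡ _ (upTo (suc b))) (∑-*ˡ _ (upTo (suc b))))) ⟩
      y * ∑ (upTo (suc b)) (λ i → pow y i * geo y (b ∸ i)) + -1# * u * ∑ (upTo (suc b)) (λ i → pow u i * geo y (b ∸ i))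
        ≈⟨ +-congˡ (*-congˡ (u-part b)) ⟩
      y * ∑ (upTo (suc b)) (λ i → pow y i * geo y (b ∸ i)) + -1# * u * pow y b
        ≈⟨ y-part b ⟩
      nat (suc b) * geo y (suc b) ∎

    open Newton (geo y) coefficient logarithmic public

-- Components of one color class in a web.

module Count where

  open import Data.Bool.Base using (Bool; true; false; if_then_else_; _∨_; _∧_)
  import Data.Bool.Properties as Bool
  open import Data.Empty using (⊥; ⊥-elim)
  open import Data.Fin.Base as Fin using (Fin; zero; suc; toℕ; fromℕ; inject₁)
  import Data.Fin.Properties as Fin
  open import Data.Fin.Subset using (Subset; inside; outside) renaming (_∈_ to _∈ˢ_)
  open import Data.Fin.Subset.Properties using (_∈?_)
  open import Data.List.Base as List using (List; []; _∷_; _++_; map; length; filter; concatMap; allFin; tabulate)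
  open import Data.List.Membership.Propositional using (_∈_; lose)
  open import Data.List.Membership.Propositional.Properties
    using (∈-concatMap⁺; ∈-map⁺; ∈-allFin; ∈-filter⁺; ∈-filter⁻)
  import Data.List.Properties as List
  open import Data.List.Relation.Unary.All as All using (All; []; _∷_)
  import Data.List.Relation.Unary.All.Properties as All
  open import Data.List.Relation.Unary.AllPairs as AllPairs using (AllPairs; []; _∷_)
  import Data.List.Relation.Unary.AllPairs.Properties as AllPairs
  open import Data.List.Relation.Unary.Any as Any using (Any; here; there; any?)
  import Data.List.Relation.Unary.Any.Properties as Any
  open import Data.List.Relation.Unary.Unique.Propositional using (Unique)
  open import Data.List.Relation.Unary.Unique.Propositional.Properties using (allFin⁺)
  open import Data.Nat.Base as ℕ using (ℕ; zero; suc; _+_; _<_; z≤n; s≤s)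
  import Data.Nat.Properties as ℕ
  open import Data.Product.Base using (_×_; _,_; proj₁; proj₂; ∃-syntax)
  open import Data.Sum.Base using (_⊎_; inj₁; inj₂)
  open import Data.Vec.Base using (Vec; []; _∷_; lookup)
  open import Function.Base using (_∘_; id)
  open import Relation.Binary.PropositionalEquality
  open import Relation.Nullary.Decidable using (Dec; yes; no; does)
  open import Relation.Nullary.Negation using (¬_)

  open import Defs

  does-∈? : ∀ {N} (i : Fin N) (A : Subset N) → does (i ∈? A) ≡ lookup A i
  does-∈? zero    (inside  ∷ A) = refl
  does-∈? zero    (outside ∷ A) = refl
  does-∈? (suc i) (a ∷ A)       = does-∈? i A

  bit : Bool → ℕ
  bit b = if b then 1 else 0

  count : ∀ n → (Fin n → Bool) → ℕ
  count zero    b = 0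
  count (suc n) b = bit (b zero) + count n (b ∘ suc)

  rank : ∀ {n} → (Fin n → Bool) → Fin n → ℕ
  rank b zero    = 0
  rank b (suc j) = bit (b zero) + rank (b ∘ suc) j

  rank-< : ∀ {n} (b : Fin n → Bool) {i j} → i Fin.< j → b i ≡ true → rank b i < rank b j
  rank-< b {zero}  {suc j} _       bi rewrite bi = s≤s z≤n
  rank-< b {suc i} {suc j} (s≤s l) bi = ℕ.+-monoʳ-< (bit (b zero)) (rank-< (b ∘ suc) l bi)

  module _ {E : Set} (h : E → Bool) where

    -- With h marking the edges of one color, two marked edges never meet at a vertex from the same
    -- side, so the marked edges form disjoint upward strands.
    Strands : Node E → Set
    Strands (through e₀ e₁)     = h e₀ ≡ h e₁
    Strands (mergeNode eL eR e) = h eL ∨ h eR ≡ h e × h eL ∧ h eR ≡ false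
    Strands (splitNode e eL eR) = h eL ∨ h eR ≡ h e × h eL ∧ h eR ≡ false

    bit-∨ : ∀ a b {c} → a ∨ b ≡ c → a ∧ b ≡ false → bit c ≡ bit a + bit b
    bit-∨ true  false refl _ = refl
    bit-∨ false b     refl _ = refl

    count-layer : ∀ {s t} (ℓ : Layer s t) f g → All Strands (layerNodes ℓ f g) →
                  count (length s) (h ∘ f) ≡ count (length t) (h ∘ g)
    count-layer []            f g []       = refl
    count-layer (strand a ℓ)  f g (e ∷ es) = cong₂ _+_ (cong bit e) (count-layer ℓ _ _ es)
    count-layer (merge a b ℓ) f g ((e , d) ∷ es) = trans (sym (ℕ.+-assoc (bit (h (f zero))) (bit (h (f (suc zero)))) (count _ (λ j → h (f (suc (suc j)))))))
      (cong₂ _+_ (sym (bit-∨ (h (f zero)) (h (f (suc zero))) e d)) (count-layer ℓ _ _ es))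
    count-layer (split a b ℓ) f g ((e , d) ∷ es) = trans (cong₂ _+_ (bit-∨ (h (g zero)) (h (g (suc zero))) e d) (count-layer ℓ _ _ es))
      (ℕ.+-assoc (bit (h (g zero))) (bit (h (g (suc zero)))) (count _ (λ j → h (g (suc (suc j))))))

    SameRank : (E → ℕ) → Node E → Set
    SameRank ρ v = ∀ d e → Any (d ≡_) (ends v) → Any (e ≡_) (ends v) → h d ≡ true → h e ≡ true → ρ d ≡ ρ e

    private
      all-equal : ∀ (ρ : E → ℕ) {v m} → (∀ d → Any (d ≡_) (ends v) → h d ≡ true → ρ d ≡ m) → SameRank ρ v
      all-equal ρ H d e d∈ e∈ hd he = trans (H d d∈ hd) (sym (H e e∈ he))

      three : ∀ (ρ : E → ℕ) {eL eR e m} → h eL ∨ h eR ≡ h e → h eL ∧ h eR ≡ false →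
              ρ eL ≡ m → ρ eR ≡ m + bit (h eL) → ρ e ≡ m →
              (h eL ≡ true → ρ eL ≡ m) × (h eR ≡ true → ρ eR ≡ m) × (h e ≡ true → ρ e ≡ m)
      three ρ {eL} {eR} {e} {m} _ d ρL ρR ρe = (λ _ → ρL) , right , λ _ → ρe
        where
        disjoint : ∀ a b → a ∧ b ≡ false → b ≡ true → bit a ≡ 0
        disjoint false true _ _ = refl
        right : h eR ≡ true → ρ eR ≡ m
        right hR = trans ρR (trans (cong (m +_) (disjoint (h eL) (h eR) d hR)) (ℕ.+-identityʳ m))

    -- Disjoint strands in the plane keep their order from left to right, so the number of strands
    -- to the left is constant along each of them; m counts those already passed. The same holds for
    -- the closing layer, which is why no component can wind around the annulus more than once.
    rank-layer : ∀ {s t} (ℓ : Layer s t) f g (ρ : E → ℕ) m → All Strands (layerNodes ℓ f g) →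
                 (∀ j → ρ (f j) ≡ m + rank (h ∘ f) j) → (∀ j → ρ (g j) ≡ m + rank (h ∘ g) j) →
                 All (SameRank ρ) (layerNodes ℓ f g)
    rank-layer []           f g ρ m []       hf hg = []
    rank-layer (strand a ℓ) f g ρ m (e ∷ es) hf hg =
      all-equal ρ {through (f zero) (g zero)} {m} (λ { _ (here refl) _ → trans (hf zero) (ℕ.+-identityʳ m)
                                                      ; _ (there (here refl)) _ → trans (hg zero) (ℕ.+-identityʳ m) }) ∷
      rank-layer ℓ _ _ ρ (m + bit (h (f zero))) es
        (λ j → trans (hf (suc j)) (sym (ℕ.+-assoc m _ _)))
        (λ j → trans (hg (suc j)) (trans (sym (ℕ.+-assoc m _ _)) (cong (λ b → m + bit b + rank (h ∘ g ∘ suc) j) (sym e))))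
    rank-layer (merge a b ℓ) f g ρ m ((e , d) ∷ es) hf hg =
      all-equal ρ {mergeNode (f zero) (f (suc zero)) (g zero)} {m} (λ { _ (here refl) x → proj₁ r x ; _ (there (here refl)) x → proj₁ (proj₂ r) x
                                                                     ; _ (there (there (here refl))) x → proj₂ (proj₂ r) x }) ∷
      rank-layer ℓ _ _ ρ (m + bit (h (g zero))) es
        (λ j → trans (hf (suc (suc j))) (trans (cong (m +_) (trans (sym (ℕ.+-assoc (bit (h (f zero))) (bit (h (f (suc zero)))) (rank (λ j → h (f (suc (suc j)))) j))) (cong (_+ rank (λ j → h (f (suc (suc j)))) j) (sym (bit-∨ (h (f zero)) (h (f (suc zero))) e d))))) (sym (ℕ.+-assoc m _ _))))
        (λ j → trans (hg (suc j)) (sym (ℕ.+-assoc m _ _)))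
      where
      r = three ρ e d (trans (hf zero) (ℕ.+-identityʳ m)) (trans (hf (suc zero)) (cong (m +_) (ℕ.+-identityʳ _))) (trans (hg zero) (ℕ.+-identityʳ m))
    rank-layer (split a b ℓ) f g ρ m ((e , d) ∷ es) hf hg =
      all-equal ρ {splitNode (f zero) (g zero) (g (suc zero))} {m} (λ { _ (here refl) x → proj₂ (proj₂ r) x ; _ (there (here refl)) x → proj₁ r x
                                                                     ; _ (there (there (here refl))) x → proj₁ (proj₂ r) x }) ∷
      rank-layer ℓ _ _ ρ (m + bit (h (f zero))) es
        (λ j → trans (hf (suc j)) (sym (ℕ.+-assoc m _ _)))
        (λ j → trans (hg (suc (suc j))) (trans (cong (m +_) (trans (sym (ℕ.+-assoc (bit (h (g zero))) (bit (h (g (suc zero)))) (rank (λ j → h (g (suc (suc j)))) j))) (cong (_+ rank (λ j → h (g (suc (suc j)))) j) (sym (bit-∨ (h (g zero)) (h (g (suc zero))) e d))))) (sym (ℕ.+-assoc m _ _))))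
      where
      r = three ρ e d (trans (hg zero) (ℕ.+-identityʳ m)) (trans (hg (suc zero)) (cong (m +_) (ℕ.+-identityʳ _))) (trans (hf zero) (ℕ.+-identityʳ m))

    Share : E → E → Node E → Set
    Share d e v = Any (d ≡_) (ends v) × Any (e ≡_) (ends v)

    next : ∀ {s t} (ℓ : Layer s t) f g → All Strands (layerNodes ℓ f g) → ∀ j → h (f j) ≡ true →
           ∃[ j′ ] h (g j′) ≡ true × Any (Share (f j) (g j′)) (layerNodes ℓ f g)
    next (strand a ℓ) f g (e ∷ es) zero hj = zero , trans (sym e) hj , here (here refl , there (here refl))
    next (strand a ℓ) f g (e ∷ es) (suc j) hj with j′ , h′ , v ← next ℓ _ _ es j hj = suc j′ , h′ , there v
    next (merge a b ℓ) f g ((e , d) ∷ es) zero hj = zero , trans (sym e) (cong (_∨ h (f (suc zero))) hj) , here (here refl , there (there (here refl)))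
    next (merge a b ℓ) f g ((e , d) ∷ es) (suc zero) hj = zero , trans (sym e) (trans (cong (h (f zero) ∨_) hj) (Bool.∨-zeroʳ _)) , here (there (here refl) , there (there (here refl)))
    next (merge a b ℓ) f g ((e , d) ∷ es) (suc (suc j)) hj with j′ , h′ , v ← next ℓ _ _ es j hj = suc j′ , h′ , there v
    next (split a b ℓ) f g ((e , d) ∷ es) zero hj with h (g zero) in h₀ | h (g (suc zero)) in h₁
    ... | true  | _     = zero , h₀ , here (here refl , there (here refl))
    ... | false | true  = suc zero , h₁ , here (here refl , there (there (here refl)))
    ... | false | false with () ← trans e hj
    next (split a b ℓ) f g ((e , d) ∷ es) (suc j) hj with j′ , h′ , v ← next ℓ _ _ es j hj = suc (suc j′) , h′ , there v

  module _ (w : Web) where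
    open Web w
    open Components w

    -- The auxiliary function of componentCount Γ, which recurses over the
    -- suffixes of Γ, is recovered here by unification.
    private
      headCount : List Edge → Edge → List Edge → ℕ
      headCount Γ e es = if does (any? (connected? Γ e) es) then 0 else 1

      right-summand : ∀ {l m n} → l ≡ m + n → ℕ
      right-summand {n = n} _ = n

      tailCount : Edge → List Edge → ℕ
      tailCount e es = right-summand {componentCount (e ∷ es)} {headCount (e ∷ es) e es} refl

      mutual
        suffixCount : List Edge → List Edge → ℕ
        suffixCount = _

        suffixCount-unique : ∀ e es → tailCount e es ≡ suffixCount (e ∷ es) es
        -- Generalizing the full list to a variable leaves the unknown function applied to distinct
        -- variables, for which the equation has exactly one solution.
        suffixCount-unique e es with e ∷ es
        ... | Γ = refl

    componentCount≡ : ∀ Γ → componentCount Γ ≡ suffixCount Γ Γ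
    componentCount≡ []      = refl
    componentCount≡ (e ∷ Γ) = refl

    data _≺_ : Edge → Edge → Set where
      below : ∀ {I J j j′} → toℕ I < toℕ J → (I , j) ≺ (J , j′)
      left  : ∀ {I j j′} → j Fin.< j′ → (I , j) ≺ (I , j′)

    edges-sorted : AllPairs _≺_ (edges w)
    edges-sorted = AllPairs.concat⁺
      (All.map⁺ (All.universal (λ I → AllPairs.map⁺ (AllPairs.tabulate⁺-< left)) (allFin _)))
      (AllPairs.map⁺ (AllPairs.tabulate⁺-< λ i<j → All.map⁺ (All.universal (λ _ → All.map⁺ (All.universal (λ _ → below i<j) (allFin _))) (allFin _))))

    ∈-edges : ∀ e → e ∈ edges w
    ∈-edges (I , j) = ∈-concatMap⁺ (λ I → map (I ,_) (allFin _)) (lose (∈-allFin I) (∈-map⁺ (I ,_) (∈-allFin j)))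

    module Strand {N} (c : Labeling w N) (i : Fin N) where

      h : Edge → Bool
      h e = lookup (c e) i

      private
        colored? : ∀ e → Dec (i ∈ˢ c e)
        colored? e = i ∈? c e

        last? : (e : Edge) → Dec (proj₁ e ≡ fromℕ k)
        last? e = proj₁ e Fin.≟ fromℕ k

        Γᵢ : List Edge
        Γᵢ = Γ w c i

        ρ : Edge → ℕ
        ρ (I , j) = rank (λ j → h (I , j)) j

        colored⇒ : ∀ {e} → i ∈ˢ c e → h e ≡ true
        colored⇒ {e} i∈ with colored? e | does-∈? i (c e)
        ... | yes _ | eq = sym eq
        ... | no i∉ | _  = ⊥-elim (i∉ i∈)

        ⇒colored : ∀ {e} → h e ≡ true → i ∈ˢ c e
        ⇒colored {e} he with colored? e | does-∈? i (c e)
        ... | yes i∈ | _  = i∈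
        ... | no _   | eq with () ← trans eq he

      module _ (strands : All (Strands h) (nodes w)) where

        private
          layer-strands : ∀ i → All (Strands h) (layerNodes (layer i) (inject₁ i ,_) (suc i ,_))
          layer-strands i = All.lookup (All.map⁻ (All.concat⁻ {xss = map (λ i → layerNodes (layer i) (inject₁ i ,_) (suc i ,_)) (allFin k)} (All.++⁻ˡ _ strands))) (∈-allFin i)

          closing-strands : All (Strands h) (layerNodes closing (fromℕ k ,_) (zero ,_))
          closing-strands = All.++⁻ʳ (concatMap (λ i → layerNodes (layer i) (inject₁ i ,_) (suc i ,_)) (allFin k)) strands

          same-rank : All (SameRank h ρ) (nodes w)
          same-rank = All.++⁺
            (All.concat⁺ (All.map⁺ (All.universal (λ i → rank-layer h (layer i) _ _ ρ 0 (layer-strands i) (λ _ → refl) (λ _ → refl)) (allFin k))))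
            (rank-layer h closing _ _ ρ 0 closing-strands (λ _ → refl) (λ _ → refl))

          touching-rank : ∀ {d e} → Touching d e → h d ≡ true → h e ≡ true → ρ d ≡ ρ e
          touching-rank t hd he with v , v∈ , d∈ , e∈ ← Data.List.Membership.Propositional.find t = All.lookup same-rank v∈ _ _ d∈ e∈ hd he

          chain-rank : ∀ m {d e} → Chain Γᵢ m d e → h d ≡ true → ρ d ≡ ρ e
          chain-rank zero    refl        hd = refl
          chain-rank (suc m) (inj₁ refl) hd = refl
          chain-rank (suc m) {d} (inj₂ r) hd with d′ , d′∈ , t , ch ← Data.List.Membership.Propositional.find r =
            trans (touching-rank t hd hd′) (chain-rank m ch hd′)
            where
            hd′ : h d′ ≡ true
            hd′ = colored⇒ (proj₂ (∈-filter⁻ colored? {xs = edges w} d′∈))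

          upward : ∀ I j → h (I , j) ≡ true → I ≢ fromℕ k → ∃[ e ] h e ≡ true × Touching (I , j) e × toℕ I < toℕ (proj₁ e)
          upward I j hj I≢ = go I (Fin.lower₁ I (λ eq → I≢ (Fin.toℕ-injective (trans (sym eq) (sym (Fin.toℕ-fromℕ k)))))) (Fin.inject₁-lower₁ I _) j hj
            where
            go : ∀ I i′ → inject₁ i′ ≡ I → ∀ j → h (I , j) ≡ true → ∃[ e ] h e ≡ true × Touching (I , j) e × toℕ I < toℕ (proj₁ e)
            go .(inject₁ i′) i′ refl j hj with j′ , hj′ , v ← next h (layer i′) _ _ (layer-strands i′) j hj =
              (suc i′ , j′) , hj′ , Any.++⁺ˡ (Any.concat⁺ (Any.map⁺ (lose (∈-allFin i′) v))) , s≤s (ℕ.≤-reflexive (Fin.toℕ-inject₁ i′))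

          chain-refl : ∀ m e → Chain Γᵢ m e e
          chain-refl zero    e = refl
          chain-refl (suc m) e = inj₁ refl

          nonempty : ∀ {e} {xs : List Edge} → e ∈ xs → ∃[ m ] length xs ≡ suc m
          nonempty {xs = _ ∷ xs} _ = length xs , refl

          connect : ∀ {d e} → Touching d e → h e ≡ true → Connected Γᵢ d e
          connect {d} {e} t he with m , eq ← nonempty (∈-filter⁺ colored? (∈-edges e) (⇒colored he)) =
            subst (λ m → Chain Γᵢ m d e) (sym eq) (inj₂ (lose (∈-filter⁺ colored? (∈-edges e) (⇒colored he)) (t , chain-refl m e)))

          -- Every edge not on the last cut is joined to one on the next cut, which
          -- comes later in Γᵢ, and the edges on the last cut have different ranks.
          suffix : ∀ es → AllPairs _≺_ es → All (λ e → h e ≡ true) es →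
                   (∀ e → h e ≡ true → e ∈ es ⊎ All (e ≺_) es) →
                   suffixCount Γᵢ es ≡ length (filter last? es)
          suffix [] _ _ _ = refl
          suffix (e ∷ es) (e≺ ∷ sorted) (he ∷ hes) later with last? e | any? (connected? Γᵢ e) es | suffix es sorted hes later′
            where
            later′ : ∀ d → h d ≡ true → d ∈ es ⊎ All (d ≺_) es
            later′ d hd with later d hd
            ... | inj₁ (here refl) = inj₂ e≺
            ... | inj₁ (there d∈)  = inj₁ d∈
            ... | inj₂ (_ ∷ d≺)    = inj₂ d≺
          ... | yes l  | no  _ | ih = cong suc ih
          ... | no  _  | yes _ | ih = ih
          ... | yes l  | yes connected | _ with e′ , e′∈ , ch ← Data.List.Membership.Propositional.find connected =
            ⊥-elim (different (All.lookup e≺ e′∈) l (chain-rank (length Γᵢ) ch he) he)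
            where
            different : ∀ {e e′} → e ≺ e′ → proj₁ e ≡ fromℕ k → ρ e ≡ ρ e′ → h e ≡ true → ⊥
            different {I , j} {J , j′} (below I<J) refl _ _ = ℕ.<-irrefl (Fin.toℕ-fromℕ k) (ℕ.≤-trans I<J (Fin.toℕ≤pred[n] J))
            different (left j<j′) _ eq he = ℕ.<-irrefl eq (rank-< _ j<j′ he)
          ... | no  ¬l | no ¬connected | _ with e′ , he′ , t , up ← upward (proj₁ e) (proj₂ e) he ¬l with later e′ he′
          ...   | inj₁ (here refl) = ⊥-elim (ℕ.<-irrefl refl up)
          ...   | inj₁ (there e′∈) = ⊥-elim (¬connected (lose e′∈ (connect t he′)))
          ...   | inj₂ (e′≺e ∷ _)  = ⊥-elim (impossible e′≺e up)
            where
            impossible : ∀ {e e′} → e′ ≺ e → toℕ (proj₁ e) < toℕ (proj₁ e′) → ⊥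
            impossible (below l) up = ℕ.<-asym l up
            impossible (left _)  up = ℕ.<-irrefl refl up

          length-filter-tabulate : ∀ {n} {A : Set} {P : A → Set} (P? : ∀ a → Dec (P a)) (g : Fin n → A) →
                                   length (filter P? (tabulate g)) ≡ count n (does ∘ P? ∘ g)
          length-filter-tabulate {zero}  P? g = refl
          length-filter-tabulate {suc n} P? g with does (P? (g zero))
          ... | true  = cong suc (length-filter-tabulate P? (g ∘ suc))
          ... | false = length-filter-tabulate P? (g ∘ suc)

          count-cong : ∀ n {b b′ : Fin n → Bool} → (∀ j → b j ≡ b′ j) → count n b ≡ count n b′
          count-cong zero    eq = refl
          count-cong (suc n) eq = cong₂ _+_ (cong bit (eq zero)) (count-cong n (eq ∘ suc))

          cutCount : Cut → ℕ
          cutCount I = count (length (thickness I)) (λ j → h (I , j))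

          segment : Cut → List Edge
          segment I = map (I ,_) (allFin _)

          length-segment : ∀ I → length (filter colored? (segment I)) ≡ cutCount I
          length-segment I = trans (cong (length ∘ filter colored?) (List.map-tabulate {n = length (thickness I)} id (λ j → _,_ {B = λ I → Fin (length (thickness I))} I j)))
            (trans (length-filter-tabulate colored? (I ,_)) (count-cong _ λ j → does-∈? i (c (I , j))))

          segment-≡ : ∀ I → All (λ e → proj₁ e ≡ I) (filter colored? (segment I))
          segment-≡ I = All.filter⁺ colored? (All.map⁺ {xs = allFin (length (thickness I))} (All.universal (λ _ → refl) (allFin (length (thickness I)))))

          last-edges : ∀ Is → Unique Is → (fromℕ k ∈ Is → length (filter last? (filter colored? (concatMap segment Is))) ≡ cutCount (fromℕ k))
                       × (¬ (fromℕ k ∈ Is) → filter last? (filter colored? (concatMap segment Is)) ≡ [])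
          last-edges [] _ = (λ ()) , λ _ → refl
          last-edges (I ∷ Is) (I∉ ∷ unique) rewrite List.filter-++ colored? (segment I) (concatMap segment Is)
            | List.filter-++ last? (filter colored? (segment I)) (filter colored? (concatMap segment Is)) = found , absent
            where
            ih = last-edges Is unique
            drop : I ≢ fromℕ k → filter last? (filter colored? (segment I)) ≡ []
            drop I≢ = List.filter-none last? (All.map (λ { refl l → I≢ l }) (segment-≡ I))
            found : fromℕ k ∈ I ∷ Is → length (filter last? (filter colored? (segment I)) ++ filter last? (filter colored? (concatMap segment Is))) ≡ cutCount (fromℕ k)
            found (here refl) = trans (cong length (trans (cong₂ _++_ (List.filter-all last? (segment-≡ I)) (proj₂ ih (λ l∈ → All.lookup I∉ l∈ refl))) (List.++-identityʳ _)))
              (length-segment I)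
            found (there l∈) = trans (cong (λ xs → length (xs ++ filter last? (filter colored? (concatMap segment Is)))) (drop (All.lookup I∉ l∈))) (proj₁ ih l∈)
            absent : ¬ (fromℕ k ∈ I ∷ Is) → filter last? (filter colored? (segment I)) ++ filter last? (filter colored? (concatMap segment Is)) ≡ []
            absent l∉ = cong₂ _++_ (drop λ { refl → l∉ (here refl) }) (proj₂ ih (l∉ ∘ there))

        -- Each component has exactly one edge on the last cut, and the closing layer preserves the
        -- number of strands, which can therefore be read at cut zero.
        componentCount-Γ : componentCount (Γ w c i) ≡ count (length (thickness zero)) (λ j → h (zero , j))
        componentCount-Γ = begin
          componentCount Γᵢ                                  ≡⟨ componentCount≡ Γᵢ ⟩
          suffixCount Γᵢ Γᵢ                                  ≡⟨ suffix Γᵢ (AllPairs.filter⁺ colored? edges-sorted)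
            (All.tabulate λ {e} e∈ → colored⇒ (proj₂ (∈-filter⁻ colored? {xs = edges w} e∈)))
            (λ e he → inj₁ (∈-filter⁺ colored? (∈-edges e) (⇒colored he))) ⟩
          length (filter last? Γᵢ)                           ≡⟨ proj₁ (last-edges (allFin _) (allFin⁺ _)) (∈-allFin (fromℕ k)) ⟩
          cutCount (fromℕ k)                                 ≡⟨ count-layer h closing _ _ closing-strands ⟩
          cutCount zero                                      ∎
          where open ≡-Reasoning

-- Colorings as labelings with disjoint unions.

module Colorings where

  open import Data.Bool.Base using (Bool; true; false; _∨_; _∧_)
  open import Data.Empty using (⊥-elim)
  open import Data.Fin.Base using (Fin; zero; suc; inject₁; fromℕ)
  open import Data.Fin.Subset using (Subset; ∣_∣; _∪_; _∩_) renaming (⊥ to ∅)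
  open import Data.List.Base as List using (List; []; _∷_; length; concatMap; allFin)
  open import Data.List.Membership.Propositional using (_∈_; find)
  open import Data.List.Membership.Propositional.Properties using (∈-concatMap⁻; ∈-allFin)
  open import Data.List.Relation.Unary.All as All using (All; []; _∷_)
  import Data.List.Relation.Unary.All.Properties as All
  open import Data.List.Relation.Unary.Any using (here)
  open import Data.Nat.Base using (ℕ; zero; suc; _+_; _≤_; s≤s; z≤n)
  import Data.Nat.Properties as ℕ
  open import Data.Product.Base using (_,_; proj₁; proj₂)
  open import Data.Vec.Base as Vec using (Vec; []; _∷_; lookup)
  import Data.Vec.Properties as Vec
  open import Function.Base using (_∘_)
  open import Relation.Binary.PropositionalEquality

  open import Defs
  open Count
  open Subsets using (lookup-∅)

  ∣∪∣-≤ : ∀ {N} (A B : Subset N) → ∣ A ∪ B ∣ ≤ ∣ A ∣ + ∣ B ∣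
  ∣∪∣-≤ []          []          = z≤n
  ∣∪∣-≤ (true  ∷ A) (true  ∷ B) = s≤s (ℕ.≤-trans (∣∪∣-≤ A B) (ℕ.+-monoʳ-≤ ∣ A ∣ (ℕ.n≤1+n ∣ B ∣)))
  ∣∪∣-≤ (true  ∷ A) (false ∷ B) = s≤s (∣∪∣-≤ A B)
  ∣∪∣-≤ (false ∷ A) (true  ∷ B) = ℕ.≤-trans (s≤s (∣∪∣-≤ A B)) (ℕ.≤-reflexive (sym (ℕ.+-suc ∣ A ∣ ∣ B ∣)))
  ∣∪∣-≤ (false ∷ A) (false ∷ B) = ∣∪∣-≤ A B

  -- Every common element makes the union smaller than the sum of the sizes.
  disjoint-by-size : ∀ {N} (A B : Subset N) → ∣ A ∪ B ∣ ≡ ∣ A ∣ + ∣ B ∣ → A ∩ B ≡ ∅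
  disjoint-by-size []          []          h = refl
  disjoint-by-size (true  ∷ A) (true  ∷ B) h = ⊥-elim (ℕ.<-irrefl (ℕ.suc-injective h)
    (ℕ.≤-trans (s≤s (∣∪∣-≤ A B)) (ℕ.≤-reflexive (sym (ℕ.+-suc ∣ A ∣ ∣ B ∣)))))
  disjoint-by-size (true  ∷ A) (false ∷ B) h = cong (false ∷_) (disjoint-by-size A B (ℕ.suc-injective h))
  disjoint-by-size (false ∷ A) (true  ∷ B) h = cong (false ∷_) (disjoint-by-size A B (ℕ.suc-injective (trans h (ℕ.+-suc ∣ A ∣ ∣ B ∣))))
  disjoint-by-size (false ∷ A) (false ∷ B) h = cong (false ∷_) (disjoint-by-size A B h)

  module _ {E : Set} {N : ℕ} (c : E → Subset N) where

    layer-disjoint : ∀ {s t} (ℓ : Layer s t) f g →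
      (∀ j → ∣ c (f j) ∣ ≡ List.lookup s j) → (∀ j → ∣ c (g j) ∣ ≡ List.lookup t j) →
      All (UnionsAgree c) (layerNodes ℓ f g) → All (DisjointUnions c) (layerNodes ℓ f g)
    layer-disjoint []            f g hf hg []       = []
    layer-disjoint (strand a ℓ)  f g hf hg (u ∷ us) = u ∷ layer-disjoint ℓ _ _ (hf ∘ suc) (hg ∘ suc) us
    layer-disjoint (merge a b ℓ) f g hf hg (u ∷ us) =
      (u , disjoint-by-size (c (f zero)) (c (f (suc zero))) (trans (cong ∣_∣ u) (trans (hg zero) (sym (cong₂ _+_ (hf zero) (hf (suc zero))))))) ∷
      layer-disjoint ℓ _ _ (λ j → hf (suc (suc j))) (hg ∘ suc) us
    layer-disjoint (split a b ℓ) f g hf hg (u ∷ us) =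
      (sym u , disjoint-by-size (c (g zero)) (c (g (suc zero))) (trans (cong ∣_∣ (sym u)) (trans (hf zero) (sym (cong₂ _+_ (hg zero) (hg (suc zero))))))) ∷
      layer-disjoint ℓ _ _ (hf ∘ suc) (λ j → hg (suc (suc j))) us

    agree : ∀ {v} → DisjointUnions c v → UnionsAgree c v
    agree {through e₀ e₁}     u       = u
    agree {mergeNode eL eR e} (u , _) = u
    agree {splitNode e eL eR} (u , _) = sym u

    strands : ∀ i {v} → DisjointUnions c v → Strands (λ e → lookup (c e) i) v
    strands i {through e₀ e₁}     u       = cong (λ A → lookup A i) u
    strands i {mergeNode eL eR e} (u , d) =
      trans (sym (Vec.lookup-zipWith _∨_ i (c eL) (c eR))) (cong (λ A → lookup A i) u) ,
      trans (sym (Vec.lookup-zipWith _∧_ i (c eL) (c eR))) (trans (cong (λ A → lookup A i) d) (lookup-∅ i))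
    strands i {splitNode e eL eR} (u , d) =
      trans (sym (Vec.lookup-zipWith _∨_ i (c eL) (c eR))) (cong (λ A → lookup A i) u) ,
      trans (sym (Vec.lookup-zipWith _∧_ i (c eL) (c eR))) (trans (cong (λ A → lookup A i) d) (lookup-∅ i))

  module _ (w : Web) {N : ℕ} (c : Labeling w N) where
    open Web w

    -- A coloring only prescribes unions, but thickness is conserved at vertices and forces the two
    -- sets to be disjoint. From here on colorings and loop decompositions satisfy the same local
    -- condition.
    coloring⇒disjoint : IsColoring w c → All (DisjointUnions c) (nodes w)
    coloring⇒disjoint (sizes , agreements) = All.++⁺
      (All.concat⁺ (All.map⁺ (All.universal (λ i → layer-disjoint c (layer i) _ _ (λ j → size (inject₁ i , j)) (λ j → size (suc i , j))
        (All.lookup (All.map⁻ (All.concat⁻ {xss = List.map lower (allFin k)} (All.++⁻ˡ (concatMap lower (allFin k)) agreements))) (∈-allFin i))) (allFin k))))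
      (layer-disjoint c closing _ _ (λ j → size (fromℕ k , j)) (λ j → size (zero , j)) (All.++⁻ʳ (concatMap lower (allFin k)) agreements))
      where
      lower : Fin k → List (Node Edge)
      lower i = layerNodes (layer i) (inject₁ i ,_) (suc i ,_)
      size : ∀ e → ∣ c e ∣ ≡ thick e
      size e = All.lookup sizes (∈-edges w e)

    disjoint⇒coloring : SizesMatch w c → All (DisjointUnions c) (nodes w) → IsColoring w c
    disjoint⇒coloring sizes du = sizes , All.map (λ {v} → agree c {v}) du

    merges-disjoint : All (DisjointUnions c) (nodes w) → ∀ {e} → e ∈ merges w → c (proj₁ e) ∩ c (proj₂ e) ≡ ∅
    merges-disjoint du e∈ with find (∈-concatMap⁻ _ {xs = nodes w} e∈)
    ... | mergeNode eL eR e , v∈ , here refl = proj₂ (All.lookup du v∈)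

    exponents≡ : All (DisjointUnions c) (nodes w) →
                 exponents w c ≡ Vec.tabulate (λ i → count (length (thickness zero)) (λ j → lookup (c (zero , j)) i))
    exponents≡ du = Vec.tabulate-cong λ i → Strand.componentCount-Γ w c i (All.map (λ {v} → strands c i {v}) du)

-- Layers as Hecke elements and as transfer matrices on sets of letters.

module Layers (R : CommutativeSemiring 0ℓ 0ℓ) (z p x : CommutativeSemiring.Carrier R) where

  open import Data.Bool.Base using (Bool; true; false; not; _∧_; _∨_)
  import Data.Bool.Properties as Bool
  open import Data.Empty using (⊥-elim)
  open import Data.Fin.Base using (Fin; zero; suc)
  open import Data.Fin.Subset using (Subset; ∣_∣; _∪_; _∩_) renaming (⊥ to ∅)
  open import Data.List.Base as List hiding (lookup; merge; sum; tail; replicate)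
  import Data.List.Properties as List
  open import Data.Nat.Base as ℕ using (ℕ; zero; suc; NonZero)
  import Data.Nat.Properties as ℕ
  open import Data.Nat.ListAction using (sum)
  open import Data.Product.Base using (_×_; _,_; proj₁; proj₂; ∃)
  open import Data.Sum.Base using (_⊎_; inj₁; inj₂)
  open import Data.Unit.Base using (⊤; tt)
  open import Data.Vec.Base as Vec using (Vec; []; _∷_; lookup)
  import Data.Vec.Properties as Vec
  open import Function.Base using (_∘_)
  open import Relation.Binary.PropositionalEquality as ≡ using (_≡_; _≢_)
  open import Relation.Nullary.Decidable using (Dec; yes; no; does)

  open import Defs using (Layer; []; strand; merge; split; subsets; choices; _≟ˢ_)
  open Sums R
  open Hecke R z p x
  open Subsets
  open Antisym R z p x
  open Words R z p x
  ∑-subsets : ∀ N {F : Subset (suc N) → Carrier} →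
    ∑ (subsets (suc N)) F ≈ ∑ (subsets N) (F ∘ (true ∷_)) + ∑ (subsets N) (F ∘ (false ∷_))
  ∑-subsets N {F} = trans (∑-++ (map (true ∷_) (subsets N)) (map (false ∷_) (subsets N)))
    (+-cong (∑-map (true ∷_) (subsets N) {F}) (∑-map (false ∷_) (subsets N) {F}))

  ∑-subsets-pick : ∀ {N} (B : Subset N) {F : Subset N → Carrier} → ∑ (subsets N) (λ A → ι (B ≟ˢ A) * F A) ≈ F B
  ∑-subsets-pick [] = trans (+-identityʳ _) (*-identityˡ _)
  ∑-subsets-pick {suc N} (true ∷ B) {F} = trans (∑-subsets N {λ A → ι ((true ∷ B) ≟ˢ A) * F A}) (trans
    (+-cong (∑-subsets-pick B) (∑-0 (subsets N) λ A → zeroˡ _)) (+-identityʳ _))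
  ∑-subsets-pick {suc N} (false ∷ B) {F} = trans (∑-subsets N {λ A → ι ((false ∷ B) ≟ˢ A) * F A}) (trans
    (+-cong (∑-0 (subsets N) λ A → zeroˡ _) (∑-subsets-pick B)) (+-identityˡ _))

  ι-≟ˢ-sym : ∀ {N} (A B : Subset N) → ι (A ≟ˢ B) ≈ ι (B ≟ˢ A)
  ι-≟ˢ-sym A B = ι-cong (A ≟ˢ B) (B ≟ˢ A) ≡.sym ≡.sym

  ∑-subsets-ins : ∀ {N} (y : Fin N) {F : Subset N → Carrier} →
    ∑ (subsets N) (λ A → 𝟙 (lookup A y) * F A) ≈ ∑ (subsets N) (λ A → 𝟙 (not (lookup A y)) * F (ins y A))
  ∑-subsets-ins {suc N} zero {F} = begin
    ∑ (subsets (suc N)) (λ A → 𝟙 (lookup A zero) * F A)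
      ≈⟨ trans (∑-subsets N {λ A → 𝟙 (lookup A zero) * F A}) (trans (+-congˡ (∑-0 (subsets N) λ A → zeroˡ _)) (+-identityʳ _)) ⟩
    ∑ (subsets N) (λ A → 1# * F (true ∷ A))
      ≈⟨ trans (∑-subsets N {λ A → 𝟙 (not (lookup A zero)) * F (ins zero A)}) (trans (+-congʳ (∑-0 (subsets N) λ A → zeroˡ _)) (+-identityˡ _)) ⟨
    ∑ (subsets (suc N)) (λ A → 𝟙 (not (lookup A zero)) * F (ins zero A)) ∎
  ∑-subsets-ins {suc N} (suc y) {F} = trans (∑-subsets N {λ A → 𝟙 (lookup A (suc y)) * F A}) (trans
    (+-cong (∑-subsets-ins y) (∑-subsets-ins y)) (sym (∑-subsets N {λ A → 𝟙 (not (lookup A (suc y))) * F (ins (suc y) A)})))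

  du : ∀ {N} → Subset N → Subset N → Subset N → Carrier
  du L R E = ι ((L ∪ R) ≟ˢ E) * ι ((L ∩ R) ≟ˢ ∅)

  private
    duᵇ : Bool → Bool → Bool → Carrier
    duᵇ l r e = ι ((l ∨ r) Bool.≟ e) * ι ((l ∧ r) Bool.≟ false)

    du-∷ : ∀ {N} l r e (L R E : Subset N) → du (l ∷ L) (r ∷ R) (e ∷ E) ≈ duᵇ l r e * du L R E
    du-∷ l r e L R E = trans
      (*-cong (𝟙-∧ (does ((l ∨ r) Bool.≟ e)) (does ((L ∪ R) ≟ˢ E))) (𝟙-∧ (does ((l ∧ r) Bool.≟ false)) (does ((L ∩ R) ≟ˢ ∅))))
      (solve 4 (λ a b c d → (a :* b) :* (c :* d) := (a :* c) :* (b :* d)) refl _ _ _ _)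

  du-ins : ∀ {N} (y : Fin N) (L R E : Subset N) →
           𝟙 (not (lookup L y)) * du (ins y L) R E ≈ 𝟙 (lookup E y) * du L R (del y E)
  du-ins zero (l ∷ L) (r ∷ R) (e ∷ E) = begin
    𝟙 (not l) * du (true ∷ L) (r ∷ R) (e ∷ E)       ≈⟨ *-congˡ (du-∷ true r e L R E) ⟩
    𝟙 (not l) * (duᵇ true r e * du L R E)            ≈⟨ trans (sym (*-assoc _ _ _)) (trans (*-congʳ (heads l r e)) (*-assoc _ _ _)) ⟩
    𝟙 e * (duᵇ l r false * du L R E)                 ≈⟨ *-congˡ (du-∷ l r false L R E) ⟨
    𝟙 e * du (l ∷ L) (r ∷ R) (false ∷ E)             ∎
    where
    heads : ∀ l r e → 𝟙 (not l) * duᵇ true r e ≈ 𝟙 e * duᵇ l r false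
    heads false false false = solve 0 (con 1 :* (con 0 :* con 1) := con 0 :* (con 1 :* con 1)) refl
    heads false false true  = refl
    heads false true  false = solve 0 (con 1 :* (con 0 :* con 0) := con 0 :* (con 0 :* con 1)) refl
    heads false true  true  = solve 0 (con 1 :* (con 1 :* con 0) := con 1 :* (con 0 :* con 1)) refl
    heads true  false false = solve 0 (con 0 :* (con 0 :* con 1) := con 0 :* (con 0 :* con 1)) refl
    heads true  false true  = solve 0 (con 0 :* (con 1 :* con 1) := con 1 :* (con 0 :* con 1)) refl
    heads true  true  false = refl
    heads true  true  true  = solve 0 (con 0 :* (con 1 :* con 0) := con 1 :* (con 0 :* con 0)) refl
  du-ins (suc y) (l ∷ L) (r ∷ R) (e ∷ E) = begin
    𝟙 (not (lookup L y)) * du (l ∷ ins y L) (r ∷ R) (e ∷ E)   ≈⟨ trans (*-congˡ (du-∷ l r e (ins y L) R E)) (x*yz≈y*xz _ _ _) ⟩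
    duᵇ l r e * (𝟙 (not (lookup L y)) * du (ins y L) R E)     ≈⟨ *-congˡ (du-ins y L R E) ⟩
    duᵇ l r e * (𝟙 (lookup E y) * du L R (del y E))           ≈⟨ trans (*-congˡ (du-∷ l r e L R (del y E))) (x*yz≈y*xz _ _ _) ⟨
    𝟙 (lookup E y) * du (l ∷ L) (r ∷ R) (e ∷ del y E)         ∎

  du-∅ : ∀ {N} (R E : Subset N) → du ∅ R E ≈ ι (R ≟ˢ E)
  du-∅ [] [] = *-identityˡ _
  du-∅ (r ∷ R) (e ∷ E) = trans (du-∷ false r e ∅ R E) (trans (*-cong (*-identityʳ _) (du-∅ R E)) (sym (𝟙-∧ (does (r Bool.≟ e)) (does (R ≟ˢ E)))))

  ι-∣ins∣ : ∀ {N} (y : Fin N) (A : Subset N) a →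
            𝟙 (not (lookup A y)) * ι (∣ ins y A ∣ ℕ.≟ suc a) ≈ 𝟙 (not (lookup A y)) * ι (∣ A ∣ ℕ.≟ a)
  ι-∣ins∣ y A a with lookup A y in y∉A
  ... | true  = trans (zeroˡ _) (sym (zeroˡ _))
  ... | false = *-congˡ (ι-cong (∣ ins y A ∣ ℕ.≟ suc a) (∣ A ∣ ℕ.≟ a)
    (λ h → ℕ.suc-injective (≡.trans (≡.sym (∣ins∣ y A y∉A)) h)) (λ h → ≡.trans (∣ins∣ y A y∉A) (≡.cong suc h)))

  𝟙-guard : ∀ b {a c} → (b ≡ true → a ≈ c) → 𝟙 b * a ≈ 𝟙 b * c
  𝟙-guard true  h = *-congˡ (h ≡.refl)
  𝟙-guard false h = trans (zeroˡ _) (sym (zeroˡ _))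

  not-guard : ∀ b {a c} → (b ≡ false → a ≈ c) → 𝟙 (not b) * a ≈ 𝟙 (not b) * c
  not-guard true  h = trans (zeroˡ _) (sym (zeroˡ _))
  not-guard false h = *-congˡ (h ≡.refl)

  -- The orderings of E are shuffled from those of the parts of its
  -- decompositions E = L ⊔ R with ∣ L ∣ = a.
  sym-split : ∀ {N} a b (E : Subset N) (f : List (Fin N) → Carrier) → ∣ E ∣ ≡ a ℕ.+ b →
    ∑ (subsets N) (λ L → ∑ (subsets N) (λ R → du L R E * (ι (∣ L ∣ ℕ.≟ a) * (ι (∣ R ∣ ℕ.≟ b) *
      sym-sum a L (λ u → sym-sum b R (λ v → f (u ++ v))))))) ≈ sym-sum (a ℕ.+ b) E f
  sym-split {N} zero b E f ∣E∣ = begin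
    ∑ (subsets N) (λ L → ∑ (subsets N) (λ R → du L R E * (ι (∣ L ∣ ℕ.≟ 0) * (ι (∣ R ∣ ℕ.≟ b) * sym-sum b R f))))
      ≈⟨ ∑-cong (subsets N) (λ L → trans (∑-cong (subsets N) λ R → x*yz≈y*xz _ _ _) (∑-*ˡ _ (subsets N))) ⟩
    ∑ (subsets N) (λ L → ι (∣ L ∣ ℕ.≟ 0) * ∑ (subsets N) (λ R → du L R E * (ι (∣ R ∣ ℕ.≟ b) * sym-sum b R f)))
      ≈⟨ ∑-cong (subsets N) (λ L → *-congʳ (ι-cong (∣ L ∣ ℕ.≟ 0) (∅ ≟ˢ L) (λ h → ≡.sym (∣∣≡0⇒∅ L h)) (λ { ≡.refl → ∣∅∣ N }))) ⟩
    ∑ (subsets N) (λ L → ι (∅ ≟ˢ L) * ∑ (subsets N) (λ R → du L R E * (ι (∣ R ∣ ℕ.≟ b) * sym-sum b R f)))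
      ≈⟨ ∑-subsets-pick {N} ∅ ⟩
    ∑ (subsets N) (λ R → du ∅ R E * (ι (∣ R ∣ ℕ.≟ b) * sym-sum b R f))
      ≈⟨ ∑-cong (subsets N) (λ R → *-congʳ (trans (du-∅ R E) (ι-≟ˢ-sym R E))) ⟩
    ∑ (subsets N) (λ R → ι (E ≟ˢ R) * (ι (∣ R ∣ ℕ.≟ b) * sym-sum b R f))
      ≈⟨ ∑-subsets-pick E ⟩
    ι (∣ E ∣ ℕ.≟ b) * sym-sum b E f
      ≈⟨ trans (*-congʳ (ι-yes (∣ E ∣ ℕ.≟ b) ∣E∣)) (*-identityˡ _) ⟩
    sym-sum b E f ∎
  sym-split {N} (suc a) b E f ∣E∣ = begin
    ∑ (subsets N) (λ L → ∑ (subsets N) (λ R → du L R E * (ι (∣ L ∣ ℕ.≟ suc a) * (ι (∣ R ∣ ℕ.≟ b) *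
      ∑∈ L (λ y → G y (del y L) R)))))
      ≈⟨ ∑-cong (subsets N) (λ L → trans (∑-cong (subsets N) λ R → begin
           du L R E * (ι (∣ L ∣ ℕ.≟ suc a) * (ι (∣ R ∣ ℕ.≟ b) * ∑∈ L (λ y → G y (del y L) R)))
             ≈⟨ solve 4 (λ d l r s → d :* (l :* (r :* s)) := (d :* (l :* r)) :* s) refl _ _ _ _ ⟩
           (du L R E * (ι (∣ L ∣ ℕ.≟ suc a) * ι (∣ R ∣ ℕ.≟ b))) * ∑∈ L (λ y → G y (del y L) R)
             ≈⟨ trans (sym (∑-*ˡ _ (allFin N))) (∑-cong (allFin N) λ y → solve 5 (λ d l r m g → (d :* (l :* r)) :* (m :* g) := m :* (d :* (l :* (r :* g)))) refl _ _ _ _ _) ⟩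
           ∑ (allFin N) (λ y → 𝟙 (lookup L y) * (du L R E * (ι (∣ L ∣ ℕ.≟ suc a) * (ι (∣ R ∣ ℕ.≟ b) * G y (del y L) R)))) ∎)
           (∑-swap (subsets N) (allFin N))) ⟩
    ∑ (subsets N) (λ L → ∑ (allFin N) (λ y → ∑ (subsets N) (λ R → 𝟙 (lookup L y) * (du L R E * (ι (∣ L ∣ ℕ.≟ suc a) * (ι (∣ R ∣ ℕ.≟ b) * G y (del y L) R))))))
      ≈⟨ trans (∑-swap (subsets N) (allFin N)) (∑-cong (allFin N) λ y → trans (∑-cong (subsets N) λ L → ∑-*ˡ _ (subsets N)) (∑-subsets-ins y)) ⟩
    ∑ (allFin N) (λ y → ∑ (subsets N) (λ L → 𝟙 (not (lookup L y)) * ∑ (subsets N) (λ R → du (ins y L) R E * (ι (∣ ins y L ∣ ℕ.≟ suc a) * (ι (∣ R ∣ ℕ.≟ b) * G y (del y (ins y L)) R)))))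
      ≈⟨ ∑-cong (allFin N) (λ y → trans (∑-cong (subsets N) λ L → trans (sym (∑-*ˡ _ (subsets N))) (trans (∑-cong (subsets N) λ R → exchange y L R) (∑-*ˡ _ (subsets N)))) (∑-*ˡ _ (subsets N))) ⟩
    ∑∈ E (λ y → ∑ (subsets N) (λ L → ∑ (subsets N) (λ R → du L R (del y E) * (ι (∣ L ∣ ℕ.≟ a) * (ι (∣ R ∣ ℕ.≟ b) * G y L R)))))
      ≈⟨ ∑∈-cong E (λ y y∈E → sym-split a b (del y E) (f ∘ (y ∷_)) (∣del∣ y E y∈E ∣E∣)) ⟩
    ∑∈ E (λ y → sym-sum (a ℕ.+ b) (del y E) (f ∘ (y ∷_))) ∎
    where
    G : Fin N → Subset N → Subset N → Carrier
    G y L R = sym-sum a L (λ u → sym-sum b R (λ v → f (y ∷ u ++ v)))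
    exchange : ∀ y L R →
      𝟙 (not (lookup L y)) * (du (ins y L) R E * (ι (∣ ins y L ∣ ℕ.≟ suc a) * (ι (∣ R ∣ ℕ.≟ b) * G y (del y (ins y L)) R))) ≈
      𝟙 (lookup E y) * (du L R (del y E) * (ι (∣ L ∣ ℕ.≟ a) * (ι (∣ R ∣ ℕ.≟ b) * G y L R)))
    exchange y L R = begin
      n * (du (ins y L) R E * (ι (∣ ins y L ∣ ℕ.≟ suc a) * (r * G y (del y (ins y L)) R)))
        ≈⟨ not-guard (lookup L y) (λ y∉L → *-congˡ (*-congˡ (*-congˡ (reflexive (≡.cong (λ L → G y L R) (del-ins y L y∉L)))))) ⟩
      n * (du (ins y L) R E * (ι (∣ ins y L ∣ ℕ.≟ suc a) * (r * G y L R)))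
        ≈⟨ solve 4 (λ n d l s → n :* (d :* (l :* s)) := d :* ((n :* l) :* s)) refl _ _ _ _ ⟩
      du (ins y L) R E * ((n * ι (∣ ins y L ∣ ℕ.≟ suc a)) * (r * G y L R))
        ≈⟨ *-congˡ (*-congʳ (ι-∣ins∣ y L a)) ⟩
      du (ins y L) R E * ((n * ι (∣ L ∣ ℕ.≟ a)) * (r * G y L R))
        ≈⟨ solve 4 (λ n d l s → d :* ((n :* l) :* s) := (n :* d) :* (l :* s)) refl _ _ _ _ ⟩
      (n * du (ins y L) R E) * (ι (∣ L ∣ ℕ.≟ a) * (r * G y L R))
        ≈⟨ trans (*-congʳ (du-ins y L R E)) (*-assoc _ _ _) ⟩
      𝟙 (lookup E y) * (du L R (del y E) * (ι (∣ L ∣ ℕ.≟ a) * (r * G y L R))) ∎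
      where
      n = 𝟙 (not (lookup L y))
      r = ι (∣ R ∣ ℕ.≟ b)

  sym-0 : ∀ {N} a (A : Subset N) {f} → ∣ A ∣ ≡ a → (∀ w → Orders A w → f w ≈ 0#) → sym-sum a A f ≈ 0#
  sym-0 a A {f} ∣A∣ h = trans (sym-cong a A ∣A∣ λ w o → trans (h w o) (sym (zeroˡ (f w)))) (trans (sym-*ˡ a A 0#) (zeroˡ _))

  Orders-∷ : ∀ {N} {y : Fin N} {w} → Orders (ins y (wset w)) (y ∷ w) → lookup (wset w) y ≡ false × Orders (wset w) w
  Orders-∷ {y = y} {w} (_ then o) with Orders⇒wset o
  ... | h = ≡.trans (≡.cong (λ A → lookup A y) h) (lookup-del y (ins y (wset w))) , ≡.subst (λ A → Orders A w) (≡.sym h) o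

  -- A word without repetition is an ordering of exactly one set; by hypothesis the other words
  -- contribute nothing, either on the left or inside an ordering on the right.
  ∑-words-sets : ∀ {N} a (F : List (Fin N) → Carrier) → (∀ w → length w ≡ a → F w ≈ 0# ⊎ Orders (wset w) w) →
                 ∑ (words N a) F ≈ ∑ (subsets N) (λ A → ι (∣ A ∣ ℕ.≟ a) * sym-sum a A F)
  ∑-words-sets {N} zero F h = trans (+-identityʳ _) (sym (trans
    (∑-cong (subsets N) λ A → *-congʳ (ι-cong (∣ A ∣ ℕ.≟ 0) (∅ ≟ˢ A) (λ h → ≡.sym (∣∣≡0⇒∅ A h)) (λ { ≡.refl → ∣∅∣ N }))) (∑-subsets-pick {N} ∅)))
  ∑-words-sets {N} (suc a) F h = begin
    ∑ (words N (suc a)) F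
      ≈⟨ ∑-words N a ⟩
    ∑ (allFin N) (λ y → ∑ (words N a) (F ∘ (y ∷_)))
      ≈⟨ ∑-cong (allFin N) (λ y → ∑-words-sets a (F ∘ (y ∷_)) (tail y)) ⟩
    ∑ (allFin N) (λ y → ∑ (subsets N) (λ A → ι (∣ A ∣ ℕ.≟ a) * sym-sum a A (F ∘ (y ∷_))))
      ≈⟨ ∑-cong (allFin N) (λ y → ∑-cong (subsets N) λ A → sym (absent y A (lookup A y) ≡.refl)) ⟩
    ∑ (allFin N) (λ y → ∑ (subsets N) (λ A → 𝟙 (not (lookup A y)) * (ι (∣ ins y A ∣ ℕ.≟ suc a) * sym-sum a (del y (ins y A)) (F ∘ (y ∷_)))))
      ≈⟨ ∑-cong (allFin N) (λ y → ∑-subsets-ins y) ⟨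
    ∑ (allFin N) (λ y → ∑ (subsets N) (λ A → 𝟙 (lookup A y) * (ι (∣ A ∣ ℕ.≟ suc a) * sym-sum a (del y A) (F ∘ (y ∷_)))))
      ≈⟨ trans (∑-swap (allFin N) (subsets N)) (∑-cong (subsets N) λ A → trans (∑-cong (allFin N) λ y → x*yz≈y*xz _ _ _) (∑-*ˡ _ (allFin N))) ⟩
    ∑ (subsets N) (λ A → ι (∣ A ∣ ℕ.≟ suc a) * sym-sum (suc a) A F) ∎
    where
    tail : ∀ y w → length w ≡ a → F (y ∷ w) ≈ 0# ⊎ Orders (wset w) w
    tail y w l with h (y ∷ w) (≡.cong suc l)
    ... | inj₁ ≈0 = inj₁ ≈0
    ... | inj₂ o  = inj₂ (proj₂ (Orders-∷ o))
    absent : ∀ y A b → lookup A y ≡ b →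
      𝟙 (not b) * (ι (∣ ins y A ∣ ℕ.≟ suc a) * sym-sum a (del y (ins y A)) (F ∘ (y ∷_))) ≈ ι (∣ A ∣ ℕ.≟ a) * sym-sum a A (F ∘ (y ∷_))
    absent y A false y∉A = trans (*-identityˡ _) (*-cong
      (ι-cong (∣ ins y A ∣ ℕ.≟ suc a) (∣ A ∣ ℕ.≟ a)
        (λ h → ℕ.suc-injective (≡.trans (≡.sym (∣ins∣ y A y∉A)) h)) (λ h → ≡.trans (∣ins∣ y A y∉A) (≡.cong suc h)))
      (reflexive (≡.cong (λ A → sym-sum a A (F ∘ (y ∷_))) (del-ins y A y∉A))))
    absent y A true y∈A = trans (zeroˡ _) (sym (trans (ι-guard (∣ A ∣ ℕ.≟ a) λ ∣A∣ → sym-0 a A ∣A∣ (repeated ∣A∣)) (zeroʳ _)))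
      where
      repeated : ∣ A ∣ ≡ a → ∀ w → Orders A w → F (y ∷ w) ≈ 0#
      repeated ∣A∣ w o with h (y ∷ w) (≡.cong suc (≡.trans (Orders⇒length o) ∣A∣))
      ... | inj₁ ≈0 = ≈0
      ... | inj₂ o′ with () ← true≢false (≡.trans (≡.sym (≡.trans (≡.cong (λ A → lookup A y) (Orders⇒wset o)) y∈A)) (proj₁ (Orders-∷ o′)))

  ∑-choices : ∀ {n} {A : Fin (suc n) → Set} (xs : ∀ i → List (A i))
    (G : (∀ i → A i) → Carrier) (G′ : A zero → (∀ i → A (suc i)) → Carrier) →
    (∀ c → G c ≈ G′ (c zero) (λ i → c (suc i))) →
    ∑ (choices xs) G ≈ ∑ (xs zero) (λ a → ∑ (choices (λ i → xs (suc i))) (G′ a))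
  ∑-choices xs G G′ h = trans (∑-concatMap _ (xs zero)) (∑-cong (xs zero) λ a →
    trans (∑-map _ (choices (λ i → xs (suc i)))) (∑-cong (choices (λ i → xs (suc i))) λ c → h _))

  del-∪ : ∀ {N} y (A B : Subset N) → lookup B y ≡ false → del y (A ∪ B) ≡ del y A ∪ B
  del-∪ zero    (a ∷ A) (.false ∷ B) ≡.refl = ≡.refl
  del-∪ (suc y) (a ∷ A) (b ∷ B)      h      = ≡.cong ((a ∨ b) ∷_) (del-∪ y A B h)

  lookup-∪ : ∀ {N} y (A B : Subset N) → lookup (A ∪ B) y ≡ lookup A y ∨ lookup B y
  lookup-∪ y A B = Vec.lookup-zipWith _∨_ y A B

  lookup-∩ : ∀ {N} y (A B : Subset N) → lookup (A ∩ B) y ≡ lookup A y ∧ lookup B y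
  lookup-∩ y A B = Vec.lookup-zipWith _∧_ y A B

  del-∩ : ∀ {N} y (A B : Subset N) → A ∩ B ≡ ∅ → del y A ∩ B ≡ ∅
  del-∩ zero    (a ∷ A) (b ∷ B) h = ≡.cong (false ∷_) (≡.cong Vec.tail h)
  del-∩ (suc y) (a ∷ A) (b ∷ B) h = ≡.cong₂ _∷_ (≡.cong Vec.head h) (del-∩ y A B (≡.cong Vec.tail h))

  ∅-∪ : ∀ {N} (B : Subset N) → ∅ ∪ B ≡ B
  ∅-∪ []      = ≡.refl
  ∅-∪ (b ∷ B) = ≡.cong (b ∷_) (∅-∪ B)

  ∉-of-disjoint : ∀ {N} y (A B : Subset N) → A ∩ B ≡ ∅ → lookup A y ≡ true → lookup B y ≡ false
  ∉-of-disjoint y A B h y∈A = ≡.trans (≡.cong (_∧ lookup B y) (≡.sym y∈A)) (≡.trans (≡.sym (lookup-∩ y A B)) (≡.trans (≡.cong (λ C → lookup C y) h) (lookup-∅ y)))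

  Orders-++ : ∀ {N} {A B : Subset N} {u v} → Orders A u → Orders B v → A ∩ B ≡ ∅ → Orders (A ∪ B) (u ++ v)
  Orders-++ {B = B} {v = v} [] o h = ≡.subst (λ C → Orders C v) (≡.sym (∅-∪ B)) o
  Orders-++ {A = A} {B} {v = v} (_then_ {y = y} {w = w} y∈A o) o′ h =
    ≡.trans (lookup-∪ y A B) (≡.cong (_∨ lookup B y) y∈A) then
    ≡.subst (λ C → Orders C (w ++ v)) (≡.sym (del-∪ y A B (∉-of-disjoint y A B h y∈A))) (Orders-++ o o′ (del-∩ y A B h))

  inhabited : ∀ {N} (A : Subset N) → A ≢ ∅ → ∃ λ y → lookup A y ≡ true
  inhabited []          A≢∅ = ⊥-elim (A≢∅ ≡.refl)
  inhabited (true  ∷ A) A≢∅ = zero , ≡.refl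
  inhabited (false ∷ A) A≢∅ with y , h ← inhabited A (A≢∅ ∘ ≡.cong (false ∷_)) = suc y , h

  State : ℕ → List ℕ → Set
  State N s = Fin (length s) → Subset N

  states : ∀ N s → List (State N s)
  states N s = choices {length s} (λ _ → subsets N)

  Sized : ∀ {N} s → State N s → Set
  Sized s A = ∀ j → ∣ A j ∣ ≡ List.lookup s j

  sz : ∀ {N} s → State N s → Carrier
  sz []      A = 1#
  sz (a ∷ s) A = ι (∣ A zero ∣ ℕ.≟ a) * sz s (A ∘ suc)

  sz-guard : ∀ {N} s (A : State N s) {a b} → (Sized s A → a ≈ b) → sz s A * a ≈ sz s A * b
  sz-guard []      A h = *-congˡ (h λ ())
  sz-guard (a ∷ s) A h = trans (*-assoc _ _ _) (trans (ι-guard (∣ A zero ∣ ℕ.≟ a) λ e →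
    sz-guard s (A ∘ suc) λ es → h λ { zero → e ; (suc j) → es j }) (sym (*-assoc _ _ _)))

  sz-Sized : ∀ {N} s (A : State N s) → Sized s A → sz s A ≈ 1#
  sz-Sized []      A h = refl
  sz-Sized (a ∷ s) A h = trans (*-cong (ι-yes (∣ A zero ∣ ℕ.≟ a) (h zero)) (sz-Sized s (A ∘ suc) (h ∘ suc))) (*-identityˡ _)

  S : ∀ {N} s → State N s → (List (Fin N) → Carrier) → Carrier
  S []      A f = f []
  S (a ∷ s) A f = sym-sum a (A zero) (λ u → S s (A ∘ suc) (f ∘ (u ++_)))

  S-ext : ∀ {N} s (A : State N s) {f g} → (∀ w → f w ≈ g w) → S s A f ≈ S s A g
  S-ext []      A h = h []
  S-ext (a ∷ s) A h = sym-ext a (A zero) λ u → S-ext s (A ∘ suc) λ v → h (u ++ v)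

  S-*ʳ : ∀ {N} s (A : State N s) c {f} → S s A (λ w → f w * c) ≈ S s A f * c
  S-*ʳ []      A c = refl
  S-*ʳ (a ∷ s) A c = trans (sym-ext a (A zero) λ u → S-*ʳ s (A ∘ suc) c) (sym-*ʳ a (A zero) c)

  S-*ˡ : ∀ {N} s (A : State N s) c {f} → S s A (λ w → c * f w) ≈ c * S s A f
  S-*ˡ s A c = trans (S-ext s A λ w → *-comm _ _) (trans (S-*ʳ s A c) (*-comm _ _))

  data OrdersS {N} : ∀ s → State N s → List (Fin N) → Set where
    nil  : ∀ {A} → OrdersS [] A []
    cons : ∀ {a s A u v} → Orders (A zero) u → ∣ A zero ∣ ≡ a → OrdersS s (A ∘ suc) v → OrdersS (a ∷ s) A (u ++ v)

  S-cong : ∀ {N} s (A : State N s) {f g} → Sized s A → (∀ w → OrdersS s A w → f w ≈ g w) → S s A f ≈ S s A g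
  S-cong []      A sized h = h [] nil
  S-cong (a ∷ s) A sized h = sym-cong a (A zero) (sized zero) λ u o → S-cong s (A ∘ suc) (sized ∘ suc) λ v os → h (u ++ v) (cons o (sized zero) os)

  OrdersS⇒Sized : ∀ {N} {s} {A : State N s} {w} → OrdersS s A w → Sized s A
  OrdersS⇒Sized (cons _ ∣A∣ os) zero    = ∣A∣
  OrdersS⇒Sized (cons _ ∣A∣ os) (suc j) = OrdersS⇒Sized os j

  factors : List ℕ → Carrier
  factors []      = 1#
  factors (a ∷ s) = fact a * factors s

  -- A merge and a split of type (a, b) both become the antisymmetrizer on their thick edge. The
  -- antisymmetrizers of the thin edges, multiplied by it, would only produce factorials.
  layerH : ∀ {s t} → Layer s t → H
  layerH []            = sc 1#
  layerH (strand a ℓ)  = AS a ⊙ sh a (layerH ℓ)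
  layerH (merge a b ℓ) = AS (a ℕ.+ b) ⊙ sh (a ℕ.+ b) (layerH ℓ)
  layerH (split a b ℓ) = AS (a ℕ.+ b) ⊙ sh (a ℕ.+ b) (layerH ℓ)

  module Transfer {N} (O : Order (Fin N)) (x+p≈0 : x + p ≈ 0#) where
    open Weights O x+p≈0
    open Act O

    ∏≈∏∈ : ∀ {A u} (G : Fin N → Carrier) → Orders A u → ∏ u G ≈ ∏∈ A G
    ∏≈∏∈ G [] = sym (∏∈-∅ N)
    ∏≈∏∈ {A} G (_then_ {y = y} y∈A o) = trans (*-congˡ (∏≈∏∈ G o)) (trans (sym (∏∈-ins y (del y A) (lookup-del y A)))
      (reflexive (≡.cong (λ B → ∏∈ B G) (ins-del y A y∈A))))

    cross : Subset N → Subset N → Carrier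
    cross A B = ∏∈ A (λ a → ex a B)

    -- Only merges carry a power of q, as in the definitions of inv and of attacking pairs; at a
    -- split the bare condition of disjoint union remains.
    wt : ∀ {s t} → Layer s t → State N s → State N t → Carrier
    wt []            A B = 1#
    wt (strand a ℓ)  A B = ι (A zero ≟ˢ B zero) * wt ℓ (A ∘ suc) (B ∘ suc)
    wt (merge a b ℓ) A B = du (A zero) (A (suc zero)) (B zero) * (cross (A zero) (A (suc zero)) * wt ℓ (λ j → A (suc (suc j))) (B ∘ suc))
    wt (split a b ℓ) A B = du (B zero) (B (suc zero)) (A zero) * wt ℓ (A ∘ suc) (λ j → B (suc (suc j)))

    J : ∀ {s t} → Layer s t → State N s → (List (Fin N) → Carrier) → Carrier
    J {s} {t} ℓ A f = ∑ (states N t) λ B → wt ℓ A B * (sz t B * S t B f)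

    J-ext : ∀ {s t} (ℓ : Layer s t) A {f g} → (∀ w → f w ≈ g w) → J ℓ A f ≈ J ℓ A g
    J-ext {t = t} ℓ A h = ∑-cong (states N t) λ B → *-congˡ (*-congˡ (S-ext t B h))

    private
      pull : ∀ {s t} (ℓ : Layer s t) A a (B : Subset N) f →
        ∑ (states N t) (λ B′ → wt ℓ A B′ * (sz t B′ * sym-sum a B (λ u → S t B′ (f ∘ (u ++_))))) ≈
        sym-sum a B (λ u → J ℓ A (f ∘ (u ++_)))
      pull {t = t} ℓ A a B f = sym (trans (sym-∑ a B (states N t)) (∑-cong (states N t) λ B′ →
        trans (sym-*ˡ a B _) (*-congˡ (sym-*ˡ a B _))))

      J-strand : ∀ a .⦃ _ : ℕ.NonZero a ⦄ {s t} (ℓ : Layer s t) A f →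
        J (strand a ℓ) A f ≈ ι (∣ A zero ∣ ℕ.≟ a) * sym-sum a (A zero) (λ u → J ℓ (A ∘ suc) (f ∘ (u ++_)))
      J-strand a {s} {t} ℓ A f = begin
        J (strand a ℓ) A f
          ≈⟨ ∑-choices (λ _ → subsets N) _ (λ B₀ B → ι (A zero ≟ˢ B₀) * wt ℓ (A ∘ suc) B * (ι (∣ B₀ ∣ ℕ.≟ a) * sz t B * sym-sum a B₀ (λ u → S t B (f ∘ (u ++_))))) (λ _ → refl) ⟩
        ∑ (subsets N) (λ B₀ → ∑ (states N t) (λ B → ι (A zero ≟ˢ B₀) * wt ℓ (A ∘ suc) B * (ι (∣ B₀ ∣ ℕ.≟ a) * sz t B * sym-sum a B₀ (λ u → S t B (f ∘ (u ++_))))))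
          ≈⟨ ∑-cong (subsets N) (λ B₀ → trans (∑-cong (states N t) λ B →
               solve 5 (λ i w j s y → i :* w :* (j :* s :* y) := i :* j :* (w :* (s :* y))) refl _ _ _ _ _)
               (trans (∑-*ˡ _ (states N t)) (trans (*-congˡ (pull ℓ (A ∘ suc) a B₀ f)) (*-assoc _ _ _)))) ⟩
        ∑ (subsets N) (λ B₀ → ι (A zero ≟ˢ B₀) * (ι (∣ B₀ ∣ ℕ.≟ a) * sym-sum a B₀ (λ u → J ℓ (A ∘ suc) (f ∘ (u ++_)))))
          ≈⟨ ∑-subsets-pick (A zero) ⟩
        ι (∣ A zero ∣ ℕ.≟ a) * sym-sum a (A zero) (λ u → J ℓ (A ∘ suc) (f ∘ (u ++_))) ∎

      J-merge : ∀ a b .⦃ _ : ℕ.NonZero a ⦄ .⦃ _ : ℕ.NonZero b ⦄ {s t} (ℓ : Layer s t) A f → let A₀ = A zero; A₁ = A (suc zero) in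
        J (merge a b ℓ) A f ≈ ι ((A₀ ∩ A₁) ≟ˢ ∅) * (cross A₀ A₁ * (ι (∣ A₀ ∪ A₁ ∣ ℕ.≟ a ℕ.+ b) *
          sym-sum (a ℕ.+ b) (A₀ ∪ A₁) (λ u → J ℓ (λ j → A (suc (suc j))) (f ∘ (u ++_)))))
      J-merge a b {s} {t} ℓ A f = begin
        J (merge a b ℓ) A f
          ≈⟨ ∑-choices (λ _ → subsets N) _ (λ B₀ B → du A₀ A₁ B₀ * (cross A₀ A₁ * wt ℓ A′ B) * (ι (∣ B₀ ∣ ℕ.≟ a ℕ.+ b) * sz t B * sym-sum (a ℕ.+ b) B₀ (λ u → S t B (f ∘ (u ++_))))) (λ _ → refl) ⟩
        ∑ (subsets N) (λ B₀ → ∑ (states N t) (λ B → du A₀ A₁ B₀ * (cross A₀ A₁ * wt ℓ A′ B) * (ι (∣ B₀ ∣ ℕ.≟ a ℕ.+ b) * sz t B * sym-sum (a ℕ.+ b) B₀ (λ u → S t B (f ∘ (u ++_))))))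
          ≈⟨ ∑-cong (subsets N) (λ B₀ → trans (∑-cong (states N t) λ B →
               solve 7 (λ i k c w j s y → i :* k :* (c :* w) :* (j :* s :* y) := i :* (k :* (c :* j)) :* (w :* (s :* y))) refl _ _ _ _ _ _ _)
               (trans (∑-*ˡ _ (states N t)) (trans (*-congˡ (pull ℓ A′ (a ℕ.+ b) B₀ f))
                 (solve 5 (λ i k c j y → i :* (k :* (c :* j)) :* y := i :* (k :* (c :* (j :* y)))) refl _ _ _ _ _)))) ⟩
        ∑ (subsets N) (λ B₀ → ι ((A₀ ∪ A₁) ≟ˢ B₀) * (ι ((A₀ ∩ A₁) ≟ˢ ∅) * (cross A₀ A₁ * (ι (∣ B₀ ∣ ℕ.≟ a ℕ.+ b) * sym-sum (a ℕ.+ b) B₀ (λ u → J ℓ A′ (f ∘ (u ++_)))))))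
          ≈⟨ ∑-subsets-pick (A₀ ∪ A₁) ⟩
        _ ∎
        where
        A₀ = A zero
        A₁ = A (suc zero)
        A′ : State N s
        A′ j = A (suc (suc j))

      J-split : ∀ a b .⦃ _ : ℕ.NonZero a ⦄ .⦃ _ : ℕ.NonZero b ⦄ {s t} (ℓ : Layer s t) A f → ∣ A zero ∣ ≡ a ℕ.+ b →
        J (split a b ℓ) A f ≈ sym-sum (a ℕ.+ b) (A zero) (λ u → J ℓ (A ∘ suc) (f ∘ (u ++_)))
      J-split a b {s} {t} ℓ A f ∣A∣ = begin
        J (split a b ℓ) A f
          ≈⟨ ∑-choices (λ _ → subsets N) _ (λ B₀ B → du B₀ (B zero) (A zero) * wt ℓ A′ (B ∘ suc) * (ι (∣ B₀ ∣ ℕ.≟ a) * (ι (∣ B zero ∣ ℕ.≟ b) * sz t (B ∘ suc)) *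
               sym-sum a B₀ (λ u → sym-sum b (B zero) (λ v → S t (B ∘ suc) (λ w → f (u ++ v ++ w)))))) (λ _ → refl) ⟩
        ∑ (subsets N) (λ B₀ → ∑ (choices {suc (length t)} (λ _ → subsets N)) (λ B → du B₀ (B zero) (A zero) * wt ℓ A′ (B ∘ suc) * (ι (∣ B₀ ∣ ℕ.≟ a) * (ι (∣ B zero ∣ ℕ.≟ b) * sz t (B ∘ suc)) *
               sym-sum a B₀ (λ u → sym-sum b (B zero) (λ v → S t (B ∘ suc) (λ w → f (u ++ v ++ w)))))))
          ≈⟨ ∑-cong (subsets N) (λ B₀ → ∑-choices (λ _ → subsets N) _ (λ B₁ B → du B₀ B₁ (A zero) * wt ℓ A′ B * (ι (∣ B₀ ∣ ℕ.≟ a) * (ι (∣ B₁ ∣ ℕ.≟ b) * sz t B) *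
               sym-sum a B₀ (λ u → sym-sum b B₁ (λ v → S t B (λ w → f (u ++ v ++ w)))))) (λ _ → refl)) ⟩
        ∑ (subsets N) (λ B₀ → ∑ (subsets N) (λ B₁ → ∑ (states N t) (λ B → du B₀ B₁ (A zero) * wt ℓ A′ B * (ι (∣ B₀ ∣ ℕ.≟ a) * (ι (∣ B₁ ∣ ℕ.≟ b) * sz t B) *
               sym-sum a B₀ (λ u → sym-sum b B₁ (λ v → S t B (λ w → f (u ++ v ++ w))))))))
          ≈⟨ ∑-cong (subsets N) (λ B₀ → ∑-cong (subsets N) λ B₁ → trans (∑-cong (states N t) λ B →
               solve 6 (λ d w i j s y → d :* w :* (i :* (j :* s) :* y) := d :* (i :* j) :* (w :* (s :* y))) refl _ _ _ _ _ _)
               (trans (∑-*ˡ _ (states N t)) (trans (*-congˡ (inner B₀ B₁))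
                 (solve 4 (λ d i j y → d :* (i :* j) :* y := d :* (i :* (j :* y))) refl _ _ _ _)))) ⟩
        ∑ (subsets N) (λ B₀ → ∑ (subsets N) (λ B₁ → du B₀ B₁ (A zero) * (ι (∣ B₀ ∣ ℕ.≟ a) * (ι (∣ B₁ ∣ ℕ.≟ b) *
          sym-sum a B₀ (λ u → sym-sum b B₁ (λ v → J ℓ A′ (λ w → f ((u ++ v) ++ w))))))))
          ≈⟨ sym-split a b (A zero) (λ u → J ℓ A′ (f ∘ (u ++_))) ∣A∣ ⟩
        sym-sum (a ℕ.+ b) (A zero) (λ u → J ℓ A′ (f ∘ (u ++_))) ∎
        where
        A′ : State N s
        A′ = A ∘ suc
        inner : ∀ B₀ B₁ → ∑ (states N t) (λ B → wt ℓ A′ B * (sz t B * sym-sum a B₀ (λ u → sym-sum b B₁ (λ v → S t B (λ w → f (u ++ v ++ w)))))) ≈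
                sym-sum a B₀ (λ u → sym-sum b B₁ (λ v → J ℓ A′ (λ w → f ((u ++ v) ++ w))))
        inner B₀ B₁ = sym (begin
          sym-sum a B₀ (λ u → sym-sum b B₁ (λ v → J ℓ A′ (λ w → f ((u ++ v) ++ w))))
            ≈⟨ sym-ext a B₀ (λ u → sym-ext b B₁ λ v → J-ext ℓ A′ λ w → reflexive (≡.cong f (List.++-assoc u v w))) ⟩
          sym-sum a B₀ (λ u → sym-sum b B₁ (λ v → J ℓ A′ (λ w → f (u ++ v ++ w))))
            ≈⟨ sym-ext a B₀ (λ u → sym (pull ℓ A′ b B₁ (f ∘ (u ++_)))) ⟩
          sym-sum a B₀ (λ u → ∑ (states N t) (λ B → wt ℓ A′ B * (sz t B * sym-sum b B₁ (λ v → S t B (λ w → f (u ++ v ++ w))))))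
            ≈⟨ trans (sym-∑ a B₀ (states N t)) (∑-cong (states N t) λ B → trans (sym-*ˡ a B₀ _) (*-congˡ (sym-*ˡ a B₀ _))) ⟩
          ∑ (states N t) (λ B → wt ℓ A′ B * (sz t B * sym-sum a B₀ (λ u → sym-sum b B₁ (λ v → S t B (λ w → f (u ++ v ++ w)))))) ∎)

      block-zero : ∀ {a} g f u v → length u ≡ a → ewt u ≈ 0# → ⟪ AS a ⊙ sh a g ⟫ f (u ++ v) ≈ 0#
      block-zero g f u v ≡.refl ≈0 = trans (⟪AS⟫ _ u v) (trans (*-congʳ ≈0) (zeroˡ _))

      block : ∀ {a A u} g f v → Orders A u → ∣ A ∣ ≡ a →
              ⟪ AS a ⊙ sh a g ⟫ f (u ++ v) ≈ ewt u * sym-sum a A (λ u′ → ⟪ g ⟫ (f ∘ (u′ ++_)) v)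
      block {a} {A} {u} g f v o ∣A∣ = begin
        ⟪ AS a ⟫ F (u ++ v)
          ≈⟨ reflexive (≡.cong (λ a → ⟪ AS a ⟫ F (u ++ v)) (≡.sym lu)) ⟩
        ⟪ AS (length u) ⟫ F (u ++ v)
          ≈⟨ ⟪AS⟫ F u v ⟩
        ewt u * sym-sum (length u) (wset u) (λ u′ → F (u′ ++ v))
          ≈⟨ *-congˡ (reflexive (≡.cong₂ (λ a B → sym-sum a B (λ u′ → F (u′ ++ v))) lu (Orders⇒wset o))) ⟩
        ewt u * sym-sum a A (λ u′ → F (u′ ++ v))
          ≈⟨ *-congˡ (sym-cong a A ∣A∣ λ u′ o′ → trans
               (reflexive (≡.cong (λ a → ⟪ sh a g ⟫ f (u′ ++ v)) (≡.sym (≡.trans (Orders⇒length o′) ∣A∣)))) (⟪sh⟫ g f u′ v)) ⟩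
        ewt u * sym-sum a A (λ u′ → ⟪ g ⟫ (f ∘ (u′ ++_)) v) ∎
        where
        F : List (Fin N) → Carrier
        F = ⟪ sh a g ⟫ f
        lu : length u ≡ a
        lu = ≡.trans (Orders⇒length o) ∣A∣

      crw : List (Fin N) → List (Fin N) → Carrier
      crw u v = ∏ u (λ a → ew a v)

      ewt-++ : ∀ u v → ewt (u ++ v) ≈ ewt u * (crw u v * ewt v)
      ewt-++ []      v = sym (trans (*-identityˡ _) (*-identityˡ _))
      ewt-++ (a ∷ u) v = trans (*-cong (∏-++ u v) (ewt-++ u v))
        (solve 5 (λ a b c d e → a :* b :* (c :* (d :* e)) := a :* c :* (b :* d :* e)) refl _ _ _ _ _)

      crw≈cross : ∀ {A B u v} → Orders A u → Orders B v → crw u v ≈ cross A B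
      crw≈cross {A} {B} {u} o o′ = trans (∏-cong u λ a → ew≈ex a o′) (∏≈∏∈ _ o)

      cross-0 : ∀ A B y → lookup A y ≡ true → lookup B y ≡ true → cross A B ≈ 0#
      cross-0 A B y y∈A y∈B = trans (reflexive (≡.cong (λ C → cross C B) (≡.sym (ins-del y A y∈A))))
        (trans (∏∈-ins y (del y A) (lookup-del y A)) (trans (*-congʳ (ex-∈ y B y∈B)) (zeroˡ _)))

      take-++ : ∀ {a} (u v : List (Fin N)) → length u ≡ a → take a (u ++ v) ≡ u × drop a (u ++ v) ≡ v
      take-++ []      v ≡.refl = ≡.refl , ≡.refl
      take-++ (b ∷ u) v ≡.refl = ≡.cong (b ∷_) (proj₁ (take-++ u v ≡.refl)) , proj₂ (take-++ u v ≡.refl)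

    ewts : List ℕ → List (Fin N) → Carrier
    ewts []      w = 1#
    ewts (a ∷ s) w = ewt (take a w) * ewts s (drop a w)

    ewts-++ : ∀ {a} s u v → length u ≡ a → ewts (a ∷ s) (u ++ v) ≈ ewt u * ewts s v
    ewts-++ s u v l = reflexive (≡.cong₂ (λ u v → ewt u * ewts s v) (proj₁ (take-++ u v l)) (proj₂ (take-++ u v l)))

    -- By `⟪AS⟫` each block of w is forgotten except for its set and its weight. At a merge the
    -- weight of the concatenated block splits into the weights of its two halves and the `cross` of
    -- their sets, which is precisely the weight of the vertex.
    layer-word : ∀ {s t} (ℓ : Layer s t) {A w} f → OrdersS s A w → ⟪ layerH ℓ ⟫ f w ≈ ewts s w * J ℓ A f
    layer-word [] f nil = *-congˡ (sym (trans (+-identityʳ _) (trans (*-identityˡ _) (*-identityˡ _))))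
    layer-word {a ∷ s} (strand a ℓ) {A} f (cons {u = u} {v} o ∣A∣ os) = begin
      ⟪ AS a ⊙ sh a (layerH ℓ) ⟫ f (u ++ v)
        ≈⟨ block (layerH ℓ) f v o ∣A∣ ⟩
      ewt u * sym-sum a (A zero) (λ u′ → ⟪ layerH ℓ ⟫ (f ∘ (u′ ++_)) v)
        ≈⟨ *-congˡ (trans (sym-ext a (A zero) λ u′ → layer-word ℓ (f ∘ (u′ ++_)) os) (sym-*ˡ a (A zero) (ewts s v))) ⟩
      ewt u * (ewts s v * sym-sum a (A zero) (λ u′ → J ℓ (A ∘ suc) (f ∘ (u′ ++_))))
        ≈⟨ sym (*-assoc _ _ _) ⟩
      ewt u * ewts s v * sym-sum a (A zero) (λ u′ → J ℓ (A ∘ suc) (f ∘ (u′ ++_)))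
        ≈⟨ *-cong (ewts-++ s u v (≡.trans (Orders⇒length o) ∣A∣)) (trans (J-strand a ℓ A f) (trans (*-congʳ (ι-yes (∣ A zero ∣ ℕ.≟ a) ∣A∣)) (*-identityˡ _))) ⟨
      ewts (a ∷ s) (u ++ v) * J (strand a ℓ) A f ∎
    layer-word {c ∷ s} (split a b ℓ) {A} f (cons {u = u} {v} o ∣A∣ os) = begin
      ⟪ AS c ⊙ sh c (layerH ℓ) ⟫ f (u ++ v)
        ≈⟨ block (layerH ℓ) f v o ∣A∣ ⟩
      ewt u * sym-sum c (A zero) (λ u′ → ⟪ layerH ℓ ⟫ (f ∘ (u′ ++_)) v)
        ≈⟨ *-congˡ (trans (sym-ext c (A zero) λ u′ → layer-word ℓ (f ∘ (u′ ++_)) os) (sym-*ˡ c (A zero) (ewts s v))) ⟩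
      ewt u * (ewts s v * sym-sum c (A zero) (λ u′ → J ℓ (A ∘ suc) (f ∘ (u′ ++_))))
        ≈⟨ sym (*-assoc _ _ _) ⟩
      ewt u * ewts s v * sym-sum c (A zero) (λ u′ → J ℓ (A ∘ suc) (f ∘ (u′ ++_)))
        ≈⟨ *-cong (ewts-++ s u v (≡.trans (Orders⇒length o) ∣A∣)) (J-split a b ℓ A f ∣A∣) ⟨
      ewts (c ∷ s) (u ++ v) * J (split a b ℓ) A f ∎
    layer-word {a ∷ b ∷ s} (merge a b ℓ) {A} f (cons {u = u₀} o₀ ∣A₀∣ (cons {u = u₁} {v} o₁ ∣A₁∣ os)) =
      cases ((A zero ∩ A (suc zero)) ≟ˢ ∅)
      where
      w = u₀ ++ u₁ ++ v
      cases : Dec (A zero ∩ A (suc zero) ≡ ∅) → ⟪ layerH (merge a b ℓ) ⟫ f w ≈ ewts (a ∷ b ∷ s) w * J (merge a b ℓ) A f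
      cases (yes disjoint) = begin
        ⟪ AS (a ℕ.+ b) ⊙ sh (a ℕ.+ b) (layerH ℓ) ⟫ f (u₀ ++ u₁ ++ v)
          ≈⟨ reflexive (≡.cong (⟪ AS (a ℕ.+ b) ⊙ sh (a ℕ.+ b) (layerH ℓ) ⟫ f) (≡.sym (List.++-assoc u₀ u₁ v))) ⟩
        ⟪ AS (a ℕ.+ b) ⊙ sh (a ℕ.+ b) (layerH ℓ) ⟫ f ((u₀ ++ u₁) ++ v)
          ≈⟨ block (layerH ℓ) f v o ∣A∣ ⟩
        ewt (u₀ ++ u₁) * sym-sum (a ℕ.+ b) A₀₁ (λ u → ⟪ layerH ℓ ⟫ (f ∘ (u ++_)) v)
          ≈⟨ *-cong (trans (ewt-++ u₀ u₁) (*-congˡ (*-congʳ (crw≈cross o₀ o₁))))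
               (trans (sym-ext (a ℕ.+ b) A₀₁ λ u → layer-word ℓ (f ∘ (u ++_)) os) (sym-*ˡ (a ℕ.+ b) A₀₁ (ewts s v))) ⟩
        ewt u₀ * (cross (A zero) (A (suc zero)) * ewt u₁) * (ewts s v * Y)
          ≈⟨ solve 5 (λ e c e′ es y → e :* (c :* e′) :* (es :* y) := e :* (e′ :* es) :* (con 1 :* (c :* (con 1 :* y)))) refl _ _ _ _ _ ⟩
        ewt u₀ * (ewt u₁ * ewts s v) * (1# * (cross (A zero) (A (suc zero)) * (1# * Y)))
          ≈⟨ *-cong (trans (ewts-++ (b ∷ s) u₀ (u₁ ++ v) (≡.trans (Orders⇒length o₀) ∣A₀∣)) (*-congˡ (ewts-++ s u₁ v (≡.trans (Orders⇒length o₁) ∣A₁∣))))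
               (trans (J-merge a b ℓ A f) (*-cong (ι-yes ((A zero ∩ A (suc zero)) ≟ˢ ∅) disjoint) (*-congˡ (*-congʳ (ι-yes (∣ A₀₁ ∣ ℕ.≟ a ℕ.+ b) ∣A∣))))) ⟨
        ewts (a ∷ b ∷ s) (u₀ ++ u₁ ++ v) * J (merge a b ℓ) A f ∎
        where
        A₀₁ = A zero ∪ A (suc zero)
        o : Orders A₀₁ (u₀ ++ u₁)
        o = Orders-++ o₀ o₁ disjoint
        ∣A∣ : ∣ A₀₁ ∣ ≡ a ℕ.+ b
        ∣A∣ = ≡.trans (≡.sym (Orders⇒length o)) (≡.trans (List.length-++ u₀) (≡.cong₂ ℕ._+_ (≡.trans (Orders⇒length o₀) ∣A₀∣) (≡.trans (Orders⇒length o₁) ∣A₁∣)))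
        Y = sym-sum (a ℕ.+ b) A₀₁ (λ u → J ℓ (λ j → A (suc (suc j))) (f ∘ (u ++_)))
      -- A letter common to both incoming edges makes `cross` vanish on the left, and the
      -- disjointness condition in `du` makes the right side vanish.
      cases (no meet) = trans
          (trans (reflexive (≡.cong (⟪ AS (a ℕ.+ b) ⊙ sh (a ℕ.+ b) (layerH ℓ) ⟫ f) (≡.sym (List.++-assoc u₀ u₁ v))))
            (block-zero (layerH ℓ) f (u₀ ++ u₁) v (≡.trans (List.length-++ u₀) (≡.cong₂ ℕ._+_ (≡.trans (Orders⇒length o₀) ∣A₀∣) (≡.trans (Orders⇒length o₁) ∣A₁∣)))
              (trans (ewt-++ u₀ u₁) (trans (*-congˡ (trans (*-congʳ (trans (crw≈cross o₀ o₁) vanish)) (zeroˡ _))) (zeroʳ _)))))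
          (sym (trans (*-congˡ (trans (J-merge a b ℓ A f) (trans (*-congʳ (ι-no ((A zero ∩ A (suc zero)) ≟ˢ ∅) (λ d → ⊥-elim (meet d)))) (zeroˡ _)))) (zeroʳ _)))
        where
        vanish : cross (A zero) (A (suc zero)) ≈ 0#
        vanish with y , y∈ ← inhabited (A zero ∩ A (suc zero)) meet =
          cross-0 (A zero) (A (suc zero)) y (Bool.∧-conicalˡ _ _ y∈′) (Bool.∧-conicalʳ _ _ y∈′)
          where
          y∈′ : lookup (A zero) y ∧ lookup (A (suc zero)) y ≡ true
          y∈′ = ≡.trans (≡.sym (lookup-∩ y (A zero) (A (suc zero)))) y∈

    S-ewts : ∀ s A → Sized s A → S s A (ewts s) ≈ factors s
    S-ewts []      A sized = refl
    S-ewts (a ∷ s) A sized = begin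
      sym-sum a (A zero) (λ u → S s (A ∘ suc) (λ v → ewts (a ∷ s) (u ++ v)))
        ≈⟨ sym-cong a (A zero) (sized zero) (λ u o → trans (S-ext s (A ∘ suc) λ v → ewts-++ s u v (≡.trans (Orders⇒length o) (sized zero)))
             (trans (S-*ˡ s (A ∘ suc) (ewt u)) (*-congˡ (S-ewts s (A ∘ suc) (sized ∘ suc))))) ⟩
      sym-sum a (A zero) (λ u → ewt u * factors s)
        ≈⟨ trans (sym-*ʳ a (A zero) (factors s)) (*-congʳ (sym-ewt a (A zero) (sized zero))) ⟩
      factors (a ∷ s) ∎

    -- The weights of the orderings of a state sum to the factorials of its thicknesses, by
    -- `S-ewts`. Layers can thus be composed on the level of states, at the cost of one such factor
    -- per layer.
    S-layer : ∀ {s t} (ℓ : Layer s t) A f → Sized s A → S s A (⟪ layerH ℓ ⟫ f) ≈ factors s * J ℓ A f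
    S-layer {s} ℓ A f sized = trans (S-cong s A sized λ w os → layer-word ℓ f os)
      (trans (S-*ʳ s A (J ℓ A f)) (*-congʳ (S-ewts s A sized)))

    -- The value at w is `ewts s w` times a quantity depending on the state only, so it can be
    -- recovered from the sum over all orderings of that state.
    layer-absorb : ∀ {s t} (ℓ : Layer s t) {A w} f → OrdersS s A w →
                   factors s * ⟪ layerH ℓ ⟫ f w ≈ ewts s w * S s A (⟪ layerH ℓ ⟫ f)
    layer-absorb {s} ℓ {A} {w} f os = begin
      factors s * ⟪ layerH ℓ ⟫ f w      ≈⟨ *-congˡ (layer-word ℓ f os) ⟩
      factors s * (ewts s w * J ℓ A f)  ≈⟨ x*yz≈y*xz _ _ _ ⟩
      ewts s w * (factors s * J ℓ A f)  ≈⟨ *-congˡ (S-layer ℓ A f (OrdersS⇒Sized os)) ⟨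
      ewts s w * S s A (⟪ layerH ℓ ⟫ f) ∎

    Distinct : List ℕ → List (Fin N) → Set
    Distinct []      w = ⊤
    Distinct (a ∷ s) w = Orders (wset (take a w)) (take a w) × Distinct s (drop a w)

    private
      length-take-≤ : ∀ a (w : List (Fin N)) {n} → length w ≡ a ℕ.+ n → length (take a w) ≡ a × length (drop a w) ≡ n
      length-take-≤ zero    w       h = ≡.refl , h
      length-take-≤ (suc a) (y ∷ w) h with length-take-≤ a w (ℕ.suc-injective h)
      ... | l , l′ = ≡.cong suc l , l′

      take-drop : ∀ a (w : List (Fin N)) → take a w ++ drop a w ≡ w
      take-drop a w = List.take++drop≡id a w

      two : ∀ {a b} (w : List (Fin N)) → length (take a w) ≡ a → length (take b (drop a w)) ≡ b → length (take a w ++ take b (drop a w)) ≡ a ℕ.+ b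
      two {a} w h h′ = ≡.trans (List.length-++ (take a w)) (≡.cong₂ ℕ._+_ h h′)

      three : ∀ a b (w : List (Fin N)) → w ≡ (take a w ++ take b (drop a w)) ++ drop b (drop a w)
      three a b w = ≡.sym (≡.trans (List.++-assoc (take a w) _ _) (≡.trans (≡.cong (take a w ++_) (take-drop b (drop a w))) (take-drop a w)))

      ⟪⟫-at : ∀ h f {w w′} → w ≡ w′ → ⟪ h ⟫ f w′ ≈ 0# → ⟪ h ⟫ f w ≈ 0#
      ⟪⟫-at h f ≡.refl ≈0 = ≈0

      sym-all-0 : ∀ a (A : Subset N) {f} → (∀ w → f w ≈ 0#) → sym-sum a A f ≈ 0#
      sym-all-0 a A {f} h = trans (sym-ext a A λ w → trans (h w) (sym (zeroˡ 0#))) (trans (sym-*ˡ a A 0#) (zeroˡ _))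

      block-tail-zero : ∀ {a} g f u v → length u ≡ a → Orders (wset u) u → (∀ f → ⟪ g ⟫ f v ≈ 0#) → ⟪ AS a ⊙ sh a g ⟫ f (u ++ v) ≈ 0#
      block-tail-zero {a} g f u v l o h = trans (block g f v o (≡.trans (≡.sym (Orders⇒length o)) l))
        (trans (*-congˡ (sym-all-0 a (wset u) λ u′ → h (f ∘ (u′ ++_)))) (zeroʳ _))

    -- The vanishing is uniform in f, so a letter repeated within a block of the first layer kills
    -- the whole product of layers, whatever follows.
    layer-vanishes : ∀ {s t} (ℓ : Layer s t) w → length w ≡ sum s → (∀ f → ⟪ layerH ℓ ⟫ f w ≈ 0#) ⊎ Distinct s w
    layer-vanishes [] w l = inj₂ tt
    layer-vanishes {a ∷ s} (strand a ℓ) w l = single a ℓ w l (layer-vanishes ℓ)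
      where
      single : ∀ a {s t} (ℓ : Layer s t) w → length w ≡ a ℕ.+ sum s →
        (∀ w → length w ≡ sum s → (∀ f → ⟪ layerH ℓ ⟫ f w ≈ 0#) ⊎ Distinct s w) →
        (∀ f → ⟪ AS a ⊙ sh a (layerH ℓ) ⟫ f w ≈ 0#) ⊎ Distinct (a ∷ s) w
      single a ℓ w l rec with length-take-≤ a w l
      ... | lu , lv with distinct? (take a w) | rec (drop a w) lv
      ...   | inj₁ ≈0 | _ = inj₁ λ f → ⟪⟫-at (AS a ⊙ sh a (layerH ℓ)) f (≡.sym (take-drop a w)) (block-zero (layerH ℓ) f (take a w) (drop a w) lu ≈0)
      ...   | inj₂ o  | inj₁ h = inj₁ λ f → ⟪⟫-at (AS a ⊙ sh a (layerH ℓ)) f (≡.sym (take-drop a w)) (block-tail-zero (layerH ℓ) f (take a w) (drop a w) lu o h)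
      ...   | inj₂ o  | inj₂ d = inj₂ (o , d)
    layer-vanishes {c ∷ s} (split a b ℓ) w l with length-take-≤ c w l
    ... | lu , lv with distinct? (take c w) | layer-vanishes ℓ (drop c w) lv
    ...   | inj₁ ≈0 | _ = inj₁ λ f → ⟪⟫-at (AS c ⊙ sh c (layerH ℓ)) f (≡.sym (take-drop c w)) (block-zero (layerH ℓ) f (take c w) (drop c w) lu ≈0)
    ...   | inj₂ o  | inj₁ h = inj₁ λ f → ⟪⟫-at (AS c ⊙ sh c (layerH ℓ)) f (≡.sym (take-drop c w)) (block-tail-zero (layerH ℓ) f (take c w) (drop c w) lu o h)
    ...   | inj₂ o  | inj₂ d = inj₂ (o , d)
    layer-vanishes {a ∷ b ∷ s} (merge a b ℓ) w l with length-take-≤ a w l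
    ... | lu , lv with length-take-≤ b (drop a w) lv
    ...   | lu′ , lv′ with distinct? (take a w) | distinct? (take b (drop a w)) | layer-vanishes ℓ (drop b (drop a w)) lv′
    ...     | inj₂ o | inj₂ o′ | inj₂ d = inj₂ (o , o′ , d)
    ...     | inj₁ ≈0 | _ | _ = inj₁ λ f → ⟪⟫-at (AS (a ℕ.+ b) ⊙ sh (a ℕ.+ b) (layerH ℓ)) f (three a b w)
              (block-zero (layerH ℓ) f (take a w ++ take b (drop a w)) (drop b (drop a w)) (two w lu lu′)
                (trans (ewt-++ (take a w) _) (trans (*-congʳ ≈0) (zeroˡ _))))
    ...     | inj₂ o | inj₁ ≈0 | _ = inj₁ λ f → ⟪⟫-at (AS (a ℕ.+ b) ⊙ sh (a ℕ.+ b) (layerH ℓ)) f (three a b w)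
              (block-zero (layerH ℓ) f (take a w ++ take b (drop a w)) (drop b (drop a w)) (two w lu lu′)
                (trans (ewt-++ (take a w) _) (trans (*-congˡ (trans (*-congˡ ≈0) (zeroʳ _))) (zeroʳ _))))
    ...     | inj₂ o | inj₂ o′ | inj₁ h with distinct? (take a w ++ take b (drop a w))
    ...       | inj₁ ≈0 = inj₁ λ f → ⟪⟫-at (AS (a ℕ.+ b) ⊙ sh (a ℕ.+ b) (layerH ℓ)) f (three a b w)
              (block-zero (layerH ℓ) f (take a w ++ take b (drop a w)) (drop b (drop a w)) (two w lu lu′) ≈0)
    ...       | inj₂ o″ = inj₁ λ f → ⟪⟫-at (AS (a ℕ.+ b) ⊙ sh (a ℕ.+ b) (layerH ℓ)) f (three a b w)
              (block-tail-zero (layerH ℓ) f (take a w ++ take b (drop a w)) (drop b (drop a w)) (two w lu lu′) o″ h)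

    ∑-words-states : ∀ s (F : List (Fin N) → Carrier) → (∀ w → length w ≡ sum s → F w ≈ 0# ⊎ Distinct s w) →
                     ∑ (words N (sum s)) F ≈ ∑ (states N s) (λ A → sz s A * S s A F)
    ∑-words-states [] F h = trans (+-identityʳ _) (sym (trans (+-identityʳ _) (*-identityˡ _)))
    ∑-words-states (a ∷ s) F h = begin
      ∑ (words N (a ℕ.+ sum s)) F
        ≈⟨ ∑-words-++ N a (sum s) ⟩
      ∑ (words N a) (λ u → ∑ (words N (sum s)) (λ v → F (u ++ v)))
        ≈⟨ ∑-words-cong N a (λ u lu → ∑-words-states s (F ∘ (u ++_)) (tail-hyp u lu)) ⟩
      ∑ (words N a) (λ u → ∑ (states N s) (λ A → sz s A * S s A (F ∘ (u ++_))))
        ≈⟨ ∑-swap (words N a) (states N s) ⟩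
      ∑ (states N s) (λ A → ∑ (words N a) (λ u → sz s A * S s A (F ∘ (u ++_))))
        ≈⟨ ∑-cong (states N s) (λ A → ∑-words-sets a (λ u → sz s A * S s A (F ∘ (u ++_))) (head-hyp A)) ⟩
      ∑ (states N s) (λ A → ∑ (subsets N) (λ B → ι (∣ B ∣ ℕ.≟ a) * sym-sum a B (λ u → sz s A * S s A (F ∘ (u ++_)))))
        ≈⟨ ∑-swap (states N s) (subsets N) ⟩
      ∑ (subsets N) (λ B → ∑ (states N s) (λ A → ι (∣ B ∣ ℕ.≟ a) * sym-sum a B (λ u → sz s A * S s A (F ∘ (u ++_)))))
        ≈⟨ ∑-cong (subsets N) (λ B → ∑-cong (states N s) λ A → trans (*-congˡ (sym-*ˡ a B (sz s A))) (sym (*-assoc _ _ _))) ⟩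
      ∑ (subsets N) (λ B → ∑ (states N s) (λ A → ι (∣ B ∣ ℕ.≟ a) * sz s A * sym-sum a B (λ u → S s A (F ∘ (u ++_)))))
        ≈⟨ ∑-choices (λ _ → subsets N) (λ A → sz (a ∷ s) A * S (a ∷ s) A F) (λ B A → ι (∣ B ∣ ℕ.≟ a) * sz s A * sym-sum a B (λ u → S s A (F ∘ (u ++_)))) (λ _ → refl) ⟨
      ∑ (states N (a ∷ s)) (λ A → sz (a ∷ s) A * S (a ∷ s) A F) ∎
      where
      at-split : ∀ u v → length u ≡ a → length v ≡ sum s → F (u ++ v) ≈ 0# ⊎ (Orders (wset u) u × Distinct s v)
      at-split u v lu lv with h (u ++ v) (≡.trans (List.length-++ u) (≡.cong₂ ℕ._+_ lu lv))
      ... | inj₁ ≈0 = inj₁ ≈0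
      ... | inj₂ (o , d) rewrite proj₁ (take-++ u v lu) | proj₂ (take-++ u v lu) = inj₂ (o , d)
      tail-hyp : ∀ u → length u ≡ a → ∀ v → length v ≡ sum s → F (u ++ v) ≈ 0# ⊎ Distinct s v
      tail-hyp u lu v lv with at-split u v lu lv
      ... | inj₁ ≈0 = inj₁ ≈0
      ... | inj₂ (_ , d) = inj₂ d
      OrdersS⇒length : ∀ {s} {A : State N s} {w} → OrdersS s A w → length w ≡ sum s
      OrdersS⇒length nil = ≡.refl
      OrdersS⇒length (cons {u = u} o ∣A∣ os) = ≡.trans (List.length-++ u) (≡.cong₂ ℕ._+_ (≡.trans (Orders⇒length o) ∣A∣) (OrdersS⇒length os))
      head-hyp : ∀ A u → length u ≡ a → sz s A * S s A (F ∘ (u ++_)) ≈ 0# ⊎ Orders (wset u) u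
      head-hyp A u lu with distinct? u
      ... | inj₂ o  = inj₂ o
      -- The weight of u may vanish in R for other reasons than a repetition, so it does not show
      -- that u fails to be an ordering; repetition is decided on the word itself.
      ... | inj₁ ≈0 with repeated? u
        where
        repeated? : ∀ u → Dec (Orders (wset u) u)
        repeated? [] = yes []
        repeated? (y ∷ u) with repeated? u | lookup (wset u) y in y∈
        ... | yes o | false = yes (lookup-ins y (wset u) then ≡.subst (λ A → Orders A u) (≡.sym (del-ins y (wset u) y∈)) o)
        ... | yes o | true  = no λ o′ → true≢false (≡.trans (≡.sym y∈) (proj₁ (Orders-∷ o′)))
        ... | no ¬o | _     = no λ o′ → ¬o (proj₂ (Orders-∷ o′))
      ...   | yes o = inj₂ o
      ...   | no ¬o = inj₁ (trans (sz-guard s A {b = 0#} λ sized → trans (S-cong s A sized λ v os → vanish v (OrdersS⇒length os)) (trans (S-*ˡ s A 0# {λ _ → 0#}) (zeroˡ _))) (zeroʳ _))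
        where
        vanish : ∀ v → length v ≡ sum s → F (u ++ v) ≈ 0# * 0#
        vanish v lv with at-split u v lu lv
        ... | inj₁ ≈0 = trans ≈0 (sym (zeroˡ 0#))
        ... | inj₂ (o , _) = ⊥-elim (¬o o)

-- Transfer matrices around the annulus.

module Paths (R : CommutativeSemiring 0ℓ 0ℓ) (z p x : CommutativeSemiring.Carrier R) where

  open import Data.Bool.Base using (Bool; true; false)
  open import Data.Empty using (⊥-elim)
  open import Data.Fin.Base as Fin using (Fin; zero; suc; inject₁; fromℕ)
  import Data.Fin.Properties as Fin
  open import Data.Fin.Subset using (Subset; ∣_∣) renaming (⊥ to ∅)
  open import Data.List.Base hiding (lookup; merge; sum; tail; replicate; zipWith; updateAt; partition)
  open import Data.Nat.Base as ℕ using (ℕ; zero; suc)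
  import Data.Nat.Properties as ℕ
  open import Data.Nat.ListAction using (sum)
  open import Data.Sum.Base using (_⊎_; inj₁; inj₂)
  open import Data.Vec.Base as Vec using (Vec; []; _∷_; lookup; replicate; zipWith; updateAt)
  import Data.Vec.Properties as Vec
  open import Function.Base using (_∘_)
  open import Relation.Binary.PropositionalEquality as ≡ using (_≡_)
  open import Relation.Nullary.Decidable using (does)

  open import Defs using (Layer; []; strand; merge; split; subsets; choices; _≟ˢ_; _≟ᵛ_)
  open Sums R
  open Hecke R z p x
  open Subsets
  open Antisym R z p x
  open Words R z p x
  open Traces R z p x using (module Delta; χ)
  open PowerSeries R z p x using (cont-++)
  open Layers R z p x
  open Count using (bit)

  private
    variable
      k : ℕ

  Kernel : (Fin (suc k) → Set) → Set
  Kernel {k} X = (i : Fin k) → X (inject₁ i) → X (suc i) → Carrier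

  -- Partial path sums with F evaluated at the far end: `up` starts at cut zero and ends at I, and
  -- `dn` starts at I and ends at the last cut.
  up : {X : Fin (suc k) → Set} → (∀ i → List (X i)) → Kernel X → ∀ I → (X I → Carrier) → X zero → Carrier
  up         xs M zero    F a = F a
  up {suc k} xs M (suc I) F a = ∑ (xs (suc zero)) λ b → M zero a b * up (λ i → xs (suc i)) (λ i → M (suc i)) I F b

  dn : {X : Fin (suc k) → Set} → (∀ i → List (X i)) → Kernel X → ∀ I → (X (fromℕ k) → Carrier) → X I → Carrier
  dn {zero}  xs M zero    F a = F a
  dn {suc k} xs M zero    F a = ∑ (xs (suc zero)) λ b → M zero a b * dn (λ i → xs (suc i)) (λ i → M (suc i)) zero F b
  dn {suc k} xs M (suc I) F a = dn (λ i → xs (suc i)) (λ i → M (suc i)) I F a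

  path : {X : Fin (suc k) → Set} → Kernel X → (∀ i → X i) → Carrier
  path {k} M c = ∏ (allFin k) λ i → M i (c (inject₁ i)) (c (suc i))

  up-cong : {X : Fin (suc k) → Set} (xs : ∀ i → List (X i)) (M : Kernel X) → ∀ I {F G} → (∀ b → F b ≈ G b) → ∀ a → up xs M I F a ≈ up xs M I G a
  up-cong         xs M zero    h a = h a
  up-cong {suc k} xs M (suc I) h a = ∑-cong (xs (suc zero)) λ b → *-congˡ (up-cong _ _ I h b)

  up-* : {X : Fin (suc k) → Set} (xs : ∀ i → List (X i)) (M : Kernel X) → ∀ I c {F} a → up xs M I (λ b → c * F b) a ≈ c * up xs M I F a
  up-*         xs M zero    c a = refl
  up-* {suc k} xs M (suc I) c a = trans (∑-cong (xs (suc zero)) λ b → trans (*-congˡ (up-* _ _ I c b)) (x*yz≈y*xz _ _ _)) (∑-*ˡ c (xs (suc zero)))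

  dn-cong : {X : Fin (suc k) → Set} (xs : ∀ i → List (X i)) (M : Kernel X) → ∀ I {F G} → (∀ b → F b ≈ G b) → ∀ a → dn xs M I F a ≈ dn xs M I G a
  dn-cong {zero}  xs M zero    h a = h a
  dn-cong {suc k} xs M zero    h a = ∑-cong (xs (suc zero)) λ b → *-congˡ (dn-cong (λ i → xs (suc i)) (λ i → M (suc i)) zero h b)
  dn-cong {suc k} xs M (suc I) h a = dn-cong (λ i → xs (suc i)) (λ i → M (suc i)) I h a

  dn-* : {X : Fin (suc k) → Set} (xs : ∀ i → List (X i)) (M : Kernel X) → ∀ I c {F} a → dn xs M I (λ b → c * F b) a ≈ c * dn xs M I F a
  dn-* {zero}  xs M zero    c a = refl
  dn-* {suc k} xs M zero    c a = trans (∑-cong (xs (suc zero)) λ b → trans (*-congˡ (dn-* (λ i → xs (suc i)) (λ i → M (suc i)) zero c b)) (x*yz≈y*xz _ _ _)) (∑-*ˡ c (xs (suc zero)))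
  dn-* {suc k} xs M (suc I) c a = dn-* (λ i → xs (suc i)) (λ i → M (suc i)) I c a

  dn-∑ : {X : Fin (suc k) → Set} (xs : ∀ i → List (X i)) (M : Kernel X) → ∀ I {B : Set} (ys : List B) {F : B → X (fromℕ k) → Carrier} a →
         dn xs M I (λ l → ∑ ys (λ y → F y l)) a ≈ ∑ ys (λ y → dn xs M I (F y) a)
  dn-∑ {zero}  xs M zero    ys a = refl
  dn-∑ {suc k} xs M zero    ys a = trans (∑-cong (xs (suc zero)) λ b → trans (*-congˡ (dn-∑ (λ i → xs (suc i)) (λ i → M (suc i)) zero ys b)) (sym (∑-*ˡ _ ys))) (∑-swap (xs (suc zero)) ys)
  dn-∑ {suc k} xs M (suc I) ys a = dn-∑ (λ i → xs (suc i)) (λ i → M (suc i)) I ys a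

  closed-paths₀ : {X : Fin (suc k) → Set} (xs : ∀ i → List (X i)) (M : Kernel X) (r : X zero → X (fromℕ k) → Carrier) →
    ∑ (choices xs) (λ c → path M c * r (c zero) (c (fromℕ k))) ≈ ∑ (xs zero) (λ a → dn xs M zero (r a) a)
  closed-paths₀ {zero} xs M r = trans (∑-choices xs _ (λ a _ → 1# * r a a) (λ _ → refl))
    (∑-cong (xs zero) λ a → trans (+-identityʳ _) (*-identityˡ _))
  closed-paths₀ {suc k} {X} xs M r = trans
    (∑-choices xs _ (λ a c → path (λ i → M (suc i)) c * (M zero a (c zero) * r a (c (fromℕ k)))) λ c →
      trans (*-congʳ (∏-allFin k)) (trans (*-assoc _ _ _) (x*yz≈y*xz _ _ _)))
    (∑-cong (xs zero) λ a → trans (closed-paths₀ (λ i → xs (suc i)) (λ i → M (suc i)) (λ b l → M zero a b * r a l))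
      (∑-cong (xs (suc zero)) λ b → dn-* (λ i → xs (suc i)) (λ i → M (suc i)) zero _ b))

  -- A closed path is broken at cut I, where an arbitrary function g of the state may be inserted;
  -- later g fixes this state.
  closed-paths : {X : Fin (suc k) → Set} (xs : ∀ i → List (X i)) (M : Kernel X) (r : X zero → X (fromℕ k) → Carrier) →
    ∀ I (g : X I → Carrier) →
    ∑ (choices xs) (λ c → path M c * (r (c zero) (c (fromℕ k)) * g (c I))) ≈
    ∑ (xs zero) (λ a → up xs M I (λ b → g b * dn xs M I (r a) b) a)
  closed-paths xs M r zero g = trans (closed-paths₀ xs M λ a l → r a l * g a)
    (∑-cong (xs zero) λ a → trans (dn-cong xs M zero (λ l → *-comm _ _) a) (dn-* xs M zero (g a) a))
  closed-paths {suc k} xs M r (suc I) g = trans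
    (∑-choices xs _ (λ a c → path (λ i → M (suc i)) c * (M zero a (c zero) * r a (c (fromℕ k)) * g (c I))) λ c →
      trans (*-congʳ (∏-allFin k)) (solve 4 (λ m p r g → m :* p :* (r :* g) := p :* (m :* r :* g)) refl _ _ _ _))
    (∑-cong (xs zero) λ a → trans (closed-paths (λ i → xs (suc i)) (λ i → M (suc i)) (λ b l → M zero a b * r a l) I g)
      (∑-cong (xs (suc zero)) λ b → trans
        (up-cong _ _ I (λ b′ → trans (*-congˡ (dn-* _ _ I _ b′)) (x*yz≈y*xz _ _ _)) b) (up-* _ _ I _ b)))

  δS : ∀ {N} s → State N s → State N s → Carrier
  δS []      A b = 1#
  δS (a ∷ s) A b = ι (b zero ≟ˢ A zero) * δS s (A ∘ suc) (b ∘ suc)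

  δS-guard : ∀ {N} s (A b : State N s) {u v} → ((∀ j → b j ≡ A j) → u ≈ v) → δS s A b * u ≈ δS s A b * v
  δS-guard []      A b h = *-congˡ (h λ ())
  δS-guard (a ∷ s) A b h = trans (*-assoc _ _ _) (trans (ι-guard (b zero ≟ˢ A zero) λ e →
    δS-guard s (A ∘ suc) (b ∘ suc) λ es → h λ { zero → e ; (suc j) → es j }) (sym (*-assoc _ _ _)))

  -- States are functions compared pointwise, so g is required to respect pointwise equality.
  ∑-states-pick : ∀ {N} s (g : State N s → Carrier) → (∀ A B → (∀ j → A j ≡ B j) → g A ≈ g B) → ∀ b →
                  ∑ (states N s) (λ A → δS s A b * g A) ≈ g b
  ∑-states-pick []      g ext b = trans (+-identityʳ _) (trans (*-identityˡ _) (ext _ b λ ()))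
  ∑-states-pick {N} (a ∷ s) g ext b = begin
    ∑ (states N (a ∷ s)) (λ A → δS (a ∷ s) A b * g A)
      ≈⟨ ∑-choices (λ _ → subsets N) _ (λ X A → ι (b zero ≟ˢ X) * (δS s A (b ∘ suc) * g (put X A))) (λ A → trans (*-assoc _ _ _) (*-congˡ (*-congˡ (ext _ _ λ { zero → ≡.refl ; (suc j) → ≡.refl })))) ⟩
    ∑ (subsets N) (λ X → ∑ (states N s) (λ A → ι (b zero ≟ˢ X) * (δS s A (b ∘ suc) * g (put X A))))
      ≈⟨ ∑-cong (subsets N) (λ X → trans (∑-*ˡ _ (states N s)) (*-congˡ (∑-states-pick s (λ A → g (put X A)) (λ A B h → ext _ _ λ { zero → ≡.refl ; (suc j) → h j }) (b ∘ suc)))) ⟩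
    ∑ (subsets N) (λ X → ι (b zero ≟ˢ X) * g (put X (b ∘ suc)))
      ≈⟨ ∑-subsets-pick (b zero) ⟩
    g (put (b zero) (b ∘ suc))
      ≈⟨ ext _ _ (λ { zero → ≡.refl ; (suc j) → ≡.refl }) ⟩
    g b ∎
    where
    put : Subset N → State N s → State N (a ∷ s)
    put X A zero    = X
    put X A (suc j) = A j

  contS : ∀ {N} s → State N s → Vec ℕ N
  contS {N} []      A = replicate N 0
  contS     (a ∷ s) A = zipWith ℕ._+_ (Vec.map bit (A zero)) (contS s (A ∘ suc))

  contS-ext : ∀ {N} s {A B : State N s} → (∀ j → A j ≡ B j) → contS s A ≡ contS s B
  contS-ext []      h = ≡.refl
  contS-ext (a ∷ s) h = ≡.cong₂ (λ X v → zipWith ℕ._+_ (Vec.map bit X) v) (h zero) (contS-ext s (h ∘ suc))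

  cont-Orders : ∀ {N} {A : Subset N} {u} → Orders A u → cont u ≡ Vec.map bit A
  cont-Orders {N} [] = ≡.sym (Vec.map-replicate bit false N)
  cont-Orders {A = A} (_then_ {y = y} {w = w} y∈A o) = ≡.trans (≡.cong (λ c → updateAt c y suc) (cont-Orders o)) (add y A y∈A)
    where
    add : ∀ {N} (y : Fin N) A → lookup A y ≡ true → updateAt (Vec.map bit (del y A)) y suc ≡ Vec.map bit A
    add zero    (true ∷ A) h = ≡.refl
    add (suc y) (a ∷ A)    h = ≡.cong (bit a ∷_) (add y A h)

  cont-OrdersS : ∀ {N} {s} {A : State N s} {w} → OrdersS s A w → cont w ≡ contS s A
  cont-OrdersS nil = ≡.refl
  cont-OrdersS (cons {u = u} {v} o ∣A∣ os) = ≡.trans (cont-++ u v) (≡.cong₂ (zipWith ℕ._+_) (cont-Orders o) (cont-OrdersS os))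

  -- A web cut open at its first cut, with closing layer from the last cut to t₀.
  module Cylinder (t₀ : List ℕ) where

    Layers : (th : Fin (suc k) → List ℕ) → Set
    Layers {k} th = (i : Fin k) → Layer (th (inject₁ i)) (th (suc i))

    -- `upH` is the product of the layers from cut zero to I, and `dnH` that from I through the
    -- closing layer. Multiplied in one order they go once around from cut zero, in the other order
    -- once around from cut I.
    upH : (th : Fin (suc k) → List ℕ) → Layers th → Fin (suc k) → H
    upH         th ly zero    = sc 1#
    upH {suc k} th ly (suc I) = layerH (ly zero) ⊙ upH (λ i → th (suc i)) (λ i → ly (suc i)) I

    dnH : (th : Fin (suc k) → List ℕ) → Layers th → Layer (th (fromℕ k)) t₀ → Fin (suc k) → H
    dnH {zero}  th ly cl zero    = layerH cl
    dnH {suc k} th ly cl zero    = layerH (ly zero) ⊙ dnH (λ i → th (suc i)) (λ i → ly (suc i)) cl zero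
    dnH {suc k} th ly cl (suc I) = dnH (λ i → th (suc i)) (λ i → ly (suc i)) cl I

    upH-dnH : {A : Set} (O : Order A) (th : Fin (suc k) → List ℕ) (ly : Layers th) (cl : Layer (th (fromℕ k)) t₀) → ∀ I f w →
              Act.⟪_⟫ O (upH th ly I ⊙ dnH th ly cl I) f w ≈ Act.⟪_⟫ O (dnH th ly cl zero) f w
    upH-dnH         O th ly cl zero    f w = *-identityˡ _
    upH-dnH {suc k} O th ly cl (suc I) f w = Act.⟪⟫-ext O (layerH (ly zero)) (upH-dnH O (λ i → th (suc i)) (λ i → ly (suc i)) cl I f) w

    -- The factorials that `S-layer` collects on the two parts, one set for the lower cut of each
    -- layer; together they give `total`, which does not depend on I.
    upF dnF : (th : Fin (suc k) → List ℕ) → Fin (suc k) → Carrier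
    upF         th zero    = 1#
    upF {suc k} th (suc I) = factors (th zero) * upF (λ i → th (suc i)) I
    dnF {zero}  th zero    = factors (th zero)
    dnF {suc k} th zero    = factors (th zero) * dnF (λ i → th (suc i)) zero
    dnF {suc k} th (suc I) = dnF (λ i → th (suc i)) I

    total : (Fin (suc k) → List ℕ) → Carrier
    total {k} th = ∏ (allFin (suc k)) (λ i → factors (th i))

    upF-dnF : (th : Fin (suc k) → List ℕ) → ∀ I → upF th I * dnF th I ≈ total th
    upF-dnF {zero}  th zero    = trans (*-identityˡ _) (sym (*-identityʳ _))
    upF-dnF {suc k} th zero    = trans (*-identityˡ _) (trans (*-congˡ (trans (sym (*-identityˡ _)) (upF-dnF (λ i → th (suc i)) zero))) (sym (∏-allFin (suc k))))
    upF-dnF {suc k} th (suc I) = trans (*-assoc _ _ _) (trans (*-congˡ (upF-dnF (λ i → th (suc i)) I)) (sym (∏-allFin (suc k))))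

    module Operators {N} (O : Order (Fin N)) (x+p≈0 : x + p ≈ 0#) where
      open Transfer O x+p≈0
      open Act O
      open Delta (Fin._≟_ {N})

      kernel : (th : Fin (suc k) → List ℕ) → Layers th → Kernel (λ i → State N (th i))
      kernel th ly i A B = wt (ly i) A B * sz (th (suc i)) B

      cuts : (th : Fin (suc k) → List ℕ) → ∀ i → List (State N (th i))
      cuts th i = states N (th i)

      S-up : (th : Fin (suc k) → List ℕ) (ly : Layers th) → ∀ I f A → Sized (th zero) A →
             S (th zero) A (⟪ upH th ly I ⟫ f) ≈ upF th I * up (cuts th) (kernel th ly) I (λ B → S (th I) B f) A
      S-up         th ly zero    f A sized = S-*ˡ (th zero) A 1#
      S-up {suc k} th ly (suc I) f A sized = begin
        S (th zero) A (⟪ layerH (ly zero) ⟫ (⟪ upH th′ ly′ I ⟫ f))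
          ≈⟨ S-layer (ly zero) A _ sized ⟩
        factors (th zero) * ∑ (states N (th (suc zero))) (λ B → wt (ly zero) A B * (sz (th (suc zero)) B * S (th (suc zero)) B (⟪ upH th′ ly′ I ⟫ f)))
          ≈⟨ *-congˡ (∑-cong (states N (th (suc zero))) λ B → trans (*-congˡ (sz-guard (th (suc zero)) B (S-up th′ ly′ I f B)))
               (solve 4 (λ w s u y → w :* (s :* (u :* y)) := u :* (w :* s :* y)) refl _ _ _ _)) ⟩
        factors (th zero) * ∑ (states N (th (suc zero))) (λ B → upF th′ I * (kernel th ly zero A B * up (cuts th′) (kernel th′ ly′) I (λ B → S (th (suc I)) B f) B))
          ≈⟨ trans (*-congˡ (∑-*ˡ _ (states N (th (suc zero))))) (sym (*-assoc _ _ _)) ⟩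
        factors (th zero) * upF th′ I * up (cuts th) (kernel th ly) (suc I) (λ B → S (th (suc I)) B f) A ∎
        where
        th′ = λ i → th (suc i)
        ly′ = λ i → ly (suc i)

      S-dn : (th : Fin (suc k) → List ℕ) (ly : Layers th) (cl : Layer (th (fromℕ k)) t₀) → ∀ I f A → Sized (th I) A →
             S (th I) A (⟪ dnH th ly cl I ⟫ f) ≈ dnF th I * dn (cuts th) (kernel th ly) I (λ L → J cl L f) A
      S-dn {zero}  th ly cl zero f A sized = S-layer cl A f sized
      S-dn {suc k} th ly cl zero f A sized = begin
        S (th zero) A (⟪ layerH (ly zero) ⟫ (⟪ dnH th′ ly′ cl zero ⟫ f))
          ≈⟨ S-layer (ly zero) A _ sized ⟩
        factors (th zero) * ∑ (states N (th (suc zero))) (λ B → wt (ly zero) A B * (sz (th (suc zero)) B * S (th (suc zero)) B (⟪ dnH th′ ly′ cl zero ⟫ f)))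
          ≈⟨ *-congˡ (∑-cong (states N (th (suc zero))) λ B → trans (*-congˡ (sz-guard (th (suc zero)) B (S-dn th′ ly′ cl zero f B)))
               (solve 4 (λ w s u y → w :* (s :* (u :* y)) := u :* (w :* s :* y)) refl _ _ _ _)) ⟩
        factors (th zero) * ∑ (states N (th (suc zero))) (λ B → dnF th′ zero * (kernel th ly zero A B * dn (cuts th′) (kernel th′ ly′) zero (λ L → J cl L f) B))
          ≈⟨ trans (*-congˡ (∑-*ˡ _ (states N (th (suc zero))))) (sym (*-assoc _ _ _)) ⟩
        factors (th zero) * dnF th′ zero * dn (cuts th) (kernel th ly) zero (λ L → J cl L f) A ∎
        where
        th′ = λ i → th (suc i)
        ly′ = λ i → ly (suc i)
      S-dn {suc k} th ly cl (suc I) f A sized = S-dn (λ i → th (suc i)) (λ i → ly (suc i)) cl I f A sized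

      dn-absorb : (th : Fin (suc k) → List ℕ) (ly : Layers th) (cl : Layer (th (fromℕ k)) t₀) → ∀ I f {A w} → OrdersS (th I) A w →
                  factors (th I) * ⟪ dnH th ly cl I ⟫ f w ≈ ewts (th I) w * S (th I) A (⟪ dnH th ly cl I ⟫ f)
      dn-absorb {zero}  th ly cl zero    f os = layer-absorb cl f os
      dn-absorb {suc k} th ly cl zero    f os = layer-absorb (ly zero) _ os
      dn-absorb {suc k} th ly cl (suc I) f os = dn-absorb (λ i → th (suc i)) (λ i → ly (suc i)) cl I f os

      dn-vanishes : (th : Fin (suc k) → List ℕ) (ly : Layers th) (cl : Layer (th (fromℕ k)) t₀) → ∀ w → length w ≡ sum (th zero) →
                    (∀ f → ⟪ dnH th ly cl zero ⟫ f w ≈ 0#) ⊎ Distinct (th zero) w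
      dn-vanishes {zero}  th ly cl w l = layer-vanishes cl w l
      dn-vanishes {suc k} th ly cl w l with layer-vanishes (ly zero) w l
      ... | inj₁ h = inj₁ λ f → h _
      ... | inj₂ d = inj₂ d

      up-sized : (th : Fin (suc k) → List ℕ) (ly : Layers th) → ∀ I {F G : State N (th I) → Carrier} → (∀ B → Sized (th I) B → F B ≈ G B) →
                 ∀ A → Sized (th zero) A → up (cuts th) (kernel th ly) I F A ≈ up (cuts th) (kernel th ly) I G A
      up-sized         th ly zero    h A sized = h A sized
      up-sized {suc k} th ly (suc I) h A sized = ∑-cong (states N (th (suc zero))) λ B → trans (*-assoc _ _ _)
        (trans (*-congˡ (sz-guard (th (suc zero)) B (up-sized (λ i → th (suc i)) (λ i → ly (suc i)) I h B))) (sym (*-assoc _ _ _)))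

      wt-ext : ∀ {s t} (ℓ : Layer s t) {A A′ : State N s} {B B′ : State N t} → (∀ j → A j ≡ A′ j) → (∀ j → B j ≡ B′ j) → wt ℓ A B ≈ wt ℓ A′ B′
      wt-ext []            h h′ = refl
      wt-ext (strand a ℓ)  h h′ = *-cong (reflexive (≡.cong₂ (λ A B → ι (A ≟ˢ B)) (h zero) (h′ zero))) (wt-ext ℓ (h ∘ suc) (h′ ∘ suc))
      wt-ext (merge a b ℓ) {A} {A′} {B} {B′} h h′ = *-cong
        (reflexive (≡.trans (≡.cong₂ (λ X Y → du X Y (B zero)) (h zero) (h (suc zero))) (≡.cong (du (A′ zero) (A′ (suc zero))) (h′ zero))))
        (*-cong (reflexive (≡.cong₂ cross (h zero) (h (suc zero)))) (wt-ext ℓ (λ j → h (suc (suc j))) (h′ ∘ suc)))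
      wt-ext (split a b ℓ) {A} {A′} {B} {B′} h h′ = *-cong
        (reflexive (≡.trans (≡.cong₂ (λ X Y → du X Y (A zero)) (h′ zero) (h′ (suc zero))) (≡.cong (du (B′ zero) (B′ (suc zero))) (h zero))))
        (wt-ext ℓ (h ∘ suc) (λ j → h′ (suc (suc j))))

      dn-ext : (th : Fin (suc k) → List ℕ) (ly : Layers th) → ∀ I {F} → (∀ L L′ → (∀ j → L j ≡ L′ j) → F L ≈ F L′) →
               ∀ A A′ → (∀ j → A j ≡ A′ j) → dn (cuts th) (kernel th ly) I F A ≈ dn (cuts th) (kernel th ly) I F A′
      dn-ext {zero}  th ly zero    ext A A′ h = ext A A′ h
      dn-ext {suc k} th ly zero    ext A A′ h = ∑-cong (states N (th (suc zero))) λ B → *-congʳ (*-congʳ (wt-ext (ly zero) h λ _ → ≡.refl))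
      dn-ext {suc k} th ly (suc I) ext A A′ h = dn-ext (λ i → th (suc i)) (λ i → ly (suc i)) I ext A A′ h

      -- Of the sets of size a, only the set of its own letters has w among its orderings, and it
      -- has it once.
      sym-δ : ∀ a {A B : Subset N} {w} → Orders A w → ∣ A ∣ ≡ a → ∣ B ∣ ≡ a → sym-sum a B (δ w) ≈ ι (B ≟ˢ A)
      sym-δ zero    {A} {B} [] ∣A∣ ∣B∣ rewrite ∣∣≡0⇒∅ B ∣B∣ = sym (ι-yes (∅ {N} ≟ˢ ∅) ≡.refl)
      sym-δ zero    {A} {B} (_then_ {y = y} y∈A o) ∣A∣ ∣B∣ = ⊥-elim (true≢false (≡.trans (≡.sym y∈A) (≡.trans (≡.cong (λ C → lookup C y) (∣∣≡0⇒∅ A ∣A∣)) (lookup-∅ y))))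
      sym-δ (suc a) {B = B} [] ∣A∣ ∣B∣ with () ← ≡.trans (≡.sym (∣∅∣ N)) ∣A∣
      sym-δ (suc a) {A} {B} (_then_ {y = y} {w = w} y∈A o) ∣A∣ ∣B∣ = begin
        ∑ (allFin N) (λ u → 𝟙 (lookup B u) * sym-sum a (del u B) (λ v → δ (y ∷ w) (u ∷ v)))
          ≈⟨ ∑-cong (allFin N) (λ u → *-congˡ (trans (sym-ext a (del u B) λ v → 𝟙-∧ (does (u Fin.≟ y)) (does (δ? w v))) (sym-*ˡ a (del u B) (ι (u Fin.≟ y))))) ⟩
        ∑ (allFin N) (λ u → 𝟙 (lookup B u) * (ι (u Fin.≟ y) * sym-sum a (del u B) (δ w)))
          ≈⟨ trans (∑-cong (allFin N) λ u → x*yz≈y*xz _ _ _) (∑-allFin-pick y) ⟩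
        𝟙 (lookup B y) * sym-sum a (del y B) (δ w)
          ≈⟨ 𝟙-guard (lookup B y) (λ y∈B → trans (sym-δ a o (∣del∣ y A y∈A ∣A∣) (∣del∣ y B y∈B ∣B∣))
               (ι-cong (del y B ≟ˢ del y A) (B ≟ˢ A) (λ h → ≡.trans (≡.sym (ins-del y B y∈B)) (≡.trans (≡.cong (ins y) h) (ins-del y A y∈A))) (≡.cong (del y)))) ⟩
        𝟙 (lookup B y) * ι (B ≟ˢ A)
          ≈⟨ trans (*-comm _ _) (ι-guard (B ≟ˢ A) (λ h → reflexive (≡.cong 𝟙 (≡.trans (≡.cong (λ C → lookup C y) h) y∈A)))) ⟩
        ι (B ≟ˢ A) * 1#
          ≈⟨ *-identityʳ _ ⟩
        ι (B ≟ˢ A) ∎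
        where
        ∑-allFin-pick : ∀ {N} (y : Fin N) {F : Fin N → Carrier} → ∑ (allFin N) (λ u → ι (u Fin.≟ y) * F u) ≈ F y
        ∑-allFin-pick {suc N} zero    {F} = trans (∑-allFin N) (trans (+-cong (*-identityˡ _) (∑-0 (allFin N) λ u → zeroˡ _)) (+-identityʳ _))
        ∑-allFin-pick {suc N} (suc y) {F} = trans (∑-allFin N) (trans (+-cong (zeroˡ _)
          (trans (∑-cong (allFin N) λ u → *-congʳ (ι-cong (suc u Fin.≟ suc y) (u Fin.≟ y) Fin.suc-injective (≡.cong suc))) (∑-allFin-pick y))) (+-identityˡ _))

      -- Among states of the right sizes, the delta function at an ordering of A becomes the
      -- indicator of A.
      S-δ : ∀ s {A w} B → OrdersS s A w → Sized s B → S s B (δ w) ≈ δS s A B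
      S-δ []      B nil sized = δ-refl []
      S-δ (a ∷ s) {A} B (cons {u = u} {v} o ∣A∣ os) sized = begin
        sym-sum a (B zero) (λ u′ → S s (B ∘ suc) (λ v′ → δ (u ++ v) (u′ ++ v′)))
          ≈⟨ sym-cong a (B zero) (sized zero) (λ u′ o′ → trans
               (S-ext s (B ∘ suc) λ v′ → δ-++ u′ u v′ v (≡.trans (≡.trans (Orders⇒length o′) (sized zero)) (≡.sym (≡.trans (Orders⇒length o) ∣A∣))))
               (S-*ˡ s (B ∘ suc) (δ u u′))) ⟩
        sym-sum a (B zero) (λ u′ → δ u u′ * S s (B ∘ suc) (δ v))
          ≈⟨ trans (sym-*ʳ a (B zero) _) (*-cong (sym-δ a o ∣A∣ (sized zero)) (S-δ s (B ∘ suc) os (sized ∘ suc))) ⟩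
        δS (a ∷ s) A B ∎

  module ClosedWeb {N} (O : Order (Fin N)) (x+p≈0 : x + p ≈ 0#)
                   (th : Fin (suc k) → List ℕ) (ly : (i : Fin k) → Layer (th (inject₁ i)) (th (suc i)))
                   (cl : Layer (th (fromℕ k)) (th zero)) where
    open Transfer O x+p≈0
    open Act O
    open Delta (Fin._≟_ {N})
    open Cylinder (th zero)
    open Operators O x+p≈0

    closingKernel : State N (th zero) → State N (th (fromℕ k)) → Carrier
    closingKernel A L = wt cl L A * sz (th zero) A

    -- The state sum of the closed web with an observable g. Fixing the state at a cut gives loop
    -- decompositions; recording the content gives colorings.
    partition : ((∀ i → State N (th i)) → Carrier) → Carrier
    partition g = ∑ (choices (cuts th)) λ c → path (kernel th ly) c * (closingKernel (c zero) (c (fromℕ k)) * g c)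

    private
      xs = cuts th
      M = kernel th ly

    -- `dn-absorb` replaces the single word w by a sum over the orderings of A, after which all
    -- layers act on states; `S-δ` turns the closing delta into the condition that the path returns
    -- to A at cut I.
    diagonal : ∀ I {A w} → OrdersS (th I) A w →
      factors (th I) * ⟪ dnH th ly cl I ⊙ upH th ly I ⟫ (δ w) w ≈ ewts (th I) w * (total th * partition (λ c → δS (th I) A (c I)))
    diagonal I {A} {w} os = begin
      factors (th I) * ⟪ dnH th ly cl I ⟫ (⟪ upH th ly I ⟫ (δ w)) w
        ≈⟨ dn-absorb th ly cl I _ os ⟩
      ewts (th I) w * S (th I) A (⟪ dnH th ly cl I ⟫ (⟪ upH th ly I ⟫ (δ w)))
        ≈⟨ *-congˡ (trans (S-dn th ly cl I _ A (OrdersS⇒Sized os)) (*-congˡ (dn-cong xs M I inner A))) ⟩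
      ewts (th I) w * (dnF th I * dn xs M I (λ L → upF th I * ∑ (states N (th zero)) (λ B → closingKernel B L * up xs M I (δS (th I) A) B)) A)
        ≈⟨ *-congˡ (trans (*-congˡ (dn-* xs M I (upF th I) A)) (trans (x*yz≈y*xz _ _ _) (trans (sym (*-assoc _ _ _)) (*-congʳ (upF-dnF th I))))) ⟩
      ewts (th I) w * (total th * dn xs M I (λ L → ∑ (states N (th zero)) (λ B → closingKernel B L * up xs M I (δS (th I) A) B)) A)
        ≈⟨ *-congˡ (*-congˡ (sym loops)) ⟩
      ewts (th I) w * (total th * partition (λ c → δS (th I) A (c I))) ∎
      where
      inner : ∀ L → J cl L (⟪ upH th ly I ⟫ (δ w)) ≈ upF th I * ∑ (states N (th zero)) (λ B → closingKernel B L * up xs M I (δS (th I) A) B)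
      inner L = trans (∑-cong (states N (th zero)) λ B → trans
          (*-congˡ (sz-guard (th zero) B λ sized → trans (S-up th ly I (δ w) B sized)
            (*-congˡ (up-sized th ly I (λ b → S-δ (th I) b os) B sized))))
          (solve 4 (λ w s u y → w :* (s :* (u :* y)) := u :* (w :* s :* y)) refl _ _ _ _))
        (∑-*ˡ _ (states N (th zero)))
      loops : partition (λ c → δS (th I) A (c I)) ≈ dn xs M I (λ L → ∑ (states N (th zero)) (λ B → closingKernel B L * up xs M I (δS (th I) A) B)) A
      loops = begin
        partition (λ c → δS (th I) A (c I))
          ≈⟨ closed-paths xs M closingKernel I (δS (th I) A) ⟩
        ∑ (states N (th zero)) (λ B → up xs M I (λ b → δS (th I) A b * dn xs M I (closingKernel B) b) B)
          ≈⟨ ∑-cong (states N (th zero)) (λ B → trans (up-cong xs M I (λ b → trans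
               (δS-guard (th I) A b λ h → dn-ext th ly I (λ L L′ e → *-congʳ (wt-ext cl e λ _ → ≡.refl)) b A h) (*-comm _ _)) B)
               (trans (up-* xs M I (dn xs M I (closingKernel B) A) B) (*-comm _ _))) ⟩
        ∑ (states N (th zero)) (λ B → up xs M I (δS (th I) A) B * dn xs M I (closingKernel B) A)
          ≈⟨ ∑-cong (states N (th zero)) (λ B → trans (dn-cong xs M I (λ L → *-comm _ _) A) (dn-* xs M I (up xs M I (δS (th I) A) B) A)) ⟨
        ∑ (states N (th zero)) (λ B → dn xs M I (λ L → closingKernel B L * up xs M I (δS (th I) A) B) A)
          ≈⟨ dn-∑ xs M I (states N (th zero)) A ⟨
        dn xs M I (λ L → ∑ (states N (th zero)) (λ B → closingKernel B L * up xs M I (δS (th I) A) B)) A ∎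

    -- Contributing words are orderings of a state of cut zero, each is evaluated by `diagonal`, and
    -- their weights sum to factorials. The common factor remains on both sides because nothing is
    -- assumed invertible yet.
    trace : ∀ β → factors (th zero) * ∑ (words N (sum (th zero))) (λ w → χ β w * ⟪ dnH th ly cl zero ⊙ upH th ly zero ⟫ (δ w) w) ≈
                  factors (th zero) * (total th * partition (λ c → ι (contS (th zero) (c zero) ≟ᵛ β)))
    trace β = begin
      factors t * ∑ (words N (sum t)) F
        ≈⟨ *-congˡ (∑-words-states t F vanish) ⟩
      factors t * ∑ (states N t) (λ A → sz t A * S t A F)
        ≈⟨ trans (sym (∑-*ˡ _ (states N t))) (∑-cong (states N t) λ A → trans (x*yz≈y*xz _ _ _) (sz-guard t A (per-state A))) ⟩
      ∑ (states N t) (λ A → sz t A * (factors t * (total th * (χS A * partition (λ c → δS t A (c zero))))))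
        ≈⟨ trans (∑-cong (states N t) λ A → solve 5 (λ s f T c p → s :* (f :* (T :* (c :* p))) := f :* T :* (s :* (c :* p))) refl _ _ _ _ _) (trans (∑-*ˡ _ (states N t)) (*-assoc _ _ _)) ⟩
      factors t * (total th * ∑ (states N t) (λ A → sz t A * (χS A * partition (λ c → δS t A (c zero)))))
        ≈⟨ *-congˡ (*-congˡ (trans (∑-cong (states N t) λ A → trans (sym (*-assoc _ _ _)) (trans (sym (∑-*ˡ _ (choices xs))) (∑-cong (choices xs) λ c →
             solve 5 (λ s c p r d → s :* c :* (p :* (r :* d)) := p :* (r :* (d :* (s :* c)))) refl _ _ _ _ _)))
             (∑-swap (states N t) (choices xs)))) ⟩
      factors t * (total th * ∑ (choices xs) (λ c → ∑ (states N t) (λ A → path M c * (closingKernel (c zero) (c (fromℕ k)) * (δS t A (c zero) * (sz t A * χS A))))))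
        ≈⟨ *-congˡ (*-congˡ (∑-cong (choices xs) λ c → trans (∑-*ˡ _ (states N t)) (*-congˡ (trans (∑-*ˡ _ (states N t)) (trans
             (*-congˡ (∑-states-pick t (λ A → sz t A * χS A) (λ A B h → *-cong (sz-ext t h) (reflexive (≡.cong (λ v → ι (v ≟ᵛ β)) (contS-ext t h)))) (c zero)))
             (trans (*-assoc _ _ _) (trans (*-congˡ (sz-guard t (c zero) λ sized → trans (*-congʳ (sz-Sized t (c zero) sized)) (*-identityˡ _))) (sym (*-assoc _ _ _)))))))) ) ⟩
      factors t * (total th * partition (λ c → χS (c zero))) ∎
      where
      t = th zero
      χS : State N t → Carrier
      χS A = ι (contS t A ≟ᵛ β)
      h = dnH th ly cl zero ⊙ upH th ly zero
      F : List (Fin N) → Carrier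
      F w = χ β w * ⟪ h ⟫ (δ w) w
      vanish : ∀ w → length w ≡ sum t → F w ≈ 0# ⊎ Distinct t w
      vanish w l with dn-vanishes th ly cl w l
      ... | inj₁ z = inj₁ (trans (*-congˡ (z _)) (zeroʳ _))
      ... | inj₂ d = inj₂ d
      sz-ext : ∀ s {A B : State N s} → (∀ j → A j ≡ B j) → sz s A ≈ sz s B
      sz-ext []      h = refl
      sz-ext (a ∷ s) h = *-cong (reflexive (≡.cong (λ X → ι (∣ X ∣ ℕ.≟ a)) (h zero))) (sz-ext s (h ∘ suc))
      per-state : ∀ A → Sized t A → factors t * S t A F ≈ factors t * (total th * (χS A * partition (λ c → δS t A (c zero))))
      per-state A sized = begin
        factors t * S t A F
          ≈⟨ S-*ˡ t A (factors t) ⟨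
        S t A (λ w → factors t * (χ β w * ⟪ h ⟫ (δ w) w))
          ≈⟨ S-cong t A sized (λ w os → trans (x*yz≈y*xz _ _ _) (trans (*-cong (reflexive (≡.cong (λ v → ι (v ≟ᵛ β)) (cont-OrdersS os))) (diagonal zero os)) (x*yz≈y*xz _ _ _))) ⟩
        S t A (λ w → ewts t w * (χS A * (total th * partition (λ c → δS t A (c zero)))))
          ≈⟨ trans (S-*ʳ t A _) (*-cong (S-ewts t A sized) (x*yz≈y*xz _ _ _)) ⟩
        factors t * (total th * (χS A * partition (λ c → δS t A (c zero)))) ∎

-- State sums rewritten as sums over labelings of edges.

module Labelings (R : CommutativeSemiring 0ℓ 0ℓ) (z p x : CommutativeSemiring.Carrier R) where

  open import Data.Bool.Base using (Bool; true; false; if_then_else_)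
  open import Data.Empty using (⊥; ⊥-elim)
  open import Data.Fin.Base as Fin using (Fin; zero; suc; inject₁; fromℕ; _↑ˡ_; _↑ʳ_)
  import Data.Fin.Properties as Fin
  open import Data.Fin.Subset using (Subset; ∣_∣; _∪_; _∩_) renaming (⊥ to ∅; ⊤ to full)
  open import Data.List.Base as List hiding (lookup; merge; sum; tail; replicate; zipWith; updateAt; partition)
  import Data.List.Properties as List
  open import Data.List.Relation.Unary.All as All using (All; []; _∷_; all?)
  import Data.List.Relation.Unary.All.Properties as All
  open import Data.List.Relation.Unary.AllPairs using (AllPairs; []; _∷_)
  open import Data.Nat.Base as ℕ using (ℕ; zero; suc)
  import Data.Nat.Properties as ℕ
  open import Data.Nat.ListAction using (sum)
  open import Data.Product.Base using (_×_; _,_; proj₁; proj₂)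
  open import Data.Vec.Base as Vec using (Vec; []; _∷_; lookup)
  import Data.Vec.Properties as Vec
  open import Function.Base using (_∘_; id)
  open import Relation.Binary.PropositionalEquality as ≡ using (_≡_)
  open import Relation.Nullary.Decidable using (Dec; yes; no; does; _×-dec_)

  open import Defs using (Layer; []; strand; merge; split; Web; Node; through; mergeNode; splitNode; layerNodes; nodes; merges; edges; Labeling; labelings; sizesMatch?; disjointUnions?; block; choices; _≟ˢ_)
  open Sums R
  open Hecke R z p x
  open Subsets
  open Antisym R z p x
  open Words R z p x
  open Layers R z p x
  open Paths R z p x

  ι-× : {P Q : Set} (d : Dec P) (d′ : Dec Q) → ι (d ×-dec d′) ≈ ι d * ι d′
  ι-× d d′ = 𝟙-∧ (does d) (does d′)

  ι-all : {A : Set} {P : A → Set} (P? : ∀ a → Dec (P a)) (xs : List A) → ι (all? P? xs) ≈ ∏ xs (λ a → ι (P? a))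
  ι-all P? []       = refl
  ι-all P? (a ∷ xs) = trans (𝟙-∧ (does (P? a)) (does (all? P? xs))) (*-congˡ (ι-all P? xs))

  if-yes : {P : Set} (d : Dec P) {a b : Carrier} → P → (if does d then a else b) ≈ a
  if-yes (yes _) _ = refl
  if-yes (no ¬h) h = ⊥-elim (¬h h)

  if-no : {P : Set} (d : Dec P) {a b : Carrier} → (P → ⊥) → (if does d then a else b) ≈ b
  if-no (yes h) ¬h = ⊥-elim (¬h h)
  if-no (no _)  _  = refl

  module Weighted {N} (O : Order (Fin N)) (x+p≈0 : x + p ≈ 0#) where
    open Transfer O x+p≈0

    module _ {E : Set} (c : E → Subset N) where
      nodeCross : Node E → Carrier
      nodeCross (through e₀ e₁)     = 1#
      nodeCross (mergeNode eL eR e) = cross (c eL) (c eR)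
      nodeCross (splitNode e eL eR) = 1#

      nodeWeight : Node E → Carrier
      nodeWeight v = ι (disjointUnions? c v) * nodeCross v

      wt≈∏ : ∀ {s t} (ℓ : Layer s t) f g → wt ℓ (c ∘ f) (c ∘ g) ≈ ∏ (layerNodes ℓ f g) nodeWeight
      wt≈∏ []            f g = refl
      wt≈∏ (strand a ℓ)  f g = *-cong (sym (*-identityʳ _)) (wt≈∏ ℓ _ _)
      wt≈∏ (merge a b ℓ) f g = trans (sym (*-assoc _ _ _)) (*-cong (*-congʳ (sym (ι-× ((c (f zero) ∪ c (f (suc zero))) ≟ˢ c (g zero)) ((c (f zero) ∩ c (f (suc zero))) ≟ˢ ∅)))) (wt≈∏ ℓ _ _))
      wt≈∏ (split a b ℓ) f g = *-cong (trans (sym (ι-× ((c (g zero) ∪ c (g (suc zero))) ≟ˢ c (f zero)) ((c (g zero) ∩ c (g (suc zero))) ≟ˢ ∅))) (sym (*-identityʳ _))) (wt≈∏ ℓ _ _)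

      sz≈∏ : ∀ t f → sz t (c ∘ f) ≈ ∏ (allFin (length t)) (λ j → ι (∣ c (f j) ∣ ℕ.≟ List.lookup t j))
      sz≈∏ []      f = refl
      sz≈∏ (a ∷ t) f = trans (*-congˡ (sz≈∏ t (f ∘ suc))) (sym (∏-allFin (length t)))

    module _ (w : Web) where
      open Web w
      open Cylinder.Operators (thickness zero) O x+p≈0
      open ClosedWeb O x+p≈0 thickness layer closing

      weight : Labeling w N → Carrier
      weight c = ι (sizesMatch? w c) * (ι (all? (disjointUnions? c) (nodes w)) *
                   ∏ (merges w) (λ e → cross (c (proj₁ e)) (c (proj₂ e))))

      private
        ∏-merges : ∀ (c : Labeling w N) → ∏ (nodes w) (nodeCross c) ≈ ∏ (merges w) (λ e → cross (c (proj₁ e)) (c (proj₂ e)))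
        ∏-merges c = sym (trans (∏-concatMap _ (nodes w)) (∏-cong (nodes w) λ
          { (through _ _) → refl ; (mergeNode eL eR e) → *-identityʳ _ ; (splitNode _ _ _) → refl }))

        ∏-nodes : ∀ (c : Labeling w N) → ∏ (nodes w) (nodeWeight c) ≈
          ∏ (allFin k) (λ i → wt (layer i) (λ j → c (inject₁ i , j)) (λ j → c (suc i , j))) * wt closing (λ j → c (fromℕ k , j)) (λ j → c (zero , j))
        ∏-nodes c = trans (∏-++ (concatMap (λ i → layerNodes (layer i) (inject₁ i ,_) (suc i ,_)) (allFin k)) _)
          (*-cong (trans (∏-concatMap (λ i → layerNodes (layer i) (inject₁ i ,_) (suc i ,_)) (allFin k)) (∏-cong (allFin k) λ i → sym (wt≈∏ c (layer i) (inject₁ i ,_) (suc i ,_)))) (sym (wt≈∏ c closing (fromℕ k ,_) (zero ,_))))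

        ∏-edges : ∀ (c : Labeling w N) → ι (sizesMatch? w c) ≈ ∏ (allFin (suc k)) (λ I → sz (thickness I) (λ j → c (I , j)))
        ∏-edges c = trans (ι-all (λ e → ∣ c e ∣ ℕ.≟ thick e) (edges w)) (trans (∏-concatMap segment (allFin (suc k)))
          (∏-cong (allFin (suc k)) λ I → trans (∏-map (at I) (allFin (length (thickness I))) {λ e → ι (∣ c e ∣ ℕ.≟ thick e)}) (sym (sz≈∏ c (thickness I) (at I)))))
          where
          at : ∀ I → Fin (length (thickness I)) → Edge
          at I j = I , j
          segment : Cut → List Edge
          segment I = map (at I) (allFin (length (thickness I)))

        pointwise : ∀ (c : Labeling w N) G → path (kernel thickness layer) (λ I j → c (I , j)) *
                      (closingKernel (λ j → c (zero , j)) (λ j → c (fromℕ k , j)) * G) ≈ weight c * G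
        pointwise c G = begin
          ∏ (allFin k) (λ i → wt (layer i) (st (inject₁ i)) (st (suc i)) * sz (thickness (suc i)) (st (suc i))) * (wt closing (st (fromℕ k)) (st zero) * sz (thickness zero) (st zero) * G)
            ≈⟨ *-congʳ (∏-* (allFin k)) ⟩
          P * Z * (w₀ * z₀ * G)
            ≈⟨ solve 5 (λ p z w y g → p :* z :* (w :* y :* g) := (y :* z) :* (p :* w) :* g) refl P Z w₀ z₀ G ⟩
          (z₀ * Z) * (P * w₀) * G
            ≈⟨ *-congʳ (*-cong (trans (sym (∏-allFin k)) (sym (∏-edges c))) (trans (sym (∏-nodes c)) (trans (∏-* (nodes w)) (*-cong (sym (ι-all _ (nodes w))) (∏-merges c))))) ⟩
          weight c * G ∎
          where
          st : ∀ I → State N (thickness I)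
          st I j = c (I , j)
          P = ∏ (allFin k) (λ i → wt (layer i) (st (inject₁ i)) (st (suc i)))
          Z = ∏ (allFin k) (λ i → sz (thickness (suc i)) (st (suc i)))
          w₀ = wt closing (st (fromℕ k)) (st zero)
          z₀ = sz (thickness zero) (st zero)

      -- A labeling is a family of states, one for each cut; the factors of a path regroup into
      -- conditions on edges, conditions at nodes and weights of merges.
      partition≈ : (g : (∀ I → State N (thickness I)) → Carrier) →
        partition g ≈ ∑ (labelings w N) (λ c → weight c * g (λ I j → c (I , j)))
      partition≈ g = sym (trans (∑-map _ (choices (λ I → states N (thickness I))))
        (∑-cong (choices (λ I → states N (thickness I))) λ c → sym (pointwise (λ e → c (proj₁ e) (proj₂ e)) (g c))))

    δS≈ι : ∀ s (A b : State N s) (d : Dec (∀ j → b j ≡ A j)) → δS s A b ≈ ι d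
    δS≈ι s A b (yes h) = trans (sym (*-identityʳ _)) (trans (δS-one s A b h) refl)
      where
      δS-one : ∀ s (A b : State N s) → (∀ j → b j ≡ A j) → δS s A b * 1# ≈ 1#
      δS-one []      A b h = *-identityʳ _
      δS-one (a ∷ s) A b h = trans (*-assoc _ _ _) (trans (*-cong (ι-yes (b zero ≟ˢ A zero) (h zero)) (δS-one s (A ∘ suc) (b ∘ suc) (h ∘ suc))) (*-identityʳ _))
    δS≈ι s A b (no ¬h) = trans (sym (*-identityʳ _)) (trans (δS-guard s A b {1#} {0#} λ h → ⊥-elim (¬h h)) (zeroʳ _))

    ∏∈-cong : ∀ (A : Subset N) {F G : Fin N → Carrier} → (∀ y → lookup A y ≡ true → F y ≈ G y) → ∏∈ A F ≈ ∏∈ A G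
    ∏∈-cong A {F} {G} h = ∏-cong (allFin N) λ y → lemma y (lookup A y) ≡.refl
      where
      lemma : ∀ y b → lookup A y ≡ b → (if b then F y else 1#) ≈ (if b then G y else 1#)
      lemma y true  e = h y e
      lemma y false e = refl

    -- The contribution of the attacking pairs inside a block of the initial cut.
    blockWeight : Subset N → Carrier
    blockWeight A = ∏∈ A λ u → ∏∈ A λ v → if does (u Fin.<? v) then e (Order.cmp O u v) else 1#

    private
      open Weights O x+p≈0

      blockWeight-sorted : ∀ {A w} → Orders A w → AllPairs Fin._<_ w → blockWeight A ≈ ewt w
      blockWeight-sorted {A} {w} o sorted = trans (sym (∏≈∏∈ _ o)) (trans (∏-cong w λ u → sym (∏≈∏∈ _ o)) (pairs w sorted))
        where
        f : Fin N → Fin N → Carrier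
        f u v = if does (u Fin.<? v) then e (Order.cmp O u v) else 1#
        f-< : ∀ {u v} → u Fin.< v → f u v ≈ e (Order.cmp O u v)
        f-< {u} {v} l = if-yes (u Fin.<? v) l
        f-≮ : ∀ {u v} → (u Fin.< v → ⊥) → f u v ≈ 1#
        f-≮ {u} {v} ¬l = if-no (u Fin.<? v) ¬l
        above : ∀ u w → All (u Fin.<_) w → ∏ w (f u) ≈ ew u w
        above u []      []       = refl
        above u (v ∷ w) (l ∷ ls) = *-cong (f-< l) (above u w ls)
        below : ∀ u w → All (u Fin.<_) w → ∏ w (λ v → ∏ (u ∷ w) (f v)) ≈ ∏ w (λ v → ∏ w (f v))
        below u w ls = ∏-cong∈ w λ {v} v∈ → trans (*-congʳ (f-≮ (ℕ.<-asym (All.lookup ls v∈)))) (*-identityˡ _)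
        pairs : ∀ w → AllPairs Fin._<_ w → ∏ w (λ u → ∏ w (f u)) ≈ ewt w
        pairs []      []       = refl
        pairs (u ∷ w) (ls ∷ s) = *-cong (trans (*-congʳ (f-≮ (ℕ.<-irrefl ≡.refl))) (trans (*-identityˡ _) (above u w ls)))
          (trans (below u w ls) (pairs w s))

      sorted-++ : ∀ {u v : List (Fin N)} → AllPairs Fin._<_ (u ++ v) → AllPairs Fin._<_ u × AllPairs Fin._<_ v
      sorted-++ {[]}    s        = [] , s
      sorted-++ {a ∷ u} (l ∷ s) with sorted-++ {u} s
      ... | su , sv = All.++⁻ˡ u l ∷ su , sv

    -- Each block of a sorted word is listed increasingly, so its pairs u < v are exactly the pairs
    -- of positions weighed by `ewt`. The in-block attacking pairs thus reproduce the prefactor in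
    -- `diagonal`.
    blockWeights : ∀ {s} {A : State N s} {w} → OrdersS s A w → AllPairs Fin._<_ w →
                   ∏ (allFin (length s)) (λ j → blockWeight (A j)) ≈ ewts s w
    blockWeights nil sorted = refl
    blockWeights {a ∷ s} {A} (cons {u = u} {v} o ∣A∣ os) sorted with sorted-++ {u} sorted
    ... | su , sv = trans (∏-allFin (length s)) (trans (*-cong (blockWeight-sorted o su) (blockWeights os sv))
      (sym (ewts-++ s u v (≡.trans (Orders⇒length o) ∣A∣))))

  private
    tabulate-+ : ∀ {A : Set} a {m} (f : Fin (a ℕ.+ m) → A) → tabulate f ≡ tabulate (f ∘ (_↑ˡ m)) ++ tabulate (f ∘ (a ↑ʳ_))
    tabulate-+ zero    f = ≡.refl
    tabulate-+ (suc a) f = ≡.cong (f zero ∷_) (tabulate-+ a (f ∘ suc))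

    Orders-suc : ∀ {N} {A : Subset N} {w} → Orders A w → Orders (false ∷ A) (map suc w)
    Orders-suc []          = []
    Orders-suc (y∈A then o) = y∈A then Orders-suc o

    Orders-↑ʳ : ∀ {N} a {A : Subset N} {w} → Orders A w → Orders (∅ {a} Vec.++ A) (map (a ↑ʳ_) w)
    Orders-↑ʳ zero    {w = w} o = ≡.subst (Orders _) (≡.sym (List.map-id w)) o
    Orders-↑ʳ (suc a) {w = w} o = ≡.subst (Orders _) (≡.sym (List.map-∘ w)) (Orders-suc (Orders-↑ʳ a o))

    Orders-full : ∀ a m → Orders (full {a} Vec.++ ∅ {m}) (tabulate (_↑ˡ m))
    Orders-full zero    m = []
    Orders-full (suc a) m = ≡.refl then ≡.subst (Orders _) (List.map-tabulate (_↑ˡ m) suc) (Orders-suc (Orders-full a m))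

    OrdersS-↑ʳ : ∀ {N s} a {A : State N s} {w} → OrdersS s A w → OrdersS s (λ j → ∅ {a} Vec.++ A j) (map (a ↑ʳ_) w)
    OrdersS-↑ʳ a nil = nil
    OrdersS-↑ʳ {s = b ∷ s} a {A} (cons {u = u} {v} o ∣A∣ os) = ≡.subst (OrdersS _ _) (≡.sym (List.map-++ (a ↑ʳ_) u v))
      (cons (Orders-↑ʳ a o) (≡.trans (card a (A zero)) ∣A∣) (OrdersS-↑ʳ a os))
      where
      card : ∀ a {N} (A : Subset N) → ∣ ∅ {a} Vec.++ A ∣ ≡ ∣ A ∣
      card zero    A = ≡.refl
      card (suc a) A = card a A

  -- The blocks are consecutive intervals, so the identity word orders the initial state; this
  -- selects it as the word at which the label trace is read.
  OrdersS-block : ∀ t → OrdersS t (block t) (allFin (sum t))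
  OrdersS-block []      = nil
  OrdersS-block (a ∷ t) = ≡.subst (OrdersS (a ∷ t) (block (a ∷ t))) (≡.sym (tabulate-+ a id))
    (cons (Orders-full a (sum t)) (card a (sum t)) (≡.subst (OrdersS t _) (List.map-tabulate id (a ↑ʳ_)) (OrdersS-↑ʳ a (OrdersS-block t))))
    where
    card : ∀ a m → ∣ full {a} Vec.++ ∅ {m} ∣ ≡ a
    card zero    m = ∣∅∣ m
    card (suc a) m = ≡.cong suc (card a m)

-- Colorings and loop decompositions as values of the two traces.

module Evaluation (R : CommutativeSemiring 0ℓ 0ℓ) (z p x : CommutativeSemiring.Carrier R)
  (x+p≈0 : CommutativeSemiring._≈_ R (CommutativeSemiring._+_ R x p) (CommutativeSemiring.0# R))
  (qᶻ : ℤ → CommutativeSemiring.Carrier R) where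

  open import Data.Bool.Base using (Bool; true; false; if_then_else_)
  open import Data.Empty using (⊥-elim)
  open import Data.Fin.Base as Fin using (Fin; zero; suc; toℕ)
  import Data.Fin.Properties as Fin
  open import Data.Fin.Subset using (Subset; _∩_) renaming (⊥ to ∅)
  open import Data.Fin.Subset.Properties using (_∈?_)
  open import Data.List.Base as List hiding (lookup; merge; sum; tail; replicate; zipWith; updateAt; partition)
  import Data.List.Properties as List
  open import Data.List.Relation.Unary.All using (All; all?; universal)
  open import Data.List.Relation.Unary.AllPairs using (AllPairs)
  import Data.List.Relation.Unary.AllPairs.Properties as AllPairs
  open import Data.Nat.Base as ℕ using (ℕ; zero; suc; s≤s)
  import Data.Nat.Properties as ℕ
  open import Data.Nat.ListAction using (sum)
  open import Data.Product.Base using (_×_; _,_; proj₁; proj₂)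
  open import Data.Unit.Base using (⊤; tt)
  open import Data.Vec.Base as Vec using (Vec; []; _∷_; lookup)
  import Data.Vec.Properties as Vec
  open import Function.Base using (_∘_; id)
  open import Relation.Binary.Definitions using (tri<; tri≈; tri>)
  open import Relation.Binary.PropositionalEquality as ≡ using (_≡_; _≢_)
  open import Relation.Nullary.Decidable using (Dec; yes; no; does; _×-dec_; _⊎-dec_)

  open import Defs using (Web; nodes; merges; Labeling; labelings; sizesMatch?; disjointUnions?; isColoring?; colorings; exponents; inv; sgn; ∑ℤ; elements; isSLD?; SLD; attackingPairs; ε; invL; content; block; choices; _≟ˢ_; _≟ᵛ_)
  open Count using (does-∈?; count; bit)
  open Colorings
  open Reduction using (asc)
  open Sums R
  open Hecke R z p x
  open Subsets
  open Antisym R z p x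
  open Words R z p x
  open Traces R z p x
  open Layers R z p x
  open Paths R z p x
  open Labelings R z p x

  module _ (qᶻ-0 : qᶻ 0ℤ ≈ 1#) (qᶻ-+ : ∀ a b → qᶻ (a ℤ.+ b) ≈ qᶻ a * qᶻ b) (qᶻ-1 : qᶻ 1ℤ ≈ q) (qᶻ--1 : qᶻ -1ℤ ≈ p) where

    private
      qᶻ-∑ : {A : Set} (xs : List A) (f : A → ℤ) → qᶻ (∑ℤ xs f) ≈ ∏ xs (λ a → qᶻ (f a))
      qᶻ-∑ []       f = qᶻ-0
      qᶻ-∑ (a ∷ xs) f = trans (qᶻ-+ (f a) _) (*-congˡ (qᶻ-∑ xs f))

      ∏-1 : {A : Set} (xs : List A) → ∏ xs (λ _ → 1#) ≈ 1#
      ∏-1 []       = refl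
      ∏-1 (a ∷ xs) = trans (*-identityˡ _) (∏-1 xs)

      ∏-swap : {A B : Set} (xs : List A) (ys : List B) {f : A → B → Carrier} → ∏ xs (λ a → ∏ ys (f a)) ≈ ∏ ys (λ b → ∏ xs (λ a → f a b))
      ∏-swap []       ys = sym (∏-1 ys)
      ∏-swap (a ∷ xs) ys = trans (*-congˡ (∏-swap xs ys)) (sym (∏-* ys))

      ∏-elements : ∀ {N} (A : Subset N) (f : Fin N → Carrier) → ∏ (elements A) f ≈ ∏∈ A f
      ∏-elements A f = trans (∏-filter (_∈? A) (allFin _)) (∏-cong (allFin _) λ y → reflexive (≡.cong (λ b → if b then f y else 1#) (does-∈? y A)))

      ∏-cartesian : {A B : Set} (xs : List A) (ys : List B) {f : A × B → Carrier} → ∏ (cartesianProduct xs ys) f ≈ ∏ xs (λ a → ∏ ys (λ b → f (a , b)))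
      ∏-cartesian []       ys = refl
      ∏-cartesian (a ∷ xs) ys = trans (∏-++ (map (a ,_) ys) _) (*-cong (∏-map (a ,_) ys) (∏-cartesian xs ys))

      ncmp-< : ∀ {m n} → m ℕ.< n → ncmp m n ≡ lt
      ncmp-< {zero}  {suc n} _       = ≡.refl
      ncmp-< {suc m} {suc n} (s≤s l) = ncmp-< l

      ncmp-> : ∀ {m n} → n ℕ.< m → ncmp m n ≡ gt
      ncmp-> {m} {n} l = ≡.trans (ncmp-flip n m) (≡.cong flip (ncmp-< l))

      distinct-members : ∀ {N} (A B : Subset N) → A ∩ B ≡ ∅ → ∀ {a b} → lookup A a ≡ true → lookup B b ≡ true → a ≢ b
      distinct-members A B h {a} a∈A b∈B ≡.refl = true≢false (≡.trans (≡.sym b∈B) (∉-of-disjoint a A B h a∈A))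

    module _ (w : Web) where
      open Web w

      module _ (N : ℕ) (β : Vec ℕ N) where
        open Weighted (finOrder N) x+p≈0
        open Transfer (finOrder N) x+p≈0 using (cross)

        private
          -- In inv the first argument of `sgn` comes from the right incoming edge, whereas `cross`
          -- takes the left letter first; hence the reversal of a and b.
          sgn-weight : ∀ (a b : Fin N) → b ≢ a → qᶻ (sgn a b) ≈ e (ncmp (toℕ b) (toℕ a))
          sgn-weight a b b≢a with Fin.<-cmp a b
          ... | tri< a<b _ _ = trans qᶻ--1 (reflexive (≡.cong e (≡.sym (ncmp-> a<b))))
          ... | tri≈ _ a≡b _ = ⊥-elim (b≢a (≡.sym a≡b))
          ... | tri> _ _ b<a = trans qᶻ-1 (reflexive (≡.cong e (≡.sym (ncmp-< b<a))))

          merge-weight : ∀ (A B : Subset N) → A ∩ B ≡ ∅ → qᶻ (∑ℤ (elements B) λ a → ∑ℤ (elements A) λ b → sgn a b) ≈ cross A B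
          merge-weight A B h = begin
            qᶻ (∑ℤ (elements B) λ a → ∑ℤ (elements A) λ b → sgn a b)
              ≈⟨ trans (qᶻ-∑ (elements B) _) (∏-cong (elements B) λ a → qᶻ-∑ (elements A) (sgn a)) ⟩
            ∏ (elements B) (λ a → ∏ (elements A) (λ b → qᶻ (sgn a b)))
              ≈⟨ ∏-swap (elements B) (elements A) ⟩
            ∏ (elements A) (λ b → ∏ (elements B) (λ a → qᶻ (sgn a b)))
              ≈⟨ trans (∏-elements A _) (∏∈-cong A λ b b∈A → trans (∏-elements B _) (∏∈-cong B λ a a∈B → sgn-weight a b (distinct-members A B h b∈A a∈B))) ⟩
            cross A B ∎

          lookup-contS : ∀ t (A : State N t) i → lookup (contS t A) i ≡ count (length t) (λ j → lookup (A j) i)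
          lookup-contS []      A i = Vec.lookup-replicate i 0
          lookup-contS (a ∷ t) A i = ≡.trans (Vec.lookup-zipWith ℕ._+_ i (Vec.map bit (A zero)) (contS t (A ∘ suc)))
            (≡.cong₂ ℕ._+_ (Vec.lookup-map i bit (A zero)) (lookup-contS t (A ∘ suc) i))

          exponents-contS : ∀ (c : Labeling w N) → All (Defs.DisjointUnions c) (nodes w) → exponents w c ≡ contS (thickness zero) (λ j → c (zero , j))
          exponents-contS c du = ≡.trans (exponents≡ w c du) (≡.trans (Vec.tabulate-cong λ i → ≡.sym (lookup-contS (thickness zero) _ i)) (Vec.tabulate∘lookup _))

          χc : Labeling w N → Carrier
          χc c = ι (contS (thickness zero) (λ j → c (zero , j)) ≟ᵛ β)

        -- The weight of a coloring is the product of `cross` over the merges, and its exponents,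
        -- the numbers of components, are the multiplicities of the colors on cut zero.
        X-partition : ∑ (filter (λ c → exponents w c ≟ᵛ β) (colorings w N)) (λ c → qᶻ (inv w c)) ≈
                      ClosedWeb.partition (finOrder N) x+p≈0 thickness layer closing (λ c → ι (contS (thickness zero) (c zero) ≟ᵛ β))
        X-partition = begin
          ∑ (filter (λ c → exponents w c ≟ᵛ β) (colorings w N)) (λ c → qᶻ (inv w c))
            ≈⟨ trans (∑-filter (λ c → exponents w c ≟ᵛ β) (colorings w N)) (∑-filter (isColoring? w) (labelings w N)) ⟩
          ∑ (labelings w N) (λ c → ι (isColoring? w c) * (ι (exponents w c ≟ᵛ β) * qᶻ (inv w c)))
            ≈⟨ ∑-cong (labelings w N) (λ c → trans (ι-guard (isColoring? w c) λ col → let du = coloring⇒disjoint w c col in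
                 *-cong (reflexive (≡.cong (λ v → ι (v ≟ᵛ β)) (exponents-contS c du)))
                        (trans (qᶻ-∑ (merges w) _) (∏-cong∈ (merges w) λ {e} e∈ → merge-weight _ _ (merges-disjoint w c du e∈))))
               (trans (*-congʳ (trans
                 (ι-cong (isColoring? w c) (sizesMatch? w c ×-dec all? (disjointUnions? c) (nodes w))
                   (λ col → proj₁ col , coloring⇒disjoint w c col) (λ { (s , d) → disjoint⇒coloring w c s d }))
                 (ι-× (sizesMatch? w c) (all? (disjointUnions? c) (nodes w)))))
               (solve 4 (λ s d χ m → s :* d :* (χ :* m) := s :* (d :* m) :* χ) refl _ _ _ _))) ⟩
          ∑ (labelings w N) (λ c → weight w c * χc c)
            ≈⟨ partition≈ w (λ c → ι (contS (thickness zero) (c zero) ≟ᵛ β)) ⟨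
          ClosedWeb.partition (finOrder N) x+p≈0 thickness layer closing (λ c → ι (contS (thickness zero) (c zero) ≟ᵛ β)) ∎

      module _ (I : Cut) where
        private
          t = thickness I
          n = sum t

        colorOrder : ∀ {N} → (Fin n → Fin N) → Order (Fin n)
        colorOrder σ = lexOrder (toℕ ∘ σ) toℕ Fin.toℕ-injective

        module _ {N : ℕ} (σ : Fin n → Fin N) where
          open Weighted (colorOrder σ) x+p≈0
          open Transfer (colorOrder σ) x+p≈0 using (cross; ewts)

          private
            -- For distinct labels, ε_σ(u,v) = 1 means that u precedes v in `colorOrder σ`: smaller
            -- color first, and larger label first in a tie.
            ε-weight : ∀ u v → u ≢ v → qᶻ (ε w I σ u v) ≈ e (Order.cmp (colorOrder σ) u v)
            ε-weight u v u≢v = cases (σ u Fin.<? σ v) (σ v Fin.≟ σ u) (v Fin.<? u)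
              where
              cases : (d₁ : Dec (σ u Fin.< σ v)) (d₂ : Dec (σ v ≡ σ u)) (d₃ : Dec (v Fin.< u)) →
                      qᶻ (if does (d₁ ⊎-dec (d₂ ×-dec d₃)) then 1ℤ else -1ℤ) ≈ e (Order.cmp (colorOrder σ) u v)
              cases (yes l) d₂ d₃ = trans qᶻ-1 (reflexive (≡.cong e (≡.sym (≡.cong (λ c → lex c _) (ncmp-< l)))))
              cases (no ¬l) (yes h) (yes l) = trans qᶻ-1 (reflexive (≡.cong e (≡.sym (≡.cong₂ lex same (ncmp-< l)))))
                where
                same : ncmp (toℕ (σ u)) (toℕ (σ v)) ≡ eq
                same = ≡.trans (≡.cong (λ a → ncmp (toℕ (σ u)) (toℕ a)) h) (ncmp-refl (toℕ (σ u)))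
              cases (no ¬l) (yes h) (no ¬l′) = trans qᶻ--1 (reflexive (≡.cong e (≡.sym (≡.cong₂ lex same (ncmp-> (ℕ.≤∧≢⇒< (ℕ.≮⇒≥ ¬l′) (u≢v ∘ Fin.toℕ-injective)))))))
                where
                same : ncmp (toℕ (σ u)) (toℕ (σ v)) ≡ eq
                same = ≡.trans (≡.cong (λ a → ncmp (toℕ (σ u)) (toℕ a)) h) (ncmp-refl (toℕ (σ u)))
              cases (no ¬l) (no ¬h) d₃ = trans qᶻ--1 (reflexive (≡.cong e (≡.sym (≡.cong (λ c → lex c (ncmp (toℕ v) (toℕ u))) (ncmp-> (ℕ.≤∧≢⇒< (ℕ.≮⇒≥ ¬l) (¬h ∘ Fin.toℕ-injective)))))))

            block-weight : ∀ B → ∏ (filter (λ { (u , v) → u Fin.<? v }) (cartesianProduct (elements B) (elements B))) (λ { (u , v) → qᶻ (ε w I σ u v) }) ≈ blockWeight B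
            block-weight B = trans (∏-filter _ (cartesianProduct (elements B) (elements B))) (trans (∏-cartesian (elements B) (elements B))
              (trans (∏-elements B _) (∏∈-cong B λ u _ → trans (∏-elements B _) (∏∈-cong B λ v _ → strict u v (u Fin.<? v)))))
              where
              strict : ∀ u v (d : Dec (u Fin.< v)) → (if does d then qᶻ (ε w I σ u v) else 1#) ≈ (if does d then e (Order.cmp (colorOrder σ) u v) else 1#)
              strict u v (yes l) = ε-weight u v λ h → ℕ.<-irrefl (≡.cong toℕ h) l
              strict u v (no _)  = refl

            attacking-weight : ∀ ℒ → All (Defs.DisjointUnions ℒ) (nodes w) →
              qᶻ (invL w I ℒ σ) ≈ ∏ (allFin (length t)) (λ j → blockWeight (block t j)) * ∏ (merges w) (λ e → cross (ℒ (proj₁ e)) (ℒ (proj₂ e)))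
            attacking-weight ℒ du = trans (qᶻ-∑ (attackingPairs w I ℒ) _) (trans
              (∏-++ (concatMap (λ j → filter (λ { (u , v) → u Fin.<? v }) (cartesianProduct (elements (block t j)) (elements (block t j)))) (allFin (length t))) _)
              (*-cong (trans (∏-concatMap _ (allFin (length t))) (∏-cong (allFin (length t)) λ j → block-weight (block t j)))
                      (trans (∏-concatMap _ (merges w)) (∏-cong∈ (merges w) λ {e} e∈ → pair-weight (ℒ (proj₁ e)) (ℒ (proj₂ e)) (merges-disjoint w ℒ du e∈)))))
              where
              pair-weight : ∀ A B → A ∩ B ≡ ∅ → ∏ (cartesianProduct (elements A) (elements B)) (λ { (u , v) → qᶻ (ε w I σ u v) }) ≈ cross A B
              pair-weight A B h = trans (∏-cartesian (elements A) (elements B)) (trans (∏-elements A _) (∏∈-cong A λ u u∈A →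
                trans (∏-elements B _) (∏∈-cong B λ v v∈B → ε-weight u v (distinct-members A B h u∈A v∈B))))

          -- The in-block pairs are the same for every ℒ and yield the constant `ewts`; the pairs at
          -- merges yield the weights of the state sum, and the prescribed blocks on the initial cut
          -- fix its state there.
          SLD-partition : ∑ (SLD w I) (λ ℒ → qᶻ (invL w I ℒ σ)) ≈
            ewts t (allFin n) * ClosedWeb.partition (colorOrder σ) x+p≈0 thickness layer closing (λ c → δS t (block t) (c I))
          SLD-partition = begin
            ∑ (SLD w I) (λ ℒ → qᶻ (invL w I ℒ σ))
              ≈⟨ ∑-filter (isSLD? w I) (labelings w n) ⟩
            ∑ (labelings w n) (λ ℒ → ι (isSLD? w I ℒ) * qᶻ (invL w I ℒ σ))
              ≈⟨ ∑-cong (labelings w n) (λ ℒ → trans (ι-guard (isSLD? w I ℒ) λ sld → trans (attacking-weight ℒ (proj₂ (proj₂ sld))) (*-congʳ (blockWeights (OrdersS-block t) sorted)))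
                   (trans (*-congʳ (trans (ι-× (starts ℒ) (sizesMatch? w ℒ ×-dec all? (disjointUnions? ℒ) (nodes w))) (*-cong (sym (δS≈ι t (block t) (λ j → ℒ (I , j)) (starts ℒ))) (ι-× (sizesMatch? w ℒ) (all? (disjointUnions? ℒ) (nodes w))))))
                   (solve 5 (λ f s d b m → f :* (s :* d) :* (b :* m) := b :* (s :* (d :* m) :* f)) refl _ _ _ _ _))) ⟩
            ∑ (labelings w n) (λ ℒ → ewts t (allFin n) * (weight w ℒ * δS t (block t) (λ j → ℒ (I , j))))
              ≈⟨ ∑-*ˡ (ewts t (allFin n)) (labelings w n) ⟩
            ewts t (allFin n) * ∑ (labelings w n) (λ ℒ → weight w ℒ * δS t (block t) (λ j → ℒ (I , j)))
              ≈⟨ *-congˡ (partition≈ w (λ c → δS t (block t) (c I))) ⟨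
            ewts t (allFin n) * ClosedWeb.partition (colorOrder σ) x+p≈0 thickness layer closing (λ c → δS t (block t) (c I)) ∎
            where
            starts : ∀ (ℒ : Labeling w n) → Dec (∀ j → ℒ (I , j) ≡ block t j)
            starts ℒ = Fin.all? (λ j → ℒ (I , j) ≟ˢ block t j)
            sorted : AllPairs Fin._<_ (allFin n)
            sorted = AllPairs.tabulate⁺-< λ i<j → i<j

        module _ (N : ℕ) (β : Vec ℕ N) where
          private
            colors : List (Fin n → Fin N)
            colors = choices (λ _ → allFin N)

            h : H
            h = Cylinder.dnH (thickness zero) thickness layer closing I ⊙ Cylinder.upH (thickness zero) thickness layer I

            total : Carrier
            total = Cylinder.total (thickness zero) thickness

            diagonal : (Fin n → Fin N) → Carrier
            diagonal σ = Act.⟪_⟫ (colorOrder σ) h (Delta.δ Fin._≟_ (allFin n)) (allFin n)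

            lookup-cont : ∀ {m} (σ : Fin m → Fin N) i → length (filter (λ u → σ u Fin.≟ i) (allFin m)) ≡ lookup (cont (tabulate σ)) i
            lookup-cont {zero}  σ i = ≡.sym (Vec.lookup-replicate i 0)
            lookup-cont {suc m} σ i = ≡.trans (≡.cong length (filter-head (σ zero Fin.≟ i))) (count-head (σ zero Fin.≟ i))
              where
              rest : List (Fin (suc m))
              rest = filter (λ u → σ u Fin.≟ i) (tabulate suc)
              filter-head : (d : Dec (σ zero ≡ i)) → filter (λ u → σ u Fin.≟ i) (allFin (suc m)) ≡ filter (λ u → σ u Fin.≟ i) (zero ∷ []) ++ rest
              filter-head _ = List.filter-++ (λ u → σ u Fin.≟ i) (zero ∷ []) (tabulate suc)
              length-rest : length rest ≡ lookup (cont (tabulate (σ ∘ suc))) i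
              length-rest = ≡.trans (≡.cong (λ us → length (filter (λ u → σ u Fin.≟ i) us)) (≡.sym (List.map-tabulate id suc)))
                (≡.trans (length-filter-map (allFin m)) (lookup-cont (σ ∘ suc) i))
                where
                length-filter-map : ∀ us → length (filter (λ u → σ u Fin.≟ i) (map suc us)) ≡ length (filter (λ u → σ (suc u) Fin.≟ i) us)
                length-filter-map []       = ≡.refl
                length-filter-map (u ∷ us) with does (σ (suc u) Fin.≟ i)
                ... | true  = ≡.cong suc (length-filter-map us)
                ... | false = length-filter-map us
              count-head : (d : Dec (σ zero ≡ i)) → length (filter (λ u → σ u Fin.≟ i) (zero ∷ []) ++ rest) ≡ lookup (cont (tabulate σ)) i
              count-head (yes ≡.refl) = ≡.trans (≡.cong (λ us → length (us ++ rest)) (List.filter-accept (λ u → σ u Fin.≟ i) {zero} {[]} ≡.refl))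
                (≡.trans (≡.cong suc length-rest) (≡.sym (Vec.lookup∘updateAt (σ zero) (cont (tabulate (σ ∘ suc))))))
              count-head (no h) = ≡.trans (≡.cong (λ us → length (us ++ rest)) (List.filter-reject (λ u → σ u Fin.≟ i) {zero} {[]} h))
                (≡.trans length-rest (≡.sym (Vec.lookup∘updateAt′ i (σ zero) (λ e → h (≡.sym e)) (cont (tabulate (σ ∘ suc))))))

            content≡ : ∀ σ → content w I σ ≡ cont (tabulate σ)
            content≡ σ = ≡.trans (Vec.tabulate-cong (lookup-cont σ)) (Vec.tabulate∘lookup (cont (tabulate σ)))

            ∑-choices-words : ∀ m (F : List (Fin N) → Carrier) → ∑ (choices {m} (λ _ → allFin N)) (λ σ → F (tabulate σ)) ≈ ∑ (words N m) F
            ∑-choices-words zero    F = refl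
            ∑-choices-words (suc m) F = trans (∑-choices (λ _ → allFin N) _ (λ a σ → F (a ∷ tabulate σ)) (λ _ → refl))
              (trans (∑-cong (allFin N) λ a → ∑-choices-words m (F ∘ (a ∷_))) (sym (∑-words N m)))

            asc≡ : ∀ m l → asc m l ≡ tabulate {n = l} (λ i → m ℕ.+ toℕ i)
            asc≡ m zero    = ≡.refl
            asc≡ m (suc l) = ≡.cong₂ _∷_ (≡.sym (ℕ.+-identityʳ m)) (≡.trans (asc≡ (suc m) l) (List.tabulate-cong λ i → ≡.sym (ℕ.+-suc m (toℕ i))))

            at-tabulate : ∀ {m} (σ : Fin m → Fin N) u → at (tabulate σ) (toℕ u) ≡ toℕ (σ u)
            at-tabulate σ zero    = ≡.refl
            at-tabulate σ (suc u) = at-tabulate (σ ∘ suc) u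

            diagonal≈ : ∀ σ → let ids = asc 0 (length (tabulate σ)) in diagonal σ ≈ LabelTrace.K N (tabulate σ) h ids ids
            diagonal≈ σ = sym (begin
              K h (asc 0 (length (tabulate σ)))
                ≈⟨ reflexive (≡.cong (K h) (≡.trans (≡.cong (asc 0) (List.length-tabulate σ)) (≡.trans (asc≡ 0 n) (≡.sym (List.map-tabulate id toℕ))))) ⟩
              K h (map toℕ (allFin n))
                ≈⟨ transport (labelOrder (tabulate σ)) (colorOrder σ) toℕ {λ _ → ⊤}
                     (λ {a} {b} _ _ → ≡.cong (λ c → lex c (ncmp (toℕ b) (toℕ a))) (≡.cong₂ ncmp (at-tabulate σ a) (at-tabulate σ b)))
                     h _ (allFin n) (universal (λ _ → tt) (allFin n)) ⟩
              Act.⟪_⟫ (colorOrder σ) h (LabelTrace.δ N (map toℕ (allFin n)) ∘ map toℕ) (allFin n)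
                ≈⟨ Act.⟪⟫-ext (colorOrder σ) h (λ v → ι-cong (LabelTrace.δ? N (map toℕ (allFin n)) (map toℕ v)) (Delta.δ? Fin._≟_ (allFin n) v)
                     (List.map-injective Fin.toℕ-injective) (≡.cong (map toℕ))) (allFin n) ⟩
              diagonal σ ∎)
              where
              K : H → List ℕ → Carrier
              K h w = LabelTrace.K N (tabulate σ) h w w

          -- For fixed σ the sum over ℒ is, by `SLD-partition` and `diagonal`, a single diagonal
          -- entry at the identity word in the order of σ; summation over σ makes it the label
          -- trace. `transport` identifies the labels in `Fin n` with natural numbers.
          LLT-trace : total * ∑ (SLD w I) (λ ℒ → ∑ (filter (λ σ → content w I σ ≟ᵛ β) (choices (λ _ → allFin N))) (λ σ → qᶻ (invL w I ℒ σ))) ≈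
                      factors t * LabelTrace.tr N n β h
          LLT-trace = begin
            total * ∑ (SLD w I) (λ ℒ → ∑ (filter (λ σ → content w I σ ≟ᵛ β) colors) (λ σ → qᶻ (invL w I ℒ σ)))
              ≈⟨ *-congˡ (trans (∑-cong (SLD w I) λ ℒ → ∑-filter (λ σ → content w I σ ≟ᵛ β) colors)
                   (trans (∑-swap (SLD w I) colors) (∑-cong colors λ σ → trans (∑-*ˡ _ (SLD w I)) (*-congˡ (SLD-partition σ))))) ⟩
            total * ∑ colors (λ σ → ι (content w I σ ≟ᵛ β) * (Transfer.ewts (colorOrder σ) x+p≈0 t (allFin n) * partitionσ σ))
              ≈⟨ trans (sym (∑-*ˡ total colors)) (∑-cong colors λ σ → trans
                   (solve 4 (λ T i e y → T :* (i :* (e :* y)) := i :* (e :* (T :* y))) refl _ _ _ _)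
                   (*-congˡ (sym (ClosedWeb.diagonal (colorOrder σ) x+p≈0 thickness layer closing I (OrdersS-block t))))) ⟩
            ∑ colors (λ σ → ι (content w I σ ≟ᵛ β) * (factors t * diagonal σ))
              ≈⟨ ∑-cong colors (λ σ → trans (*-cong (reflexive (≡.cong (λ v → ι (v ≟ᵛ β)) (content≡ σ))) (*-congˡ (diagonal≈ σ))) (x*yz≈y*xz _ _ _)) ⟩
            ∑ colors (λ σ → factors t * (χ β (tabulate σ) * LabelTrace.K N (tabulate σ) h (asc 0 (length (tabulate σ))) (asc 0 (length (tabulate σ)))))
              ≈⟨ trans (∑-*ˡ (factors t) colors) (*-congˡ (∑-choices-words n (λ ρ → χ β ρ * LabelTrace.K N ρ h (asc 0 (length ρ)) (asc 0 (length ρ))))) ⟩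
            factors t * LabelTrace.tr N n β h ∎
            where
            partitionσ : (Fin n → Fin N) → Carrier
            partitionσ σ = ClosedWeb.partition (colorOrder σ) x+p≈0 thickness layer closing (λ c → δS t (block t) (c I))

-- Comparison of the two traces by induction on words.

module Pairs (R : CommutativeSemiring 0ℓ 0ℓ) (z p x : CommutativeSemiring.Carrier R) where

  open import Data.Fin.Base using (Fin)
  open import Data.List.Base using (List; []; _∷_; _++_; upTo; length)
  open import Data.List.Membership.Propositional using (_∈_)
  open import Data.List.Membership.Propositional.Properties using (∈-upTo⁻)
  open import Data.List.Relation.Unary.All using (All)
  open import Data.List.Relation.Unary.Any using (here; there)
  open import Data.Nat.Base as ℕ using (ℕ; zero; suc; _∸_)
  import Data.Nat.Induction as ℕ
  import Data.Nat.Properties as ℕ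
  open import Data.Product.Base using (Σ; _,_; proj₁; proj₂)
  open import Data.Vec.Base using (Vec; []; _∷_; sum; replicate)
  open import Function.Base using (_∘_)
  open import Relation.Binary.PropositionalEquality as ≡ using (_≡_)

  open import Defs using (_≟ᵛ_; splittings)
  open Sums R
  open Hecke R z p x
  open Words R z p x
  open Traces R z p x hiding (module Coxeter)
  open PowerSeries R z p x
  open Reduction using (asc; TraceClosed; trace-induction)

  Series : Set
  Series = (N : ℕ) → Vec ℕ N → Carrier

  infix 4 _≈ˢ_
  infixr 7 _•ˢ_

  _≈ˢ_ : Series → Series → Set
  F ≈ˢ G = ∀ N β → F N β ≈ G N β

  _•ˢ_ : Carrier → Series → Series
  (a •ˢ F) N β = a * F N β

  _+ˢ_ _*ˢ_ : Series → Series → Series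
  (F +ˢ G) N β = F N β + G N β
  (F *ˢ G) N β = ∑ (splittings β) λ γδ → F N (proj₁ γδ) * G N (proj₂ γδ)

  0ˢ 1ˢ : Series
  0ˢ N β = 0#
  1ˢ N β = ι (β ≟ᵛ replicate N 0)

  infix 4 _∼_
  -- Expressions are identified when they act alike in every order representation, which is all that
  -- the traces can see.
  record _∼_ (h g : H) : Set₁ where
    constructor equal
    field ⟪⟫-≈ : ∀ {A : Set} (O : Order A) f w → Act.⟪_⟫ O h f w ≈ Act.⟪_⟫ O g f w
  open _∼_

  record Linear (Q : H → Set) : Set₁ where
    field
      ∼-closed : ∀ {h g} → h ∼ g → Q g → Q h
      ⊞-closed : ∀ {h g} → Q h → Q g → Q (h ⊞ g)
      sc-closed : ∀ c {h} → Q h → Q (sc c ⊙ h)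

  -- Every expression acts as a linear combination of words. For a product, the outer induction
  -- expands the left factor and the inner one the right factor.
  linear-induction : ∀ h {Q} → Linear Q → (∀ ss → Q (word ss)) → Q h
  linear-induction (T s) linear words = ∼-closed (equal λ O f w → Act.⟪⟫-ext O (T s) {f} (λ v → sym (*-identityˡ (f v))) w) (words (s ∷ []))
    where open Linear linear
  linear-induction (sc c) linear words = ∼-closed (equal λ O f w → *-congˡ (sym (*-identityˡ _))) (sc-closed c (words []))
    where open Linear linear
  linear-induction (h ⊞ g) linear words = ⊞-closed (linear-induction h linear words) (linear-induction g linear words)
    where open Linear linear
  linear-induction (h ⊙ g) {Q} linear words = linear-induction h left λ ss → linear-induction g (right ss) λ ts →
    ∼-closed (equal λ O f w → sym (Act.word-++ O ss ts f w)) (words (ss ++ ts))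
    where
    open Linear linear
    left : Linear (λ h → Q (h ⊙ g))
    left = record
      { ∼-closed  = λ h∼ → ∼-closed (equal λ O f w → ⟪⟫-≈ h∼ O _ w)
      ; ⊞-closed  = λ Qh Qh′ → ∼-closed (equal λ O f w → refl) (⊞-closed Qh Qh′)
      ; sc-closed = λ c Qh → ∼-closed (equal λ O f w → refl) (sc-closed c Qh) }
    right : ∀ ss → Linear (λ g → Q (word ss ⊙ g))
    right ss = record
      { ∼-closed  = λ g∼ → ∼-closed (equal λ O f w → Act.⟪⟫-ext O (word ss) (⟪⟫-≈ g∼ O f) w)
      ; ⊞-closed  = λ Qg Qg′ → ∼-closed (equal λ O f w → Act.⟪⟫-+ O (word ss) _ _ w) (⊞-closed Qg Qg′)
      ; sc-closed = λ c Qg → ∼-closed (equal λ O f w → Act.⟪⟫-* O (word ss) c _ w) (sc-closed c Qg) }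

  colorTrace labelTrace : ℕ → H → Series
  colorTrace n h N β = ColorTrace.tr N n β h
  labelTrace n h N β = LabelTrace.tr N n β h

  label-length : ∀ {N} (σ : List (Fin N)) → length (asc 0 (length σ)) ≡ length σ
  label-length σ = length-asc 0 (length σ)

  labelTrace-cyclic : ∀ n h g → labelTrace n (h ⊙ g) ≈ˢ labelTrace n (g ⊙ h)
  labelTrace-cyclic n h g N β = LabelTrace.tr-cyclic N label-length n β (LabelTrace.exchange N n β) h g

  labelTrace-∼ : ∀ n {h g} → h ∼ g → labelTrace n h ≈ˢ labelTrace n g
  labelTrace-∼ n {h} {g} h∼g N β = LabelTrace.tr-cong N label-length n β h g λ σ f w _ → ⟪⟫-≈ h∼g _ f w

  module _ (zi : Carrier) (z*zi≈1 : z * zi ≈ 1#) (x+p≈0 : x + p ≈ 0#)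
           (-1# : Carrier) (1+-1≈0 : 1# + -1# ≈ 0#) where

    -- These are -q and -z: written over 1 - y t, the series 1 + z t / (1 - y t) has numerator 1 + q
    -- t for y = x = -p, and 1 + z t for y = 0.
    u₁ u₀ : Carrier
    u₁ = -1# * (z + p)
    u₀ = -1# * z

    private
      -1*a+a≈0 : ∀ a → -1# * a + a ≈ 0#
      -1*a+a≈0 a = trans (solve 2 (λ n a → n :* a :+ a := (con 1 :+ n) :* a) refl -1# a) (trans (*-congʳ 1+-1≈0) (zeroˡ a))

      u₁+z≈x : u₁ + z ≈ x
      u₁+z≈x = begin
        u₁ + z                                  ≈⟨ +-identityʳ _ ⟨
        u₁ + z + 0#                             ≈⟨ +-congˡ x+p≈0 ⟨
        u₁ + z + (x + p)                        ≈⟨ solve 4 (λ n z p x → n :* (z :+ p) :+ z :+ (x :+ p) := n :* (z :+ p) :+ (z :+ p) :+ x) refl -1# z p x ⟩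
        u₁ + (z + p) + x                        ≈⟨ trans (+-congʳ (-1*a+a≈0 (z + p))) (+-identityˡ x) ⟩
        x                                       ∎

    module Color = Geometric x u₁ -1# u₁+z≈x 1+-1≈0
    module Label = Geometric 0# u₀ -1# (-1*a+a≈0 z) 1+-1≈0

    module _ (nat-inverse : ∀ m → Σ Carrier λ c → c * nat (suc m) ≈ 1#)
      -- Later instantiated by the relation G = (q - q⁻¹)^n F[x/(q - q⁻¹)]. Kept abstract, it enters
      -- only through closure properties, which are those of a graded algebra homomorphism given on
      -- power sums.
      (Good : ℕ → Series → Series → Set)
      (≈ˢ-closed  : ∀ {n F F′ G G′} → F ≈ˢ F′ → G ≈ˢ G′ → Good n F G → Good n F′ G′)
      (•ˢ-closed  : ∀ {n F G} a → Good n F G → Good n (a •ˢ F) (a •ˢ G))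
      (+-closed  : ∀ {n F F′ G G′} → Good n F G → Good n F′ G′ → Good n (F +ˢ F′) (G +ˢ G′))
      (*-closed  : ∀ {m n F F′ G G′} → Good m F G → Good n F′ G′ → Good (m ℕ.+ n) (F *ˢ F′) (G *ˢ G′))
      (0-closed  : ∀ {n} → Good n 0ˢ 0ˢ)
      (1-closed  : Good 0 1ˢ 1ˢ)
      (power-sum-closed : ∀ i → Good (suc i) (Color.coefficient i •ˢ power-sum (suc i)) (Label.coefficient i •ˢ power-sum (suc i)))
      where

      private
        ∑-closed : ∀ {n} (is : List ℕ) {F G : ℕ → Series} → (∀ {i} → i ∈ is → Good n (F i) (G i)) →
                   Good n (λ N β → ∑ is λ i → F i N β) (λ N β → ∑ is λ i → G i N β)
        ∑-closed []       h = 0-closed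
        ∑-closed (i ∷ is) h = +-closed (h (here ≡.refl)) (∑-closed is (h ∘ there))

        mult-0 : ∀ g → g 0 ≈ 1# → 1ˢ ≈ˢ mult g 0
        mult-0 g g0≈1 N β = trans (ι-cong (β ≟ᵛ replicate N 0) (sum β ℕ.≟ 0) (λ { ≡.refl → sum-replicate-0 N }) (sum≡0⇒ β))
          (trans (sym (*-identityʳ _)) (ι-guard (sum β ℕ.≟ 0) λ h → trans (sym (∏-0 N)) (reflexive (≡.cong (∏ᵛ g) (≡.sym (sum≡0⇒ β h))))))
          where
          ∏-0 : ∀ N → ∏ᵛ g (replicate N 0) ≈ 1#
          ∏-0 zero    = refl
          ∏-0 (suc N) = trans (*-cong g0≈1 (∏-0 N)) (*-identityˡ 1#)

        mult-good : ∀ m → Good m (mult (geo x) m) (mult (geo 0#) m)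
        mult-good = ℕ.<-rec (λ m → Good m (mult (geo x) m) (mult (geo 0#) m)) step
          where
          step : ∀ m → (∀ {l} → l ℕ.< m → Good l (mult (geo x) l) (mult (geo 0#) l)) → Good m (mult (geo x) m) (mult (geo 0#) m)
          step zero    rec = ≈ˢ-closed (mult-0 (geo x) refl) (mult-0 (geo 0#) refl) 1-closed
          step (suc m) rec with nat-inverse m
          ... | c , c-inverse = ≈ˢ-closed (divide (geo x) Color.coefficient Color.newton) (divide (geo 0#) Label.coefficient Label.newton)
            (•ˢ-closed c (∑-closed (upTo (suc m)) λ {i} i∈ → ≡.subst (λ n → Good n (term (geo x) Color.coefficient i) (term (geo 0#) Label.coefficient i))
              (ℕ.m+[n∸m]≡n (∈-upTo⁻ i∈)) (*-closed (power-sum-closed i) (rec (ℕ.s≤s (ℕ.m∸n≤m m i))))))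
            where
            term : (ℕ → Carrier) → (ℕ → Carrier) → ℕ → Series
            term g a i = (a i •ˢ power-sum (suc i)) *ˢ mult g (suc m ∸ suc i)
            divide : ∀ g a → (∀ m N (β : Vec ℕ N) → nat m * mult g m N β ≈
              ∑ (upTo m) (λ i → a i * ∑ (splittings β) (λ γδ → power-sum (suc i) N (proj₁ γδ) * mult g (m ∸ suc i) N (proj₂ γδ)))) →
              (c •ˢ (λ N β → ∑ (upTo (suc m)) λ i → term g a i N β)) ≈ˢ mult g (suc m)
            divide g a newton N β = begin
              c * ∑ (upTo (suc m)) (λ i → term g a i N β)
                ≈⟨ *-congˡ (∑-cong (upTo (suc m)) λ i → trans (∑-cong (splittings β) λ γδ → *-assoc _ _ _) (∑-*ˡ (a i) (splittings β))) ⟩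
              c * _                                  ≈⟨ *-congˡ (newton (suc m) N β) ⟨
              c * (nat (suc m) * mult g (suc m) N β) ≈⟨ trans (sym (*-assoc _ _ _)) (trans (*-congʳ c-inverse) (*-identityˡ _)) ⟩
              mult g (suc m) N β                     ∎

        Words : ℕ → List ℕ → Set
        Words n ss = Good n (colorTrace n (word ss)) (labelTrace n (word ss))

        linear : ∀ n → Linear (λ h → Good n (colorTrace n h) (labelTrace n h))
        linear n = record
          { ∼-closed  = λ {h} {g} h∼g → ≈ˢ-closed
              (λ N β → sym (ColorTrace.tr-cong N (λ _ → ≡.refl) n β h g λ σ f w _ → ⟪⟫-≈ h∼g _ f w))
              (λ N β → sym (labelTrace-∼ n h∼g N β))
          ; ⊞-closed  = λ {h} {g} Gh Gg → ≈ˢ-closed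
              (λ N β → sym (ColorTrace.tr-⊞ N (λ _ → ≡.refl) n β h g)) (λ N β → sym (LabelTrace.tr-⊞ N label-length n β h g)) (+-closed Gh Gg)
          ; sc-closed = λ c {h} Gh → ≈ˢ-closed
              (λ N β → sym (ColorTrace.tr-sc N (λ _ → ≡.refl) n β c h)) (λ N β → sym (LabelTrace.tr-sc N label-length n β c h)) (•ˢ-closed c Gh) }

        closed : TraceClosed Words
        closed = record
          { nil = ≈ˢ-closed
              (λ N β → sym (trans (+-identityʳ _) (trans (*-cong (replicate-≟ N β) (trans (*-identityˡ _) (ColorTrace.δ-refl N []))) (*-identityʳ _))))
              (λ N β → sym (trans (+-identityʳ _) (trans (*-cong (replicate-≟ N β) (trans (*-identityˡ _) (LabelTrace.δ-refl N []))) (*-identityʳ _)))) 1-closed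
          ; quadratic = λ n u s v Wv Wsv → ≈ˢ-closed
              (λ N β → sym (ColorTrace.tr-quadratic N (λ _ → ≡.refl) n β x+p≈0 u s v))
              (λ N β → sym (LabelTrace.tr-quadratic N label-length n β x+p≈0 u s v))
              (+-closed (•ˢ-closed z Wsv) (•ˢ-closed (q * p) Wv))
          ; braid = λ n u s v s<n → ≈ˢ-closed
              (λ N β → sym (ColorTrace.tr-braid N (λ _ → ≡.refl) n β x+p≈0 u s v s<n)) (λ N β → sym (LabelTrace.tr-braid N label-length n β x+p≈0 u s v s<n))
          ; commute = λ n u s t v far → ≈ˢ-closed
              (λ N β → sym (ColorTrace.tr-commute N (λ _ → ≡.refl) n β u s t v far)) (λ N β → sym (LabelTrace.tr-commute N label-length n β u s t v far))
          ; cyclic = λ n u v → ≈ˢ-closed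
              (λ N β → ColorTrace.tr-word-cyclic N (λ _ → ≡.refl) n β (ColorTrace.exchange N n β) u v)
              (λ N β → LabelTrace.tr-word-cyclic N label-length n β (LabelTrace.exchange N n β) u v)
          ; drop-junk = λ n u s v n≤s W → ≈ˢ-closed
              (λ N β → sym (ColorTrace.tr-drop N (λ _ → ≡.refl) n β u s v n≤s)) (λ N β → sym (LabelTrace.tr-drop N label-length n β u s v n≤s)) (•ˢ-closed q W)
          -- Adding a Coxeter element on r + 1 strands multiplies each trace by its own series of
          -- degree r + 1; zi removes the factor z found in `coxeter-series`.
          ; coxeter = λ m r g gs W → ≈ˢ-closed
              (λ N β → sym (trans (color-coxeter N m r β g gs) (trans (product-series N m (suc r) β _ (ch α)) (∑-cong (splittings β) λ γδ → *-congˡ (series α x ≡.refl ≡.refl ≡.refl r N (proj₂ γδ))))))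
              (λ N β → sym (trans (label-coxeter N m r β g gs) (trans (product-series N m (suc r) β _ (ch α₀)) (∑-cong (splittings β) λ γδ → *-congˡ (series α₀ 0# ≡.refl ≡.refl ≡.refl r N (proj₂ γδ))))))
              (*-closed W (•ˢ-closed zi (mult-good (suc r))))
          }
          where
          replicate-≟ : ∀ N (β : Vec ℕ N) → ι (replicate N 0 ≟ᵛ β) ≈ ι (β ≟ᵛ replicate N 0)
          replicate-≟ N β = ι-cong (replicate N 0 ≟ᵛ β) (β ≟ᵛ replicate N 0) ≡.sym ≡.sym
          series : ∀ κ y → κ lt ≡ z → κ eq ≡ y → κ gt ≡ 0# → ∀ r N (β : Vec ℕ N) →
                   ∑ (words N (suc r)) (λ w → χ β w * ch κ w) ≈ zi * mult (geo y) (suc r) N β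
          series κ y l e g r N β = begin
            ∑ (words N (suc r)) (λ w → χ β w * ch κ w)                ≈⟨ trans (sym (*-identityˡ _)) (*-congʳ (trans (sym z*zi≈1) (*-comm z zi))) ⟩
            zi * z * ∑ (words N (suc r)) (λ w → χ β w * ch κ w)       ≈⟨ trans (*-assoc _ _ _) (*-congˡ (Coxeter.coxeter-series κ y l e g N r β)) ⟩
            zi * mult (geo y) (suc r) N β                             ∎


      traces-good : ∀ n h → Good n (colorTrace n h) (labelTrace n h)
      traces-good n h = linear-induction h (linear n) (trace-induction closed n)

-- Both functions as traces of one full turn; independence of the cut.

module Cuts (R : CommutativeSemiring 0ℓ 0ℓ) (z p x : CommutativeSemiring.Carrier R)
  (x+p≈0 : CommutativeSemiring._≈_ R (CommutativeSemiring._+_ R x p) (CommutativeSemiring.0# R))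
  (qᶻ : ℤ → CommutativeSemiring.Carrier R) where

  open import Data.Fin.Base using (Fin; zero; suc)
  open import Data.List.Base using (List; []; _∷_; filter; allFin)
  open import Data.Nat.Base using (zero; suc)
  open import Data.Nat.ListAction using (sum)
  open import Data.Product.Base using (Σ; _,_; proj₁)
  open import Relation.Binary.PropositionalEquality as ≡ using (_≡_)

  open import Defs using (Web; colorings; exponents; inv; SLD; invL; content; choices; degree-cut; _≟ᵛ_)
  open Sums R
  open Hecke R z p x
  open Antisym R z p x
  open Words R z p x
  open Layers R z p x
  open Paths R z p x
  open Evaluation R z p x x+p≈0 qᶻ
  open Pairs R z p x

  module Comparison (qᶻ-0 : qᶻ 0ℤ ≈ 1#) (qᶻ-+ : ∀ a b → qᶻ (a ℤ.+ b) ≈ qᶻ a * qᶻ b) (qᶻ-1 : qᶻ 1ℤ ≈ q) (qᶻ--1 : qᶻ -1ℤ ≈ p)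
                    (br-inverse : ∀ k → Σ Carrier λ c → c * br (suc k) ≈ 1#) where

    Unit : Carrier → Set
    Unit a = Σ Carrier λ c → c * a ≈ 1#

    private
      Unit-1 : Unit 1#
      Unit-1 = 1# , *-identityˡ 1#

      Unit-* : ∀ {a b} → Unit a → Unit b → Unit (a * b)
      Unit-* (c , ca) (d , db) = c * d , trans (solve 4 (λ c d a b → c :* d :* (a :* b) := c :* a :* (d :* b)) refl _ _ _ _) (trans (*-cong ca db) (*-identityˡ 1#))

      cancel : ∀ {a b c} (ua : Unit a) → a * b ≈ c → b ≈ proj₁ ua * c
      cancel (d , da) h = trans (sym (*-identityˡ _)) (trans (*-congʳ (sym da)) (trans (*-assoc _ _ _) (*-congˡ h)))

    fact-unit : ∀ n → Unit (fact n)
    fact-unit zero    = Unit-1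
    fact-unit (suc n) = Unit-* (fact-unit n) (br-inverse n)

    factors-unit : ∀ t → Unit (factors t)
    factors-unit []      = Unit-1
    factors-unit (a ∷ t) = Unit-* (fact-unit a) (factors-unit t)

    module _ (w : Web) where
      open Web w
      open Cylinder (thickness zero)

      X-series : Series
      X-series N β = ∑ (filter (λ c → exponents w c ≟ᵛ β) (colorings w N)) λ c → qᶻ (inv w c)

      LLT-series : Cut → Series
      LLT-series I N β = proj₁ (factors-unit (thickness I)) *
        ∑ (SLD w I) (λ ℒ → ∑ (filter (λ σ → content w I σ ≟ᵛ β) (choices (λ _ → allFin N))) (λ σ → qᶻ (invL w I ℒ σ)))

      private
        total-unit : Unit (total thickness)
        total-unit = go (allFin (suc k))
          where
          go : ∀ is → Unit (∏ is λ i → factors (thickness i))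
          go []       = Unit-1
          go (i ∷ is) = Unit-* (factors-unit (thickness i)) (go is)

      scale : Carrier
      scale = proj₁ total-unit

      round : H
      round = dnH thickness layer closing zero

      -- Here the factorials become units, so the factor that `trace` had to keep on both sides is
      -- cancelled.
      X-trace : X-series ≈ˢ scale •ˢ colorTrace degree round
      X-trace N β = cancel total-unit (begin
        total thickness * X-series N β
          ≈⟨ *-congˡ (X-partition qᶻ-0 qᶻ-+ qᶻ-1 qᶻ--1 w N β) ⟩
        total thickness * _
          ≈⟨ trans (cancel f (sym (ClosedWeb.trace (finOrder N) x+p≈0 thickness layer closing β))) (sym (cancel f refl)) ⟩
        colorTrace degree (round ⊙ sc 1#) N β
          ≈⟨ ColorTrace.tr-cong N (λ _ → ≡.refl) degree β (round ⊙ sc 1#) round (λ σ g v _ → Act.⟪⟫-ext (finOrder N) round (λ _ → *-identityˡ _) v) ⟩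
        colorTrace degree round N β ∎)
        where
        open Traces R z p x
        f = factors-unit (thickness zero)

      -- The cut only determines where the product of layers starts. Cyclicity moves the layers
      -- between cut zero and I to the front, and the result is the same element `round` for every
      -- I; the factorials of the cut cancel against the normalization of LLT.
      LLT-round : ∀ I → LLT-series I ≈ˢ scale •ˢ labelTrace degree round
      LLT-round I N β = cancel total-unit (begin
        total thickness * LLT-series I N β
          ≈⟨ x*yz≈y*xz _ _ _ ⟩
        proj₁ f * (total thickness * _)
          ≈⟨ *-congˡ (LLT-trace qᶻ-0 qᶻ-+ qᶻ-1 qᶻ--1 w I N β) ⟩
        proj₁ f * (factors (thickness I) * labelTrace n (down ⊙ rise) N β)
          ≈⟨ cancel f refl ⟨
        labelTrace n (down ⊙ rise) N β
          ≈⟨ labelTrace-cyclic n down rise N β ⟩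
        labelTrace n (rise ⊙ down) N β
          ≈⟨ labelTrace-∼ n {rise ⊙ down} {round} (equal λ O → upH-dnH O thickness layer closing I) N β ⟩
        labelTrace n round N β
          ≡⟨ ≡.cong (λ m → labelTrace m round N β) (degree-cut w I) ⟩
        labelTrace degree round N β ∎)
        where
        n = sum (thickness I)
        f = factors-unit (thickness I)
        down = dnH thickness layer closing I
        rise = upH thickness layer I

-- Specialization to q = v and p = 1/v in a commutative ring.

module Quantum (CR : CommutativeRing 0ℓ 0ℓ) (v v⁻¹ : CommutativeRing.Carrier CR)
  (v*v⁻¹≈1 : CommutativeRing._≈_ CR (CommutativeRing._*_ CR v v⁻¹) (CommutativeRing.1# CR)) where

  open import Data.Integer.Base as ℤ using (ℤ; +_; -[1+_]; 1ℤ; -1ℤ; _⊖_)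
  import Data.Integer.Properties as ℤ
  open import Data.Nat.Base as ℕ using (ℕ; zero; suc)
  open import Relation.Binary.PropositionalEquality as ≡ using (_≡_)

  open CommutativeRing CR using (ring; -_; -‿inverseˡ; -‿inverseʳ; commutativeSemiring)
  open import Algebra.Properties.Ring ring using (-‿distribˡ-*; -1*x≈-x)
  open Sums commutativeSemiring

  z p x : Carrier
  z = v + - v⁻¹
  p = v⁻¹
  x = - v⁻¹

  open Hecke commutativeSemiring z p x using (q)
  open Antisym commutativeSemiring z p x using (br; pw)
  open PowerSeries commutativeSemiring z p x using (pow)
  open Pairs commutativeSemiring z p x using (module Color; module Label)

  x+p≈0 : x + p ≈ 0#
  x+p≈0 = -‿inverseˡ p

  1+-1≈0 : 1# + - 1# ≈ 0#
  1+-1≈0 = -‿inverseʳ 1#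

  q≈v : q ≈ v
  q≈v = trans (+-assoc v x p) (trans (+-congˡ x+p≈0) (+-identityʳ v))

  pow-cong : ∀ {a b} n → a ≈ b → pow a n ≈ pow b n
  pow-cong zero    h = refl
  pow-cong (suc n) h = *-cong h (pow-cong n h)

  pow-+ : ∀ a m n → pow a (m ℕ.+ n) ≈ pow a m * pow a n
  pow-+ a zero    n = sym (*-identityˡ _)
  pow-+ a (suc m) n = trans (*-congˡ (pow-+ a m n)) (sym (*-assoc _ _ _))

  pow-* : ∀ a b n → pow (a * b) n ≈ pow a n * pow b n
  pow-* a b zero    = sym (*-identityˡ 1#)
  pow-* a b (suc n) = trans (*-congˡ (pow-* a b n)) (solve 4 (λ a b c d → a :* b :* (c :* d) := a :* c :* (b :* d)) refl a b _ _)

  pw≈pow : ∀ n → pw n ≈ pow p n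
  pw≈pow zero    = refl
  pw≈pow (suc n) = *-congˡ (pw≈pow n)

  difference : ℕ → Carrier
  difference m = pow v m + - pow p m

  module _ (vᶻ : ℤ → Carrier) (vᶻ-+ve : ∀ n → vᶻ (+ n) ≈ pow v n) (vᶻ-−ve : ∀ n → vᶻ -[1+ n ] ≈ pow p (suc n)) where

    vᶻ-⊖ : ∀ m n → vᶻ (m ⊖ n) ≈ pow v m * pow p n
    vᶻ-⊖ m       zero    = trans (vᶻ-+ve m) (sym (*-identityʳ _))
    vᶻ-⊖ zero    (suc n) = trans (vᶻ-−ve n) (sym (*-identityˡ _))
    vᶻ-⊖ (suc m) (suc n) = trans (reflexive (≡.cong vᶻ (ℤ.[1+m]⊖[1+n]≡m⊖n m n))) (trans (vᶻ-⊖ m n) (sym (begin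
      v * pow v m * (p * pow p n)     ≈⟨ solve 4 (λ v m p n → v :* m :* (p :* n) := v :* p :* (m :* n)) refl v _ p _ ⟩
      v * p * (pow v m * pow p n)     ≈⟨ trans (*-congʳ v*v⁻¹≈1) (*-identityˡ _) ⟩
      pow v m * pow p n               ∎)))

    vᶻ-+ : ∀ a b → vᶻ (a ℤ.+ b) ≈ vᶻ a * vᶻ b
    vᶻ-+ (+ m)    (+ n)    = trans (vᶻ-+ve (m ℕ.+ n)) (trans (pow-+ v m n) (sym (*-cong (vᶻ-+ve m) (vᶻ-+ve n))))
    vᶻ-+ (+ m)    -[1+ n ] = trans (vᶻ-⊖ m (suc n)) (sym (*-cong (vᶻ-+ve m) (vᶻ-−ve n)))
    vᶻ-+ -[1+ m ] (+ n)    = trans (vᶻ-⊖ n (suc m)) (trans (*-comm _ _) (sym (*-cong (vᶻ-−ve m) (vᶻ-+ve n))))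
    vᶻ-+ -[1+ m ] -[1+ n ] = trans (vᶻ-−ve (suc (m ℕ.+ n))) (trans (*-congˡ (*-congˡ (pow-+ p m n)))
      (trans (solve 3 (λ p a b → p :* (p :* (a :* b)) := p :* a :* (p :* b)) refl p _ _) (sym (*-cong (vᶻ-−ve m) (vᶻ-−ve n)))))

    vᶻ-1 : vᶻ 1ℤ ≈ q
    vᶻ-1 = trans (vᶻ-+ve 1) (trans (*-identityʳ v) (sym q≈v))

    vᶻ--1 : vᶻ -1ℤ ≈ p
    vᶻ--1 = trans (vᶻ-−ve 0) (*-identityʳ p)

  -- With p^k added to the left side, the recursion of `br` becomes multiplication by q, which
  -- leaves a pure power of v.
  z*br : ∀ k → z * br k ≈ difference k
  z*br k = begin
    z * br k                              ≈⟨ trans (+-congˡ (-‿inverseʳ (pow p k))) (+-identityʳ _) ⟨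
    z * br k + (pow p k + - pow p k)      ≈⟨ +-assoc _ _ _ ⟨
    z * br k + pow p k + - pow p k        ≈⟨ +-congʳ (trans (+-congˡ (sym (pw≈pow k))) (z*br+pw k)) ⟩
    difference k                          ∎
    where
    z*br+pw : ∀ k → z * br k + pw k ≈ pow v k
    z*br+pw zero    = trans (+-congʳ (zeroʳ z)) (+-identityˡ 1#)
    z*br+pw (suc k) = begin
      z * (q * br k + pw k) + p * pw k    ≈⟨ solve 4 (λ z p b w → z :* ((z :+ p) :* b :+ w) :+ p :* w := (z :+ p) :* (z :* b :+ w)) refl z p (br k) (pw k) ⟩
      q * (z * br k + pw k)               ≈⟨ *-cong q≈v (z*br+pw k) ⟩
      v * pow v k                         ∎

  -- Clears negative powers, so that the nonvanishing of the difference becomes a statement about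
  -- polynomials.
  difference*pow : ∀ m → difference m * pow v m ≈ pow v (m ℕ.+ m) + - 1#
  difference*pow m = trans (distribʳ _ _ _) (+-cong (sym (pow-+ v m m)) (trans (sym (-‿distribˡ-* (pow p m) (pow v m))) (-‿cong (begin
    pow p m * pow v m   ≈⟨ pow-* p v m ⟨
    pow (p * v) m       ≈⟨ pow-cong m (trans (*-comm p v) v*v⁻¹≈1) ⟩
    pow 1# m            ≈⟨ pow-1 m ⟩
    1#                  ∎))))
    where
    open CommutativeRing CR using (-‿cong)
    pow-1 : ∀ m → pow 1# m ≈ 1#
    pow-1 zero    = refl
    pow-1 (suc m) = trans (*-identityˡ _) (pow-1 m)

  sign : ℕ → Carrier
  sign = pow (- 1#)

  private
    -1*-1 : - 1# * - 1# ≈ 1#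
    -1*-1 = trans (-1*x≈-x (- 1#)) (-‿involutive 1#)
      where open import Algebra.Properties.Ring ring using (-‿involutive)

    -1*pow : ∀ a i → - 1# * pow (- 1# * a) (suc i) ≈ sign i * pow a (suc i)
    -1*pow a i = begin
      - 1# * pow (- 1# * a) (suc i)         ≈⟨ *-congˡ (pow-* (- 1#) a (suc i)) ⟩
      - 1# * (- 1# * sign i * pow a (suc i)) ≈⟨ solve 3 (λ n s a → n :* (n :* s :* a) := n :* n :* (s :* a)) refl (- 1#) _ _ ⟩
      - 1# * - 1# * (sign i * pow a (suc i)) ≈⟨ trans (*-congʳ -1*-1) (*-identityˡ _) ⟩
      sign i * pow a (suc i)                 ∎

  -- The coefficient is (-p)^(i+1) - (-q)^(i+1). Its sign (-1)^i is also that of the label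
  -- coefficient, so no sign enters the substitution of power sums.
  color-coefficient : ∀ zi z*zi≈1 i → Color.coefficient zi z*zi≈1 x+p≈0 (- 1#) 1+-1≈0 i ≈ sign i * difference (suc i)
  color-coefficient zi z*zi≈1 i = trans (+-comm _ _) (trans (+-cong
    (trans (-1*pow q i) (*-congˡ (pow-cong (suc i) q≈v)))
    (begin
      pow x (suc i)                         ≈⟨ pow-cong (suc i) (sym (-1*x≈-x p)) ⟩
      pow (- 1# * p) (suc i)                ≈⟨ pow-* (- 1#) p (suc i) ⟩
      - 1# * sign i * pow p (suc i)         ≈⟨ solve 3 (λ n s a → n :* s :* a := s :* (n :* a)) refl (- 1#) _ _ ⟩
      sign i * (- 1# * pow p (suc i))       ≈⟨ *-congˡ (-1*x≈-x _) ⟩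
      sign i * - pow p (suc i)              ∎))
    (sym (distribˡ _ _ _)))

  label-coefficient : ∀ zi z*zi≈1 i → Label.coefficient zi z*zi≈1 x+p≈0 (- 1#) 1+-1≈0 i ≈ sign i * pow z (suc i)
  label-coefficient zi z*zi≈1 i = trans (+-congʳ (zeroˡ _)) (trans (+-identityˡ _) (-1*pow z i))

-- The plethystic substitution as the relation between the traces.

module Plethysm (CR : CommutativeRing 0ℓ 0ℓ) (v v⁻¹ : CommutativeRing.Carrier CR)
  (v*v⁻¹≈1 : CommutativeRing._≈_ CR (CommutativeRing._*_ CR v v⁻¹) (CommutativeRing.1# CR)) where

  open import Data.Integer.Base using (ℤ; +_; -[1+_])
  open import Data.Nat.Base as ℕ using (ℕ; zero; suc)
  open import Data.Product.Base using (Σ; _,_; proj₁; proj₂)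
  open import Relation.Binary.PropositionalEquality using (_≡_)

  open import Defs using (Web; splittings)
  open CommutativeRing CR using (-_; commutativeSemiring)
  open Sums commutativeSemiring
  open Quantum CR v v⁻¹ v*v⁻¹≈1
  open Antisym commutativeSemiring z p x using (br)
  open PowerSeries commutativeSemiring z p x using (pow; nat; power-sum; ∑-splittings-0)
  open Pairs commutativeSemiring z p x

  scalar-*ˢ : ∀ a F → (a •ˢ 1ˢ) *ˢ F ≈ˢ a •ˢ F
  scalar-*ˢ a F N β = trans (∑-cong (splittings β) λ γδ → *-assoc _ _ _)
    (trans (∑-*ˡ a (splittings β)) (*-congˡ (∑-splittings-0 (F N) β)))

  module Expressions (zi : Carrier) (z*zi≈1 : z * zi ≈ 1#) (nat-inverse : ∀ m → Σ Carrier λ c → c * nat (suc m) ≈ 1#)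
    (d : ℕ → Carrier) (d*difference≈1 : ∀ i → d i * difference (suc i) ≈ 1#)
    (Λ : Set) (⟨_⟩ : Carrier → Λ) (p[1+_] : ℕ → Λ) (_⊕_ _⊗_ : Λ → Λ → Λ) (⟦_⟧ : Λ → Series) (_[x/q-q⁻¹] : Λ → Λ)
    (⟦⟨⟩⟧ : ∀ a → ⟦ ⟨ a ⟩ ⟧ ≈ˢ a •ˢ 1ˢ) (⟦p⟧ : ∀ i → ⟦ p[1+ i ] ⟧ ≈ˢ power-sum (suc i))
    (⟦⊕⟧ : ∀ f g → ⟦ f ⊕ g ⟧ ≈ˢ ⟦ f ⟧ +ˢ ⟦ g ⟧) (⟦⊗⟧ : ∀ f g → ⟦ f ⊗ g ⟧ ≈ˢ ⟦ f ⟧ *ˢ ⟦ g ⟧)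
    (⟨⟩-plethysm : ∀ a → ⟦ ⟨ a ⟩ [x/q-q⁻¹] ⟧ ≈ˢ a •ˢ 1ˢ) (p-plethysm : ∀ i → ⟦ p[1+ i ] [x/q-q⁻¹] ⟧ ≈ˢ d i •ˢ power-sum (suc i))
    (⊕-plethysm : ∀ f g → ⟦ (f ⊕ g) [x/q-q⁻¹] ⟧ ≈ˢ ⟦ f [x/q-q⁻¹] ⟧ +ˢ ⟦ g [x/q-q⁻¹] ⟧)
    (⊗-plethysm : ∀ f g → ⟦ (f ⊗ g) [x/q-q⁻¹] ⟧ ≈ˢ ⟦ f [x/q-q⁻¹] ⟧ *ˢ ⟦ g [x/q-q⁻¹] ⟧) where

    -- Carrying the degree n makes the power of z multiplicative: together with p_m going to
    -- p_m/(q^m - q^(-m)) it amounts to p_m going to z^m p_m/(q^m - q^(-m)), so related series have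
    -- related products.
    record IsPlethysm (n : ℕ) (F G : Series) : Set where
      constructor plethysm
      field
        expression : Λ
        expansion  : ⟦ expression ⟧ ≈ˢ F
        image      : ⟦ expression [x/q-q⁻¹] ⟧ ≈ˢ pow zi n •ˢ G

    private
      *ˢ-cong : ∀ {F F′ G G′} → F ≈ˢ F′ → G ≈ˢ G′ → F *ˢ G ≈ˢ F′ *ˢ G′
      *ˢ-cong h h′ N β = ∑-cong (splittings β) λ γδ → *-cong (h N (proj₁ γδ)) (h′ N (proj₂ γδ))

      •ˢ-*ˢ : ∀ a b F G → (a •ˢ F) *ˢ (b •ˢ G) ≈ˢ (a * b) •ˢ (F *ˢ G)
      •ˢ-*ˢ a b F G N β = trans (∑-cong (splittings β) λ γδ →
        solve 4 (λ a f b g → a :* f :* (b :* g) := a :* b :* (f :* g)) refl a _ b _) (∑-*ˡ (a * b) (splittings β))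

      ≈ˢ-closed : ∀ {n F F′ G G′} → F ≈ˢ F′ → G ≈ˢ G′ → IsPlethysm n F G → IsPlethysm n F′ G′
      ≈ˢ-closed h h′ (plethysm f F≋ G≋) = plethysm f (λ N β → trans (F≋ N β) (h N β)) λ N β → trans (G≋ N β) (*-congˡ (h′ N β))

      •ˢ-closed : ∀ {n F G} a → IsPlethysm n F G → IsPlethysm n (a •ˢ F) (a •ˢ G)
      •ˢ-closed {n} {F} {G} a (plethysm f F≋ G≋) = plethysm (⟨ a ⟩ ⊗ f)
        (λ N β → trans (⟦⊗⟧ ⟨ a ⟩ f N β) (trans (*ˢ-cong (⟦⟨⟩⟧ a) F≋ N β) (scalar-*ˢ a F N β)))
        λ N β → trans (⊗-plethysm ⟨ a ⟩ f N β) (trans (*ˢ-cong (⟨⟩-plethysm a) G≋ N β)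
          (trans (scalar-*ˢ a (pow zi n •ˢ G) N β) (x*yz≈y*xz a (pow zi n) (G N β))))

      +-closed : ∀ {n F F′ G G′} → IsPlethysm n F G → IsPlethysm n F′ G′ → IsPlethysm n (F +ˢ F′) (G +ˢ G′)
      +-closed (plethysm f F≋ G≋) (plethysm f′ F′≋ G′≋) = plethysm (f ⊕ f′)
        (λ N β → trans (⟦⊕⟧ f f′ N β) (+-cong (F≋ N β) (F′≋ N β)))
        λ N β → trans (⊕-plethysm f f′ N β) (trans (+-cong (G≋ N β) (G′≋ N β)) (sym (distribˡ _ _ _)))

      *-closed : ∀ {m n F F′ G G′} → IsPlethysm m F G → IsPlethysm n F′ G′ → IsPlethysm (m ℕ.+ n) (F *ˢ F′) (G *ˢ G′)
      *-closed {m} {n} {F} {F′} {G} {G′} (plethysm f F≋ G≋) (plethysm f′ F′≋ G′≋) = plethysm (f ⊗ f′)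
        (λ N β → trans (⟦⊗⟧ f f′ N β) (*ˢ-cong F≋ F′≋ N β))
        λ N β → trans (⊗-plethysm f f′ N β) (trans (*ˢ-cong G≋ G′≋ N β)
          (trans (•ˢ-*ˢ (pow zi m) (pow zi n) G G′ N β) (*-congʳ (sym (pow-+ zi m n)))))

      0-closed : ∀ {n} → IsPlethysm n 0ˢ 0ˢ
      0-closed = plethysm ⟨ 0# ⟩ (λ N β → trans (⟦⟨⟩⟧ 0# N β) (zeroˡ _)) λ N β → trans (⟨⟩-plethysm 0# N β) (trans (zeroˡ _) (sym (zeroʳ _)))

      1-closed : IsPlethysm 0 1ˢ 1ˢ
      1-closed = plethysm ⟨ 1# ⟩ (λ N β → trans (⟦⟨⟩⟧ 1# N β) (*-identityˡ _)) (⟨⟩-plethysm 1#)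

      zi*z : ∀ n → pow zi n * pow z n ≈ 1#
      zi*z zero    = *-identityˡ 1#
      zi*z (suc n) = trans (solve 4 (λ a b c d → a :* b :* (c :* d) := c :* a :* (b :* d)) refl zi _ z _) (trans (*-cong z*zi≈1 (zi*z n)) (*-identityˡ 1#))

      power-sum-closed : ∀ i → IsPlethysm (suc i) (Color.coefficient zi z*zi≈1 x+p≈0 (- 1#) 1+-1≈0 i •ˢ power-sum (suc i))
                                                  (Label.coefficient zi z*zi≈1 x+p≈0 (- 1#) 1+-1≈0 i •ˢ power-sum (suc i))
      power-sum-closed i = plethysm (⟨ c ⟩ ⊗ p[1+ i ])
        (λ N β → trans (⟦⊗⟧ ⟨ c ⟩ p[1+ i ] N β) (trans (*ˢ-cong (⟦⟨⟩⟧ c) (⟦p⟧ i) N β) (trans (scalar-*ˢ c P N β) (*-congʳ (sym (color-coefficient zi z*zi≈1 i))))))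
        λ N β → trans (⊗-plethysm ⟨ c ⟩ p[1+ i ] N β) (trans (*ˢ-cong (⟨⟩-plethysm c) (p-plethysm i) N β) (trans (scalar-*ˢ c (d i •ˢ P) N β) (begin
          sign i * difference (suc i) * (d i * P N β)
            ≈⟨ solve 4 (λ s D d P → s :* D :* (d :* P) := d :* D :* (s :* P)) refl (sign i) (difference (suc i)) (d i) (P N β) ⟩
          d i * difference (suc i) * (sign i * P N β)
            -- Both products equal 1. Exchanging them trades the denominator of the substitution for
            -- the power of z in the label coefficient.
            ≈⟨ *-congʳ (trans (d*difference≈1 i) (sym (zi*z (suc i)))) ⟩
          pow zi (suc i) * pow z (suc i) * (sign i * P N β)
            ≈⟨ solve 4 (λ a b s P → a :* b :* (s :* P) := a :* (s :* b :* P)) refl (pow zi (suc i)) (pow z (suc i)) (sign i) (P N β) ⟩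
          pow zi (suc i) * (sign i * pow z (suc i) * P N β)
            ≈⟨ *-congˡ (*-congʳ (label-coefficient zi z*zi≈1 i)) ⟨
          pow zi (suc i) * (Label.coefficient zi z*zi≈1 x+p≈0 (- 1#) 1+-1≈0 i * P N β) ∎)))
        where
        c = sign i * difference (suc i)
        P = power-sum (suc i)

      -- A quantum integer divides the invertible difference q^(k+1) - q^-(k+1), with cofactor z.
      br-inverse : ∀ k → Σ Carrier λ c → c * br (suc k) ≈ 1#
      br-inverse k = d k * z , trans (*-assoc _ _ _) (trans (*-congˡ (z*br (suc k))) (d*difference≈1 k))

    module Plethysms (vᶻ : ℤ → Carrier) (vᶻ-+ve : ∀ n → vᶻ (+ n) ≈ pow v n) (vᶻ-−ve : ∀ n → vᶻ -[1+ n ] ≈ pow p (suc n)) where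

      open Cuts commutativeSemiring z p x x+p≈0 vᶻ using (module Comparison)
      open Comparison (vᶻ-+ve 0) (vᶻ-+ vᶻ vᶻ-+ve vᶻ-−ve) (vᶻ-1 vᶻ vᶻ-+ve vᶻ-−ve) (vᶻ--1 vᶻ vᶻ-+ve vᶻ-−ve) br-inverse public

      LLT-plethysm : ∀ w I → IsPlethysm (Web.degree w) (X-series w) (LLT-series w I)
      LLT-plethysm w I = ≈ˢ-closed (λ N β → sym (X-trace w N β)) (λ N β → sym (LLT-round w I N β))
        (•ˢ-closed (scale w) (traces-good zi z*zi≈1 x+p≈0 (- 1#) 1+-1≈0 nat-inverse IsPlethysm
          ≈ˢ-closed •ˢ-closed +-closed *-closed 0-closed 1-closed power-sum-closed (Web.degree w) (round w)))

      LLT-cut : ∀ w I J → LLT-series w I ≈ˢ LLT-series w J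
      LLT-cut w I J N β = trans (LLT-round w I N β) (sym (LLT-round w J N β))

      z^n*zi^n : ∀ n F → pow z n •ˢ pow zi n •ˢ F ≈ˢ F
      z^n*zi^n n F N β = trans (sym (*-assoc _ _ _)) (trans (*-congʳ (trans (*-comm _ _) (zi*z n))) (*-identityˡ _))

-- Permuting the variables in products and power sums.

module Symmetry (R : CommutativeSemiring 0ℓ 0ℓ) where

  open import Data.Fin.Base as Fin using (Fin; suc)
  import Data.Fin.Properties as Fin
  open import Data.Fin.Permutation using (Permutation′; _⟨$⟩ʳ_; _⟨$⟩ˡ_; inverseˡ; inverseʳ)
  open import Data.List.Base hiding (lookup; zipWith; replicate; tabulate; sum; find)
  open import Data.List.Membership.Propositional using (_∈_; lose; find)
  open import Data.List.Membership.Propositional.Properties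
    using (∈-concatMap⁺; ∈-concatMap⁻; ∈-map⁺; ∈-map⁻; ∈-upTo⁺; ∈-upTo⁻; ∈-allFin)
  open import Data.List.Membership.Propositional.Properties.WithK using (unique∧set⇒bag)
  open import Data.List.Relation.Binary.BagAndSetEquality using (∼bag⇒↭)
  open import Data.List.Relation.Unary.All as All using (All; []; _∷_)
  import Data.List.Relation.Unary.All.Properties as All
  open import Data.List.Relation.Unary.AllPairs as AllPairs using (AllPairs; []; _∷_)
  import Data.List.Relation.Unary.AllPairs.Properties as AllPairs
  open import Data.List.Relation.Unary.Any using (here)
  open import Data.List.Relation.Unary.Unique.Propositional using (Unique)
  import Data.List.Relation.Unary.Unique.Propositional.Properties as Unique
  open import Data.Nat.Base as ℕ using (ℕ; suc; _∸_)
  import Data.Nat.Properties as ℕ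
  open import Data.Product.Base using (Σ; _×_; _,_; proj₁; proj₂)
  open import Data.Empty using (⊥)
  open import Data.Vec.Base as Vec using (Vec; []; _∷_; lookup; zipWith; replicate; tabulate; _[_]≔_)
  import Data.Vec.Properties as Vec
  open import Function.Base using (_∘_)
  open import Function.Bundles using (mk⇔)
  open import Relation.Binary.PropositionalEquality as ≡ using (_≡_; _≢_)
  open import Relation.Nullary.Decidable using (yes; no)

  open import Defs using (_≟ᵛ_; splittings)
  open Sums R

  ∑-reindex : ∀ {A B : Set} (xs : List A) (ys : List B) (f : A → B) {h : B → Carrier} →
              (∀ {a b} → f a ≡ f b → a ≡ b) → Unique xs → Unique ys →
              (∀ {a} → a ∈ xs → f a ∈ ys) → (∀ {b} → b ∈ ys → Σ A λ a → a ∈ xs × b ≡ f a) →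
              ∑ ys h ≈ ∑ xs (h ∘ f)
  ∑-reindex xs ys f inj uxs uys into onto = trans
    (∑-↭ (∼bag⇒↭ (unique∧set⇒bag uys (Unique.map⁺ inj uxs) (mk⇔ to from)))) (∑-map f xs)
    where
    to : ∀ {b} → b ∈ ys → b ∈ map f xs
    to b∈ with a , a∈ , ≡.refl ← onto b∈ = ∈-map⁺ f a∈
    from : ∀ {b} → b ∈ map f xs → b ∈ ys
    from b∈ with a , a∈ , ≡.refl ← ∈-map⁻ f b∈ = into a∈

  permute : ∀ {N} → Permutation′ N → Vec ℕ N → Vec ℕ N
  permute π β = tabulate λ i → lookup β (π ⟨$⟩ʳ i)

  private
    unpermute : ∀ {N} → Permutation′ N → Vec ℕ N → Vec ℕ N
    unpermute π β = tabulate λ i → lookup β (π ⟨$⟩ˡ i)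

    vec-ext : ∀ {N} {u v : Vec ℕ N} → (∀ i → lookup u i ≡ lookup v i) → u ≡ v
    vec-ext {u = u} {v} h = ≡.trans (≡.sym (Vec.tabulate∘lookup u)) (≡.trans (Vec.tabulate-cong h) (Vec.tabulate∘lookup v))

    lookup-permute : ∀ {N} (π : Permutation′ N) β i → lookup (permute π β) i ≡ lookup β (π ⟨$⟩ʳ i)
    lookup-permute π β i = Vec.lookup∘tabulate _ i

    permute-unpermute : ∀ {N} (π : Permutation′ N) β → permute π (unpermute π β) ≡ β
    permute-unpermute π β = vec-ext λ i → ≡.trans (lookup-permute π (unpermute π β) i)
      (≡.trans (Vec.lookup∘tabulate _ (π ⟨$⟩ʳ i)) (≡.cong (lookup β) (inverseˡ π)))

    unpermute-permute : ∀ {N} (π : Permutation′ N) β → unpermute π (permute π β) ≡ β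
    unpermute-permute π β = vec-ext λ i → ≡.trans (Vec.lookup∘tabulate _ i)
      (≡.trans (lookup-permute π β (π ⟨$⟩ˡ i)) (≡.cong (lookup β) (inverseʳ π)))

    permute-injective : ∀ {N} (π : Permutation′ N) {β γ} → permute π β ≡ permute π γ → β ≡ γ
    permute-injective π {β} {γ} h = ≡.trans (≡.sym (unpermute-permute π β)) (≡.trans (≡.cong (unpermute π) h) (unpermute-permute π γ))

    permute-+ : ∀ {N} (π : Permutation′ N) γ δ → zipWith ℕ._+_ (permute π γ) (permute π δ) ≡ permute π (zipWith ℕ._+_ γ δ)
    permute-+ π γ δ = vec-ext λ i → ≡.trans (Vec.lookup-zipWith ℕ._+_ i (permute π γ) (permute π δ))
      (≡.trans (≡.cong₂ ℕ._+_ (lookup-permute π γ i) (lookup-permute π δ i))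
      (≡.sym (≡.trans (lookup-permute π (zipWith ℕ._+_ γ δ) i) (Vec.lookup-zipWith ℕ._+_ (π ⟨$⟩ʳ i) γ δ))))

    cons : ∀ {N} → ℕ → ℕ → Vec ℕ N × Vec ℕ N → Vec ℕ (suc N) × Vec ℕ (suc N)
    cons b a (γ , δ) = a ∷ γ , b ∸ a ∷ δ

    ∈-splittings⁺ : ∀ {N} (γ δ : Vec ℕ N) → (γ , δ) ∈ splittings (zipWith ℕ._+_ γ δ)
    ∈-splittings⁺ [] [] = here ≡.refl
    ∈-splittings⁺ (a ∷ γ) (d ∷ δ) = ∈-concatMap⁺ (λ c → map (cons (a ℕ.+ d) c) (splittings (zipWith ℕ._+_ γ δ)))
      (lose (∈-upTo⁺ (ℕ.s≤s (ℕ.m≤m+n a d))) (≡.subst (λ e → (a ∷ γ , e ∷ δ) ∈ map (cons (a ℕ.+ d) a) (splittings (zipWith ℕ._+_ γ δ)))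
        (ℕ.m+n∸m≡n a d) (∈-map⁺ (cons (a ℕ.+ d) a) (∈-splittings⁺ γ δ))))

    ∈-splittings⁻ : ∀ {N} (β : Vec ℕ N) {γ δ} → (γ , δ) ∈ splittings β → zipWith ℕ._+_ γ δ ≡ β
    ∈-splittings⁻ [] {[]} {[]} _ = ≡.refl
    ∈-splittings⁻ (b ∷ β) γδ∈ with find (∈-concatMap⁻ (λ c → map (cons b c) (splittings β)) {xs = upTo (suc b)} γδ∈)
    ... | a , a∈ , p with ∈-map⁻ (cons b a) p
    ...   | (γ , δ) , q , ≡.refl = ≡.cong₂ _∷_ (ℕ.m+[n∸m]≡n (ℕ.s≤s⁻¹ (∈-upTo⁻ a∈))) (∈-splittings⁻ β q)

    Unique-splittings : ∀ {N} (β : Vec ℕ N) → Unique (splittings β)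
    Unique-splittings []      = [] ∷ []
    Unique-splittings (b ∷ β) = Unique.concat⁺
      (All.map⁺ (All.universal (λ a → Unique.map⁺ {f = cons b a} (cons-injective a) (Unique-splittings β)) (upTo (suc b))))
      (AllPairs.map⁺ (AllPairs.map (λ {a} {a′} a≢a′ → λ { (p , p′) → disjoint a a′ a≢a′ p p′ }) (Unique.upTo⁺ (suc b))))
      where
      cons-injective : ∀ a {x y} → cons b a x ≡ cons b a y → x ≡ y
      cons-injective a {γ , δ} {γ′ , δ′} h = ≡.cong₂ _,_ (Vec.∷-injectiveʳ (≡.cong proj₁ h)) (Vec.∷-injectiveʳ (≡.cong proj₂ h))
      disjoint : ∀ a a′ → a ≢ a′ → ∀ {x} → x ∈ map (cons b a) (splittings β) → x ∈ map (cons b a′) (splittings β) → ⊥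
      disjoint a a′ a≢a′ p p′ with ∈-map⁻ (cons b a) p | ∈-map⁻ (cons b a′) p′
      ... | _ , _ , ≡.refl | _ , _ , h = a≢a′ (Vec.∷-injectiveˡ (≡.cong proj₁ h))

  -- Each pair of vectors with sum β is listed exactly once, and permuting both members is a
  -- bijection onto the pairs for the permuted sum.
  ∑-splittings-permute : ∀ {N} (π : Permutation′ N) β {f : Vec ℕ N × Vec ℕ N → Carrier} →
    ∑ (splittings (permute π β)) f ≈ ∑ (splittings β) (λ γδ → f (permute π (proj₁ γδ) , permute π (proj₂ γδ)))
  ∑-splittings-permute {N} π β {f} = ∑-reindex (splittings β) (splittings (permute π β)) both {f} inj (Unique-splittings β) (Unique-splittings (permute π β)) into onto
    where
    both : Vec ℕ N × Vec ℕ N → Vec ℕ N × Vec ℕ N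
    both γδ = permute π (proj₁ γδ) , permute π (proj₂ γδ)
    inj : ∀ {a b} → both a ≡ both b → a ≡ b
    inj h = ≡.cong₂ _,_ (permute-injective π (≡.cong proj₁ h)) (permute-injective π (≡.cong proj₂ h))
    into : ∀ {a} → a ∈ splittings β → both a ∈ splittings (permute π β)
    into {γ , δ} a∈ = ≡.subst (λ β → both (γ , δ) ∈ splittings β)
      (≡.trans (permute-+ π γ δ) (≡.cong (permute π) (∈-splittings⁻ β a∈))) (∈-splittings⁺ (permute π γ) (permute π δ))
    onto : ∀ {b} → b ∈ splittings (permute π β) → Σ (Vec ℕ N × Vec ℕ N) λ a → a ∈ splittings β × b ≡ both a
    onto {γ , δ} b∈ = (unpermute π γ , unpermute π δ) ,
      ≡.subst (λ β → (unpermute π γ , unpermute π δ) ∈ splittings β) β≡ (∈-splittings⁺ (unpermute π γ) (unpermute π δ)) ,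
      ≡.cong₂ _,_ (≡.sym (permute-unpermute π γ)) (≡.sym (permute-unpermute π δ))
      where
      β≡ : zipWith ℕ._+_ (unpermute π γ) (unpermute π δ) ≡ β
      β≡ = permute-injective π (≡.trans (≡.sym (permute-+ π (unpermute π γ) (unpermute π δ)))
        (≡.trans (≡.cong₂ (zipWith ℕ._+_) (permute-unpermute π γ) (permute-unpermute π δ)) (∈-splittings⁻ (permute π β) b∈)))

  permute-replicate : ∀ {N} (π : Permutation′ N) a → permute π (replicate N a) ≡ replicate N a
  permute-replicate {N} π a = vec-ext λ i → ≡.trans (lookup-permute π (replicate N a) i)
    (≡.trans (Vec.lookup-replicate (π ⟨$⟩ʳ i) a) (≡.sym (Vec.lookup-replicate i a)))

  ι-permute : ∀ {N} (π : Permutation′ N) β γ → ι (permute π β ≟ᵛ permute π γ) ≈ ι (β ≟ᵛ γ)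
  ι-permute π β γ = ι-cong (permute π β ≟ᵛ permute π γ) (β ≟ᵛ γ) (permute-injective π) (≡.cong (permute π))

  power-sum-permute : ∀ m {N} (π : Permutation′ N) β →
    ∑ (allFin N) (λ i → ι (permute π β ≟ᵛ (replicate N 0 [ i ]≔ m))) ≈ ∑ (allFin N) (λ i → ι (β ≟ᵛ (replicate N 0 [ i ]≔ m)))
  power-sum-permute m {N} π β = sym (trans
    (∑-reindex (allFin N) (allFin N) (π ⟨$⟩ʳ_) (λ {a} {b} h → ≡.trans (≡.sym (inverseˡ π)) (≡.trans (≡.cong (π ⟨$⟩ˡ_) h) (inverseˡ π)))
      (Unique.allFin⁺ N) (Unique.allFin⁺ N) (λ _ → ∈-allFin _) (λ {b} _ → π ⟨$⟩ˡ b , ∈-allFin _ , ≡.sym (inverseʳ π)))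
    (∑-cong (allFin N) λ i → trans (sym (ι-permute π β _)) (reflexive (≡.cong (λ γ → ι (permute π β ≟ᵛ γ)) (permute-single i)))))
    where
    permute-single : ∀ i → permute π (replicate N 0 [ π ⟨$⟩ʳ i ]≔ m) ≡ replicate N 0 [ i ]≔ m
    permute-single i = vec-ext single
      where
      single : ∀ j → lookup (permute π (replicate N 0 [ π ⟨$⟩ʳ i ]≔ m)) j ≡ lookup (replicate N 0 [ i ]≔ m) j
      single j with j Fin.≟ i
      ... | yes ≡.refl = ≡.trans (lookup-permute π (replicate N 0 [ π ⟨$⟩ʳ i ]≔ m) j) (≡.trans (Vec.lookup∘updateAt (π ⟨$⟩ʳ i) (replicate N 0)) (≡.sym (Vec.lookup∘updateAt i (replicate N 0))))
      ... | no j≢i = ≡.trans (lookup-permute π (replicate N 0 [ π ⟨$⟩ʳ i ]≔ m) j) (≡.trans (Vec.lookup∘updateAt′ (π ⟨$⟩ʳ j) (π ⟨$⟩ʳ i) (λ h → j≢i (≡.trans (≡.sym (inverseˡ π)) (≡.trans (≡.cong (π ⟨$⟩ˡ_) h) (inverseˡ π)))) (replicate N 0))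
        (≡.trans (Vec.lookup-replicate (π ⟨$⟩ʳ j) 0) (≡.sym (≡.trans (Vec.lookup∘updateAt′ j i j≢i (replicate N 0)) (Vec.lookup-replicate j 0)))))

-- The rational functions in q form a field.

module Field where

  open import Algebra.Bundles using (CommutativeRing)
  open import Data.Empty using (⊥; ⊥-elim)
  open import Data.List.Base using (List; []; _∷_; map)
  open import Data.Nat.Base using (zero; suc)
  open import Data.Product.Base using (_,_)
  open import Data.Rational.Base as ℚ using (ℚ; 0ℚ; 1ℚ) renaming (-_ to negℚ)
  import Data.Rational.Properties as ℚ
  open import Level using (0ℓ)
  open import Relation.Binary.Bundles using (Setoid)
  open import Relation.Binary.PropositionalEquality as ≡ using (_≡_; cong; cong₂; module ≡-Reasoning)
  open import Relation.Nullary.Decidable using (Dec; yes; no)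

  open import Defs hiding (X)

  -- The equalities are wrapped in records to help type inference.
  infix 4 _≈ₚ_ _≃_

  record _≈ₚ_ (a b : Poly) : Set where
    constructor poly≈
    field coeff≡ : a ≈ᴾ b
  open _≈ₚ_ public

  record _≃_ (a b : K) : Set where
    constructor K≈
    field cross : a ≈ᴷ b
  open _≃_ public

  private
    negᴾ : Poly → Poly
    negᴾ = map negℚ

    scale : ℚ → Poly → Poly
    scale a = map (a ℚ.*_)

    coeff-+ : ∀ p r k → coeff (p +ᴾ r) k ≡ coeff p k ℚ.+ coeff r k
    coeff-+ []      r       k       = ≡.sym (ℚ.+-identityˡ (coeff r k))
    coeff-+ (a ∷ p) []      k       = ≡.sym (ℚ.+-identityʳ (coeff (a ∷ p) k))
    coeff-+ (a ∷ p) (b ∷ r) zero    = ≡.refl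
    coeff-+ (a ∷ p) (b ∷ r) (suc k) = coeff-+ p r k

    coeff-map : (f : ℚ → ℚ) → f 0ℚ ≡ 0ℚ → ∀ p k → coeff (map f p) k ≡ f (coeff p k)
    coeff-map f f0 []      k       = ≡.sym f0
    coeff-map f f0 (a ∷ p) zero    = ≡.refl
    coeff-map f f0 (a ∷ p) (suc k) = coeff-map f f0 p k

    coeff-scale : ∀ a p k → coeff (scale a p) k ≡ a ℚ.* coeff p k
    coeff-scale a = coeff-map (a ℚ.*_) (ℚ.*-zeroʳ a)

    ≈ₚ-refl : ∀ {p} → p ≈ₚ p
    ≈ₚ-refl = poly≈ λ _ → ≡.refl

    ≈ₚ-sym : ∀ {p r} → p ≈ₚ r → r ≈ₚ p
    ≈ₚ-sym h = poly≈ λ k → ≡.sym (coeff≡ h k)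

    ≈ₚ-trans : ∀ {p r s} → p ≈ₚ r → r ≈ₚ s → p ≈ₚ s
    ≈ₚ-trans h h′ = poly≈ λ k → ≡.trans (coeff≡ h k) (coeff≡ h′ k)

    +-cong : ∀ {p p′ r r′} → p ≈ₚ p′ → r ≈ₚ r′ → p +ᴾ r ≈ₚ p′ +ᴾ r′
    +-cong {p} {p′} {r} {r′} h h′ = poly≈ λ k → ≡.trans (coeff-+ p r k)
      (≡.trans (cong₂ ℚ._+_ (coeff≡ h k) (coeff≡ h′ k)) (≡.sym (coeff-+ p′ r′ k)))

    +-assoc : ∀ p r s → (p +ᴾ r) +ᴾ s ≈ₚ p +ᴾ (r +ᴾ s)
    +-assoc p r s = poly≈ λ k → begin
      coeff (p +ᴾ r +ᴾ s) k                       ≡⟨ ≡.trans (coeff-+ (p +ᴾ r) s k) (cong (ℚ._+ coeff s k) (coeff-+ p r k)) ⟩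
      coeff p k ℚ.+ coeff r k ℚ.+ coeff s k       ≡⟨ ℚ.+-assoc (coeff p k) (coeff r k) (coeff s k) ⟩
      coeff p k ℚ.+ (coeff r k ℚ.+ coeff s k)     ≡⟨ ≡.trans (coeff-+ p (r +ᴾ s) k) (cong (coeff p k ℚ.+_) (coeff-+ r s k)) ⟨
      coeff (p +ᴾ (r +ᴾ s)) k                     ∎
      where open ≡-Reasoning

    +-comm : ∀ p r → p +ᴾ r ≈ₚ r +ᴾ p
    +-comm p r = poly≈ λ k → ≡.trans (coeff-+ p r k) (≡.trans (ℚ.+-comm (coeff p k) (coeff r k)) (≡.sym (coeff-+ r p k)))

    +-inverseʳ : ∀ p → p +ᴾ negᴾ p ≈ₚ []
    +-inverseʳ p = poly≈ λ k → ≡.trans (coeff-+ p (negᴾ p) k)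
      (≡.trans (cong (coeff p k ℚ.+_) (coeff-map negℚ ≡.refl p k)) (ℚ.+-inverseʳ (coeff p k)))

    +-identityʳ : ∀ p → p +ᴾ [] ≈ₚ p
    +-identityʳ p = +-comm p []

    X : Poly → Poly
    X p = 0ℚ ∷ p

    X-cong : ∀ {a b p r} → a ≡ b → p ≈ₚ r → a ∷ p ≈ₚ b ∷ r
    X-cong a≡b h = poly≈ λ { zero → a≡b ; (suc k) → coeff≡ h k }

    X-[] : X [] ≈ₚ []
    X-[] = poly≈ λ { zero → ≡.refl ; (suc k) → ≡.refl }

    scale-cong : ∀ a {p r} → p ≈ₚ r → scale a p ≈ₚ scale a r
    scale-cong a {p} {r} h = poly≈ λ k → ≡.trans (coeff-scale a p k) (≡.trans (cong (a ℚ.*_) (coeff≡ h k)) (≡.sym (coeff-scale a r k)))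

    scale-+ : ∀ a p r → scale a (p +ᴾ r) ≈ₚ scale a p +ᴾ scale a r
    scale-+ a p r = poly≈ λ k → begin
      coeff (scale a (p +ᴾ r)) k                         ≡⟨ ≡.trans (coeff-scale a (p +ᴾ r) k) (cong (a ℚ.*_) (coeff-+ p r k)) ⟩
      a ℚ.* (coeff p k ℚ.+ coeff r k)                    ≡⟨ ℚ.*-distribˡ-+ a (coeff p k) (coeff r k) ⟩
      a ℚ.* coeff p k ℚ.+ a ℚ.* coeff r k                ≡⟨ ≡.trans (coeff-+ (scale a p) (scale a r) k) (cong₂ ℚ._+_ (coeff-scale a p k) (coeff-scale a r k)) ⟨
      coeff (scale a p +ᴾ scale a r) k                   ∎
      where open ≡-Reasoning

    swap-inner : ∀ p r s t → (p +ᴾ r) +ᴾ (s +ᴾ t) ≈ₚ (p +ᴾ s) +ᴾ (r +ᴾ t)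
    swap-inner p r s t = ≈ₚ-trans (+-assoc p r (s +ᴾ t)) (≈ₚ-trans (+-cong {p} ≈ₚ-refl
      (≈ₚ-trans (≈ₚ-sym (+-assoc r s t)) (≈ₚ-trans (+-cong (+-comm r s) ≈ₚ-refl) (+-assoc s r t)))) (≈ₚ-sym (+-assoc p s (r +ᴾ t))))

    *-congˡ : ∀ p {r s} → r ≈ₚ s → p *ᴾ r ≈ₚ p *ᴾ s
    *-congˡ []      h = ≈ₚ-refl
    *-congˡ (a ∷ p) h = +-cong (scale-cong a h) (X-cong ≡.refl (*-congˡ p h))

    *-distribˡ : ∀ p r s → p *ᴾ (r +ᴾ s) ≈ₚ p *ᴾ r +ᴾ p *ᴾ s
    *-distribˡ []      r s = ≈ₚ-refl
    *-distribˡ (a ∷ p) r s = ≈ₚ-trans (+-cong (scale-+ a r s) (X-cong ≡.refl (*-distribˡ p r s)))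
      (swap-inner (scale a r) (scale a s) (X (p *ᴾ r)) (X (p *ᴾ s)))

    *-zeroʳ : ∀ p → p *ᴾ [] ≈ₚ []
    *-zeroʳ []      = ≈ₚ-refl
    *-zeroʳ (a ∷ p) = ≈ₚ-trans (X-cong ≡.refl (*-zeroʳ p)) X-[]

    -- The mirror image of the recursion defining the product; commutativity is proved by playing
    -- the two against each other.
    *-∷ : ∀ p b r → p *ᴾ (b ∷ r) ≈ₚ scale b p +ᴾ X (p *ᴾ r)
    *-∷ []      b r = ≈ₚ-sym X-[]
    *-∷ (a ∷ p) b r = X-cong (cong (ℚ._+ 0ℚ) (ℚ.*-comm a b)) (≈ₚ-trans (+-cong {scale a r} ≈ₚ-refl (*-∷ p b r))
      (≈ₚ-trans (≈ₚ-sym (+-assoc (scale a r) (scale b p) _)) (≈ₚ-trans (+-cong (+-comm (scale a r) (scale b p)) ≈ₚ-refl)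
        (+-assoc (scale b p) (scale a r) _))))

    *-comm : ∀ p r → p *ᴾ r ≈ₚ r *ᴾ p
    *-comm []      r = ≈ₚ-sym (*-zeroʳ r)
    *-comm (a ∷ p) r = ≈ₚ-trans (+-cong {scale a r} ≈ₚ-refl (X-cong ≡.refl (*-comm p r))) (≈ₚ-sym (*-∷ r a p))

    *-congʳ : ∀ r {p s} → p ≈ₚ s → p *ᴾ r ≈ₚ s *ᴾ r
    *-congʳ r {p} {s} h = ≈ₚ-trans (*-comm p r) (≈ₚ-trans (*-congˡ r h) (*-comm r s))

    *-distribʳ : ∀ s p r → (p +ᴾ r) *ᴾ s ≈ₚ p *ᴾ s +ᴾ r *ᴾ s
    *-distribʳ s p r = ≈ₚ-trans (*-comm (p +ᴾ r) s) (≈ₚ-trans (*-distribˡ s p r) (+-cong (*-comm s p) (*-comm s r)))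

    scale-* : ∀ a r s → scale a r *ᴾ s ≈ₚ scale a (r *ᴾ s)
    scale-* a []      s = ≈ₚ-refl
    scale-* a (b ∷ r) s = ≈ₚ-trans (+-cong scale-scale (X-cong (≡.sym (ℚ.*-zeroʳ a)) (scale-* a r s)))
      (≈ₚ-sym (scale-+ a (scale b s) (X (r *ᴾ s))))
      where
      scale-scale : scale (a ℚ.* b) s ≈ₚ scale a (scale b s)
      scale-scale = poly≈ λ k → ≡.trans (coeff-scale (a ℚ.* b) s k) (≡.trans (ℚ.*-assoc a b (coeff s k))
        (≡.sym (≡.trans (coeff-scale a (scale b s) k) (cong (a ℚ.*_) (coeff-scale b s k)))))

    X-* : ∀ u s → X u *ᴾ s ≈ₚ X (u *ᴾ s)
    X-* u s = +-cong {scale 0ℚ s} {[]} {X (u *ᴾ s)} (poly≈ λ k → ≡.trans (coeff-scale 0ℚ s k) (ℚ.*-zeroˡ (coeff s k))) ≈ₚ-refl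

    *-assoc : ∀ p r s → (p *ᴾ r) *ᴾ s ≈ₚ p *ᴾ (r *ᴾ s)
    *-assoc []      r s = ≈ₚ-refl
    *-assoc (a ∷ p) r s = ≈ₚ-trans (*-distribʳ s (scale a r) (X (p *ᴾ r)))
      (+-cong (scale-* a r s) (≈ₚ-trans (X-* (p *ᴾ r) s) (X-cong ≡.refl (*-assoc p r s))))

    *-identityˡ : ∀ p → oneᴾ *ᴾ p ≈ₚ p
    *-identityˡ p = ≈ₚ-trans (+-cong {scale 1ℚ p} {p} {X []} {[]} (poly≈ λ k → ≡.trans (coeff-scale 1ℚ p k) (ℚ.*-identityˡ (coeff p k))) X-[]) (+-identityʳ p)

  polynomials : CommutativeRing 0ℓ 0ℓ
  polynomials = record
    { Carrier = Poly ; _≈_ = _≈ₚ_ ; _+_ = _+ᴾ_ ; _*_ = _*ᴾ_ ; -_ = negᴾ ; 0# = [] ; 1# = oneᴾ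
    ; isCommutativeRing = record
      { isRing = record
        { +-isAbelianGroup = record
          { isGroup = record
            { isMonoid = record
              { isSemigroup = record
                { isMagma = record
                  { isEquivalence = record { refl = ≈ₚ-refl ; sym = ≈ₚ-sym ; trans = ≈ₚ-trans }
                  ; ∙-cong = +-cong }
                ; assoc = +-assoc }
              ; identity = (λ p → ≈ₚ-refl) , +-identityʳ }
            ; inverse = (λ p → ≈ₚ-trans (+-comm (negᴾ p) p) (+-inverseʳ p)) , +-inverseʳ
            ; ⁻¹-cong = λ {p} {r} h → poly≈ λ k → ≡.trans (coeff-map negℚ ≡.refl p k)
                (≡.trans (cong negℚ (coeff≡ h k)) (≡.sym (coeff-map negℚ ≡.refl r k))) }
          ; comm = +-comm }
        ; *-cong = λ {p} {p′} {r} {r′} h h′ → ≈ₚ-trans (*-congʳ r h) (*-congˡ p′ h′)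
        ; *-assoc = *-assoc
        ; *-identity = *-identityˡ , λ p → ≈ₚ-trans (*-comm p oneᴾ) (*-identityˡ p)
        ; distrib = *-distribˡ , *-distribʳ }
      ; *-comm = *-comm } }

  private
    module P = CommutativeRing polynomials
    open import Algebra.Properties.Ring P.ring using (-‿distribˡ-*)
    open import Algebra.Solver.Ring.NaturalCoefficients.Default P.commutativeSemiring
      using (solve; _:=_; _:+_; _:*_)

    -- A nonzero coefficient of p - r would leave one in (p - r) d, as there are no zero divisors.
    -- Cancellation is what makes equality of fractions transitive.
    *-cancelʳ : ∀ d p r → NonZeroᴾ d → p *ᴾ d ≈ₚ r *ᴾ d → p ≈ₚ r
    *-cancelʳ d p r d≉0 h = P.trans (P.sym (P.+-identityʳ p)) (P.trans (P.+-congˡ {p} (P.sym (P.-‿inverseˡ r)))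
      (P.trans (P.sym (P.+-assoc p (P.- r) r)) (P.trans (P.+-congʳ p-r≈0) (P.+-identityˡ r))))
      where
      p-r : Poly
      p-r = p +ᴾ negᴾ r
      p-r*d≈0 : p-r *ᴾ d ≈ₚ []
      p-r*d≈0 = P.trans (P.distribʳ d p (P.- r)) (P.trans (P.+-cong h (P.sym (-‿distribˡ-* r d))) (P.-‿inverseʳ (r *ᴾ d)))
      p-r≈0 : p-r ≈ₚ []
      p-r≈0 = poly≈ λ k → vanish k (coeff p-r k ℚ.≟ 0ℚ)
        where
        vanish : ∀ k → Dec (coeff p-r k ≡ 0ℚ) → coeff p-r k ≡ 0ℚ
        vanish k (yes h) = h
        vanish k (no  h) with m , m≢0 ← *-nonZeroᴾ p-r d (k , h) d≉0 = ⊥-elim (m≢0 (coeff≡ p-r*d≈0 m))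

    open K
    ≃⇒ : ∀ {a b} → a ≃ b → num a *ᴾ den b ≈ₚ num b *ᴾ den a
    ≃⇒ h = poly≈ (cross h)
    ⇒≃ : ∀ {a b} → num a *ᴾ den b ≈ₚ num b *ᴾ den a → a ≃ b
    ⇒≃ h = K≈ (coeff≡ h)

    ≃-trans : ∀ {a b c} → a ≃ b → b ≃ c → a ≃ c
    ≃-trans {frac a b _} {frac c d d≉0} {frac e f _} h h′ = ⇒≃ (*-cancelʳ d _ _ d≉0 (begin
      a *ᴾ f *ᴾ d    ≈⟨ solve 3 (λ a f d → a :* f :* d := a :* d :* f) P.refl a f d ⟩
      a *ᴾ d *ᴾ f    ≈⟨ P.*-congʳ (≃⇒ h) ⟩
      c *ᴾ b *ᴾ f    ≈⟨ solve 3 (λ c b f → c :* b :* f := c :* f :* b) P.refl c b f ⟩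
      c *ᴾ f *ᴾ b    ≈⟨ P.*-congʳ (≃⇒ h′) ⟩
      e *ᴾ d *ᴾ b    ≈⟨ solve 3 (λ e d b → e :* d :* b := e :* b :* d) P.refl e d b ⟩
      e *ᴾ b *ᴾ d    ∎))
      where open import Relation.Binary.Reasoning.Setoid P.setoid

    +ᴷ-cong : ∀ {a a′ c c′} → a ≃ a′ → c ≃ c′ → a +ᴷ c ≃ a′ +ᴷ c′
    +ᴷ-cong {frac a b _} {frac a′ b′ _} {frac c d _} {frac c′ d′ _} h h′ = ⇒≃ (begin
      (a *ᴾ d +ᴾ c *ᴾ b) *ᴾ (b′ *ᴾ d′)
        ≈⟨ solve 6 (λ a b c d b′ d′ → (a :* d :+ c :* b) :* (b′ :* d′) := a :* b′ :* (d :* d′) :+ c :* d′ :* (b :* b′)) P.refl a b c d b′ d′ ⟩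
      a *ᴾ b′ *ᴾ (d *ᴾ d′) +ᴾ c *ᴾ d′ *ᴾ (b *ᴾ b′)
        ≈⟨ P.+-cong (P.*-congʳ (≃⇒ h)) (P.*-congʳ (≃⇒ h′)) ⟩
      a′ *ᴾ b *ᴾ (d *ᴾ d′) +ᴾ c′ *ᴾ d *ᴾ (b *ᴾ b′)
        ≈⟨ solve 6 (λ a′ b c′ d b′ d′ → a′ :* b :* (d :* d′) :+ c′ :* d :* (b :* b′) := (a′ :* d′ :+ c′ :* b′) :* (b :* d)) P.refl a′ b c′ d b′ d′ ⟩
      (a′ *ᴾ d′ +ᴾ c′ *ᴾ b′) *ᴾ (b *ᴾ d) ∎)
      where open import Relation.Binary.Reasoning.Setoid P.setoid

    *ᴷ-cong : ∀ {a a′ c c′} → a ≃ a′ → c ≃ c′ → a *ᴷ c ≃ a′ *ᴷ c′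
    *ᴷ-cong {frac a b _} {frac a′ b′ _} {frac c d _} {frac c′ d′ _} h h′ = ⇒≃ (begin
      a *ᴾ c *ᴾ (b′ *ᴾ d′)      ≈⟨ solve 4 (λ a c b d → a :* c :* (b :* d) := a :* b :* (c :* d)) P.refl a c b′ d′ ⟩
      a *ᴾ b′ *ᴾ (c *ᴾ d′)      ≈⟨ P.*-cong (≃⇒ h) (≃⇒ h′) ⟩
      a′ *ᴾ b *ᴾ (c′ *ᴾ d)      ≈⟨ solve 4 (λ a c b d → a :* b :* (c :* d) := a :* c :* (b :* d)) P.refl a′ c′ b d ⟩
      a′ *ᴾ c′ *ᴾ (b *ᴾ d)      ∎)
      where open import Relation.Binary.Reasoning.Setoid P.setoid

  field-ring : CommutativeRing 0ℓ 0ℓ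
  field-ring = record
    { Carrier = K ; _≈_ = _≃_ ; _+_ = _+ᴷ_ ; _*_ = _*ᴷ_ ; -_ = negᴷ ; 0# = 0ᴷ ; 1# = 1ᴷ
    ; isCommutativeRing = record
      { isRing = record
        { +-isAbelianGroup = record
          { isGroup = record
            { isMonoid = record
              { isSemigroup = record
                { isMagma = record
                  { isEquivalence = record { refl = ⇒≃ P.refl ; sym = λ h → ⇒≃ (P.sym (≃⇒ h)) ; trans = ≃-trans }
                  ; ∙-cong = +ᴷ-cong }
                ; assoc = λ { (frac a b _) (frac c d _) (frac e f _) → ⇒≃ (solve 6 (λ a b c d e f →
                    ((a :* d :+ c :* b) :* f :+ e :* (b :* d)) :* (b :* (d :* f)) :=
                    (a :* (d :* f) :+ (c :* f :+ e :* d) :* b) :* (b :* d :* f)) P.refl a b c d e f) } }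
              ; identity = (λ a → ≃-trans (comm 0ᴷ a) (identityʳ a)) , identityʳ }
            ; inverse = (λ a → ≃-trans (comm (negᴷ a) a) (inverseʳ a)) , inverseʳ
            ; ⁻¹-cong = λ { {frac a b _} {frac a′ b′ _} h → ⇒≃ (P.trans (P.sym (-‿distribˡ-* a b′)) (P.trans (P.-‿cong (≃⇒ h)) (-‿distribˡ-* a′ b))) } }
          ; comm = comm }
        ; *-cong = *ᴷ-cong
        ; *-assoc = λ { (frac a b _) (frac c d _) (frac e f _) → ⇒≃ (solve 6 (λ a b c d e f →
            a :* c :* e :* (b :* (d :* f)) := a :* (c :* e) :* (b :* d :* f)) P.refl a b c d e f) }
        ; *-identity = (λ a → ≃-trans (*-commᴷ 1ᴷ a) (*-identityʳ a)) , *-identityʳ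
        ; distrib = distribˡ , λ a b c → ≃-trans (*-commᴷ (b +ᴷ c) a) (≃-trans (distribˡ a b c) (+ᴷ-cong (*-commᴷ a b) (*-commᴷ a c))) }
      ; *-comm = *-commᴷ } }
    where
    comm : ∀ a c → a +ᴷ c ≃ c +ᴷ a
    comm (frac a b _) (frac c d _) = ⇒≃ (solve 4 (λ a b c d → (a :* d :+ c :* b) :* (d :* b) := (c :* b :+ a :* d) :* (b :* d)) P.refl a b c d)
    identityʳ : ∀ a → a +ᴷ 0ᴷ ≃ a
    identityʳ (frac a b _) = ⇒≃ (P.trans (P.*-congʳ (P.+-identityʳ (a *ᴾ oneᴾ))) (P.trans (P.*-assoc a oneᴾ b) (P.*-congˡ {a} (P.*-comm oneᴾ b))))
    inverseʳ : ∀ a → a +ᴷ negᴷ a ≃ 0ᴷ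
    inverseʳ (frac a b _) = ⇒≃ (P.trans (P.*-congʳ (P.trans (P.+-congˡ {a *ᴾ b} (P.sym (-‿distribˡ-* a b))) (P.-‿inverseʳ (a *ᴾ b)))) (P.trans (P.zeroˡ oneᴾ) (P.sym (P.zeroˡ (b *ᴾ b)))))
    *-commᴷ : ∀ a c → a *ᴷ c ≃ c *ᴷ a
    *-commᴷ (frac a b _) (frac c d _) = ⇒≃ (solve 4 (λ a b c d → a :* c :* (d :* b) := c :* a :* (b :* d)) P.refl a b c d)
    *-identityʳ : ∀ a → a *ᴷ 1ᴷ ≃ a
    *-identityʳ (frac a b _) = ⇒≃ (P.trans (P.*-assoc a oneᴾ b) (P.*-congˡ {a} (P.*-comm oneᴾ b)))
    distribˡ : ∀ a c e → a *ᴷ (c +ᴷ e) ≃ a *ᴷ c +ᴷ a *ᴷ e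
    distribˡ (frac a b _) (frac c d _) (frac e f _) = ⇒≃ (solve 6 (λ a b c d e f →
      a :* (c :* f :+ e :* d) :* (b :* d :* (b :* f)) := (a :* c :* (b :* f) :+ a :* e :* (b :* d)) :* (b :* (d :* f))) P.refl a b c d e f)

  inverseʳ : ∀ a → (a ≃ 0ᴷ → ⊥) → a *ᴷ a ⁻¹ ≃ 1ᴷ
  inverseʳ a a≄0 with nonZeroᴾ? (num a)
  ... | yes _   = ⇒≃ (P.trans (P.*-comm (num a *ᴾ den a) oneᴾ) (P.*-congˡ {oneᴾ} (P.*-comm (num a) (den a))))
  ... | no  a≈0 = ⊥-elim (a≄0 (⇒≃ (P.trans (P.*-congʳ {oneᴾ} num≈0) (P.trans (P.zeroˡ oneᴾ) (P.sym (P.zeroˡ (den a)))))))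
    where
    num≈0 : num a ≈ₚ []
    num≈0 = poly≈ λ k → vanish k (coeff (num a) k ℚ.≟ 0ℚ)
      where
      vanish : ∀ k → Dec (coeff (num a) k ≡ 0ℚ) → coeff (num a) k ≡ 0ℚ
      vanish k (yes h) = h
      vanish k (no  h) = ⊥-elim (a≈0 (k , h))

  polynomial : Poly → K
  polynomial a = frac a oneᴾ oneᴾ≉0

  polynomial-injective : ∀ {a b} → polynomial a ≃ polynomial b → a ≈ₚ b
  polynomial-injective {a} {b} h = P.trans (P.sym (P.*-identityʳ a)) (P.trans (≃⇒ h) (P.*-identityʳ b))

  polynomial-cong : ∀ {a b} → a ≈ₚ b → polynomial a ≃ polynomial b
  polynomial-cong h = ⇒≃ (P.*-congʳ h)

  polynomial-* : ∀ a b → polynomial (a *ᴾ b) ≃ polynomial a *ᴷ polynomial b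
  polynomial-* a b = ⇒≃ (P.*-congˡ {a *ᴾ b} (P.*-identityˡ oneᴾ))

  polynomial-+ : ∀ a b → polynomial (a +ᴾ b) ≃ polynomial a +ᴷ polynomial b
  polynomial-+ a b = ⇒≃ (P.trans (P.*-congˡ {a +ᴾ b} (P.*-identityˡ oneᴾ)) (P.*-congʳ (P.sym (P.+-cong (P.*-identityʳ a) (P.*-identityʳ b)))))

-- The theorem over the rational functions in q.

open import Data.Empty using (⊥)
open import Data.Fin.Base as Fin using (Fin)
open import Data.Fin.Permutation using (Permutation′)
open import Data.Integer.Base using (+_; -[1+_])
open import Data.List.Base using (List; []; _∷_)
open import Data.Nat.Base as ℕ using (ℕ; zero; suc)
open import Data.Product.Base using (Σ; _×_; _,_; proj₁; proj₂)
open import Data.Rational.Base as ℚ using (ℚ; 0ℚ; 1ℚ)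
import Data.Rational.Properties as ℚ
open import Data.Vec.Base using (replicate)
open import Relation.Binary.PropositionalEquality as ≡ using (_≡_; _≢_)
open import Relation.Nullary.Decidable using (does)

open import Defs
open Field

open CommutativeRing field-ring hiding (zero)

private
  natural : ℕ → ℚ
  natural zero    = 0ℚ
  natural (suc m) = 1ℚ ℚ.+ natural m

  natural-≥0 : ∀ m → 0ℚ ℚ.≤ natural m
  natural-≥0 zero    = ℚ.≤-refl
  natural-≥0 (suc m) = ℚ.+-mono-≤ {0ℚ} {1ℚ} {0ℚ} (ℚ.nonNegative⁻¹ 1ℚ) (natural-≥0 m)

  natural-≢0 : ∀ m → natural (suc m) ≢ 0ℚ
  natural-≢0 m h = ℚ.<⇒≢ (ℚ.+-mono-<-≤ {0ℚ} {1ℚ} {0ℚ} (ℚ.positive⁻¹ 1ℚ) (natural-≥0 m)) (≡.sym h)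

  monomial : ℕ → Poly
  monomial zero    = oneᴾ
  monomial (suc m) = (0ℚ ∷ 1ℚ ∷ []) *ᴾ monomial m

  coeff-monomial : ∀ m → coeff (monomial (suc m)) 0 ≡ 0ℚ
  coeff-monomial m with monomial m
  ... | []    = ≡.refl
  ... | a ∷ r = ≡.trans (≡.cong (ℚ._+ 0ℚ) (ℚ.*-zeroˡ a)) ≡.refl

  q≄0 : q ≃ 0ᴷ → ⊥
  q≄0 h with coeff≡ (polynomial-injective {0ℚ ∷ 1ℚ ∷ []} {[]} h) 1
  ... | ()

open Quantum field-ring q (q ⁻¹) (inverseʳ q q≄0)
open PowerSeries commutativeSemiring z p x using (pow; nat)

private
  pow-polynomial : ∀ m → pow q m ≃ polynomial (monomial m)
  pow-polynomial zero    = refl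
  pow-polynomial (suc m) = trans (*-cong {q} {q} refl (pow-polynomial m)) (sym (polynomial-* (0ℚ ∷ 1ℚ ∷ []) (monomial m)))

  nat-polynomial : ∀ m → nat m ≃ polynomial (natural m ∷ [])
  nat-polynomial zero    = polynomial-cong (poly≈ λ { zero → ≡.refl ; (suc _) → ≡.refl })
  nat-polynomial (suc m) = trans (+-cong {1ᴷ} {1ᴷ} refl (nat-polynomial m)) (sym (polynomial-+ oneᴾ (natural m ∷ [])))

  inverseˡ : ∀ a → (a ≃ 0ᴷ → ⊥) → a ⁻¹ *ᴷ a ≃ 1ᴷ
  inverseˡ a a≄0 = trans (*-comm (a ⁻¹) a) (inverseʳ a a≄0)

  nat-inverse : ∀ m → Σ K λ c → c *ᴷ nat (suc m) ≃ 1ᴷ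
  nat-inverse m = nat (suc m) ⁻¹ , inverseˡ (nat (suc m)) λ h →
    natural-≢0 m (coeff≡ (polynomial-injective {natural (suc m) ∷ []} {[]} (trans (sym (nat-polynomial (suc m))) h)) 0)

  -- If q^m = q^(-m), then q^(2m) = 1, but for positive m these two polynomials have different
  -- constant terms.
  difference≄0 : ∀ m → difference (suc m) ≃ 0ᴷ → ⊥
  difference≄0 m h = 1≢0 (≡.trans (≡.sym (coeff≡ (polynomial-injective {monomial (suc m ℕ.+ suc m)} {oneᴾ}
    (trans (sym (pow-polynomial (suc m ℕ.+ suc m))) q^2m≃1)) 0)) (coeff-monomial (m ℕ.+ suc m)))
    where
    1≢0 : 1ℚ ≢ 0ℚ
    1≢0 ()
    Q = pow q (suc m ℕ.+ suc m)
    q^2m≃1 : Q ≃ 1ᴷ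
    q^2m≃1 = x-y≈0⇒x≈y (trans (sym (difference*pow (suc m))) (trans (*-cong h (refl {pow q (suc m)})) (zeroˡ (pow q (suc m)))))
      where
      x-y≈0⇒x≈y : Q -ᴷ 1ᴷ ≃ 0ᴷ → Q ≃ 1ᴷ
      x-y≈0⇒x≈y = x∙y⁻¹≈ε⇒x≈y Q 1ᴷ
        where open import Algebra.Properties.Group +-group using (x∙y⁻¹≈ε⇒x≈y)

  ^ᴷ≡pow : ∀ a n → a ^ᴷ n ≡ pow a n
  ^ᴷ≡pow a zero    = ≡.refl
  ^ᴷ≡pow a (suc n) = ≡.cong (a *ᴷ_) (^ᴷ≡pow a n)

  q^m-q^-m≡ : ∀ m → q^m-q^-m m ≡ difference m
  q^m-q^-m≡ zero    = ≡.refl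
  q^m-q^-m≡ (suc m) = ≡.cong₂ _-ᴷ_ (^ᴷ≡pow q (suc m)) (^ᴷ≡pow (q ⁻¹) (suc m))

  d : ℕ → K
  d i = q^m-q^-m (suc i) ⁻¹

  d*difference≃1 : ∀ i → d i *ᴷ difference (suc i) ≃ 1ᴷ
  d*difference≃1 i = ≡.subst (λ D → D ⁻¹ *ᴷ difference (suc i) ≃ 1ᴷ) (≡.sym (q^m-q^-m≡ (suc i))) (inverseˡ (difference (suc i)) (difference≄0 i))

  z≄0 : z ≃ 0ᴷ → ⊥
  z≄0 h = difference≄0 0 (trans (+-cong (*-identityʳ q) (-‿cong (*-identityʳ (q ⁻¹)))) h)

  q^-+ve : ∀ n → q^ (+ n) ≃ pow q n
  q^-+ve n = reflexive (^ᴷ≡pow q n)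

  q^-−ve : ∀ n → q^ -[1+ n ] ≃ pow p (suc n)
  q^-−ve n = reflexive (^ᴷ≡pow p (suc n))

open Sums commutativeSemiring using (ι; 𝟙; if-0; ∑-cong)
open Antisym commutativeSemiring z p x using (br; fact)
open Layers commutativeSemiring z p x using (factors)
open Pairs commutativeSemiring z p x using (1ˢ; _≈ˢ_; _•ˢ_)
open Symmetry commutativeSemiring
open Plethysm field-ring q (q ⁻¹) (inverseʳ q q≄0)

private
  ⟦⟨⟩⟧ : ∀ a → constant a ≈ˢ a •ˢ 1ˢ
  ⟦⟨⟩⟧ a N β = trans (if-0 b {a}) (*-comm (𝟙 b) a)
    where b = does (β ≟ᵛ replicate N 0)

open Expressions (z ⁻¹) (inverseʳ z z≄0) nat-inverse d d*difference≃1 Λ ⟨_⟩ (λ i → p[ suc i ]) _⊕_ _⊗_ ⟦_⟧ _[x/q-q⁻¹]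
  ⟦⟨⟩⟧ (λ i N β → refl) (λ f g N β → refl) (λ f g N β → refl)
  ⟦⟨⟩⟧ (λ i N β → trans (∑-cong (splittings β) λ γδ → *-cong (⟦⟨⟩⟧ (d i) N (proj₁ γδ)) (refl {powerSum (suc i) N (proj₂ γδ)}))
    (scalar-*ˢ (d i) (powerSum (suc i)) N β))
  (λ f g N β → refl) (λ f g N β → refl)

open Plethysms q^_ q^-+ve q^-−ve

private
  bracket : ∀ k → [ k ] ≃ br k
  bracket k = begin
    q^m-q^-m k *ᴷ z ⁻¹       ≡⟨ ≡.cong (_*ᴷ z ⁻¹) (q^m-q^-m≡ k) ⟩
    difference k *ᴷ z ⁻¹     ≈⟨ *-cong (sym (z*br k)) (refl {z ⁻¹}) ⟩
    z *ᴷ br k *ᴷ z ⁻¹        ≈⟨ *-cong (*-comm z (br k)) (refl {z ⁻¹}) ⟩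
    br k *ᴷ z *ᴷ z ⁻¹        ≈⟨ *-assoc (br k) z (z ⁻¹) ⟩
    br k *ᴷ (z *ᴷ z ⁻¹)      ≈⟨ *-cong (refl {br k}) (inverseʳ z z≄0) ⟩
    br k *ᴷ 1ᴷ               ≈⟨ *-identityʳ (br k) ⟩
    br k                     ∎
    where open import Relation.Binary.Reasoning.Setoid setoid

  bracket-factorial : ∀ k → [ k ]! ≃ fact k
  bracket-factorial zero    = refl
  bracket-factorial (suc k) = *-cong (bracket-factorial k) (bracket (suc k))

  bracket-factorials : ∀ t → [ t ]!ᶜ ≃ factors t
  bracket-factorials []      = refl
  bracket-factorials (a ∷ t) = *-cong (bracket-factorial a) (bracket-factorials t)

  1≄0 : 1ᴷ ≃ 0ᴷ → ⊥
  1≄0 h with coeff≡ (polynomial-injective {oneᴾ} {[]} h) 0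
  ... | ()

  -- `_⁻¹` is defined by cases on a representing fraction. Uniqueness of inverses compares it with a
  -- known inverse of an equal element, here the one built from the factors of a factorial.
  inverse-unique : ∀ a b c → a ≃ b → c *ᴷ b ≃ 1ᴷ → a ⁻¹ ≃ c
  inverse-unique a b c a≃b cb≃1 = begin
    a ⁻¹                  ≈⟨ *-identityˡ (a ⁻¹) ⟨
    1ᴷ *ᴷ a ⁻¹            ≈⟨ *-cong ca≃1 (refl {a ⁻¹}) ⟨
    c *ᴷ a *ᴷ a ⁻¹        ≈⟨ *-assoc c a (a ⁻¹) ⟩
    c *ᴷ (a *ᴷ a ⁻¹)      ≈⟨ *-cong (refl {c}) (inverseʳ a a≄0) ⟩
    c *ᴷ 1ᴷ               ≈⟨ *-identityʳ c ⟩
    c                     ∎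
    where
    open import Relation.Binary.Reasoning.Setoid setoid
    ca≃1 : c *ᴷ a ≃ 1ᴷ
    ca≃1 = trans (*-cong (refl {c}) a≃b) cb≃1
    a≄0 : a ≃ 0ᴷ → ⊥
    a≄0 h = 1≄0 (trans (sym ca≃1) (trans (*-cong (refl {c}) h) (zeroʳ c)))

  LLT≋ : ∀ w I → LLT w I ≈ˢ LLT-series w I
  LLT≋ w I N β = *-cong (inverse-unique ([ t ]!ᶜ) (factors t) (proj₁ (factors-unit t)) (bracket-factorials t) (proj₂ (factors-unit t))) refl
    where t = Web.thickness w I

  symmetric : ∀ f N (π : Permutation′ N) β → ⟦ f ⟧ N (permute π β) ≃ ⟦ f ⟧ N β
  symmetric ⟨ a ⟩ N π β = trans (if-0 (does (permute π β ≟ᵛ replicate N 0)) {a}) (trans (*-cong same (refl {a})) (sym (if-0 (does (β ≟ᵛ replicate N 0)) {a})))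
    where
    same : ι (permute π β ≟ᵛ replicate N 0) ≃ ι (β ≟ᵛ replicate N 0)
    same = trans (reflexive (≡.cong (λ γ → ι (permute π β ≟ᵛ γ)) (≡.sym (permute-replicate π 0)))) (ι-permute π β (replicate N 0))
  symmetric p[ m ]  N π β = power-sum-permute m π β
  symmetric (f ⊕ g) N π β = +-cong (symmetric f N π β) (symmetric g N π β)
  symmetric (f ⊗ g) N π β = trans (∑-splittings-permute π β {λ γδ → ⟦ f ⟧ N (proj₁ γδ) *ᴷ ⟦ g ⟧ N (proj₂ γδ)})
    (∑-cong (splittings β) {λ γδ → ⟦ f ⟧ N (permute π (proj₁ γδ)) *ᴷ ⟦ g ⟧ N (permute π (proj₂ γδ))} {λ γδ → ⟦ f ⟧ N (proj₁ γδ) *ᴷ ⟦ g ⟧ N (proj₂ γδ)} λ γδ → *-cong (symmetric f N π (proj₁ γδ)) (symmetric g N π (proj₂ γδ)))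

proposition5p2 :
  (w : Web) (n : ℕ) → Web.degree w ≡ n →
    (Σ Series λ G → (G IsPlethysmOf X w) × ((I : Web.Cut w) → LLT w I ≋ ((q-q⁻¹ ^ᴷ n) • G)))
  × ((I : Web.Cut w) → Symmetric (LLT w I))
  × ((I J : Web.Cut w) → LLT w I ≋ LLT w J)
proposition5p2 w n ≡.refl = (G , (expression , (λ N β → cross (expansion N β)) , (λ N β → cross (image N β))) , (λ I N β → cross (LLT≋z^n•G I N β))) ,
  -- Up to a power of z, LLT is the expansion of an expression in power sums, and every such
  -- expansion is symmetric.
  (λ I N π β → cross (trans (LLT≋image I N (permute π β)) (trans (*-cong (refl {pow z n}) (symmetric (expression [x/q-q⁻¹]) N π β)) (sym (LLT≋image I N β))))) ,
  λ I J N β → cross (trans (LLT≋ w I N β) (trans (LLT-cut w I J N β) (sym (LLT≋ w J N β))))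
  where
  open IsPlethysm (LLT-plethysm w Fin.zero)
  G : Series
  -- Chosen at cut zero, so that `image` identifies it with the plethystic image; the other cuts
  -- follow from independence of the cut.
  G = pow (z ⁻¹) n •ˢ LLT-series w Fin.zero
  LLT≋z^n : ∀ I → LLT w I ≈ˢ pow z n •ˢ G
  LLT≋z^n I N β = trans (LLT≋ w I N β) (trans (LLT-cut w I Fin.zero N β) (sym (z^n*zi^n n (LLT-series w Fin.zero) N β)))
  LLT≋z^n•G : ∀ I → LLT w I ≈ˢ (q-q⁻¹ ^ᴷ n) •ˢ G
  LLT≋z^n•G I N β = trans (LLT≋z^n I N β) (reflexive (≡.cong (_*ᴷ G N β) (≡.sym (^ᴷ≡pow z n))))
  LLT≋image : ∀ I → LLT w I ≈ˢ pow z n •ˢ ⟦ expression [x/q-q⁻¹] ⟧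
  LLT≋image I N β = trans (LLT≋z^n I N β) (*-cong (refl {pow z n}) (sym (image N β)))
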